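{- Let $K=\mathbb{Q}(\sqrt{p},\sqrt{q})$ be a real biquadratic field (with $p,q>1$ distinct square-free integers) such that $K$ does not contain any of $\sqrt{2}$, $\sqrt{3}$, $\sqrt{5}$, $\sqrt{6}$, $\sqrt{7}$, $\sqrt{13}$. Then $\mathcal{P}(\mathcal{O}_K)\geq 6$.
   Context: $\mathcal{O}_K$ denotes the ring of algebraic integers of $K$. For a commutative ring $\mathcal{O}$, let $\sum\mathcal{O}^2$ be the set of elements of $\mathcal{O}$ that are sums of squares of elements of $\mathcal{O}$, and $\sum^m\mathcal{O}^2$ the set of those that are sums of at most $m$ squares. The Pythagoras number is $\mathcal{P}(\mathcal{O})=\inf\{m\in\mathbb{N}\cup\{+\infty\} : \sum\mathcal{O}^2=\sum^m\mathcal{O}^2\}$. -}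

module Defs where

open import Data.Nat as ℕ using (ℕ)
open import Data.Nat.Divisibility using (_∣_)
open import Relation.Nullary using (¬_)
open import Data.Integer as ℤ using (ℤ)
open import Data.Rational as ℚ using (ℚ; _+_; _*_; 0ℚ; 1ℚ)
open import Data.List using (List; []; _∷_; length)
open import Data.Product using (Σ; ∃; _×_; _,_)
open import Relation.Binary.PropositionalEquality using (_≡_)

SquareFree : ℕ → Set
SquareFree n = ∀ d → (d ℕ.* d) ∣ n → d ≡ 1

-- Elements of K = ℚ(√p, √q), written a + b√p + c√q + d√p√q with a,b,c,d ∈ ℚ.
-- For p ≠ q square-free > 1 the family 1, √p, √q, √p√q is a ℚ-basis of K,
-- so equality of elements is equality of coordinate tuples.
record K (p q : ℕ) : Set where
  constructor mkK
  field
    a b c d : ℚ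

module _ {p q : ℕ} where
  private
    P Q : ℚ
    P = (ℤ.+ p ℚ./ 1)
    Q = (ℤ.+ q ℚ./ 1)

  fromℚ : ℚ → K p q
  fromℚ r = mkK r 0ℚ 0ℚ 0ℚ

  fromℤ : ℤ → K p q
  fromℤ z = fromℚ (z ℚ./ 1)

  _⊕_ : K p q → K p q → K p q
  mkK a b c d ⊕ mkK a' b' c' d' = mkK (a + a') (b + b') (c + c') (d + d')

  -- multiplication using (√p)² = p, (√q)² = q
  _⊗_ : K p q → K p q → K p q
  mkK a b c d ⊗ mkK a' b' c' d' =
    mkK (a * a' + P * (b * b') + Q * (c * c') + (P * Q) * (d * d'))
        (a * b' + b * a' + Q * (c * d') + Q * (d * c'))
        (a * c' + c * a' + P * (b * d') + P * (d * b'))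
        (a * d' + d * a' + b * c' + c * b')

  zeroK oneK : K p q
  zeroK = fromℚ 0ℚ
  oneK = fromℚ 1ℚ

  _^K_ : K p q → ℕ → K p q
  x ^K ℕ.zero = oneK
  x ^K ℕ.suc n = x ⊗ (x ^K n)

  evalℤ : List ℤ → K p q → K p q
  evalℤ [] x = zeroK
  evalℤ (c ∷ cs) x = fromℤ c ⊕ (x ⊗ evalℤ cs x)

  -- x is an algebraic integer: root of the monic integer polynomial
  -- X^n + c_{n-1} X^{n-1} + ... + c_0, where cs = [c_0, ..., c_{n-1}]
  IsAlgInt : K p q → Set
  IsAlgInt x = Σ (List ℤ) λ cs → (x ^K length cs) ⊕ evalℤ cs x ≡ zeroK

  sumSq : List (K p q) → K p q
  sumSq [] = zeroK
  sumSq (y ∷ ys) = (y ⊗ y) ⊕ sumSq ys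

  data AllAlgInt : List (K p q) → Set where
    []  : AllAlgInt []
    _∷_ : ∀ {y ys} → IsAlgInt y → AllAlgInt ys → AllAlgInt (y ∷ ys)

  IsSumSq : K p q → Set
  IsSumSq x = Σ (List (K p q)) λ ys → AllAlgInt ys × sumSq ys ≡ x

  IsSumSqAtMost : ℕ → K p q → Set
  IsSumSqAtMost m x = Σ (List (K p q)) λ ys → AllAlgInt ys × (length ys ℕ.≤ m) × sumSq ys ≡ x

HasSqrt : (p q : ℕ) → ℕ → Set
HasSqrt p q n = ∃ λ (x : K p q) → x ⊗ x ≡ fromℚ ((ℤ.+ n ℚ./ 1))

-- Σ O_K² = Σ^m O_K² (for elements of O_K; note Σ^m ⊆ Σ always)
PythEq : (p q : ℕ) → ℕ → Set
PythEq p q m = ∀ (x : K p q) → IsAlgInt x → IsSumSq x → IsSumSqAtMost m x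

PythagorasGe : (p q : ℕ) → ℕ → Set
PythagorasGe p q k = ∀ m → m ℕ.< k → ¬ (PythEq p q m)

{-# OPTIONS --safe #-}
module Submission where

-- Let g = gcd(p, q).  In the basis 1, √p, √q, √r with r = pq/g² the three square roots play symmetric
-- roles.  An algebraic integer x has powers of bounded denominator; elements with that property form a
-- ring, and a rational one is an integer.  Applied to relative traces and norms this bounds the
-- denominators of the coordinates of x by 2 or 4 and gives congruences between the numerators.
-- According to p, q, r modulo 4 one then takes α = 7 + w₁² + w₂² with w₁, w₂ integers of small trace,
-- for instance 1 + (√p + √q)/2 and (√p − √q)/2.  Comparing coordinates in α = x₁² + … + x₅², size
-- and parity force two of the xᵢ to be ±w₁ and ±w₂ (or to have the same contribution), so that the
-- remaining three would be rational integers with squares summing to 7.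
open import Defs
open import Algebra.Bundles using (CommutativeRing)
import Algebra.Solver.Ring.NaturalCoefficients.Default as SemiringSolver
open import Data.Empty using (⊥; ⊥-elim)
open import Data.Fin using (Fin; toℕ; fromℕ<)
open import Data.Fin.Properties using (all?; toℕ-fromℕ<)
open import Data.Integer as ℤ using (ℤ; +_; -[1+_]; ∣_∣)
import Data.Integer.Divisibility.Signed as Signed
import Data.Integer.Properties as ℤP
import Data.Integer.Tactic.RingSolver as ℤ-Solver
open import Data.List as List using (List; []; _∷_; length)
open import Data.List.Properties using (length-map)
open import Data.List.Relation.Binary.Permutation.Propositional as Perm using (_↭_; ↭-refl; ↭-trans; prep)
open import Data.List.Relation.Binary.Permutation.Propositional.Properties using (All-resp-↭; ↭-length)
open import Data.List.Relation.Unary.All as All using (All; []; _∷_)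
open import Data.Nat as ℕ using (ℕ; zero; suc; z≤n; s≤s; _<_)
open import Data.Nat.Coprimality as Coprimality using (Coprime; coprime-divisor)
open import Data.Nat.Divisibility using (_∣_; divides; ∣⇒≤; ∣1⇒≡1; ∣-trans; *-cancelˡ-∣; *-monoʳ-∣; m∣m*n; n∣m*n; m*n∣⇒m∣)
import Data.Nat.DivMod as DivMod
open import Data.Nat.GCD using (gcd; gcd[m,n]∣m; gcd[m,n]∣n; gcd[m,n]≢0; gcd-greatest)
open import Data.Nat.Induction using (<-rec)
import Data.Nat.Properties as ℕP
import Data.Nat.Solver as ℕ-Solve
import Data.Nat.Tactic.RingSolver as ℕ-Solver
open import Data.Product using (∃; _×_; _,_; proj₁; proj₂)
open import Data.Rational as ℚ using (ℚ; mkℚ; 0ℚ; 1ℚ; ½; ↥_; ↧_; ↧ₙ_)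
import Data.Rational.Properties as ℚP
open import Data.Rational.Solver using (module +-*-Solver)
import Data.Rational.Unnormalised as ℚᵘ
import Data.Rational.Unnormalised.Properties as ℚᵘP
open import Data.Sum as Sum using (_⊎_; inj₁; inj₂)
open import Relation.Binary.Definitions using (tri<; tri≈; tri>)
open import Relation.Binary.PropositionalEquality
open import Relation.Nullary using (¬_; yes; no)
open import Relation.Nullary.Decidable using (toWitness; decidable-stable; ¬?; _×-dec_)

-- Write p = k₁k₂, q = k₁k₃, r = k₂k₃. Permuting the kᵢ permutes the three square roots, and
-- negating all kᵢ only replaces √r by -√r, so the cases are residue patterns of the kᵢ modulo 4 up
-- to these moves. Denominator 4 occurs only if p ≡ q ≡ r ≡ 1 (mod 4); then all kᵢ agree modulo 4
-- and can be made ≡ 1 by a change of sign. The obstacle is that the rational coordinate bounds only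
-- the total size of five squares. The three other equations supply parities: an odd numerator that
-- is not wanted brings a second one with it, and the pair is too large. These estimates fix the
-- excluded fields. One type of estimate reads 4p > 32, hence p ≥ 10 for square-free p; another
-- reads 2r > 33 for some r ≡ 1 (mod 4), hence r ≥ 17, so that 13 is lost as well. Residues alone do
-- not determine α. If r is large against p + q, a single odd √r-coordinate is already too
-- expensive; if r is small, α must contain (1 + √r)/2 itself; and if some kᵢ is 1, one radicand is
-- the product of the other two and a different pair w₁, w₂ is used. The number 7 = 4 + 1 + 1 + 1 is
-- the least one that is not a sum of three squares.

module Quadruples where

  -- Arithmetic of the field in a symmetric basis.

  open import Data.Rational using (_+_; _*_; -_; _-_)

  opaque
    -- Opaque, so that the normalising division is not unfolded; the laws below are checked on
    -- unnormalised rationals, where sums and products compute.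
    ι : ℤ → ℚ
    ι z = z ℚ./ 1

    toℚᵘ-ι : ∀ z → ℚ.toℚᵘ (ι z) ℚᵘ.≃ ℚᵘ.mkℚᵘ z 0
    toℚᵘ-ι z = ℚP.toℚᵘ-fromℚᵘ (ℚᵘ.mkℚᵘ z 0)

    ι-+ : ∀ x y → ι (x ℤ.+ y) ≡ ι x + ι y
    ι-+ x y = ℚP.toℚᵘ-injective (begin
      ℚ.toℚᵘ (ι (x ℤ.+ y))             ≈⟨ toℚᵘ-ι (x ℤ.+ y) ⟩
      ℚᵘ.mkℚᵘ (x ℤ.+ y) 0              ≈⟨ ℚᵘ.*≡* (cong (ℤ._* + 1) (cong₂ ℤ._+_ (sym (ℤP.*-identityʳ x)) (sym (ℤP.*-identityʳ y)))) ⟩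
      ℚᵘ.mkℚᵘ x 0 ℚᵘ.+ ℚᵘ.mkℚᵘ y 0     ≈⟨ ℚᵘP.+-cong (ℚᵘP.≃-sym (toℚᵘ-ι x)) (ℚᵘP.≃-sym (toℚᵘ-ι y)) ⟩
      ℚ.toℚᵘ (ι x) ℚᵘ.+ ℚ.toℚᵘ (ι y)   ≈⟨ ℚᵘP.≃-sym (ℚP.toℚᵘ-homo-+ (ι x) (ι y)) ⟩
      ℚ.toℚᵘ (ι x + ι y)               ∎)
      where open ℚᵘP.≃-Reasoning

    ι-* : ∀ x y → ι (x ℤ.* y) ≡ ι x * ι y
    ι-* x y = ℚP.toℚᵘ-injective (begin
      ℚ.toℚᵘ (ι (x ℤ.* y))             ≈⟨ toℚᵘ-ι (x ℤ.* y) ⟩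
      ℚᵘ.mkℚᵘ x 0 ℚᵘ.* ℚᵘ.mkℚᵘ y 0     ≈⟨ ℚᵘP.*-cong (ℚᵘP.≃-sym (toℚᵘ-ι x)) (ℚᵘP.≃-sym (toℚᵘ-ι y)) ⟩
      ℚ.toℚᵘ (ι x) ℚᵘ.* ℚ.toℚᵘ (ι y)   ≈⟨ ℚᵘP.≃-sym (ℚP.toℚᵘ-homo-* (ι x) (ι y)) ⟩
      ℚ.toℚᵘ (ι x * ι y)               ∎)
      where open ℚᵘP.≃-Reasoning

    ι-neg : ∀ x → ι (ℤ.- x) ≡ - ι x
    ι-neg x = ℚP.toℚᵘ-injective (begin
      ℚ.toℚᵘ (ι (ℤ.- x))     ≈⟨ toℚᵘ-ι (ℤ.- x) ⟩
      ℚᵘ.- ℚᵘ.mkℚᵘ x 0       ≈⟨ ℚᵘP.-‿cong (ℚᵘP.≃-sym (toℚᵘ-ι x)) ⟩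
      ℚᵘ.- ℚ.toℚᵘ (ι x)      ≈⟨ ℚᵘP.≃-sym (ℚP.toℚᵘ-homo‿- (ι x)) ⟩
      ℚ.toℚᵘ (- ι x)         ∎)
      where open ℚᵘP.≃-Reasoning

    ι-injective : ∀ {x y} → ι x ≡ ι y → x ≡ y
    ι-injective {x} {y} eq with ℚᵘP.≃-trans (ℚᵘP.≃-sym (toℚᵘ-ι x)) (ℚᵘP.≃-trans (ℚP.toℚᵘ-cong eq) (toℚᵘ-ι y))
    ... | ℚᵘ.*≡* e = trans (sym (ℤP.*-identityʳ x)) (trans e (ℤP.*-identityʳ y))

    ι-denominator : ∀ t → ι (↧ t) * t ≡ ι (↥ t)
    ι-denominator t@(mkℚ n d _) = ℚP.toℚᵘ-injective (begin
      ℚ.toℚᵘ (ι (↧ t) * t)                ≈⟨ ℚP.toℚᵘ-homo-* (ι (↧ t)) t ⟩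
      ℚ.toℚᵘ (ι (↧ t)) ℚᵘ.* ℚ.toℚᵘ t      ≈⟨ ℚᵘP.*-congʳ (toℚᵘ-ι (↧ t)) ⟩
      ℚᵘ.mkℚᵘ (↧ t) 0 ℚᵘ.* ℚᵘ.mkℚᵘ n d    ≈⟨ ℚᵘ.*≡* (trans (ℤP.*-identityʳ _) (trans (ℤP.*-comm (↧ t) n) (cong (λ m → n ℤ.* + suc m) (sym (ℕP.+-identityʳ d))))) ⟩
      ℚᵘ.mkℚᵘ n 0                         ≈⟨ ℚᵘP.≃-sym (toℚᵘ-ι n) ⟩
      ℚ.toℚᵘ (ι n)                        ∎)
      where open ℚᵘP.≃-Reasoning

    ι-def : ∀ z → ι z ≡ z ℚ./ 1
    ι-def z = refl

    ι-0 : ι (+ 0) ≡ 0ℚ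
    ι-0 = refl

    ι-1 : ι (+ 1) ≡ 1ℚ
    ι-1 = refl

  record Quad (R : Set) : Set where
    constructor quad
    field
      c₀ c₁ c₂ c₃ : R
  open Quad public

  quad-≡ : ∀ {R : Set} {a a' b b' c c' d d' : R} → a ≡ a' → b ≡ b' → c ≡ c' → d ≡ d' → quad a b c d ≡ quad a' b' c' d'
  quad-≡ refl refl refl refl = refl

  ιQ : Quad ℤ → Quad ℚ
  ιQ (quad a b c d) = quad (ι a) (ι b) (ι c) (ι d)

  ιQ-injective : ∀ {x y} → ιQ x ≡ ιQ y → x ≡ y
  ιQ-injective e = quad-≡ (ι-injective (cong c₀ e)) (ι-injective (cong c₁ e)) (ι-injective (cong c₂ e)) (ι-injective (cong c₃ e))

  emb : ℚ → Quad ℚ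
  emb t = quad t 0ℚ 0ℚ 0ℚ

  add : {R : Set} → (R → R → R) → Quad R → Quad R → Quad R
  add _⊞_ x y = quad (c₀ x ⊞ c₀ y) (c₁ x ⊞ c₁ y) (c₂ x ⊞ c₂ y) (c₃ x ⊞ c₃ y)

  -- Coordinates are taken in the basis 1, √(k₁k₂), √(k₁k₃), √(k₂k₃); the product of two
  -- of the square roots is one of the kᵢ times the third.
  mul : {R : Set} → (_⊞_ _⊠_ : R → R → R) → (k₁ k₂ k₃ : R) → Quad R → Quad R → Quad R
  mul _⊞_ _⊠_ k₁ k₂ k₃ x y = quad
    ((((c₀ x ⊠ c₀ y) ⊞ ((k₁ ⊠ k₂) ⊠ (c₁ x ⊠ c₁ y))) ⊞ ((k₁ ⊠ k₃) ⊠ (c₂ x ⊠ c₂ y))) ⊞ ((k₂ ⊠ k₃) ⊠ (c₃ x ⊠ c₃ y)))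
    (((c₀ x ⊠ c₁ y) ⊞ (c₁ x ⊠ c₀ y)) ⊞ (k₃ ⊠ ((c₂ x ⊠ c₃ y) ⊞ (c₃ x ⊠ c₂ y))))
    (((c₀ x ⊠ c₂ y) ⊞ (c₂ x ⊠ c₀ y)) ⊞ (k₂ ⊠ ((c₁ x ⊠ c₃ y) ⊞ (c₃ x ⊠ c₁ y))))
    (((c₀ x ⊠ c₃ y) ⊞ (c₃ x ⊠ c₀ y)) ⊞ (k₁ ⊠ ((c₁ x ⊠ c₂ y) ⊞ (c₂ x ⊠ c₁ y))))

  infixl 6 _+Q_ _+Z_
  _+Z_ : Quad ℤ → Quad ℤ → Quad ℤ
  _+Z_ = add ℤ._+_

  negQ : Quad ℚ → Quad ℚ
  negQ x = quad (- c₀ x) (- c₁ x) (- c₂ x) (- c₃ x)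

  opaque
    _+Q_ : Quad ℚ → Quad ℚ → Quad ℚ
    _+Q_ = add _+_

    +Q-def : ∀ x y → x +Q y ≡ add _+_ x y
    +Q-def x y = refl

    ιQ-+ : ∀ x y → ιQ (x +Z y) ≡ ιQ x +Q ιQ y
    ιQ-+ (quad a b c d) (quad a' b' c' d') = quad-≡ (ι-+ a a') (ι-+ b b') (ι-+ c c') (ι-+ d d')

    +Q-assoc : ∀ x y z → (x +Q y) +Q z ≡ x +Q (y +Q z)
    +Q-assoc x y z = quad-≡ (ℚP.+-assoc (c₀ x) _ _) (ℚP.+-assoc (c₁ x) _ _) (ℚP.+-assoc (c₂ x) _ _) (ℚP.+-assoc (c₃ x) _ _)

    +Q-comm : ∀ x y → x +Q y ≡ y +Q x
    +Q-comm x y = quad-≡ (ℚP.+-comm (c₀ x) _) (ℚP.+-comm (c₁ x) _) (ℚP.+-comm (c₂ x) _) (ℚP.+-comm (c₃ x) _)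

    +Q-identityˡ : ∀ x → emb 0ℚ +Q x ≡ x
    +Q-identityˡ x = quad-≡ (ℚP.+-identityˡ _) (ℚP.+-identityˡ _) (ℚP.+-identityˡ _) (ℚP.+-identityˡ _)

    +Q-inverseˡ : ∀ x → negQ x +Q x ≡ emb 0ℚ
    +Q-inverseˡ x = quad-≡ (ℚP.+-inverseˡ (c₀ x)) (ℚP.+-inverseˡ (c₁ x)) (ℚP.+-inverseˡ (c₂ x)) (ℚP.+-inverseˡ (c₃ x))

  -- The order ℤ + ℤ√p + ℤ√q + ℤ√r, against which denominators are measured. It is closed under
  -- products because √p√q = k₁√r, √p√r = k₂√q and √q√r = k₃√p.
  Λ : Quad ℚ → Set
  Λ x = ∃ λ z → ιQ z ≡ x

  module Mul (k₁ k₂ k₃ : ℤ) where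

    private
      κ₁ κ₂ κ₃ : ℚ
      κ₁ = ι k₁
      κ₂ = ι k₂
      κ₃ = ι k₃

    infixl 7 _·_ _·Z_
    _·Z_ : Quad ℤ → Quad ℤ → Quad ℤ
    _·Z_ = mul ℤ._+_ ℤ._*_ k₁ k₂ k₃

    open +-*-Solver

    private
      _⊕P_ : ∀ {n} → Quad (Polynomial n) → Quad (Polynomial n) → Quad (Polynomial n)
      _⊕P_ = add _:+_

      mulP : ∀ {n} (k l m : Polynomial n) → Quad (Polynomial n) → Quad (Polynomial n) → Quad (Polynomial n)
      mulP = mul _:+_ _:*_

    private
      Eqn : ℕ → Set
      Eqn n = curried n
        where
        curried : ℕ → Set
        curried zero    = Polynomial n × Polynomial n
        curried (suc m) = Polynomial n → curried m

      -- A projection polymorphic in the coefficients: one symbolic identity between quadruples then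
      -- serves all four coordinates.
      Coordinate : Set₁
      Coordinate = {R : Set} → Quad R → R

    opaque
      unfolding _+Q_

      _·_ : Quad ℚ → Quad ℚ → Quad ℚ
      _·_ = mul _+_ _*_ κ₁ κ₂ κ₃

      ·-def : ∀ x y → x · y ≡ mul _+_ _*_ κ₁ κ₂ κ₃ x y
      ·-def x y = refl

      ιQ-· : ∀ x y → ιQ (x ·Z y) ≡ ιQ x · ιQ y
      ιQ-· (quad a b c d) (quad a' b' c' d') = quad-≡
        (trans (ι-+ _ _) (cong₂ _+_ (trans (ι-+ _ _) (cong₂ _+_ (trans (ι-+ _ _) (cong₂ _+_ (ι-* _ _) (m4 k₁ k₂ b b'))) (m4 k₁ k₃ c c'))) (m4 k₂ k₃ d d')))
        (line a b' b a' k₃ c d' d c')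
        (line a c' c a' k₂ b d' d b')
        (line a d' d a' k₁ b c' c b')
        where
        m4 : ∀ i j k l → ι ((i ℤ.* j) ℤ.* (k ℤ.* l)) ≡ (ι i * ι j) * (ι k * ι l)
        m4 i j k l = trans (ι-* _ _) (cong₂ _*_ (ι-* i j) (ι-* k l))
        p2 : ∀ i j k l → ι (i ℤ.* j ℤ.+ k ℤ.* l) ≡ ι i * ι j + ι k * ι l
        p2 i j k l = trans (ι-+ _ _) (cong₂ _+_ (ι-* i j) (ι-* k l))
        line : ∀ i j k l m u v w x → ι (i ℤ.* j ℤ.+ k ℤ.* l ℤ.+ m ℤ.* (u ℤ.* v ℤ.+ w ℤ.* x)) ≡ ι i * ι j + ι k * ι l + ι m * (ι u * ι v + ι w * ι x)
        line i j k l m u v w x = trans (ι-+ _ _) (cong₂ _+_ (p2 i j k l) (trans (ι-* _ _) (cong (ι m *_) (p2 u v w x))))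

      ·-comm : ∀ x y → x · y ≡ y · x
      ·-comm (quad a b c d) (quad a' b' c' d') = quad-≡
        (solve 11 (E c₀) refl κ₁ κ₂ κ₃ a b c d a' b' c' d')
        (solve 11 (E c₁) refl κ₁ κ₂ κ₃ a b c d a' b' c' d')
        (solve 11 (E c₂) refl κ₁ κ₂ κ₃ a b c d a' b' c' d')
        (solve 11 (E c₃) refl κ₁ κ₂ κ₃ a b c d a' b' c' d')
        where
        E : Coordinate → Eqn 11
        E π k l m a b c d a' b' c' d' =
          let x = quad a b c d; y = quad a' b' c' d' in π (mulP k l m x y) := π (mulP k l m y x)

      ·-assoc : ∀ x y z → (x · y) · z ≡ x · (y · z)
      ·-assoc (quad a b c d) (quad a' b' c' d') (quad e f g h) = quad-≡
        (solve 15 (E c₀) refl κ₁ κ₂ κ₃ a b c d a' b' c' d' e f g h)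
        (solve 15 (E c₁) refl κ₁ κ₂ κ₃ a b c d a' b' c' d' e f g h)
        (solve 15 (E c₂) refl κ₁ κ₂ κ₃ a b c d a' b' c' d' e f g h)
        (solve 15 (E c₃) refl κ₁ κ₂ κ₃ a b c d a' b' c' d' e f g h)
        where
        E : Coordinate → Eqn 15
        E π k l m a b c d a' b' c' d' e f g h =
          let x = quad a b c d; y = quad a' b' c' d'; z = quad e f g h in
          π (mulP k l m (mulP k l m x y) z) := π (mulP k l m x (mulP k l m y z))

      ·-distribʳ : ∀ x y z → (y +Q z) · x ≡ y · x +Q z · x
      ·-distribʳ (quad a b c d) (quad a' b' c' d') (quad e f g h) = quad-≡
        (solve 15 (E c₀) refl κ₁ κ₂ κ₃ a b c d a' b' c' d' e f g h)
        (solve 15 (E c₁) refl κ₁ κ₂ κ₃ a b c d a' b' c' d' e f g h)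
        (solve 15 (E c₂) refl κ₁ κ₂ κ₃ a b c d a' b' c' d' e f g h)
        (solve 15 (E c₃) refl κ₁ κ₂ κ₃ a b c d a' b' c' d' e f g h)
        where
        E : Coordinate → Eqn 15
        E π k l m a b c d a' b' c' d' e f g h =
          let x = quad a b c d; y = quad a' b' c' d'; z = quad e f g h in
          π (mulP k l m (y ⊕P z) x) := π (mulP k l m y x ⊕P mulP k l m z x)

      emb-· : ∀ t x → emb t · x ≡ quad (t * c₀ x) (t * c₁ x) (t * c₂ x) (t * c₃ x)
      emb-· t (quad a b c d) = quad-≡
        (solve 8 (E c₀) refl κ₁ κ₂ κ₃ t a b c d)
        (solve 8 (E c₁) refl κ₁ κ₂ κ₃ t a b c d)
        (solve 8 (E c₂) refl κ₁ κ₂ κ₃ t a b c d)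
        (solve 8 (E c₃) refl κ₁ κ₂ κ₃ t a b c d)
        where
        E : Coordinate → Eqn 8
        E π k l m t a b c d =
          let o = con 0ℚ in
          π (mulP k l m (quad t o o o) (quad a b c d)) := π (quad (t :* a) (t :* b) (t :* c) (t :* d))

-- Elements whose powers have bounded denominator.

module AlmostIntegrality where

  open Quadruples
  open import Data.Rational using (_+_; _*_; -_)

  ^-∣-cancel-coprime : ∀ {d n} → Coprime d n → .{{ℕ.NonZero d}} → ∀ k m → d ℕ.^ k ∣ m ℕ.* n → d ℕ.^ k ∣ m
  ^-∣-cancel-coprime c zero m _ = divides m (sym (ℕP.*-identityʳ m))
  ^-∣-cancel-coprime {d} {n} c (suc k) m h
    with coprime-divisor c (subst (d ∣_) (ℕP.*-comm m n) (m*n∣⇒m∣ d (d ℕ.^ k) h))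
  ... | divides m' refl = subst (d ℕ.* d ℕ.^ k ∣_) (ℕP.*-comm d m') (lift (^-∣-cancel-coprime c k m' cancelled))
    where
    cancelled : d ℕ.^ k ∣ m' ℕ.* n
    cancelled = *-cancelˡ-∣ d (subst (d ℕ.* d ℕ.^ k ∣_) (trans (cong (ℕ._* n) (ℕP.*-comm m' d)) (ℕP.*-assoc d m' n)) h)
    lift : d ℕ.^ k ∣ m' → d ℕ.* d ℕ.^ k ∣ d ℕ.* m'
    lift (divides q e) = divides q (trans (cong (d ℕ.*_) e) (trans (sym (ℕP.*-assoc d q _)) (trans (cong (ℕ._* (d ℕ.^ k)) (ℕP.*-comm d q)) (ℕP.*-assoc q d _))))

  ^-∣-cancel-coprime-^ : ∀ {d n} → Coprime d n → .{{ℕ.NonZero d}} → ∀ k m j → d ℕ.^ k ∣ m ℕ.* n ℕ.^ j → d ℕ.^ k ∣ m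
  ^-∣-cancel-coprime-^ c k m zero h = subst (_ ∣_) (ℕP.*-identityʳ m) h
  ^-∣-cancel-coprime-^ {d} {n} c k m (suc j) h =
    ^-∣-cancel-coprime-^ c k m j (^-∣-cancel-coprime c k (m ℕ.* n ℕ.^ j)
      (subst (d ℕ.^ k ∣_) (trans (cong (m ℕ.*_) (ℕP.*-comm n _)) (sym (ℕP.*-assoc m _ n))) h))

  n<2+m^n : ∀ m n → n ℕ.< (2 ℕ.+ m) ℕ.^ n
  n<2+m^n m zero = ℕ.s≤s ℕ.z≤n
  n<2+m^n m (suc n) = begin-strict
    suc n                                              ≤⟨ n<2+m^n m n ⟩
    X                                                  <⟨ ℕP.m<m+n X (ℕP.≤-trans (ℕ.s≤s ℕ.z≤n) (n<2+m^n m n)) ⟩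
    X ℕ.+ X                                            ≤⟨ ℕP.+-monoʳ-≤ X (ℕP.m≤m+n X (m ℕ.* X)) ⟩
    X ℕ.+ (X ℕ.+ m ℕ.* X)                              ∎
    where
    open ℕP.≤-Reasoning
    X = (2 ℕ.+ m) ℕ.^ n

  powℚ : ℚ → ℕ → ℚ
  powℚ t zero    = 1ℚ
  powℚ t (suc k) = t * powℚ t k

  denominator^ : ∀ t k → ι ((↧ t) ℤ.^ k) * powℚ t k ≡ ι ((↥ t) ℤ.^ k)
  denominator^ t zero = trans (cong (_* 1ℚ) ι-1) (sym ι-1)
  denominator^ t (suc k) = begin
    ι (D ℤ.* D ℤ.^ k) * (t * powℚ t k)         ≡⟨ cong (_* (t * powℚ t k)) (ι-* D _) ⟩
    (ι D * ι (D ℤ.^ k)) * (t * powℚ t k)       ≡⟨ solve 4 (λ a b c d → (a :* b) :* (c :* d) := (a :* c) :* (b :* d)) refl (ι D) (ι (D ℤ.^ k)) t (powℚ t k) ⟩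
    (ι D * t) * (ι (D ℤ.^ k) * powℚ t k)       ≡⟨ cong₂ _*_ (ι-denominator t) (denominator^ t k) ⟩
    ι (↥ t) * ι ((↥ t) ℤ.^ k)                  ≡⟨ sym (ι-* (↥ t) _) ⟩
    ι ((↥ t) ℤ.* (↥ t) ℤ.^ k)                  ∎
    where
    open ≡-Reasoning
    open +-*-Solver
    D = ↧ t

  ∣^∣ : ∀ z k → ℤ.∣ z ℤ.^ k ∣ ≡ ℤ.∣ z ∣ ℕ.^ k
  ∣^∣ z zero    = refl
  ∣^∣ z (suc k) = trans (ℤP.abs-* z (z ℤ.^ k)) (cong (ℤ.∣ z ∣ ℕ.*_) (∣^∣ z k))

  -- Let M = N + 1 and let d be the reduced denominator of t. It is prime to the numerator, so d^k
  -- divides M for every k. The exponent k = M already decides: 2^M > M, hence d = 1.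
  boundedDenominators⇒integer : ∀ t N → (∀ k → ∃ λ z → ι z ≡ ι (+ suc N) * powℚ t k) → ∃ λ z → ι z ≡ t
  boundedDenominators⇒integer t N h = ↥ t , trans (sym (ι-denominator t)) (trans (cong (λ d → ι (+ d) * t) d≡1) (trans (cong (_* t) ι-1) (ℚP.*-identityˡ t)))
    where
    M = suc N
    coprime : ∀ t → Coprime (↧ₙ t) ℤ.∣ ↥ t ∣
    coprime (mkℚ _ _ c) = Coprimality.sym (Coprimality.recompute c)
    divisible : ∀ k → (↧ₙ t) ℕ.^ k ∣ M
    divisible k with h k
    ... | z , e = ^-∣-cancel-coprime-^ (coprime t) k M k
                    (divides ℤ.∣ z ∣ (begin
                      M ℕ.* ℤ.∣ ↥ t ∣ ℕ.^ k              ≡⟨ cong (M ℕ.*_) (sym (∣^∣ (↥ t) k)) ⟩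
                      M ℕ.* ℤ.∣ (↥ t) ℤ.^ k ∣            ≡⟨ sym (ℤP.abs-* (+ M) ((↥ t) ℤ.^ k)) ⟩
                      ℤ.∣ + M ℤ.* (↥ t) ℤ.^ k ∣          ≡⟨ cong ℤ.∣_∣ (sym (ι-injective eq)) ⟩
                      ℤ.∣ z ℤ.* (↧ t) ℤ.^ k ∣            ≡⟨ ℤP.abs-* z _ ⟩
                      ℤ.∣ z ∣ ℕ.* ℤ.∣ (↧ t) ℤ.^ k ∣      ≡⟨ cong (ℤ.∣ z ∣ ℕ.*_) (∣^∣ (↧ t) k) ⟩
                      ℤ.∣ z ∣ ℕ.* (↧ₙ t) ℕ.^ k           ∎))
      where
      open ≡-Reasoning
      open +-*-Solver
      eq : ι (z ℤ.* (↧ t) ℤ.^ k) ≡ ι (+ M ℤ.* (↥ t) ℤ.^ k)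
      eq = begin
        ι (z ℤ.* (↧ t) ℤ.^ k)                   ≡⟨ ι-* z _ ⟩
        ι z * ι ((↧ t) ℤ.^ k)                   ≡⟨ cong (_* ι ((↧ t) ℤ.^ k)) e ⟩
        ι (+ M) * powℚ t k * ι ((↧ t) ℤ.^ k)    ≡⟨ solve 3 (λ a b c → a :* b :* c := a :* (c :* b)) refl (ι (+ M)) (powℚ t k) (ι ((↧ t) ℤ.^ k)) ⟩
        ι (+ M) * (ι ((↧ t) ℤ.^ k) * powℚ t k)  ≡⟨ cong (ι (+ M) *_) (denominator^ t k) ⟩
        ι (+ M) * ι ((↥ t) ℤ.^ k)               ≡⟨ sym (ι-* (+ M) _) ⟩
        ι (+ M ℤ.* (↥ t) ℤ.^ k)                 ∎
    one : ∀ d → .{{ℕ.NonZero d}} → d ℕ.^ M ∣ M → d ≡ 1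
    one (suc zero) _ = refl
    one (suc (suc d)) div = ⊥-elim (ℕP.<⇒≱ (n<2+m^n d M) (∣⇒≤ div))
    d≡1 : ↧ₙ t ≡ 1
    d≡1 = one (↧ₙ t) (divisible M)

  Λ-+ : ∀ {x y} → Λ x → Λ y → Λ (x +Q y)
  Λ-+ (z , refl) (w , refl) = z +Z w , ιQ-+ z w

  Λ-neg : ∀ {x} → Λ x → Λ (negQ x)
  Λ-neg (quad a b c d , refl) = quad (ℤ.- a) (ℤ.- b) (ℤ.- c) (ℤ.- d) , quad-≡ (ι-neg a) (ι-neg b) (ι-neg c) (ι-neg d)

  embZ : ℤ → Quad ℤ
  embZ z = quad z (+ 0) (+ 0) (+ 0)

  ιQ-embZ : ∀ z → ιQ (embZ z) ≡ emb (ι z)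
  ιQ-embZ z = quad-≡ refl ι-0 ι-0 ι-0

  Λ-emb : ∀ z → Λ (emb (ι z))
  Λ-emb z = embZ z , ιQ-embZ z

  module AlmostInteger (k₁ k₂ k₃ : ℤ) where

    open Mul k₁ k₂ k₃ public

    infixr 8 _^Q_
    _^Q_ : Quad ℚ → ℕ → Quad ℚ
    x ^Q zero  = emb 1ℚ
    x ^Q suc n = x · x ^Q n

    ·-identityˡ : ∀ x → emb 1ℚ · x ≡ x
    ·-identityˡ x = trans (emb-· 1ℚ x) (quad-≡ (ℚP.*-identityˡ _) (ℚP.*-identityˡ _) (ℚP.*-identityˡ _) (ℚP.*-identityˡ _))

    ring : CommutativeRing _ _
    ring = record
      { Carrier = Quad ℚ ; _≈_ = _≡_ ; _+_ = _+Q_ ; _*_ = _·_ ; -_ = negQ ; 0# = emb 0ℚ ; 1# = emb 1ℚ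
      ; isCommutativeRing = record
        { isRing = record
          { +-isAbelianGroup = record
            { isGroup = record
              { isMonoid = record
                { isSemigroup = record
                  { isMagma = record { isEquivalence = isEquivalence ; ∙-cong = cong₂ _+Q_ }
                  ; assoc = +Q-assoc }
                ; identity = +Q-identityˡ , (λ x → trans (+Q-comm x _) (+Q-identityˡ x)) }
              ; inverse = +Q-inverseˡ , (λ x → trans (+Q-comm x _) (+Q-inverseˡ x))
              ; ⁻¹-cong = cong negQ }
            ; comm = +Q-comm }
          ; *-cong = cong₂ _·_
          ; *-assoc = ·-assoc
          ; *-identity = ·-identityˡ , (λ x → trans (·-comm x _) (·-identityˡ x))
          ; distrib = (λ x y z → trans (·-comm x _) (trans (·-distribʳ x y z) (cong₂ _+Q_ (·-comm y x) (·-comm z x)))) , ·-distribʳ }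
        ; *-comm = ·-comm } }

    open CommutativeRing ring public using (commutativeSemiring; -‿inverseʳ; distribˡ) renaming (+-identityʳ to +Q-identityʳ; zeroʳ to ·-zeroʳ; +-cong to +Q-cong)
    private
      module S = SemiringSolver commutativeSemiring

    Λ-· : ∀ {x y} → Λ x → Λ y → Λ (x · y)
    Λ-· (z , refl) (w , refl) = z ·Z w , ιQ-· z w

    emb-emb : ∀ s t → emb s · emb t ≡ emb (s * t)
    emb-emb s t = trans (emb-· s (emb t)) (quad-≡ refl (ℚP.*-zeroʳ s) (ℚP.*-zeroʳ s) (ℚP.*-zeroʳ s))

    -- One positive integer clears the denominators of all powers of x. This replaces integrality
    -- because its closure under sums and products needs no polynomial for the result. The number is
    -- written `suc N` to keep it nonzero.
    AlmostInt : Quad ℚ → Set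
    AlmostInt x = ∃ λ N → ∀ k → Λ (emb (ι (+ suc N)) · x ^Q k)

    private
      embN-* : ∀ m n → emb (ι (+ suc (n ℕ.+ m ℕ.* suc n))) ≡ emb (ι (+ suc m)) · emb (ι (+ suc n))
      embN-* m n = trans (cong emb (ι-* (+ suc m) (+ suc n))) (sym (emb-emb _ _))

    ^Q-· : ∀ x y k → (x · y) ^Q k ≡ x ^Q k · y ^Q k
    ^Q-· x y zero    = sym (·-identityˡ _)
    ^Q-· x y (suc k) = trans (cong (x · y ·_) (^Q-· x y k))
      (solve 4 (λ a b c d → (a :* b) :* (c :* d) := (a :* c) :* (b :* d)) refl x y (x ^Q k) (y ^Q k))
      where open S

    AlmostInt-· : ∀ {x y} → AlmostInt x → AlmostInt y → AlmostInt (x · y)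
    AlmostInt-· {x} {y} (M , f) (N , g) = N ℕ.+ M ℕ.* suc N , λ k → subst Λ (eq k) (Λ-· (f k) (g k))
      where
      open S
      eq : ∀ k → (emb (ι (+ suc M)) · x ^Q k) · (emb (ι (+ suc N)) · y ^Q k) ≡ emb (ι (+ suc (N ℕ.+ M ℕ.* suc N))) · (x · y) ^Q k
      eq k = trans (solve 4 (λ a b c d → (a :* b) :* (c :* d) := (a :* c) :* (b :* d)) refl (emb (ι (+ suc M))) (x ^Q k) (emb (ι (+ suc N))) (y ^Q k))
                   (sym (cong₂ _·_ (embN-* M N) (^Q-· x y k)))

    AlmostInt-+ : ∀ {x y} → AlmostInt x → AlmostInt y → AlmostInt (x +Q y)
    AlmostInt-+ {x} {y} (M , f) (N , g) = N ℕ.+ M ℕ.* suc N , λ k →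
        subst Λ (trans (cong (_· (x +Q y) ^Q k) (identity (emb (ι (+ suc M))) (emb (ι (+ suc N))))) (cong (_· (x +Q y) ^Q k) (sym (embN-* M N)))) (mixed k 0 0)
      where
      open S
      A = emb (ι (+ suc M))
      B = emb (ι (+ suc N))
      identity : ∀ a b → (a · emb 1ℚ) · (b · emb 1ℚ) ≡ a · b
      identity a b = solve 2 (λ a b → (a :* con 1) :* (b :* con 1) := a :* b) refl a b
      -- Generalised to carry x^i and y^j, so that (x + y)^k is expanded one factor at a time and no
      -- binomial coefficients appear.
      mixed : ∀ k i j → Λ ((A · x ^Q i) · (B · y ^Q j) · (x +Q y) ^Q k)
      mixed zero i j = subst Λ (solve 2 (λ a b → a :* b := a :* b :* con 1) refl (A · x ^Q i) (B · y ^Q j)) (Λ-· (f i) (g j))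
      mixed (suc k) i j = subst Λ
        (solve 7 (λ a b x y u v w → (a :* (x :* u)) :* (b :* v) :* w :+ (a :* u) :* (b :* (y :* v)) :* w := (a :* u) :* (b :* v) :* ((x :+ y) :* w))
          refl A B x y (x ^Q i) (y ^Q j) ((x +Q y) ^Q k))
        (Λ-+ (mixed k (suc i) j) (mixed k i (suc j)))

    Λ-^Q : ∀ {x} → Λ x → ∀ k → Λ (x ^Q k)
    Λ-^Q h zero    = subst (λ t → Λ (emb t)) ι-1 (Λ-emb (+ 1))
    Λ-^Q h (suc k) = Λ-· h (Λ-^Q h k)

    Λ⇒AlmostInt : ∀ {x} → Λ x → AlmostInt x
    Λ⇒AlmostInt h = 0 , λ k → Λ-· (Λ-emb (+ 1)) (Λ-^Q h k)

    emb-^Q : ∀ t k → emb t ^Q k ≡ emb (powℚ t k)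
    emb-^Q t zero    = refl
    emb-^Q t (suc k) = trans (cong (emb t ·_) (emb-^Q t k)) (emb-emb t _)

    AlmostInt-emb : ∀ {t} → AlmostInt (emb t) → ∃ λ z → ι z ≡ t
    AlmostInt-emb {t} (N , f) = boundedDenominators⇒integer t N λ k →
      let (z , e) = f k in c₀ z , cong c₀ (trans e (trans (cong (emb (ι (+ suc N)) ·_) (emb-^Q t k)) (emb-emb _ _)))

  module _ (k₁ k₂ k₃ l₁ l₂ l₃ : ℤ) where
    private
      module A = AlmostInteger k₁ k₂ k₃
      module B = AlmostInteger l₁ l₂ l₃

    -- A ring map over ℚ that respects the two orders transports bounded denominators. Both the
    -- Galois conjugations and the renamings of the basis are of this kind, hence separate
    -- parameters for source and target.
    record LatticeHom : Set where
      field
        ⟦_⟧     : Quad ℚ → Quad ℚ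
        ⟦⟧-+    : ∀ x y → ⟦ x +Q y ⟧ ≡ ⟦ x ⟧ +Q ⟦ y ⟧
        ⟦⟧-·    : ∀ x y → ⟦ x A.· y ⟧ ≡ ⟦ x ⟧ B.· ⟦ y ⟧
        ⟦⟧-emb  : ∀ t → ⟦ emb t ⟧ ≡ emb t
        ⟦⟧-Λ    : ∀ {x} → Λ x → Λ ⟦ x ⟧

      ⟦⟧-^Q : ∀ x k → ⟦ x A.^Q k ⟧ ≡ ⟦ x ⟧ B.^Q k
      ⟦⟧-^Q x zero    = ⟦⟧-emb 1ℚ
      ⟦⟧-^Q x (suc k) = trans (⟦⟧-· x _) (cong (⟦ x ⟧ B.·_) (⟦⟧-^Q x k))

      ⟦⟧-AlmostInt : ∀ {x} → A.AlmostInt x → B.AlmostInt ⟦ x ⟧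
      ⟦⟧-AlmostInt {x} (N , f) = N , λ k → subst Λ (trans (⟦⟧-· _ _) (cong₂ B._·_ (⟦⟧-emb _) (⟦⟧-^Q x k))) (⟦⟧-Λ (f k))

-- Conjugations and changes of basis.

module FieldMaps where

  open Quadruples
  open AlmostIntegrality
  open import Data.Rational using (_+_; _*_; -_)

  module Homomorphisms where
    open +-*-Solver

    private
      Eqn : Set
      Eqn = let P = Polynomial 11 in P → P → P → P → P → P → P → P → P → P → P → P × P

      Coordinate : Set₁
      Coordinate = {R : Set} → Quad R → R

      Eqns : Set₁
      Eqns = Coordinate → Eqn

      multiplicative : (f : {R : Set} → (R → R) → Quad R → Quad R)
                       (l₁ l₂ l₃ : {R : Set} → (R → R) → R → R → R → R) → Eqns
      multiplicative f l₁ l₂ l₃ π k l m a b c d a' b' c' d' =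
        let x = quad a b c d; y = quad a' b' c' d' in
        π (f :-_ (mul _:+_ _:*_ k l m x y)) := π (mul _:+_ _:*_ (l₁ :-_ k l m) (l₂ :-_ k l m) (l₃ :-_ k l m) (f :-_ x) (f :-_ y))

    -- `conj₁` fixes √p and `conj₂` fixes √q; together they generate the Galois group. The swaps
    -- realise transpositions of the kᵢ, and `flip` realises the negation of all kᵢ, which preserves
    -- p, q, r and turns √p√q = k₁√r into -k₁ times -√r. Negation is an argument so that the same
    -- formula acts on integers, rationals and symbolic polynomials.
    conj₁ conj₂ swap₂₃ swap₁₂ flip : {R : Set} → (R → R) → Quad R → Quad R
    conj₁ neg x = quad (c₀ x) (c₁ x) (neg (c₂ x)) (neg (c₃ x))
    conj₂ neg x = quad (c₀ x) (neg (c₁ x)) (c₂ x) (neg (c₃ x))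
    swap₂₃ _ x = quad (c₀ x) (c₂ x) (c₁ x) (c₃ x)
    swap₁₂ _ x = quad (c₀ x) (c₁ x) (c₃ x) (c₂ x)
    flip neg x = quad (c₀ x) (c₁ x) (c₂ x) (neg (c₃ x))

    module _ (k₁ k₂ k₃ : ℤ) where

      opaque
        unfolding _+Q_ Mul._·_

        conj₁-hom : LatticeHom k₁ k₂ k₃ k₁ k₂ k₃
        conj₁-hom = record
          { ⟦_⟧ = conj₁ -_
          ; ⟦⟧-+ = λ x y → quad-≡ refl refl (ℚP.neg-distrib-+ (c₂ x) _) (ℚP.neg-distrib-+ (c₃ x) _)
          ; ⟦⟧-· = λ { (quad a b c d) (quad a' b' c' d') → quad-≡
              (solve 11 (E c₀) refl (ι k₁) (ι k₂) (ι k₃) a b c d a' b' c' d')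
              (solve 11 (E c₁) refl (ι k₁) (ι k₂) (ι k₃) a b c d a' b' c' d')
              (solve 11 (E c₂) refl (ι k₁) (ι k₂) (ι k₃) a b c d a' b' c' d')
              (solve 11 (E c₃) refl (ι k₁) (ι k₂) (ι k₃) a b c d a' b' c' d') }
          ; ⟦⟧-emb = λ t → refl
          ; ⟦⟧-Λ = λ { (z , refl) → conj₁ ℤ.-_ z , quad-≡ refl refl (ι-neg _) (ι-neg _) } }
          where
          E : Eqns
          E = multiplicative conj₁ (λ _ k l m → k) (λ _ k l m → l) (λ _ k l m → m)

        conj₂-hom : LatticeHom k₁ k₂ k₃ k₁ k₂ k₃
        conj₂-hom = record
          { ⟦_⟧ = conj₂ -_
          ; ⟦⟧-+ = λ x y → quad-≡ refl (ℚP.neg-distrib-+ (c₁ x) _) refl (ℚP.neg-distrib-+ (c₃ x) _)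
          ; ⟦⟧-· = λ { (quad a b c d) (quad a' b' c' d') → quad-≡
              (solve 11 (E c₀) refl (ι k₁) (ι k₂) (ι k₃) a b c d a' b' c' d')
              (solve 11 (E c₁) refl (ι k₁) (ι k₂) (ι k₃) a b c d a' b' c' d')
              (solve 11 (E c₂) refl (ι k₁) (ι k₂) (ι k₃) a b c d a' b' c' d')
              (solve 11 (E c₃) refl (ι k₁) (ι k₂) (ι k₃) a b c d a' b' c' d') }
          ; ⟦⟧-emb = λ t → refl
          ; ⟦⟧-Λ = λ { (z , refl) → conj₂ ℤ.-_ z , quad-≡ refl (ι-neg _) refl (ι-neg _) } }
          where
          E : Eqns
          E = multiplicative conj₂ (λ _ k l m → k) (λ _ k l m → l) (λ _ k l m → m)

        swap₂₃-hom : LatticeHom k₁ k₂ k₃ k₁ k₃ k₂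
        swap₂₃-hom = record
          { ⟦_⟧ = swap₂₃ -_
          ; ⟦⟧-+ = λ x y → refl
          ; ⟦⟧-· = λ { (quad a b c d) (quad a' b' c' d') → quad-≡
              (solve 11 (E c₀) refl (ι k₁) (ι k₂) (ι k₃) a b c d a' b' c' d')
              (solve 11 (E c₁) refl (ι k₁) (ι k₂) (ι k₃) a b c d a' b' c' d')
              (solve 11 (E c₂) refl (ι k₁) (ι k₂) (ι k₃) a b c d a' b' c' d')
              (solve 11 (E c₃) refl (ι k₁) (ι k₂) (ι k₃) a b c d a' b' c' d') }
          ; ⟦⟧-emb = λ t → refl
          ; ⟦⟧-Λ = λ { (z , refl) → swap₂₃ ℤ.-_ z , refl } }
          where
          E : Eqns
          E = multiplicative swap₂₃ (λ _ k l m → k) (λ _ k l m → m) (λ _ k l m → l)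

        swap₁₂-hom : LatticeHom k₁ k₂ k₃ k₂ k₁ k₃
        swap₁₂-hom = record
          { ⟦_⟧ = swap₁₂ -_
          ; ⟦⟧-+ = λ x y → refl
          ; ⟦⟧-· = λ { (quad a b c d) (quad a' b' c' d') → quad-≡
              (solve 11 (E c₀) refl (ι k₁) (ι k₂) (ι k₃) a b c d a' b' c' d')
              (solve 11 (E c₁) refl (ι k₁) (ι k₂) (ι k₃) a b c d a' b' c' d')
              (solve 11 (E c₂) refl (ι k₁) (ι k₂) (ι k₃) a b c d a' b' c' d')
              (solve 11 (E c₃) refl (ι k₁) (ι k₂) (ι k₃) a b c d a' b' c' d') }
          ; ⟦⟧-emb = λ t → refl
          ; ⟦⟧-Λ = λ { (z , refl) → swap₁₂ ℤ.-_ z , refl } }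
          where
          E : Eqns
          E = multiplicative swap₁₂ (λ _ k l m → l) (λ _ k l m → k) (λ _ k l m → m)

        flip-hom : LatticeHom k₁ k₂ k₃ (ℤ.- k₁) (ℤ.- k₂) (ℤ.- k₃)
        flip-hom = record
          { ⟦_⟧ = flip -_
          ; ⟦⟧-+ = λ x y → quad-≡ refl refl refl (ℚP.neg-distrib-+ (c₃ x) _)
          ; ⟦⟧-· = λ { x@(quad a b c d) y@(quad a' b' c' d') → trans (quad-≡
              (solve 11 (E c₀) refl (ι k₁) (ι k₂) (ι k₃) a b c d a' b' c' d')
              (solve 11 (E c₁) refl (ι k₁) (ι k₂) (ι k₃) a b c d a' b' c' d')
              (solve 11 (E c₂) refl (ι k₁) (ι k₂) (ι k₃) a b c d a' b' c' d')
              (solve 11 (E c₃) refl (ι k₁) (ι k₂) (ι k₃) a b c d a' b' c' d'))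
              (cong₃ (λ k l m → mul _+_ _*_ k l m (flip -_ x) (flip -_ y)) (sym (ι-neg k₁)) (sym (ι-neg k₂)) (sym (ι-neg k₃))) }
          ; ⟦⟧-emb = λ t → refl
          ; ⟦⟧-Λ = λ { (z , refl) → flip ℤ.-_ z , quad-≡ refl refl refl (ι-neg _) } }
          where
          E : Eqns
          E = multiplicative flip (λ neg k l m → neg k) (λ neg k l m → neg l) (λ neg k l m → neg m)
          cong₃ : ∀ {A B : Set} (f : A → A → A → B) {x x' y y' z z'} → x ≡ x' → y ≡ y' → z ≡ z' → f x y z ≡ f x' y' z'
          cong₃ f refl refl refl = refl

        conj₁-⟦⟧ : ∀ x → LatticeHom.⟦_⟧ conj₁-hom x ≡ conj₁ -_ x
        conj₁-⟦⟧ x = refl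

        conj₂-⟦⟧ : ∀ x → LatticeHom.⟦_⟧ conj₂-hom x ≡ conj₂ -_ x
        conj₂-⟦⟧ x = refl

        swap₂₃-⟦⟧ : ∀ x → LatticeHom.⟦_⟧ swap₂₃-hom x ≡ swap₂₃ -_ x
        swap₂₃-⟦⟧ x = refl

        swap₁₂-⟦⟧ : ∀ x → LatticeHom.⟦_⟧ swap₁₂-hom x ≡ swap₁₂ -_ x
        swap₁₂-⟦⟧ x = refl

        flip-⟦⟧ : ∀ x → LatticeHom.⟦_⟧ flip-hom x ≡ flip -_ x
        flip-⟦⟧ x = refl

-- Integral elements and elements with bounded denominators coincide.

module IntegralElements where

  open Quadruples
  open AlmostIntegrality
  open FieldMaps
  open import Data.Rational using (_+_; _*_; -_)

  double-injective : ∀ t → t + t ≡ 0ℚ → t ≡ 0ℚ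
  double-injective t e = trans (solve 1 (λ t → t := con ½ :* (t :+ t)) refl t) (trans (cong (½ *_) e) (ℚP.*-zeroʳ ½))
    where open +-*-Solver

  module Integrality (k₁ k₂ k₃ : ℤ) where

    open AlmostInteger k₁ k₂ k₃
    open Homomorphisms
    private
      module S = SemiringSolver commutativeSemiring

    eval : List ℤ → Quad ℚ → Quad ℚ
    eval [] y       = emb 0ℚ
    eval (c ∷ cs) y = emb (ι c) +Q (y · eval cs y)

    Integral : Quad ℚ → Set
    Integral y = ∃ λ cs → y ^Q length cs +Q eval cs y ≡ emb 0ℚ

    ^Q-+ : ∀ y m n → y ^Q (m ℕ.+ n) ≡ y ^Q m · y ^Q n
    ^Q-+ y zero n    = sym (·-identityˡ _)
    ^Q-+ y (suc m) n = trans (cong (y ·_) (^Q-+ y m n)) (sym (·-assoc y _ _))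

    +Q-inverse-unique : ∀ x y → x +Q y ≡ emb 0ℚ → x ≡ negQ y
    +Q-inverse-unique x y e = begin
      x                        ≡⟨ sym (+Q-identityʳ x) ⟩
      x +Q emb 0ℚ              ≡⟨ cong (x +Q_) (sym (trans (+Q-comm y _) (+Q-inverseˡ y))) ⟩
      x +Q (y +Q negQ y)       ≡⟨ sym (+Q-assoc x y _) ⟩
      (x +Q y) +Q negQ y       ≡⟨ cong (_+Q negQ y) e ⟩
      emb 0ℚ +Q negQ y         ≡⟨ +Q-identityˡ _ ⟩
      negQ y                   ∎
      where open ≡-Reasoning

    commonDenominator : ∀ y → ∃ λ D → Λ (emb (ι (+ suc D)) · y)
    commonDenominator y@(quad a b c d) = ℕ.pred D , subst Λ (sym (emb-· _ y))
      (_ , quad-≡ (clear a (↧ b ℤ.* (↧ c ℤ.* ↧ d)) e₀) (clear b (↧ a ℤ.* (↧ c ℤ.* ↧ d)) e₁)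
                  (clear c (↧ a ℤ.* (↧ b ℤ.* ↧ d)) e₂) (clear d (↧ a ℤ.* (↧ b ℤ.* ↧ c)) e₃))
      where
      open +-*-Solver
      D = ↧ₙ a ℕ.* (↧ₙ b ℕ.* (↧ₙ c ℕ.* ↧ₙ d))
      expand : ι (+ D) ≡ ι (↧ a) * (ι (↧ b) * (ι (↧ c) * ι (↧ d)))
      expand = trans (ι-* (↧ a) (↧ b ℤ.* (↧ c ℤ.* ↧ d))) (cong (ι (↧ a) *_) (trans (ι-* (↧ b) (↧ c ℤ.* ↧ d)) (cong (ι (↧ b) *_) (ι-* (↧ c) (↧ d)))))
      three : ∀ x y z → ι (x ℤ.* (y ℤ.* z)) ≡ ι x * (ι y * ι z)
      three x y z = trans (ι-* x _) (cong (ι x *_) (ι-* y z))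
      clear : ∀ t w → ι (+ D) ≡ ι w * ι (↧ t) → ι (w ℤ.* ↥ t) ≡ ι (+ D) * t
      clear t w e = begin
        ι (w ℤ.* ↥ t)         ≡⟨ ι-* w _ ⟩
        ι w * ι (↥ t)         ≡⟨ cong (ι w *_) (sym (ι-denominator t)) ⟩
        ι w * (ι (↧ t) * t)   ≡⟨ sym (ℚP.*-assoc (ι w) _ _) ⟩
        (ι w * ι (↧ t)) * t   ≡⟨ cong (_* t) (sym e) ⟩
        ι (+ D) * t           ∎
        where open ≡-Reasoning
      e₀ : ι (+ D) ≡ ι (↧ b ℤ.* (↧ c ℤ.* ↧ d)) * ι (↧ a)
      e₀ = trans expand (trans (ℚP.*-comm (ι (↧ a)) _) (cong (_* ι (↧ a)) (sym (three (↧ b) (↧ c) (↧ d)))))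
      e₁ : ι (+ D) ≡ ι (↧ a ℤ.* (↧ c ℤ.* ↧ d)) * ι (↧ b)
      e₁ = trans expand (trans (solve 4 (λ a b c d → a :* (b :* (c :* d)) := a :* (c :* d) :* b) refl (ι (↧ a)) (ι (↧ b)) (ι (↧ c)) (ι (↧ d))) (cong (_* ι (↧ b)) (sym (three (↧ a) (↧ c) (↧ d)))))
      e₂ : ι (+ D) ≡ ι (↧ a ℤ.* (↧ b ℤ.* ↧ d)) * ι (↧ c)
      e₂ = trans expand (trans (solve 4 (λ a b c d → a :* (b :* (c :* d)) := a :* (b :* d) :* c) refl (ι (↧ a)) (ι (↧ b)) (ι (↧ c)) (ι (↧ d))) (cong (_* ι (↧ c)) (sym (three (↧ a) (↧ b) (↧ d)))))
      e₃ : ι (+ D) ≡ ι (↧ a ℤ.* (↧ b ℤ.* ↧ c)) * ι (↧ d)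
      e₃ = trans expand (trans (solve 4 (λ a b c d → a :* (b :* (c :* d)) := a :* (b :* c) :* d) refl (ι (↧ a)) (ι (↧ b)) (ι (↧ c)) (ι (↧ d))) (cong (_* ι (↧ d)) (sym (three (↧ a) (↧ b) (↧ c)))))

    powℚ-ι : ∀ m n → powℚ (ι (+ m)) n ≡ ι (+ (m ℕ.^ n))
    powℚ-ι m zero    = sym ι-1
    powℚ-ι m (suc n) = trans (cong (ι (+ m) *_) (powℚ-ι m n)) (trans (sym (ι-* (+ m) (+ (m ℕ.^ n)))) (cong ι (sym (ℤP.pos-* m (m ℕ.^ n)))))

    -- If δ clears the denominators of y and n is the degree of the monic relation, then M = δ^n
    -- clears y^j for j ≤ n. Higher powers are reduced by that relation to lower ones with integer
    -- coefficients, so the same M serves by strong induction.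
    Integral⇒AlmostInt : ∀ {y} → Integral y → AlmostInt y
    Integral⇒AlmostInt {y} (cs , root) = ℕ.pred (suc D ℕ.^ n) , λ k → subst (λ u → Λ (u · y ^Q k)) M≡ (powers k)
      where
      n = length cs
      D = proj₁ (commonDenominator y)
      δ = emb (ι (+ suc D))
      M = δ ^Q n
      M≡ : M ≡ emb (ι (+ suc (ℕ.pred (suc D ℕ.^ n))))
      M≡ = trans (emb-^Q _ n) (cong emb (trans (powℚ-ι (suc D) n) (cong (λ u → ι (+ u)) (sym (ℕP.suc-pred (suc D ℕ.^ n) {{ℕP.m^n≢0 (suc D) n}})))))

      small : ∀ n j → j ℕ.≤ n → Λ (δ ^Q n · y ^Q j)
      small n zero _ = Λ-· (Λ-^Q (Λ-emb _) n) (Λ-^Q (Λ-emb (+ 0)) zero)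
      small (suc n) (suc j) (ℕ.s≤s le) = subst Λ (solve 4 (λ a b c d → (a :* b) :* (c :* d) := (a :* c) :* (b :* d)) refl δ y (δ ^Q n) (y ^Q j))
        (Λ-· (proj₂ (commonDenominator y)) (small n j le))
        where open S

      combination : ∀ cs k → (∀ i → i ℕ.< k ℕ.+ length cs → Λ (M · y ^Q i)) → Λ ((M · y ^Q k) · eval cs y)
      combination [] k h = subst Λ (sym (·-zeroʳ _)) (subst (λ t → Λ (emb t)) ι-0 (Λ-emb (+ 0)))
      combination (c ∷ cs) k h = subst Λ
        (solve 5 (λ m u y c v → c :* (m :* u) :+ (m :* (y :* u)) :* v := (m :* u) :* (c :+ y :* v)) refl M (y ^Q k) y (emb (ι c)) (eval cs y))
        (Λ-+ (Λ-· (Λ-emb c) (h k (ℕP.m<m+n k (ℕ.s≤s ℕ.z≤n))))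
             (combination cs (suc k) (λ i lt → h i (subst (i ℕ.<_) (sym (ℕP.+-suc k (length cs))) lt))))
        where open S

      powers : ∀ j → Λ (M · y ^Q j)
      powers = <-rec (λ j → Λ (M · y ^Q j)) step
        where
        step : ∀ j → (∀ {i} → i ℕ.< j → Λ (M · y ^Q i)) → Λ (M · y ^Q j)
        step j ih with ℕP.≤-total j n
        ... | inj₁ j≤n = small n j j≤n
        ... | inj₂ n≤j = subst Λ (sym eq) (Λ-neg (combination cs (j ℕ.∸ n) (λ i lt → ih (subst (i ℕ.<_) (ℕP.m∸n+n≡m n≤j) lt))))
          where
          u = y ^Q (j ℕ.∸ n)
          split : M · y ^Q j ≡ (M · u) · y ^Q n
          split = trans (cong (λ i → M · y ^Q i) (sym (ℕP.m∸n+n≡m n≤j))) (trans (cong (M ·_) (^Q-+ y (j ℕ.∸ n) n)) (sym (·-assoc M _ _)))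
          eq : M · y ^Q j ≡ negQ ((M · u) · eval cs y)
          eq = trans split (+Q-inverse-unique _ _ (trans (sym (distribˡ (M · u) _ _)) (trans (cong ((M · u) ·_) root) (·-zeroʳ _))))

    sumSquares : List (Quad ℚ) → Quad ℚ
    sumSquares []       = emb 0ℚ
    sumSquares (y ∷ ys) = y · y +Q sumSquares ys

    AlmostInt-sumSquares : ∀ {ys} → All AlmostInt ys → AlmostInt (sumSquares ys)
    AlmostInt-sumSquares []       = Λ⇒AlmostInt (subst (λ t → Λ (emb t)) ι-0 (Λ-emb (+ 0)))
    AlmostInt-sumSquares (h ∷ hs) = AlmostInt-+ (AlmostInt-· h h) (AlmostInt-sumSquares hs)

    private
      module C₁ = LatticeHom (conj₁-hom k₁ k₂ k₃)
      module C₂ = LatticeHom (conj₂-hom k₁ k₂ k₃)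

    fixed⇒rational : ∀ x → C₁.⟦ x ⟧ ≡ x → C₂.⟦ x ⟧ ≡ x → x ≡ emb (c₀ x)
    fixed⇒rational x f₁ f₂ = quad-≡ refl (zero! (cong c₁ g₂)) (zero! (cong c₂ g₁)) (zero! (cong c₃ g₁))
      where
      g₁ = trans (sym (conj₁-⟦⟧ k₁ k₂ k₃ x)) f₁
      g₂ = trans (sym (conj₂-⟦⟧ k₁ k₂ k₃ x)) f₂
      zero! : ∀ {t} → - t ≡ t → t ≡ 0ℚ
      zero! {t} e = double-injective t (trans (cong (_+ t) (sym e)) (ℚP.+-inverseˡ t))

    module _ {y : Quad ℚ} (hy : AlmostInt y) where
      private
        y₁ y₂ y₃ : Quad ℚ
        y₁ = C₁.⟦ y ⟧
        y₂ = C₂.⟦ y ⟧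
        y₃ = C₁.⟦ C₂.⟦ y ⟧ ⟧

        neg² : ∀ t → - (- t) ≡ t
        neg² = solve 1 (λ t → :- (:- t) := t) refl
          where open +-*-Solver
        both₁ : ∀ x → C₁.⟦ C₁.⟦ x ⟧ ⟧ ≡ x
        both₁ x = trans (cong C₁.⟦_⟧ (conj₁-⟦⟧ k₁ k₂ k₃ x)) (trans (conj₁-⟦⟧ k₁ k₂ k₃ _) (quad-≡ refl refl (neg² _) (neg² _)))
        both₂ : ∀ x → C₂.⟦ C₂.⟦ x ⟧ ⟧ ≡ x
        both₂ x = trans (cong C₂.⟦_⟧ (conj₂-⟦⟧ k₁ k₂ k₃ x)) (trans (conj₂-⟦⟧ k₁ k₂ k₃ _) (quad-≡ refl (neg² _) refl (neg² _)))
        commute : ∀ x → C₂.⟦ C₁.⟦ x ⟧ ⟧ ≡ C₁.⟦ C₂.⟦ x ⟧ ⟧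
        commute x = trans (trans (cong C₂.⟦_⟧ (conj₁-⟦⟧ k₁ k₂ k₃ x)) (conj₂-⟦⟧ k₁ k₂ k₃ _))
                          (sym (trans (cong C₁.⟦_⟧ (conj₂-⟦⟧ k₁ k₂ k₃ x)) (conj₁-⟦⟧ k₁ k₂ k₃ _)))

        e₁ e₂ e₃ e₄ : Quad ℚ → Quad ℚ → Quad ℚ → Quad ℚ → Quad ℚ
        e₁ a b c d = a +Q b +Q c +Q d
        e₂ a b c d = a · b +Q a · c +Q a · d +Q b · c +Q b · d +Q c · d
        e₃ a b c d = a · b · c +Q a · b · d +Q a · c · d +Q b · c · d
        e₄ a b c d = a · b · c · d

        cong₄ : ∀ (f : Quad ℚ → Quad ℚ → Quad ℚ → Quad ℚ → Quad ℚ) {a a' b b' c c' d d'} → a ≡ a' → b ≡ b' → c ≡ c' → d ≡ d' → f a b c d ≡ f a' b' c' d'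
        cong₄ f refl refl refl refl = refl

        -- On the four conjugates of y, `conj₁` and `conj₂` act by the two double transpositions in
        -- the hypotheses. A polynomial expression invariant under both is thus fixed by the Galois
        -- group, hence rational, and a rational element with bounded denominators is an integer.
        symmetric⇒integer : (e : Quad ℚ → Quad ℚ → Quad ℚ → Quad ℚ → Quad ℚ)
          → (∀ a b c d → C₁.⟦ e a b c d ⟧ ≡ e C₁.⟦ a ⟧ C₁.⟦ b ⟧ C₁.⟦ c ⟧ C₁.⟦ d ⟧)
          → (∀ a b c d → C₂.⟦ e a b c d ⟧ ≡ e C₂.⟦ a ⟧ C₂.⟦ b ⟧ C₂.⟦ c ⟧ C₂.⟦ d ⟧)
          → (∀ a b c d → e b a d c ≡ e a b c d) → (∀ a b c d → e c d a b ≡ e a b c d)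
          → AlmostInt (e y y₁ y₂ y₃) → ∃ λ z → emb (ι z) ≡ e y y₁ y₂ y₃
        symmetric⇒integer e h₁ h₂ s₁ s₂ int = z , trans (cong emb eq) (sym rational)
          where
          rational : e y y₁ y₂ y₃ ≡ emb (c₀ (e y y₁ y₂ y₃))
          rational = fixed⇒rational _
            (trans (h₁ _ _ _ _) (trans (cong₄ e refl (both₁ y) refl (both₁ y₂)) (s₁ _ _ _ _)))
            (trans (h₂ _ _ _ _) (trans (cong₄ e refl (commute y) (both₂ y) (trans (commute y₂) (cong C₁.⟦_⟧ (both₂ y)))) (s₂ _ _ _ _)))
          found = AlmostInt-emb (subst AlmostInt rational int)
          z = proj₁ found
          eq = proj₂ found

        h₁ : AlmostInt y₁
        h₁ = C₁.⟦⟧-AlmostInt hy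
        h₂ : AlmostInt y₂
        h₂ = C₂.⟦⟧-AlmostInt hy
        h₃ : AlmostInt y₃
        h₃ = C₁.⟦⟧-AlmostInt h₂

        infixl 6 _⊹_
        infixl 7 _⊛_
        _⊹_ : ∀ {u v} → AlmostInt u → AlmostInt v → AlmostInt (u +Q v)
        _⊹_ = AlmostInt-+
        _⊛_ : ∀ {u v} → AlmostInt u → AlmostInt v → AlmostInt (u · v)
        _⊛_ = AlmostInt-·

        module Push (C : LatticeHom k₁ k₂ k₃ k₁ k₂ k₃) where
          open LatticeHom C
          push₁ : ∀ a b c d → ⟦ e₁ a b c d ⟧ ≡ e₁ ⟦ a ⟧ ⟦ b ⟧ ⟦ c ⟧ ⟦ d ⟧
          push₁ a b c d = trans (⟦⟧-+ _ _) (cong (_+Q _) (trans (⟦⟧-+ _ _) (cong (_+Q _) (⟦⟧-+ _ _))))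
          two : ∀ a b → ⟦ a · b ⟧ ≡ ⟦ a ⟧ · ⟦ b ⟧
          two = ⟦⟧-·
          three : ∀ a b c → ⟦ a · b · c ⟧ ≡ ⟦ a ⟧ · ⟦ b ⟧ · ⟦ c ⟧
          three a b c = trans (⟦⟧-· _ _) (cong (_· _) (⟦⟧-· a b))
          push₂ : ∀ a b c d → ⟦ e₂ a b c d ⟧ ≡ e₂ ⟦ a ⟧ ⟦ b ⟧ ⟦ c ⟧ ⟦ d ⟧
          push₂ a b c d = trans (⟦⟧-+ _ _) (cong₂ _+Q_ (trans (⟦⟧-+ _ _) (cong₂ _+Q_ (trans (⟦⟧-+ _ _) (cong₂ _+Q_ (trans (⟦⟧-+ _ _) (cong₂ _+Q_ (trans (⟦⟧-+ _ _) (cong₂ _+Q_ (two a b) (two a c))) (two a d))) (two b c))) (two b d))) (two c d))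
          push₃ : ∀ a b c d → ⟦ e₃ a b c d ⟧ ≡ e₃ ⟦ a ⟧ ⟦ b ⟧ ⟦ c ⟧ ⟦ d ⟧
          push₃ a b c d = trans (⟦⟧-+ _ _) (cong₂ _+Q_ (trans (⟦⟧-+ _ _) (cong₂ _+Q_ (trans (⟦⟧-+ _ _) (cong₂ _+Q_ (three a b c) (three a b d))) (three a c d))) (three b c d))
          push₄ : ∀ a b c d → ⟦ e₄ a b c d ⟧ ≡ e₄ ⟦ a ⟧ ⟦ b ⟧ ⟦ c ⟧ ⟦ d ⟧
          push₄ a b c d = trans (⟦⟧-· _ _) (cong (_· _) (three a b c))

        module P₁ = Push (conj₁-hom k₁ k₂ k₃)
        module P₂ = Push (conj₂-hom k₁ k₂ k₃)

        open S

        r₁ : ∃ λ z → emb (ι z) ≡ e₁ y y₁ y₂ y₃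
        r₁ = symmetric⇒integer e₁ P₁.push₁ P₂.push₁
          (solve 4 (λ a b c d → b :+ a :+ d :+ c := a :+ b :+ c :+ d) refl)
          (solve 4 (λ a b c d → c :+ d :+ a :+ b := a :+ b :+ c :+ d) refl)
          (hy ⊹ h₁ ⊹ h₂ ⊹ h₃)
        r₂ : ∃ λ z → emb (ι z) ≡ e₂ y y₁ y₂ y₃
        r₂ = symmetric⇒integer e₂ P₁.push₂ P₂.push₂
          (solve 4 (λ a b c d → b :* a :+ b :* d :+ b :* c :+ a :* d :+ a :* c :+ d :* c := a :* b :+ a :* c :+ a :* d :+ b :* c :+ b :* d :+ c :* d) refl)
          (solve 4 (λ a b c d → c :* d :+ c :* a :+ c :* b :+ d :* a :+ d :* b :+ a :* b := a :* b :+ a :* c :+ a :* d :+ b :* c :+ b :* d :+ c :* d) refl)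
          (hy ⊛ h₁ ⊹ hy ⊛ h₂ ⊹ hy ⊛ h₃ ⊹ h₁ ⊛ h₂ ⊹ h₁ ⊛ h₃ ⊹ h₂ ⊛ h₃)
        r₃ : ∃ λ z → emb (ι z) ≡ e₃ y y₁ y₂ y₃
        r₃ = symmetric⇒integer e₃ P₁.push₃ P₂.push₃
          (solve 4 (λ a b c d → b :* a :* d :+ b :* a :* c :+ b :* d :* c :+ a :* d :* c := a :* b :* c :+ a :* b :* d :+ a :* c :* d :+ b :* c :* d) refl)
          (solve 4 (λ a b c d → c :* d :* a :+ c :* d :* b :+ c :* a :* b :+ d :* a :* b := a :* b :* c :+ a :* b :* d :+ a :* c :* d :+ b :* c :* d) refl)
          (hy ⊛ h₁ ⊛ h₂ ⊹ hy ⊛ h₁ ⊛ h₃ ⊹ hy ⊛ h₂ ⊛ h₃ ⊹ h₁ ⊛ h₂ ⊛ h₃)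
        r₄ : ∃ λ z → emb (ι z) ≡ e₄ y y₁ y₂ y₃
        r₄ = symmetric⇒integer e₄ P₁.push₄ P₂.push₄
          (solve 4 (λ a b c d → b :* a :* d :* c := a :* b :* c :* d) refl)
          (solve 4 (λ a b c d → c :* d :* a :* b := a :* b :* c :* d) refl)
          (hy ⊛ h₁ ⊛ h₂ ⊛ h₃)

        emb-neg : ∀ z → emb (ι (ℤ.- z)) ≡ negQ (emb (ι z))
        emb-neg z = quad-≡ (ι-neg z) refl refl refl

      -- The monic polynomial is the product of X - σ(y) over the four conjugations σ. Its
      -- coefficients are elementary symmetric functions with alternating signs, integers by
      -- `symmetric⇒integer`. This direction certifies the witnesses as algebraic integers in the
      -- sense of the statement.
      AlmostInt⇒Integral : Integral y
      AlmostInt⇒Integral = proj₁ r₄ ∷ ℤ.- proj₁ r₃ ∷ proj₁ r₂ ∷ ℤ.- proj₁ r₁ ∷ [] , (begin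
        y ^Q 4 +Q (emb (ι (proj₁ r₄)) +Q y · (emb (ι (ℤ.- proj₁ r₃)) +Q y · (emb (ι (proj₁ r₂)) +Q y · (emb (ι (ℤ.- proj₁ r₁)) +Q y · emb 0ℚ))))
          ≡⟨ cong₄ (λ a b c d → y ^Q 4 +Q (a +Q y · (b +Q y · (c +Q y · (d +Q y · emb 0ℚ))))) (proj₂ r₄) (trans (emb-neg _) (cong negQ (proj₂ r₃))) (proj₂ r₂) (trans (emb-neg _) (cong negQ (proj₂ r₁))) ⟩
        y ^Q 4 +Q (E₄ +Q y · (negQ E₃ +Q y · (E₂ +Q y · (negQ E₁ +Q y · emb 0ℚ))))
          ≡⟨ vieta (negQ E₁) (negQ E₃) ⟩
        (E₁ +Q negQ E₁) · (y · y · y) +Q (E₃ +Q negQ E₃) · y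
          ≡⟨ cong₂ (λ u v → u · (y · y · y) +Q v · y) (-‿inverseʳ E₁) (-‿inverseʳ E₃) ⟩
        emb 0ℚ · (y · y · y) +Q emb 0ℚ · y
          ≡⟨ solve 1 (λ y → con 0 :* (y :* y :* y) :+ con 0 :* y := con 0) refl y ⟩
        emb 0ℚ ∎)
        where
        open ≡-Reasoning
        E₁ = e₁ y y₁ y₂ y₃
        E₂ = e₂ y y₁ y₂ y₃
        E₃ = e₃ y y₁ y₂ y₃
        E₄ = e₄ y y₁ y₂ y₃
        -- y⁴ + e₂y² + e₄ = e₁y³ + e₃y
        vieta : ∀ n₁ n₃ → y ^Q 4 +Q (E₄ +Q y · (n₃ +Q y · (E₂ +Q y · (n₁ +Q y · emb 0ℚ)))) ≡ (E₁ +Q n₁) · (y · y · y) +Q (E₃ +Q n₃) · y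
        vieta n₁ n₃ = solve 6 (λ a b c d n₁ n₃ →
          let E₁ = a :+ b :+ c :+ d
              E₂ = a :* b :+ a :* c :+ a :* d :+ b :* c :+ b :* d :+ c :* d
              E₃ = a :* b :* c :+ a :* b :* d :+ a :* c :* d :+ b :* c :* d
              E₄ = a :* b :* c :* d
          in a :* (a :* (a :* (a :* con 1))) :+ (E₄ :+ a :* (n₃ :+ a :* (E₂ :+ a :* (n₁ :+ a :* con 0))))
             := (E₁ :+ n₁) :* (a :* a :* a) :+ (E₃ :+ n₃) :* a) refl y y₁ y₂ y₃ n₁ n₃

-- Identification of the given field with quadruples.

module Presentations where

  open Quadruples
  open AlmostIntegrality
  open FieldMaps
  open IntegralElements
  open import Data.Rational using (_+_; _*_; -_)

  -- Separates the field from its coordinates: p and q stay those of the conclusion, while the kᵢ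
  -- may be permuted or negated to reach a normal form.
  record Presentation (p q : ℕ) (k₁ k₂ k₃ : ℤ) : Set where
    open Mul k₁ k₂ k₃
    field
      to        : K p q → Quad ℚ
      from      : Quad ℚ → K p q
      from∘to   : ∀ x → from (to x) ≡ x
      to∘from   : ∀ y → to (from y) ≡ y
      to-⊕      : ∀ x y → to (x ⊕ y) ≡ to x +Q to y
      to-⊗      : ∀ x y → to (x ⊗ y) ≡ to x · to y
      to-fromℚ  : ∀ t → to (fromℚ t) ≡ emb t

  module StandardIdentities where
    open +-*-Solver

    line₀ : ∀ k l m {P Q} a b c d a' b' c' d' → P ≡ k * l → Q ≡ k * m →
      a * a' + P * (b * b') + Q * (c * c') + (P * Q) * (d * d') ≡
      a * a' + (k * l) * (b * b') + (k * m) * (c * c') + (l * m) * ((k * d) * (k * d'))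
    line₀ k l m a b c d a' b' c' d' refl refl =
      solve 11 (λ k l m a b c d a' b' c' d' → a :* a' :+ (k :* l) :* (b :* b') :+ (k :* m) :* (c :* c') :+ ((k :* l) :* (k :* m)) :* (d :* d')
        := a :* a' :+ (k :* l) :* (b :* b') :+ (k :* m) :* (c :* c') :+ (l :* m) :* ((k :* d) :* (k :* d'))) refl k l m a b c d a' b' c' d'

    line₁ : ∀ k m {Q} a b c d a' b' c' d' → Q ≡ k * m →
      a * b' + b * a' + Q * (c * d') + Q * (d * c') ≡ a * b' + b * a' + m * (c * (k * d') + (k * d) * c')
    line₁ k m a b c d a' b' c' d' refl =
      solve 10 (λ k m a b c d a' b' c' d' → a :* b' :+ b :* a' :+ (k :* m) :* (c :* d') :+ (k :* m) :* (d :* c')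
        := a :* b' :+ b :* a' :+ m :* (c :* (k :* d') :+ (k :* d) :* c')) refl k m a b c d a' b' c' d'

    line₃ : ∀ k a b c d a' b' c' d' → k * (a * d' + d * a' + b * c' + c * b') ≡ a * (k * d') + (k * d) * a' + k * (b * c' + c * b')
    line₃ = solve 9 (λ k a b c d a' b' c' d' → k :* (a :* d' :+ d :* a' :+ b :* c' :+ c :* b')
      := a :* (k :* d') :+ (k :* d) :* a' :+ k :* (b :* c' :+ c :* b')) refl

  module _ {p q : ℕ} (k₁ : ℕ) (k₂ k₃ : ℤ) (p≡ : + p ≡ (+ suc k₁) ℤ.* k₂) (q≡ : + q ≡ (+ suc k₁) ℤ.* k₃) where
    private
      open Mul (+ suc k₁) k₂ k₃
      κ κ⁻¹ : ℚ
      κ = ι (+ suc k₁)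

      nonZero : ℚ.NonZero κ
      nonZero = ℚ.≢-nonZero (λ e → absurd (ι-injective (trans e (sym ι-0))))
        where
        absurd : + suc k₁ ≡ + 0 → ⊥
        absurd ()

      κ⁻¹ = ℚ.1/_ κ {{nonZero}}

      cancel : ∀ s t → s * t ≡ 1ℚ → ∀ x → s * (t * x) ≡ x
      cancel s t e x = trans (sym (ℚP.*-assoc s t x)) (trans (cong (_* x) e) (ℚP.*-identityˡ x))

      P≡ : (+ p) ℚ./ 1 ≡ κ * ι k₂
      P≡ = trans (sym (ι-def (+ p))) (trans (cong ι p≡) (ι-* _ _))

      Q≡ : (+ q) ℚ./ 1 ≡ κ * ι k₃
      Q≡ = trans (sym (ι-def (+ q))) (trans (cong ι q≡) (ι-* _ _))

      -- Here k₁ is the common factor, so √p√q = k₁√r and the last coordinate is multiplied by k₁.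
      to : K p q → Quad ℚ
      to x = quad (K.a x) (K.b x) (K.c x) (κ * K.d x)

      to-⊗ : ∀ x y → to (x ⊗ y) ≡ to x · to y
      to-⊗ (mkK a b c d) (mkK a' b' c' d') = trans
        (quad-≡ (line₀ κ (ι k₂) (ι k₃) a b c d a' b' c' d' P≡ Q≡) (line₁ κ (ι k₃) a b c d a' b' c' d' Q≡)
                (line₁ κ (ι k₂) a c b d a' c' b' d' P≡) (line₃ κ a b c d a' b' c' d'))
        (sym (·-def _ _))
        where open StandardIdentities

    standard : Presentation p q (+ suc k₁) k₂ k₃
    standard = record
      { to = to
      ; from = λ y → mkK (c₀ y) (c₁ y) (c₂ y) (κ⁻¹ * c₃ y)
      ; from∘to = λ x → cong (mkK _ _ _) (cancel κ⁻¹ κ (ℚP.*-inverseˡ κ {{nonZero}}) (K.d x))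
      ; to∘from = λ y → quad-≡ refl refl refl (cancel κ κ⁻¹ (ℚP.*-inverseʳ κ {{nonZero}}) (c₃ y))
      ; to-⊕ = λ x y → trans (quad-≡ refl refl refl (ℚP.*-distribˡ-+ κ _ _)) (sym (+Q-def _ _))
      ; to-⊗ = to-⊗
      ; to-fromℚ = λ t → quad-≡ refl refl refl (ℚP.*-zeroʳ κ) }

  √ : Quad ℚ
  √ = quad 0ℚ 1ℚ 0ℚ 0ℚ

  module _ (k₁ k₂ k₃ : ℤ) where
    open Mul k₁ k₂ k₃
    open +-*-Solver

    private
      square₀ : ∀ k l m → 0ℚ * 0ℚ + (k * l) * (1ℚ * 1ℚ) + (k * m) * (0ℚ * 0ℚ) + (l * m) * (0ℚ * 0ℚ) ≡ k * l
      square₀ = solve 3 (λ k l m → let o = con 0ℚ in o :* o :+ (k :* l) :* (con 1ℚ :* con 1ℚ) :+ (k :* m) :* (o :* o) :+ (l :* m) :* (o :* o) := k :* l) refl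
      square₁ : ∀ k → 0ℚ * 1ℚ + 1ℚ * 0ℚ + k * (0ℚ * 0ℚ + 0ℚ * 0ℚ) ≡ 0ℚ
      square₁ = solve 1 (λ k → let o = con 0ℚ in o :* con 1ℚ :+ con 1ℚ :* o :+ k :* (o :* o :+ o :* o) := o) refl
      square₂ : ∀ k → 0ℚ * 0ℚ + 0ℚ * 0ℚ + k * (1ℚ * 0ℚ + 0ℚ * 1ℚ) ≡ 0ℚ
      square₂ = solve 1 (λ k → let o = con 0ℚ in o :* o :+ o :* o :+ k :* (con 1ℚ :* o :+ o :* con 1ℚ) := o) refl

    √-square : √ · √ ≡ emb (ι k₁ * ι k₂)
    √-square = trans (·-def √ √) (quad-≡ (square₀ (ι k₁) (ι k₂) (ι k₃)) (square₁ (ι k₃)) (square₂ (ι k₂)) (square₂ (ι k₁)))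

  module _ {p q k₁ k₂ k₃} (P : Presentation p q k₁ k₂ k₃) where
    open Presentation P
    open Homomorphisms

    transport : ∀ {l₁ l₂ l₃} (h : LatticeHom k₁ k₂ k₃ l₁ l₂ l₃) (g : Quad ℚ → Quad ℚ)
      → (∀ x → g (LatticeHom.⟦_⟧ h x) ≡ x) → (∀ x → LatticeHom.⟦_⟧ h (g x) ≡ x) → Presentation p q l₁ l₂ l₃
    transport h g gh hg = record
      { to = λ x → ⟦ to x ⟧
      ; from = λ y → from (g y)
      ; from∘to = λ x → trans (cong from (gh (to x))) (from∘to x)
      ; to∘from = λ y → trans (cong ⟦_⟧ (to∘from (g y))) (hg y)
      ; to-⊕ = λ x y → trans (cong ⟦_⟧ (to-⊕ x y)) (⟦⟧-+ _ _)
      ; to-⊗ = λ x y → trans (cong ⟦_⟧ (to-⊗ x y)) (⟦⟧-· _ _)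
      ; to-fromℚ = λ t → trans (cong ⟦_⟧ (to-fromℚ t)) (⟦⟧-emb t) }
      where open LatticeHom h

    swap₂₃-presentation : Presentation p q k₁ k₃ k₂
    swap₂₃-presentation = transport (swap₂₃-hom k₁ k₂ k₃) (swap₂₃ -_) (λ x → cong (swap₂₃ -_) (swap₂₃-⟦⟧ k₁ k₂ k₃ x)) (λ x → swap₂₃-⟦⟧ k₁ k₂ k₃ _)

    swap₁₂-presentation : Presentation p q k₂ k₁ k₃
    swap₁₂-presentation = transport (swap₁₂-hom k₁ k₂ k₃) (swap₁₂ -_) (λ x → cong (swap₁₂ -_) (swap₁₂-⟦⟧ k₁ k₂ k₃ x)) (λ x → swap₁₂-⟦⟧ k₁ k₂ k₃ _)

    flip-presentation : Presentation p q (ℤ.- k₁) (ℤ.- k₂) (ℤ.- k₃)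
    flip-presentation = transport (flip-hom k₁ k₂ k₃) (flip -_)
      (λ x → trans (cong (flip -_) (flip-⟦⟧ k₁ k₂ k₃ x)) (quad-≡ refl refl refl (neg² _)))
      (λ x → trans (flip-⟦⟧ k₁ k₂ k₃ _) (quad-≡ refl refl refl (neg² _)))
      where
      open +-*-Solver
      neg² : ∀ t → - (- t) ≡ t
      neg² = solve 1 (λ t → :- (:- t) := t) refl

    to-injective : ∀ {x y} → to x ≡ to y → x ≡ y
    to-injective {x} {y} e = trans (sym (from∘to x)) (trans (cong from e) (from∘to y))

    open AlmostInteger k₁ k₂ k₃
    open Integrality k₁ k₂ k₃

    -- Turns a missing square root into an inequality for k₁k₂; applied to permuted presentations,
    -- it gives the same for k₁k₃ and k₂k₃.
    hasSqrt : ∀ n → + n ≡ k₁ ℤ.* k₂ → HasSqrt p q n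
    hasSqrt n e = from √ , to-injective (begin
        to (from √ ⊗ from √)       ≡⟨ to-⊗ (from √) (from √) ⟩
        to (from √) · to (from √)  ≡⟨ cong₂ _·_ (to∘from √) (to∘from √) ⟩
        √ · √                      ≡⟨ √-square k₁ k₂ k₃ ⟩
        emb (ι k₁ * ι k₂)          ≡⟨ cong emb (trans (sym (ι-* k₁ k₂)) (trans (cong ι (sym e)) (ι-def _))) ⟩
        emb ((+ n) ℚ./ 1)          ≡⟨ sym (to-fromℚ _) ⟩
        to (fromℚ ((+ n) ℚ./ 1))   ∎)
      where open ≡-Reasoning

    to-^K : ∀ x n → to (x ^K n) ≡ to x ^Q n
    to-^K x zero    = to-fromℚ 1ℚ
    to-^K x (suc n) = trans (to-⊗ x (x ^K n)) (cong (to x ·_) (to-^K x n))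

    to-evalℤ : ∀ cs x → to (evalℤ cs x) ≡ eval cs (to x)
    to-evalℤ [] x       = to-fromℚ 0ℚ
    to-evalℤ (c ∷ cs) x = trans (to-⊕ (fromℤ c) (x ⊗ evalℤ cs x)) (cong₂ _+Q_ (trans (to-fromℚ (c ℚ./ 1)) (cong emb (sym (ι-def c)))) (trans (to-⊗ x (evalℤ cs x)) (cong (to x ·_) (to-evalℤ cs x))))

    IsAlgInt⇒AlmostInt : ∀ {x} → IsAlgInt x → AlmostInt (to x)
    IsAlgInt⇒AlmostInt {x} (cs , e) = Integral⇒AlmostInt (cs , trans (sym (trans (to-⊕ (x ^K length cs) (evalℤ cs x)) (cong₂ _+Q_ (to-^K x (length cs)) (to-evalℤ cs x)))) (trans (cong to e) (to-fromℚ 0ℚ)))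

    Integral⇒IsAlgInt : ∀ {x} → Integral (to x) → IsAlgInt x
    Integral⇒IsAlgInt {x} (cs , e) = cs , to-injective {(x ^K length cs) ⊕ evalℤ cs x} {zeroK}
      (trans (to-⊕ (x ^K length cs) (evalℤ cs x)) (trans (cong₂ _+Q_ (to-^K x (length cs)) (to-evalℤ cs x)) (trans e (sym (to-fromℚ 0ℚ)))))

    AlmostInt⇒IsAlgInt : ∀ {x} → AlmostInt (to x) → IsAlgInt x
    AlmostInt⇒IsAlgInt {x} h = Integral⇒IsAlgInt {x} (AlmostInt⇒Integral h)

    to-sumSq : ∀ xs → to (sumSq xs) ≡ sumSquares (List.map to xs)
    to-sumSq []       = to-fromℚ 0ℚ
    to-sumSq (x ∷ xs) = trans (to-⊕ (x ⊗ x) (sumSq xs)) (cong₂ _+Q_ (to-⊗ x x) (to-sumSq xs))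

    -- For m ≤ 5 the assumed equality, applied to the sum of the squares of `ws`, would produce a
    -- representation by at most five squares. Both translations between integrality and bounded
    -- denominators enter, one for `ws` and one for the squares obtained.
    pythagorasGe : (ws : List (Quad ℚ)) → All AlmostInt ws
      → (∀ ys → All AlmostInt ys → length ys ℕ.≤ 5 → ¬ (sumSquares ys ≡ sumSquares ws))
      → PythagorasGe p q 6
    pythagorasGe ws hs bad m (ℕ.s≤s m≤5) pyth = refute (pyth x int (List.map from ws , back hs , to-injective {sumSq (List.map from ws)} {x} (trans (to-sumSq (List.map from ws)) (trans (cong sumSquares (roundTrip ws)) (sym (to∘from (sumSquares ws)))))))
      where
      x = from (sumSquares ws)
      roundTrip : ∀ ws → List.map to (List.map from ws) ≡ ws
      roundTrip []       = refl
      roundTrip (w ∷ ws) = cong₂ _∷_ (to∘from w) (roundTrip ws)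
      int : IsAlgInt x
      int = AlmostInt⇒IsAlgInt {x} (subst AlmostInt (sym (to∘from (sumSquares ws))) (AlmostInt-sumSquares hs))
      back : ∀ {ws} → All AlmostInt ws → AllAlgInt (List.map from ws)
      back []       = []
      back {w ∷ _} (h ∷ hs) = AlmostInt⇒IsAlgInt {from w} (subst AlmostInt (sym (to∘from w)) h) ∷ back hs
      forth : ∀ {xs} → AllAlgInt xs → All AlmostInt (List.map to xs)
      forth []       = []
      forth {x ∷ _} (h ∷ hs) = IsAlgInt⇒AlmostInt {x} h ∷ forth hs
      refute : ¬ IsSumSqAtMost m x
      refute (xs , ints , len , e) = bad (List.map to xs) (forth ints)
        (subst (ℕ._≤ 5) (sym (length-map to xs)) (ℕP.≤-trans len m≤5))
        (trans (sym (to-sumSq xs)) (trans (cong to e) (to∘from (sumSquares ws))))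

-- Denominators and congruences of integral coordinates.

module IntegralCoordinates where

  open Quadruples
  open AlmostIntegrality
  open FieldMaps
  open IntegralElements
  open Presentations
  open import Data.Rational using (_+_; _*_; -_)

  record GcdSplit (m n : ℕ) : Set where
    constructor gcdSplit
    field
      g m' n'  : ℕ
      m≡       : m ≡ g ℕ.* m'
      n≡       : n ≡ g ℕ.* n'
      coprime  : Coprime m' n'

  splitGcd : ∀ m n → .{{ℕ.NonZero m}} → GcdSplit m n
  splitGcd m n with gcd[m,n]∣m m n | gcd[m,n]∣n m n
  ... | divides m' e | divides n' f = gcdSplit (gcd m n) m' n' (trans e (ℕP.*-comm m' _)) (trans f (ℕP.*-comm n' _)) coprime
    where
    instance
      g≢0 : ℕ.NonZero (gcd m n)
      g≢0 = ℕ.≢-nonZero (gcd[m,n]≢0 m n (inj₁ (ℕ.≢-nonZero⁻¹ m)))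
    lift : ∀ {d l} → d ∣ l → gcd m n ℕ.* d ∣ l ℕ.* gcd m n
    lift {d} {l} h = subst (gcd m n ℕ.* d ∣_) (ℕP.*-comm (gcd m n) l) (*-monoʳ-∣ (gcd m n) h)
    coprime : Coprime m' n'
    coprime {d} (h₁ , h₂) = ∣1⇒≡1 (*-cancelˡ-∣ (gcd m n)
      (subst (gcd m n ℕ.* d ∣_) (sym (ℕP.*-identityʳ _)) (gcd-greatest (subst (gcd m n ℕ.* d ∣_) (sym e) (lift h₁)) (subst (gcd m n ℕ.* d ∣_) (sym f) (lift h₂)))))

  -- With g = gcd(p, w), p = g p' and w = g w', the factor p' divides g w'² and is prime to w', so
  -- p' divides g and p'² divides p. Hence p' = 1.
  squareFree-∣-square : ∀ p w → .{{ℕ.NonZero p}} → SquareFree p → p ∣ w ℕ.* w → p ∣ w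
  squareFree-∣-square p w sf p∣w² with splitGcd p w
  ... | gcdSplit g p' w' refl refl c = subst (λ t → g ℕ.* t ∣ g ℕ.* w') (sym p'≡1) (subst (_∣ g ℕ.* w') (sym (ℕP.*-identityʳ g)) (m∣m*n w'))
    where
    instance
      g≢0 : ℕ.NonZero g
      g≢0 = ℕP.m*n≢0⇒m≢0 g
    p'∣gw'² : p' ∣ w' ℕ.* (w' ℕ.* g)
    p'∣gw'² = *-cancelˡ-∣ g (subst (g ℕ.* p' ∣_) (solve 2 (λ g w → g :* w :* (g :* w) := g :* (w :* (w :* g))) refl g w') p∣w²)
      where open ℕ-Solve.+-*-Solver
    p'∣g : p' ∣ g
    p'∣g = coprime-divisor c (coprime-divisor c p'∣gw'²)
    p'≡1 : p' ≡ 1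
    p'≡1 = sf p' (subst (p' ℕ.* p' ∣_) (ℕP.*-comm p' g) (*-monoʳ-∣ p' p'∣g))

  ι-*-cancelʳ : ∀ n → .{{ℕ.NonZero n}} → ∀ s t → s * ι (+ n) ≡ t * ι (+ n) → s ≡ t
  ι-*-cancelʳ n s t e = begin
    s                        ≡⟨ sym (ℚP.*-identityʳ s) ⟩
    s * 1ℚ                   ≡⟨ cong (s *_) (sym inverse) ⟩
    s * (ι (+ n) * n⁻¹)      ≡⟨ sym (ℚP.*-assoc s _ _) ⟩
    (s * ι (+ n)) * n⁻¹      ≡⟨ cong (_* n⁻¹) e ⟩
    (t * ι (+ n)) * n⁻¹      ≡⟨ ℚP.*-assoc t _ _ ⟩
    t * (ι (+ n) * n⁻¹)      ≡⟨ cong (t *_) inverse ⟩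
    t * 1ℚ                   ≡⟨ ℚP.*-identityʳ t ⟩
    t                        ∎
    where
    open ≡-Reasoning
    nonZero : ℚ.NonZero (ι (+ n))
    nonZero = ℚ.≢-nonZero (λ z → ℕ.≢-nonZero⁻¹ n (ℤP.+-injective (ι-injective (trans z (sym ι-0)))))
    n⁻¹ = ℚ.1/_ (ι (+ n)) {{nonZero}}
    inverse : ι (+ n) * n⁻¹ ≡ 1ℚ
    inverse = ℚP.*-inverseʳ (ι (+ n)) {{nonZero}}

  module Lattice (k₁ k₂ k₃ : ℤ) where
    open AlmostInteger k₁ k₂ k₃
    open Homomorphisms
    open +-*-Solver
    private
      module C₁ = LatticeHom (conj₁-hom k₁ k₂ k₃)
      module C₂ = LatticeHom (conj₂-hom k₁ k₂ k₃)
      κ₁ κ₂ κ₃ : ℚ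
      κ₁ = ι k₁
      κ₂ = ι k₂
      κ₃ = ι k₃

      trace₀ : ∀ t → t + - t ≡ 0ℚ
      trace₀ = ℚP.+-inverseʳ

    trace : ∀ u v → quad u v 0ℚ 0ℚ +Q C₂.⟦ quad u v 0ℚ 0ℚ ⟧ ≡ emb (u + u)
    trace u v = trans (cong (_ +Q_) (conj₂-⟦⟧ k₁ k₂ k₃ _)) (trans (+Q-def _ _) (quad-≡ refl (trace₀ v) refl refl))

    relativeTrace : ∀ a b c d → quad a b c d +Q C₁.⟦ quad a b c d ⟧ ≡ quad (a + a) (b + b) 0ℚ 0ℚ
    relativeTrace a b c d = trans (cong (_ +Q_) (conj₁-⟦⟧ k₁ k₂ k₃ _)) (trans (+Q-def _ _) (quad-≡ refl refl (trace₀ c) (trace₀ d)))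

    private
      n₀ : ∀ k l m u v → u * u + (k * l) * (v * (- v)) + (k * m) * (0ℚ * 0ℚ) + (l * m) * (0ℚ * (- 0ℚ)) ≡ u * u + - ((k * l) * (v * v))
      n₀ = solve 5 (λ k l m u v → let o = con 0ℚ in u :* u :+ (k :* l) :* (v :* (:- v)) :+ (k :* m) :* (o :* o) :+ (l :* m) :* (o :* (:- o)) := u :* u :+ :- ((k :* l) :* (v :* v))) refl
      n₁ : ∀ m u v → u * (- v) + v * u + m * (0ℚ * (- 0ℚ) + 0ℚ * 0ℚ) ≡ 0ℚ
      n₁ = solve 3 (λ m u v → let o = con 0ℚ in u :* (:- v) :+ v :* u :+ m :* (o :* (:- o) :+ o :* o) := o) refl
      n₂ : ∀ m u v → u * 0ℚ + 0ℚ * u + m * (v * (- 0ℚ) + 0ℚ * (- v)) ≡ 0ℚ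
      n₂ = solve 3 (λ m u v → let o = con 0ℚ in u :* o :+ o :* u :+ m :* (v :* (:- o) :+ o :* (:- v)) := o) refl
      n₃ : ∀ m u v → u * (- 0ℚ) + 0ℚ * u + m * (v * 0ℚ + 0ℚ * (- v)) ≡ 0ℚ
      n₃ = solve 3 (λ m u v → let o = con 0ℚ in u :* (:- o) :+ o :* u :+ m :* (v :* o :+ o :* (:- v)) := o) refl
      r₀ : ∀ k l m a b c d → a * a + (k * l) * (b * b) + (k * m) * (c * (- c)) + (l * m) * (d * (- d)) ≡ a * a + (k * l) * (b * b) + - ((k * m) * (c * c)) + - ((l * m) * (d * d))
      r₀ = solve 7 (λ k l m a b c d → a :* a :+ (k :* l) :* (b :* b) :+ (k :* m) :* (c :* (:- c)) :+ (l :* m) :* (d :* (:- d)) := a :* a :+ (k :* l) :* (b :* b) :+ :- ((k :* m) :* (c :* c)) :+ :- ((l :* m) :* (d :* d))) refl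
      r₁ : ∀ m a b c d → a * b + b * a + m * (c * (- d) + d * (- c)) ≡ (a * b + a * b) + - (m * (c * d + c * d))
      r₁ = solve 5 (λ m a b c d → a :* b :+ b :* a :+ m :* (c :* (:- d) :+ d :* (:- c)) := (a :* b :+ a :* b) :+ :- (m :* (c :* d :+ c :* d))) refl
      r₂ : ∀ m a b c d → a * (- c) + c * a + m * (b * (- d) + d * b) ≡ 0ℚ
      r₂ = solve 5 (λ m a b c d → a :* (:- c) :+ c :* a :+ m :* (b :* (:- d) :+ d :* b) := con 0ℚ) refl
      q₀ : ∀ k l m u v → 0ℚ * u + (k * l) * (1ℚ * v) + (k * m) * (0ℚ * 0ℚ) + (l * m) * (0ℚ * 0ℚ) ≡ (k * l) * v
      q₀ = solve 5 (λ k l m u v → let o = con 0ℚ in o :* u :+ (k :* l) :* (con 1ℚ :* v) :+ (k :* m) :* (o :* o) :+ (l :* m) :* (o :* o) := (k :* l) :* v) refl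
      q₁ : ∀ m u v → 0ℚ * v + 1ℚ * u + m * (0ℚ * 0ℚ + 0ℚ * 0ℚ) ≡ u
      q₁ = solve 3 (λ m u v → let o = con 0ℚ in o :* v :+ con 1ℚ :* u :+ m :* (o :* o :+ o :* o) := u) refl
      q₂ : ∀ m u v → 0ℚ * 0ℚ + 0ℚ * u + m * (1ℚ * 0ℚ + 0ℚ * v) ≡ 0ℚ
      q₂ = solve 3 (λ m u v → let o = con 0ℚ in o :* o :+ o :* u :+ m :* (con 1ℚ :* o :+ o :* v) := o) refl

    norm : ∀ u v → quad u v 0ℚ 0ℚ · C₂.⟦ quad u v 0ℚ 0ℚ ⟧ ≡ emb (u * u + - ((κ₁ * κ₂) * (v * v)))
    norm u v = trans (cong (_ ·_) (conj₂-⟦⟧ k₁ k₂ k₃ _)) (trans (·-def _ _)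
      (quad-≡ (n₀ κ₁ κ₂ κ₃ u v) (n₁ κ₃ u v) (n₂ κ₂ u v) (n₃ κ₁ u v)))

    relativeNorm : ∀ a b c d → quad a b c d · C₁.⟦ quad a b c d ⟧ ≡
      quad (a * a + (κ₁ * κ₂) * (b * b) + - ((κ₁ * κ₃) * (c * c)) + - ((κ₂ * κ₃) * (d * d))) ((a * b + a * b) + - (κ₃ * (c * d + c * d))) 0ℚ 0ℚ
    relativeNorm a b c d = trans (cong (_ ·_) (conj₁-⟦⟧ k₁ k₂ k₃ _)) (trans (·-def _ _)
      (quad-≡ (r₀ κ₁ κ₂ κ₃ a b c d) (r₁ κ₃ a b c d) (r₂ κ₂ a b c d) (r₂ κ₁ a b d c)))

    √-times : ∀ u v → √ · quad u v 0ℚ 0ℚ ≡ quad ((κ₁ * κ₂) * v) u 0ℚ 0ℚ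
    √-times u v = trans (·-def _ _) (quad-≡ (q₀ κ₁ κ₂ κ₃ u v) (q₁ κ₃ u v) (q₂ κ₂ u v) (q₂ κ₁ u v))

    Λ-√ : Λ √
    Λ-√ = quad (+ 0) (+ 1) (+ 0) (+ 0) , quad-≡ ι-0 ι-1 ι-0 ι-0

    record QuadraticInteger (u v : ℚ) : Set where
      constructor quadraticInteger
      field
        U V n  : ℤ
        U≡     : ι U ≡ u + u
        V≡     : ι V ≡ v + v
        norm≡  : U ℤ.* U ≡ (k₁ ℤ.* k₂) ℤ.* (V ℤ.* V) ℤ.+ (+ 4) ℤ.* n

    private
      w² : ∀ k u v → (k * v + k * v) * (k * v + k * v) ≡ k * ((u + u) * (u + u) + - ((1ℚ + 1ℚ + 1ℚ + 1ℚ) * (u * u + - (k * (v * v)))))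
      w² = solve 3 (λ k u v → (k :* v :+ k :* v) :* (k :* v :+ k :* v) := k :* ((u :+ u) :* (u :+ u) :+ :- ((con 1ℚ :+ con 1ℚ :+ con 1ℚ :+ con 1ℚ) :* (u :* u :+ :- (k :* (v :* v)))))) refl
      u² : ∀ k u v → (u + u) * (u + u) ≡ k * ((v + v) * (v + v)) + (1ℚ + 1ℚ + 1ℚ + 1ℚ) * (u * u + - (k * (v * v)))
      u² = solve 3 (λ k u v → (u :+ u) :* (u :+ u) := k :* ((v :+ v) :* (v :+ v)) :+ (con 1ℚ :+ con 1ℚ :+ con 1ℚ :+ con 1ℚ) :* (u :* u :+ :- (k :* (v :* v)))) refl

    ι-4 : ι (+ 4) ≡ 1ℚ + 1ℚ + 1ℚ + 1ℚ
    ι-4 = trans (ι-+ (+ 3) (+ 1)) (cong₂ _+_ (trans (ι-+ (+ 2) (+ 1)) (cong₂ _+_ (trans (ι-+ (+ 1) (+ 1)) (cong₂ _+_ ι-1 ι-1)) ι-1)) ι-1)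

    -- If 2u and N(u + v√p) are integers then so is p(2v)², hence 2v since p is square-free.
    quadratic : ∀ p → .{{ℕ.NonZero p}} → + p ≡ k₁ ℤ.* k₂ → SquareFree p → ∀ u v → AlmostInt (quad u v 0ℚ 0ℚ) → QuadraticInteger u v
    quadratic p p≡ sf u v h = quadraticInteger U V N U≡ V≡ (ι-injective (begin
        ι (U ℤ.* U)                                                   ≡⟨ trans (ι-* U U) (cong₂ _*_ U≡ U≡) ⟩
        (u + u) * (u + u)                                             ≡⟨ u² κ u v ⟩
        κ * ((v + v) * (v + v)) + (1ℚ + 1ℚ + 1ℚ + 1ℚ) * (u * u + - (κ * (v * v)))   ≡⟨ sym (cong₂ _+_ (trans (ι-* (k₁ ℤ.* k₂) (V ℤ.* V)) (cong₂ _*_ (ι-* k₁ k₂) (trans (ι-* V V) (cong₂ _*_ V≡ V≡)))) (trans (ι-* (+ 4) N) (cong₂ _*_ ι-4 N≡))) ⟩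
        ι ((k₁ ℤ.* k₂) ℤ.* (V ℤ.* V)) + ι ((+ 4) ℤ.* N)               ≡⟨ sym (ι-+ _ _) ⟩
        ι ((k₁ ℤ.* k₂) ℤ.* (V ℤ.* V) ℤ.+ (+ 4) ℤ.* N)                 ∎))
      where
      open ≡-Reasoning
      κ = κ₁ * κ₂
      ιp : ι (+ p) ≡ κ
      ιp = trans (cong ι p≡) (ι-* k₁ k₂)
      fU : ∃ λ z → ι z ≡ u + u
      fU = AlmostInt-emb (subst AlmostInt (trace u v) (AlmostInt-+ h (C₂.⟦⟧-AlmostInt h)))
      U = proj₁ fU
      U≡ = proj₂ fU
      fN : ∃ λ z → ι z ≡ u * u + - (κ * (v * v))
      fN = AlmostInt-emb (subst AlmostInt (norm u v) (AlmostInt-· h (C₂.⟦⟧-AlmostInt h)))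
      N = proj₁ fN
      N≡ = proj₂ fN
      -- Multiplication by √p makes pv the rational part, so the trace W = 2pv is an integer. From
      -- W² = p(U² - 4N) it follows that p divides W, which makes 2v an integer.
      h' : AlmostInt (quad (κ * v) u 0ℚ 0ℚ)
      h' = subst AlmostInt (√-times u v) (AlmostInt-· (Λ⇒AlmostInt Λ-√) h)
      fW : ∃ λ z → ι z ≡ κ * v + κ * v
      fW = AlmostInt-emb (subst AlmostInt (trace (κ * v) u) (AlmostInt-+ h' (C₂.⟦⟧-AlmostInt h')))
      W = proj₁ fW
      W≡ = proj₂ fW
      W² : W ℤ.* W ≡ (+ p) ℤ.* (U ℤ.* U ℤ.+ ℤ.- ((+ 4) ℤ.* N))
      W² = ι-injective (begin
        ι (W ℤ.* W)                                                              ≡⟨ trans (ι-* W W) (cong₂ _*_ W≡ W≡) ⟩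
        (κ * v + κ * v) * (κ * v + κ * v)                                        ≡⟨ w² κ u v ⟩
        κ * ((u + u) * (u + u) + - ((1ℚ + 1ℚ + 1ℚ + 1ℚ) * (u * u + - (κ * (v * v)))))   ≡⟨ sym (trans (ι-* (+ p) _) (cong₂ _*_ ιp (trans (ι-+ _ _) (cong₂ _+_ (trans (ι-* U U) (cong₂ _*_ U≡ U≡)) (trans (ι-neg _) (cong -_ (trans (ι-* (+ 4) N) (cong₂ _*_ ι-4 N≡)))))))) ⟩
        ι ((+ p) ℤ.* (U ℤ.* U ℤ.+ ℤ.- ((+ 4) ℤ.* N)))                            ∎)
      p∣W : p ∣ ℤ.∣ W ∣
      p∣W = squareFree-∣-square p ℤ.∣ W ∣ sf (divides ℤ.∣ M ∣ (trans (sym (ℤP.abs-* W W)) (trans (cong ℤ.∣_∣ W²) (trans (ℤP.abs-* (+ p) M) (ℕP.*-comm p ℤ.∣ M ∣)))))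
        where M = U ℤ.* U ℤ.+ ℤ.- ((+ 4) ℤ.* N)
      p∣W' : (+ p) Signed.∣ W
      p∣W' = Signed.∣ᵤ⇒∣ p∣W
      V = Signed.quotient p∣W'
      V≡ : ι V ≡ v + v
      V≡ = ι-*-cancelʳ p _ _ (begin
        ι V * ι (+ p)          ≡⟨ sym (ι-* V (+ p)) ⟩
        ι (V ℤ.* (+ p))        ≡⟨ cong ι (sym (Signed._∣_.equality p∣W')) ⟩
        ι W                    ≡⟨ W≡ ⟩
        κ * v + κ * v          ≡⟨ cong₂ _+_ (ℚP.*-comm κ v) (ℚP.*-comm κ v) ⟩
        v * κ + v * κ          ≡⟨ sym (ℚP.*-distribʳ-+ κ v v) ⟩
        (v + v) * κ            ≡⟨ cong ((v + v) *_) (sym ιp) ⟩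
        (v + v) * ι (+ p)      ∎)

    four : ℚ → ℚ
    four t = (t + t) + (t + t)

    ι4-· : ∀ x → emb (ι (+ 4)) · x ≡ quad (four (c₀ x)) (four (c₁ x)) (four (c₂ x)) (four (c₃ x))
    ι4-· x = trans (emb-· _ x) (quad-≡ (times (c₀ x)) (times (c₁ x)) (times (c₂ x)) (times (c₃ x)))
      where
      times' : ∀ t → (1ℚ + 1ℚ + 1ℚ + 1ℚ) * t ≡ (t + t) + (t + t)
      times' = solve 1 (λ t → (con 1ℚ :+ con 1ℚ :+ con 1ℚ :+ con 1ℚ) :* t := (t :+ t) :+ (t :+ t)) refl
      times : ∀ t → ι (+ 4) * t ≡ four t
      times t = trans (cong (_* t) ι-4) (times' t)

  -- Necessary conditions for (A + B√p + C√q + D√r)/4 to be integral: its relative traces to the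
  -- three quadratic subfields, such as (A + B√p)/2, are integers there, and its relative norm to
  -- ℚ(√p) is an integer (U + V√p)/2.
  record IntegralCoords (k₁ k₂ k₃ : ℤ) (X : Quad ℤ) : Set where
    open Quad X renaming (c₀ to A; c₁ to B; c₂ to C; c₃ to D)
    field
      n₁ n₂ n₃ U V n : ℤ
      trace₁  : A ℤ.* A ≡ (k₁ ℤ.* k₂) ℤ.* (B ℤ.* B) ℤ.+ + 4 ℤ.* n₁
      trace₂  : A ℤ.* A ≡ (k₁ ℤ.* k₃) ℤ.* (C ℤ.* C) ℤ.+ + 4 ℤ.* n₂
      trace₃  : A ℤ.* A ≡ (k₂ ℤ.* k₃) ℤ.* (D ℤ.* D) ℤ.+ + 4 ℤ.* n₃
      norm-U  : A ℤ.* A ℤ.+ (k₁ ℤ.* k₂) ℤ.* (B ℤ.* B) ≡ (k₁ ℤ.* k₃) ℤ.* (C ℤ.* C) ℤ.+ (k₂ ℤ.* k₃) ℤ.* (D ℤ.* D) ℤ.+ + 8 ℤ.* U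
      norm-V  : A ℤ.* B ≡ k₃ ℤ.* (C ℤ.* D) ℤ.+ + 4 ℤ.* V
      norm-UV : U ℤ.* U ≡ (k₁ ℤ.* k₂) ℤ.* (V ℤ.* V) ℤ.+ + 4 ℤ.* n

  module _ (k₁ k₂ k₃ : ℤ) (p q r : ℕ) .{{_ : ℕ.NonZero p}} .{{_ : ℕ.NonZero q}} .{{_ : ℕ.NonZero r}}
    (p≡ : + p ≡ k₁ ℤ.* k₂) (q≡ : + q ≡ k₁ ℤ.* k₃) (r≡ : + r ≡ k₂ ℤ.* k₃)
    (sp : SquareFree p) (sq : SquareFree q) (sr : SquareFree r) where

    open AlmostInteger k₁ k₂ k₃
    open Homomorphisms
    open Lattice k₁ k₂ k₃ hiding (module QuadraticInteger)
    open Lattice.QuadraticInteger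
    private
      module C₁ = LatticeHom (conj₁-hom k₁ k₂ k₃)

      fU : ∀ k l m a b c d →
        let A = (a + a) + (a + a); B = (b + b) + (b + b); C = (c + c) + (c + c); D = (d + d) + (d + d)
            N = a * a + (k * l) * (b * b) + - ((k * m) * (c * c)) + - ((l * m) * (d * d)) in
        A * A + (k * l) * (B * B) ≡ (k * m) * (C * C) + (l * m) * (D * D) + ((1ℚ + 1ℚ + 1ℚ + 1ℚ) + (1ℚ + 1ℚ + 1ℚ + 1ℚ)) * (N + N)
      fU = solve 7 (λ k l m a b c d →
        let A = (a :+ a) :+ (a :+ a); B = (b :+ b) :+ (b :+ b); C = (c :+ c) :+ (c :+ c); D = (d :+ d) :+ (d :+ d)
            N = a :* a :+ (k :* l) :* (b :* b) :+ :- ((k :* m) :* (c :* c)) :+ :- ((l :* m) :* (d :* d)); o = con 1ℚ in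
        A :* A :+ (k :* l) :* (B :* B) := (k :* m) :* (C :* C) :+ (l :* m) :* (D :* D) :+ ((o :+ o :+ o :+ o) :+ (o :+ o :+ o :+ o)) :* (N :+ N)) refl
        where open +-*-Solver

      fV : ∀ m a b c d →
        let A = (a + a) + (a + a); B = (b + b) + (b + b); C = (c + c) + (c + c); D = (d + d) + (d + d)
            N = (a * b + a * b) + - (m * (c * d + c * d)) in
        A * B ≡ m * (C * D) + (1ℚ + 1ℚ + 1ℚ + 1ℚ) * (N + N)
      fV = solve 5 (λ m a b c d →
        let A = (a :+ a) :+ (a :+ a); B = (b :+ b) :+ (b :+ b); C = (c :+ c) :+ (c :+ c); D = (d :+ d) :+ (d :+ d)
            N = (a :* b :+ a :* b) :+ :- (m :* (c :* d :+ c :* d)); o = con 1ℚ in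
        A :* B := m :* (C :* D) :+ (o :+ o :+ o :+ o) :* (N :+ N)) refl
        where open +-*-Solver

    integralCoords : ∀ x → AlmostInt x → ∃ λ X → IntegralCoords k₁ k₂ k₃ X × ιQ X ≡ emb (ι (+ 4)) · x
    integralCoords (quad a b c d) h = X , record
        { n₁ = n T₁ ; n₂ = n T₂ ; n₃ = n T₃ ; U = U N ; V = V N ; n = n N
        ; trace₁ = norm≡ T₁
        ; trace₂ = subst (λ A → A ℤ.* A ≡ (k₁ ℤ.* k₃) ℤ.* (C ℤ.* C) ℤ.+ + 4 ℤ.* n T₂) (ι-injective (trans (U≡ T₂) (sym (U≡ T₁)))) (norm≡ T₂)
        ; trace₃ = subst (λ A → A ℤ.* A ≡ (k₂ ℤ.* k₃) ℤ.* (D ℤ.* D) ℤ.+ + 4 ℤ.* n T₃) (ι-injective (trans (U≡ T₃) (sym (U≡ T₁)))) (norm≡ T₃)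
        ; norm-U = ι-injective (begin
            ι (A ℤ.* A ℤ.+ (k₁ ℤ.* k₂) ℤ.* (B ℤ.* B))                 ≡⟨ trans (ι-+ _ _) (cong₂ _+_ (trans (ι-* A A) (cong₂ _*_ A≡ A≡)) (term k₁ k₂ B≡)) ⟩
            four a * four a + (ι k₁ * ι k₂) * (four b * four b)       ≡⟨ fU (ι k₁) (ι k₂) (ι k₃) a b c d ⟩
            (ι k₁ * ι k₃) * (four c * four c) + (ι k₂ * ι k₃) * (four d * four d) + ((1ℚ + 1ℚ + 1ℚ + 1ℚ) + (1ℚ + 1ℚ + 1ℚ + 1ℚ)) * (ν₁ + ν₁)
              ≡⟨ sym (trans (ι-+ _ _) (cong₂ _+_ (trans (ι-+ _ _) (cong₂ _+_ (term k₁ k₃ C≡) (term k₂ k₃ D≡))) (trans (ι-* (+ 8) (U N)) (cong₂ _*_ (trans (ι-+ (+ 4) (+ 4)) (cong₂ _+_ ι-4 ι-4)) (U≡ N))))) ⟩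
            ι ((k₁ ℤ.* k₃) ℤ.* (C ℤ.* C) ℤ.+ (k₂ ℤ.* k₃) ℤ.* (D ℤ.* D) ℤ.+ + 8 ℤ.* U N) ∎)
        ; norm-V = ι-injective (begin
            ι (A ℤ.* B)                                               ≡⟨ trans (ι-* A B) (cong₂ _*_ A≡ B≡) ⟩
            four a * four b                                           ≡⟨ fV (ι k₃) a b c d ⟩
            ι k₃ * (four c * four d) + (1ℚ + 1ℚ + 1ℚ + 1ℚ) * (ν₂ + ν₂)  ≡⟨ sym (trans (ι-+ _ _) (cong₂ _+_ (trans (ι-* k₃ _) (cong (ι k₃ *_) (trans (ι-* C D) (cong₂ _*_ C≡ D≡)))) (trans (ι-* (+ 4) (V N)) (cong₂ _*_ ι-4 (V≡ N))))) ⟩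
            ι (k₃ ℤ.* (C ℤ.* D) ℤ.+ + 4 ℤ.* V N)                      ∎)
        ; norm-UV = norm≡ N }
      , trans (quad-≡ A≡ B≡ C≡ D≡) (sym (ι4-· _))
      where
      open ≡-Reasoning
      module S₂ = LatticeHom (swap₂₃-hom k₁ k₂ k₃)
      module S₁ = LatticeHom (swap₁₂-hom k₁ k₂ k₃)
      module S₃ = LatticeHom (swap₂₃-hom k₂ k₁ k₃)
      relTrace : ∀ l₁ l₂ l₃ s .{{_ : ℕ.NonZero s}} → + s ≡ l₁ ℤ.* l₂ → SquareFree s → ∀ a b c d → AlmostInteger.AlmostInt l₁ l₂ l₃ (quad a b c d) → Lattice.QuadraticInteger l₁ l₂ l₃ (a + a) (b + b)
      relTrace l₁ l₂ l₃ s s≡ sf a b c d h = Lattice.quadratic l₁ l₂ l₃ s s≡ sf (a + a) (b + b)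
        (subst (AlmostInteger.AlmostInt l₁ l₂ l₃) (Lattice.relativeTrace l₁ l₂ l₃ a b c d) (AlmostInteger.AlmostInt-+ l₁ l₂ l₃ h (LatticeHom.⟦⟧-AlmostInt (conj₁-hom l₁ l₂ l₃) h)))
      T₁ : Lattice.QuadraticInteger k₁ k₂ k₃ (a + a) (b + b)
      T₁ = relTrace k₁ k₂ k₃ p p≡ sp a b c d h
      -- For the other two quadratic subfields the kᵢ are permuted until the radicand in question is
      -- the product of the first two.
      T₂ : Lattice.QuadraticInteger k₁ k₃ k₂ (a + a) (c + c)
      T₂ = relTrace k₁ k₃ k₂ q q≡ sq a c b d (subst (AlmostInteger.AlmostInt k₁ k₃ k₂) (swap₂₃-⟦⟧ k₁ k₂ k₃ _) (S₂.⟦⟧-AlmostInt h))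
      T₃ : Lattice.QuadraticInteger k₂ k₃ k₁ (a + a) (d + d)
      T₃ = relTrace k₂ k₃ k₁ r r≡ sr a d b c (subst (AlmostInteger.AlmostInt k₂ k₃ k₁) (trans (cong S₃.⟦_⟧ (swap₁₂-⟦⟧ k₁ k₂ k₃ _)) (swap₂₃-⟦⟧ k₂ k₁ k₃ _)) (S₃.⟦⟧-AlmostInt (S₁.⟦⟧-AlmostInt h)))
      ν₁ ν₂ : ℚ
      ν₁ = a * a + (ι k₁ * ι k₂) * (b * b) + - ((ι k₁ * ι k₃) * (c * c)) + - ((ι k₂ * ι k₃) * (d * d))
      ν₂ = (a * b + a * b) + - (ι k₃ * (c * d + c * d))
      N : Lattice.QuadraticInteger k₁ k₂ k₃ ν₁ ν₂
      N = quadratic p p≡ sp ν₁ ν₂ (subst AlmostInt (relativeNorm a b c d) (AlmostInt-· h (C₁.⟦⟧-AlmostInt h)))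
      A = U T₁
      B = V T₁
      C = V T₂
      D = V T₃
      X = quad A B C D
      A≡ : ι A ≡ four a
      A≡ = U≡ T₁
      B≡ : ι B ≡ four b
      B≡ = V≡ T₁
      C≡ : ι C ≡ four c
      C≡ = V≡ T₂
      D≡ : ι D ≡ four d
      D≡ = V≡ T₃
      term : ∀ i j {Z t} → ι Z ≡ t → ι ((i ℤ.* j) ℤ.* (Z ℤ.* Z)) ≡ (ι i * ι j) * (t * t)
      term i j {Z} e = trans (ι-* _ _) (cong₂ _*_ (ι-* i j) (trans (ι-* Z Z) (cong₂ _*_ e e)))

-- Comparison of two sums of squares coordinate by coordinate.

module CoordinateEquations where

  open Quadruples
  open AlmostIntegrality
  open FieldMaps
  open IntegralElements
  open Presentations
  open IntegralCoordinates

  ∑ : {X : Set} → (X → ℤ) → List X → ℤ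
  ∑ f []       = + 0
  ∑ f (x ∷ xs) = f x ℤ.+ ∑ f xs

  sq : ℤ → ℕ
  sq z = ∣ z ∣ ℕ.* ∣ z ∣

  ∑² : {X : Set} → (X → ℤ) → List X → ℕ
  ∑² f []       = 0
  ∑² f (x ∷ xs) = sq (f x) ℕ.+ ∑² f xs

  +sq : ∀ z → + sq z ≡ z ℤ.* z
  +sq (+ n)        = ℤP.pos-* n n
  +sq (ℤ.-[1+ n ]) = refl

  module _ {X : Set} (f g : X → ℤ) where

    infixl 7 _⊠_
    _⊠_ : X → ℤ
    _⊠_ x = f x ℤ.* g x

  sumSquaresZ : (k₁ k₂ k₃ : ℤ) → List (Quad ℤ) → Quad ℤ
  sumSquaresZ k₁ k₂ k₃ []       = embZ (+ 0)
  sumSquaresZ k₁ k₂ k₃ (X ∷ Xs) = Mul._·Z_ k₁ k₂ k₃ X X +Z sumSquaresZ k₁ k₂ k₃ Xs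

  -- The numerators have denominator 4, so this is sixteen times the original equality. The rational
  -- coordinate is a positive form and is kept in ℕ, ready for estimates; in the other three the
  -- factor 2 of the cross terms is cancelled.
  record Equations (p q r : ℕ) (k₁ k₂ k₃ : ℤ) (Xs Ws : List (Quad ℤ)) : Set where
    constructor equations
    field
      eq₀ : ∑² c₀ Xs ℕ.+ p ℕ.* ∑² c₁ Xs ℕ.+ q ℕ.* ∑² c₂ Xs ℕ.+ r ℕ.* ∑² c₃ Xs ≡
            ∑² c₀ Ws ℕ.+ p ℕ.* ∑² c₁ Ws ℕ.+ q ℕ.* ∑² c₂ Ws ℕ.+ r ℕ.* ∑² c₃ Ws
      eq₁ : ∑ (c₀ ⊠ c₁) Xs ℤ.+ k₃ ℤ.* ∑ (c₂ ⊠ c₃) Xs ≡ ∑ (c₀ ⊠ c₁) Ws ℤ.+ k₃ ℤ.* ∑ (c₂ ⊠ c₃) Ws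
      eq₂ : ∑ (c₀ ⊠ c₂) Xs ℤ.+ k₂ ℤ.* ∑ (c₁ ⊠ c₃) Xs ≡ ∑ (c₀ ⊠ c₂) Ws ℤ.+ k₂ ℤ.* ∑ (c₁ ⊠ c₃) Ws
      eq₃ : ∑ (c₀ ⊠ c₃) Xs ℤ.+ k₁ ℤ.* ∑ (c₁ ⊠ c₂) Xs ≡ ∑ (c₀ ⊠ c₃) Ws ℤ.+ k₁ ℤ.* ∑ (c₁ ⊠ c₂) Ws

  module _ (k₁ k₂ k₃ : ℤ) where
    open ℤ-Solver using (solve-∀)

    private
      step₁ : ∀ k a b c d s t → a ℤ.* b ℤ.+ b ℤ.* a ℤ.+ k ℤ.* (c ℤ.* d ℤ.+ d ℤ.* c) ℤ.+ (+ 2) ℤ.* (s ℤ.+ k ℤ.* t)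
        ≡ (+ 2) ℤ.* ((a ℤ.* b ℤ.+ s) ℤ.+ k ℤ.* (c ℤ.* d ℤ.+ t))
      step₁ = solve-∀

      line : ∀ k a b c d s t {S} → S ≡ (+ 2) ℤ.* (s ℤ.+ k ℤ.* t) → a ℤ.* b ℤ.+ b ℤ.* a ℤ.+ k ℤ.* (c ℤ.* d ℤ.+ d ℤ.* c) ℤ.+ S
        ≡ (+ 2) ℤ.* ((a ℤ.* b ℤ.+ s) ℤ.+ k ℤ.* (c ℤ.* d ℤ.+ t))
      line k a b c d s t refl = step₁ k a b c d s t

      base₁ : ∀ k → + 0 ≡ (+ 2) ℤ.* (+ 0 ℤ.+ k ℤ.* + 0)
      base₁ = solve-∀

      step₀ : ∀ P Q R a b c d a' b' c' d' →
        a ℤ.+ P ℤ.* b ℤ.+ Q ℤ.* c ℤ.+ R ℤ.* d ℤ.+ (a' ℤ.+ P ℤ.* b' ℤ.+ Q ℤ.* c' ℤ.+ R ℤ.* d')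
        ≡ (a ℤ.+ a') ℤ.+ P ℤ.* (b ℤ.+ b') ℤ.+ Q ℤ.* (c ℤ.+ c') ℤ.+ R ℤ.* (d ℤ.+ d')
      step₀ = solve-∀

      base₀ : ∀ P Q R → + 0 ≡ + 0 ℤ.+ P ℤ.* + 0 ℤ.+ Q ℤ.* + 0 ℤ.+ R ℤ.* + 0
      base₀ = solve-∀

    sumSquaresZ-c₁ : ∀ Xs → c₁ (sumSquaresZ k₁ k₂ k₃ Xs) ≡ (+ 2) ℤ.* (∑ (c₀ ⊠ c₁) Xs ℤ.+ k₃ ℤ.* ∑ (c₂ ⊠ c₃) Xs)
    sumSquaresZ-c₁ []                  = base₁ k₃
    sumSquaresZ-c₁ (quad a b c d ∷ Xs) = line k₃ a b c d (∑ (c₀ ⊠ c₁) Xs) (∑ (c₂ ⊠ c₃) Xs) (sumSquaresZ-c₁ Xs)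

    sumSquaresZ-c₂ : ∀ Xs → c₂ (sumSquaresZ k₁ k₂ k₃ Xs) ≡ (+ 2) ℤ.* (∑ (c₀ ⊠ c₂) Xs ℤ.+ k₂ ℤ.* ∑ (c₁ ⊠ c₃) Xs)
    sumSquaresZ-c₂ []                  = base₁ k₂
    sumSquaresZ-c₂ (quad a b c d ∷ Xs) = line k₂ a c b d (∑ (c₀ ⊠ c₂) Xs) (∑ (c₁ ⊠ c₃) Xs) (sumSquaresZ-c₂ Xs)

    sumSquaresZ-c₃ : ∀ Xs → c₃ (sumSquaresZ k₁ k₂ k₃ Xs) ≡ (+ 2) ℤ.* (∑ (c₀ ⊠ c₃) Xs ℤ.+ k₁ ℤ.* ∑ (c₁ ⊠ c₂) Xs)
    sumSquaresZ-c₃ []                  = base₁ k₁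
    sumSquaresZ-c₃ (quad a b c d ∷ Xs) = line k₁ a d b c (∑ (c₀ ⊠ c₃) Xs) (∑ (c₁ ⊠ c₂) Xs) (sumSquaresZ-c₃ Xs)

    sumSquaresZ-c₀ : ∀ Xs → c₀ (sumSquaresZ k₁ k₂ k₃ Xs) ≡
      + ∑² c₀ Xs ℤ.+ (k₁ ℤ.* k₂) ℤ.* + ∑² c₁ Xs ℤ.+ (k₁ ℤ.* k₃) ℤ.* + ∑² c₂ Xs ℤ.+ (k₂ ℤ.* k₃) ℤ.* + ∑² c₃ Xs
    sumSquaresZ-c₀ []                  = base₀ (k₁ ℤ.* k₂) (k₁ ℤ.* k₃) (k₂ ℤ.* k₃)
    sumSquaresZ-c₀ (quad a b c d ∷ Xs) = trans
      (cong₂ ℤ._+_ (cong₄ (λ a b c d → a ℤ.+ (k₁ ℤ.* k₂) ℤ.* b ℤ.+ (k₁ ℤ.* k₃) ℤ.* c ℤ.+ (k₂ ℤ.* k₃) ℤ.* d) (+sq a) (+sq b) (+sq c) (+sq d)) (sumSquaresZ-c₀ Xs))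
      (step₀ (k₁ ℤ.* k₂) (k₁ ℤ.* k₃) (k₂ ℤ.* k₃) (+ sq a) (+ sq b) (+ sq c) (+ sq d) (+ ∑² c₀ Xs) (+ ∑² c₁ Xs) (+ ∑² c₂ Xs) (+ ∑² c₃ Xs))
      where
      cong₄ : ∀ (f : ℤ → ℤ → ℤ → ℤ → ℤ) {a a' b b' c c' d d'} → a' ≡ a → b' ≡ b → c' ≡ c → d' ≡ d → f a b c d ≡ f a' b' c' d'
      cong₄ f refl refl refl refl = refl

    toEquations : ∀ {p q r} → + p ≡ k₁ ℤ.* k₂ → + q ≡ k₁ ℤ.* k₃ → + r ≡ k₂ ℤ.* k₃ → ∀ Xs Ws →
      sumSquaresZ k₁ k₂ k₃ Xs ≡ sumSquaresZ k₁ k₂ k₃ Ws → Equations p q r k₁ k₂ k₃ Xs Ws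
    toEquations {p} {q} {r} p≡ q≡ r≡ Xs Ws e = equations
      (ℤP.+-injective (trans (sym (natural Xs)) (trans (cong c₀ e) (natural Ws))))
      (ℤP.*-cancelˡ-≡ (+ 2) _ _ (trans (sym (sumSquaresZ-c₁ Xs)) (trans (cong c₁ e) (sumSquaresZ-c₁ Ws))))
      (ℤP.*-cancelˡ-≡ (+ 2) _ _ (trans (sym (sumSquaresZ-c₂ Xs)) (trans (cong c₂ e) (sumSquaresZ-c₂ Ws))))
      (ℤP.*-cancelˡ-≡ (+ 2) _ _ (trans (sym (sumSquaresZ-c₃ Xs)) (trans (cong c₃ e) (sumSquaresZ-c₃ Ws))))
      where
      product : ∀ {i n} m → + n ≡ i → i ℤ.* + m ≡ + (n ℕ.* m)
      product {n = n} m refl = sym (ℤP.pos-* n m)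
      natural : ∀ Xs → c₀ (sumSquaresZ k₁ k₂ k₃ Xs) ≡ + (∑² c₀ Xs ℕ.+ p ℕ.* ∑² c₁ Xs ℕ.+ q ℕ.* ∑² c₂ Xs ℕ.+ r ℕ.* ∑² c₃ Xs)
      natural Xs = trans (sumSquaresZ-c₀ Xs)
        (cong₂ ℤ._+_ (cong₂ ℤ._+_ (cong (λ s → + ∑² c₀ Xs ℤ.+ s) (product (∑² c₁ Xs) p≡)) (product (∑² c₂ Xs) q≡)) (product (∑² c₃ Xs) r≡))

    open AlmostInteger k₁ k₂ k₃
    open Integrality k₁ k₂ k₃
    private
      module S = SemiringSolver commutativeSemiring

    QuarterAlmostInt : Quad ℤ → Set
    QuarterAlmostInt W = ∃ λ w → AlmostInt w × ιQ W ≡ emb (ι (+ 4)) · w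

    private
      scale : ∀ h x s → (h · x) · (h · x) +Q h · (h · s) ≡ h · (h · (x · x +Q s))
      scale = solve 3 (λ h x s → (h :* x) :* (h :* x) :+ h :* (h :* s) := h :* (h :* (x :* x :+ s))) refl
        where open S

      data Scaled : List (Quad ℤ) → List (Quad ℚ) → Set where
        []  : Scaled [] []
        _∷_ : ∀ {X x Xs xs} → ιQ X ≡ emb (ι (+ 4)) · x → Scaled Xs xs → Scaled (X ∷ Xs) (x ∷ xs)

      scaled-sum : ∀ {Xs xs} → Scaled Xs xs → ιQ (sumSquaresZ k₁ k₂ k₃ Xs) ≡ emb (ι (+ 4)) · (emb (ι (+ 4)) · sumSquares xs)
      scaled-sum [] = trans (trans (ιQ-embZ (+ 0)) (cong emb ι-0)) (sym (trans (cong (emb (ι (+ 4)) ·_) (·-zeroʳ _)) (·-zeroʳ _)))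
      scaled-sum {X ∷ Xs} {x ∷ xs} (e ∷ es) = trans (ιQ-+ (X ·Z X) (sumSquaresZ k₁ k₂ k₃ Xs))
        (trans (cong₂ _+Q_ (trans (ιQ-· X X) (cong₂ _·_ e e)) (scaled-sum es)) (scale _ x (sumSquares xs)))

      unscale : ∀ {Ws} → All QuarterAlmostInt Ws → ∃ λ ws → All AlmostInt ws × Scaled Ws ws
      unscale []                   = [] , [] , []
      unscale ((w , h , e) ∷ rest) = let (ws , hs , es) = unscale rest in w ∷ ws , h ∷ hs , e ∷ es

    module _ {p₀ q₀} (P : Presentation p₀ q₀ k₁ k₂ k₃) (p q r : ℕ) .{{_ : ℕ.NonZero p}} .{{_ : ℕ.NonZero q}} .{{_ : ℕ.NonZero r}}
      (p≡ : + p ≡ k₁ ℤ.* k₂) (q≡ : + q ≡ k₁ ℤ.* k₃) (r≡ : + r ≡ k₂ ℤ.* k₃)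
      (sp : SquareFree p) (sq : SquareFree q) (sr : SquareFree r) where

      private
        rescale : ∀ {xs} → All AlmostInt xs → ∃ λ Xs → All (IntegralCoords k₁ k₂ k₃) Xs × Scaled Xs xs × length Xs ≡ length xs
        rescale [] = [] , [] , [] , refl
        rescale {x ∷ _} (h ∷ hs) =
          let (X , c , e) = integralCoords k₁ k₂ k₃ p q r p≡ q≡ r≡ sp sq sr x h
              (Xs , cs , es , len) = rescale hs
          in X ∷ Xs , c ∷ cs , e ∷ es , cong suc len

      -- After this reduction only integers remain: it is enough to refute the coordinate equations
      -- for at most five numerators that satisfy the conditions of integrality.
      criterion : (Ws : List (Quad ℤ)) → All QuarterAlmostInt Ws →
        (∀ Xs → All (IntegralCoords k₁ k₂ k₃) Xs → length Xs ℕ.≤ 5 → Equations p q r k₁ k₂ k₃ Xs Ws → ⊥) → PythagorasGe p₀ q₀ 6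
      criterion Ws ints bad = let (ws , hs , es) = unscale ints in
        pythagorasGe P ws hs λ ys hs' len e →
          let (Xs , cs , es' , len') = rescale hs' in
          bad Xs cs (subst (ℕ._≤ 5) (sym len') len)
            (toEquations p≡ q≡ r≡ Xs Ws (ιQ-injective (trans (scaled-sum es') (trans (cong (λ s → emb (ι (+ 4)) · (emb (ι (+ 4)) · s)) e) (sym (scaled-sum es))))))

-- Parity, units, and extraction of terms from a list.

module Parity where

  open CoordinateEquations using (∑; ∑²; sq; _⊠_)
  open import Data.Integer using (_+_; _*_; -_)
  open ℤ-Solver using (solve-∀)

  Even Odd : ℤ → Set
  Even z = ∃ λ a → z ≡ + 2 * a
  Odd z  = ∃ λ a → z ≡ + 1 + + 2 * a

  parity : ∀ z → Even z ⊎ Odd z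
  parity (+ n) = natural n
    where
    natural : ∀ n → Even (+ n) ⊎ Odd (+ n)
    natural zero = inj₁ (+ 0 , refl)
    natural (suc n) with natural n
    ... | inj₁ (a , e) = inj₂ (a , cong (λ z → + 1 + z) e)
    ... | inj₂ (a , e) = inj₁ (+ 1 + a , trans (cong (λ z → + 1 + z) e) (shift a))
      where
      shift : ∀ a → + 1 + (+ 1 + + 2 * a) ≡ + 2 * (+ 1 + a)
      shift = solve-∀
  parity -[1+ n ] with parity (+ suc n)
  ... | inj₁ (a , e) = inj₁ (- a , trans (cong -_ e) (shift a))
    where
    shift : ∀ a → - (+ 2 * a) ≡ + 2 * (- a)
    shift = solve-∀
  ... | inj₂ (a , e) = inj₂ (- a + - (+ 1) , trans (cong -_ e) (shift a))
    where
    shift : ∀ a → - (+ 1 + + 2 * a) ≡ + 1 + + 2 * (- a + - (+ 1))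
    shift = solve-∀

  even≢odd : ∀ {z} → Even z → Odd z → ⊥
  even≢odd {z} (a , e) (b , f) = absurd (a + - b) (trans (distribute a b) (trans (cong (λ w → w + - (+ 2 * b)) (trans (sym e) f)) (cancel b)))
    where
    distribute : ∀ a b → + 2 * (a + - b) ≡ + 2 * a + - (+ 2 * b)
    distribute = solve-∀
    cancel : ∀ b → + 1 + + 2 * b + - (+ 2 * b) ≡ + 1
    cancel = solve-∀
    absurd : ∀ c → + 2 * c ≡ + 1 → ⊥
    absurd c e with ℕP.m*n≡1⇒m≡1 2 ∣ c ∣ (trans (sym (ℤP.abs-* (+ 2) c)) (cong ∣_∣ e))
    ... | ()

  -- Total, so that it can be applied along a list without proofs; on odd numbers it is the floor,
  -- and `half-even` gives it its meaning on even ones.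
  half : ℤ → ℤ
  half z = Sum.[ proj₁ , proj₁ ] (parity z)

  half-even : ∀ {z} → Even z → z ≡ + 2 * half z
  half-even {z} h with parity z
  ... | inj₁ (_ , e) = e
  ... | inj₂ o = ⊥-elim (even≢odd h o)

  even-+ : ∀ {x y} → Even x → Even y → Even (x + y)
  even-+ (a , refl) (b , refl) = a + b , lemma a b
    where
    lemma : ∀ a b → + 2 * a + + 2 * b ≡ + 2 * (a + b)
    lemma = solve-∀

  odd-+ : ∀ {x y} → Odd x → Odd y → Even (x + y)
  odd-+ (a , refl) (b , refl) = + 1 + a + b , lemma a b
    where
    lemma : ∀ a b → (+ 1 + + 2 * a) + (+ 1 + + 2 * b) ≡ + 2 * (+ 1 + a + b)
    lemma = solve-∀

  odd-+-even : ∀ {x y} → Odd x → Even y → Odd (x + y)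
  odd-+-even (a , refl) (b , refl) = a + b , lemma a b
    where
    lemma : ∀ a b → (+ 1 + + 2 * a) + + 2 * b ≡ + 1 + + 2 * (a + b)
    lemma = solve-∀

  even-*ʳ : ∀ x {y} → Even y → Even (x * y)
  even-*ʳ x (b , refl) = x * b , lemma x b
    where
    lemma : ∀ x b → x * (+ 2 * b) ≡ + 2 * (x * b)
    lemma = solve-∀

  even-*ˡ : ∀ {x} y → Even x → Even (x * y)
  even-*ˡ {x} y h = subst Even (ℤP.*-comm y x) (even-*ʳ y h)

  odd-* : ∀ {x y} → Odd x → Odd y → Odd (x * y)
  odd-* (a , refl) (b , refl) = a + b + + 2 * (a * b) , lemma a b
    where
    lemma : ∀ a b → (+ 1 + + 2 * a) * (+ 1 + + 2 * b) ≡ + 1 + + 2 * (a + b + + 2 * (a * b))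
    lemma = solve-∀

  odd-*⁻ : ∀ x y → Odd (x * y) → Odd x × Odd y
  odd-*⁻ x y o with parity x | parity y
  ... | inj₁ e | _ = ⊥-elim (even≢odd (even-*ˡ y e) o)
  ... | inj₂ _ | inj₁ e = ⊥-elim (even≢odd (even-*ʳ x e) o)
  ... | inj₂ a | inj₂ b = a , b

  even-+⁻ʳ : ∀ {x y} → Even x → Even (x + y) → Even y
  even-+⁻ʳ {x} {y} ex exy with parity y
  ... | inj₁ e = e
  ... | inj₂ o = ⊥-elim (even≢odd exy (subst Odd (ℤP.+-comm y x) (odd-+-even o ex)))

  odd-+⁻ʳ : ∀ {x y} → Odd x → Even (x + y) → Odd y
  odd-+⁻ʳ {x} {y} ox exy with parity y
  ... | inj₂ o = o
  ... | inj₁ e = ⊥-elim (even≢odd exy (odd-+-even ox e))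

  odd-+⁻ʳ-even : ∀ {x y} → Odd x → Odd (x + y) → Even y
  odd-+⁻ʳ-even {x} {y} ox oxy with parity y
  ... | inj₁ e = e
  ... | inj₂ o = ⊥-elim (even≢odd (odd-+ ox o) oxy)

  infix 4 _≡₂_
  _≡₂_ : ℤ → ℤ → Set
  x ≡₂ y = Even (x + y)

  ≡₂-odd : ∀ {x y} → x ≡₂ y → Odd x → Odd y
  ≡₂-odd h o = odd-+⁻ʳ o h

  ≡₂-even : ∀ {x y} → x ≡₂ y → Even x → Even y
  ≡₂-even h e = even-+⁻ʳ e h

  ≡₂-sym : ∀ {x y} → x ≡₂ y → y ≡₂ x
  ≡₂-sym {x} {y} = subst Even (ℤP.+-comm x y)

  sq-nonZero : ∀ {z} → z ≢ + 0 → 1 ℕ.≤ sq z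
  sq-nonZero {+ zero} h = ⊥-elim (h refl)
  sq-nonZero {+ suc n} h = s≤s z≤n
  sq-nonZero { -[1+ n ]} h = s≤s z≤n

  odd⇒nonZero : ∀ {z} → Odd z → z ≢ + 0
  odd⇒nonZero o refl = even≢odd (+ 0 , refl) o

  sq-odd : ∀ {z} → Odd z → 1 ℕ.≤ sq z
  sq-odd o = sq-nonZero (odd⇒nonZero o)

  sq-2* : ∀ a → sq (+ 2 * a) ≡ 4 ℕ.* sq a
  sq-2* a = trans (cong (λ n → n ℕ.* n) (ℤP.abs-* (+ 2) a)) (lemma ∣ a ∣)
    where
    lemma : ∀ n → (2 ℕ.* n) ℕ.* (2 ℕ.* n) ≡ 4 ℕ.* (n ℕ.* n)
    lemma = ℕ-Solver.solve-∀

  sq-even : ∀ {z} → Even z → z ≢ + 0 → 4 ℕ.≤ sq z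
  sq-even (a , refl) h = subst (4 ℕ.≤_) (sym (sq-2* a)) (ℕP.*-monoʳ-≤ 4 (sq-nonZero {a} λ { refl → h refl }))

  Unit : ℤ → Set
  Unit z = z ≡ + 1 ⊎ z ≡ -[1+ 0 ]

  abs-one⇒unit : ∀ {z} → ∣ z ∣ ≡ 1 → Unit z
  abs-one⇒unit {+ 1} refl = inj₁ refl
  abs-one⇒unit { -[1+ 0 ]} refl = inj₂ refl

  unit-sq : ∀ {z} → Unit z → sq z ≡ 1
  unit-sq (inj₁ refl) = refl
  unit-sq (inj₂ refl) = refl

  small⇒unit : ∀ {z} → z ≢ + 0 → sq z ℕ.< 4 → Unit z
  small⇒unit {z} nz lt = abs-one⇒unit (one ∣ z ∣ (λ e → nz (ℤP.∣i∣≡0⇒i≡0 e)) lt)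
    where
    one : ∀ n → n ≢ 0 → n ℕ.* n ℕ.< 4 → n ≡ 1
    one zero h _ = ⊥-elim (h refl)
    one (suc zero) _ _ = refl
    one (suc (suc n)) _ lt = ⊥-elim (ℕP.<⇒≱ lt (ℕP.*-mono-≤ {2} {2 ℕ.+ n} {2} {2 ℕ.+ n} (s≤s (s≤s z≤n)) (s≤s (s≤s z≤n))))

  odd⇒unit : ∀ {z} → Odd z → sq z ℕ.< 9 → Unit z
  odd⇒unit {z} o lt = abs-one⇒unit (one ∣ z ∣ (λ e → odd⇒nonZero o (ℤP.∣i∣≡0⇒i≡0 e)) two lt)
    where
    two : ∣ z ∣ ≢ 2
    two e = even≢odd (abs-even z e) o
      where
      abs-even : ∀ z → ∣ z ∣ ≡ 2 → Even z
      abs-even (+ 2) refl = + 1 , refl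
      abs-even -[1+ 1 ] refl = -[1+ 0 ] , refl
    one : ∀ n → n ≢ 0 → n ≢ 2 → n ℕ.* n ℕ.< 9 → n ≡ 1
    one zero h _ _ = ⊥-elim (h refl)
    one (suc zero) _ _ _ = refl
    one (suc (suc zero)) _ h _ = ⊥-elim (h refl)
    one (suc (suc (suc n))) _ _ lt = ⊥-elim (ℕP.<⇒≱ lt (ℕP.*-mono-≤ {3} {3 ℕ.+ n} {3} {3 ℕ.+ n} (s≤s (s≤s (s≤s z≤n))) (s≤s (s≤s (s≤s z≤n)))))

  product-one : ∀ x y → x * y ≡ + 1 → sq x ≡ 1 × sq y ≡ 1
  product-one x y e = cong (λ n → n ℕ.* n) (ℕP.m*n≡1⇒m≡1 ∣ x ∣ ∣ y ∣ abs) , cong (λ n → n ℕ.* n) (ℕP.m*n≡1⇒n≡1 ∣ x ∣ ∣ y ∣ abs)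
    where
    abs : ∣ x ∣ ℕ.* ∣ y ∣ ≡ 1
    abs = trans (sym (ℤP.abs-* x y)) (cong ∣_∣ e)

  7≢□+□+□ : ∀ a b c → a ℕ.* a ℕ.+ (b ℕ.* b ℕ.+ (c ℕ.* c ℕ.+ 0)) ≢ 7
  7≢□+□+□ a b c e = check a b c (bound a c₁) (bound b c₂) (bound c c₃) e
    where
    bound : ∀ n → n ℕ.* n ℕ.≤ 7 → n ℕ.< 3
    bound n le with n ℕ.<? 3
    ... | yes lt = lt
    ... | no ge = ⊥-elim (ℕP.<⇒≱ (ℕP.≤-trans (s≤s le) (ℕP.n≤1+n 8)) (ℕP.*-mono-≤ (ℕP.≮⇒≥ ge) (ℕP.≮⇒≥ ge)))
    c₁ : a ℕ.* a ℕ.≤ 7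
    c₁ = subst (a ℕ.* a ℕ.≤_) e (ℕP.m≤m+n _ _)
    c₂ : b ℕ.* b ℕ.≤ 7
    c₂ = subst (b ℕ.* b ℕ.≤_) e (ℕP.≤-trans (ℕP.m≤m+n _ _) (ℕP.m≤n+m _ (a ℕ.* a)))
    c₃ : c ℕ.* c ℕ.≤ 7
    c₃ = subst (c ℕ.* c ℕ.≤_) e (ℕP.≤-trans (ℕP.≤-trans (ℕP.m≤m+n _ _) (ℕP.m≤n+m _ (b ℕ.* b))) (ℕP.m≤n+m _ (a ℕ.* a)))
    check : ∀ a b c → a ℕ.< 3 → b ℕ.< 3 → c ℕ.< 3 → a ℕ.* a ℕ.+ (b ℕ.* b ℕ.+ (c ℕ.* c ℕ.+ 0)) ≢ 7
    check a b c a<3 b<3 c<3 = subst₃ (λ a b c → a ℕ.* a ℕ.+ (b ℕ.* b ℕ.+ (c ℕ.* c ℕ.+ 0)) ≢ 7)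
      (toℕ-fromℕ< a<3) (toℕ-fromℕ< b<3) (toℕ-fromℕ< c<3) (table (fromℕ< a<3) (fromℕ< b<3) (fromℕ< c<3))
      where
      subst₃ : ∀ (P : ℕ → ℕ → ℕ → Set) {a a' b b' c c'} → a ≡ a' → b ≡ b' → c ≡ c' → P a b c → P a' b' c'
      subst₃ P refl refl refl h = h
      table : ∀ (a b c : Fin 3) → toℕ a ℕ.* toℕ a ℕ.+ (toℕ b ℕ.* toℕ b ℕ.+ (toℕ c ℕ.* toℕ c ℕ.+ 0)) ≢ 7
      table = toWitness {a? = all? λ a → all? λ b → all? λ c → ¬? (_ ℕP.≟ _)} _

  module _ {X : Set} where

    ∑-↭ : ∀ (f : X → ℤ) {xs ys} → xs ↭ ys → ∑ f xs ≡ ∑ f ys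
    ∑-↭ f Perm.refl = refl
    ∑-↭ f (prep x h) = cong (λ s → f x + s) (∑-↭ f h)
    ∑-↭ f (Perm.swap {xs} {ys} x y h) = trans (cong (λ s → f x + (f y + s)) (∑-↭ f h)) (lemma (f x) (f y) (∑ f ys))
      where
      lemma : ∀ a b c → a + (b + c) ≡ b + (a + c)
      lemma = solve-∀
    ∑-↭ f (Perm.trans h g) = trans (∑-↭ f h) (∑-↭ f g)

    ∑²-↭ : ∀ (f : X → ℤ) {xs ys} → xs ↭ ys → ∑² f xs ≡ ∑² f ys
    ∑²-↭ f Perm.refl = refl
    ∑²-↭ f (prep x h) = cong (sq (f x) ℕ.+_) (∑²-↭ f h)
    ∑²-↭ f (Perm.swap {xs} {ys} x y h) = trans (cong (λ s → sq (f x) ℕ.+ (sq (f y) ℕ.+ s)) (∑²-↭ f h)) (lemma (sq (f x)) (sq (f y)) (∑² f ys))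
      where
      lemma : ∀ a b c → a ℕ.+ (b ℕ.+ c) ≡ b ℕ.+ (a ℕ.+ c)
      lemma = ℕ-Solver.solve-∀
    ∑²-↭ f (Perm.trans h g) = trans (∑²-↭ f h) (∑²-↭ f g)

    -- The sums and hypotheses do not depend on the order of the terms, so a distinguished term may
    -- be moved to the front.
    record Pick (P : X → Set) (xs : List X) : Set where
      constructor pick
      field
        {x}   : X
        {ys}  : List X
        perm  : xs ↭ x ∷ ys
        found : P x

    pickOrAll : ∀ {P Q : X → Set} → (∀ x → P x ⊎ Q x) → ∀ xs → Pick P xs ⊎ All Q xs
    pickOrAll d [] = inj₂ []
    pickOrAll d (x ∷ xs) with d x
    ... | inj₁ p = inj₁ (pick ↭-refl p)
    ... | inj₂ q with pickOrAll d xs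
    ...   | inj₁ (pick {y} h p) = inj₁ (pick (↭-trans (prep x h) (Perm.swap x y ↭-refl)) p)
    ...   | inj₂ qs = inj₂ (q ∷ qs)

    pickOdd⊎even : ∀ (f : X → ℤ) xs → Pick (λ x → Odd (f x)) xs ⊎ All (λ x → Even (f x)) xs
    pickOdd⊎even f = pickOrAll (λ x → Sum.swap (parity (f x)))

    pickNonZero⊎zero : ∀ (f : X → ℤ) xs → Pick (λ x → f x ≢ + 0) xs ⊎ All (λ x → f x ≡ + 0) xs
    pickNonZero⊎zero f = pickOrAll λ x → case x (f x ℤP.≟ + 0)
      where
      case : ∀ x → _ → _
      case x (yes e) = inj₂ e
      case x (no h)  = inj₁ h

    ∑-even : ∀ (f : X → ℤ) {xs} → All (λ x → Even (f x)) xs → Even (∑ f xs)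
    ∑-even f [] = + 0 , refl
    ∑-even f (e ∷ es) = even-+ e (∑-even f es)

    pickOdd : ∀ (f : X → ℤ) xs → Odd (∑ f xs) → Pick (λ x → Odd (f x)) xs
    pickOdd f xs o with pickOdd⊎even f xs
    ... | inj₁ p  = p
    ... | inj₂ es = ⊥-elim (even≢odd (∑-even f es) o)

    ∑-zero : ∀ (f : X → ℤ) {xs} → All (λ x → f x ≡ + 0) xs → ∑ f xs ≡ + 0
    ∑-zero f [] = refl
    ∑-zero f (e ∷ es) = cong₂ _+_ e (∑-zero f es)

    ∑²-zero : ∀ (f : X → ℤ) {xs} → All (λ x → f x ≡ + 0) xs → ∑² f xs ≡ 0
    ∑²-zero f [] = refl
    ∑²-zero f (e ∷ es) = cong₂ ℕ._+_ (cong sq e) (∑²-zero f es)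

    ∑-⊠-zeroˡ : ∀ (f g : X → ℤ) {xs} → All (λ x → f x ≡ + 0) xs → ∑ (f ⊠ g) xs ≡ + 0
    ∑-⊠-zeroˡ f g es = ∑-zero (f ⊠ g) (All.map (λ {x} e → cong (_* g x) e) es)

    ∑-⊠-zeroʳ : ∀ (f g : X → ℤ) {xs} → All (λ x → g x ≡ + 0) xs → ∑ (f ⊠ g) xs ≡ + 0
    ∑-⊠-zeroʳ f g es = ∑-zero (f ⊠ g) (All.map (λ {x} e → trans (cong (f x *_) e) (ℤP.*-zeroʳ (f x))) es)

    ∑²-4* : ∀ (f g : X → ℤ) {xs} → All (λ x → f x ≡ + 2 * g x) xs → ∑² f xs ≡ 4 ℕ.* ∑² g xs
    ∑²-4* f g [] = refl
    ∑²-4* f g {x ∷ xs} (e ∷ es) = trans (cong₂ ℕ._+_ (trans (cong sq e) (sq-2* (g x))) (∑²-4* f g es)) (sym (ℕP.*-distribˡ-+ 4 (sq (g x)) (∑² g xs)))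

    ∑-scale : ∀ n (f g : X → ℤ) {xs} → All (λ x → f x ≡ n * g x) xs → ∑ f xs ≡ n * ∑ g xs
    ∑-scale n f g [] = sym (ℤP.*-zeroʳ n)
    ∑-scale n f g {x ∷ xs} (e ∷ es) = trans (cong₂ _+_ e (∑-scale n f g es)) (sym (ℤP.*-distribˡ-+ n (g x) (∑ g xs)))

    halves : ∀ (f : X → ℤ) {xs} → All (λ x → Even (f x)) xs → All (λ x → f x ≡ + 2 * half (f x)) xs
    halves f = All.map half-even

    ∑²-odd : ∀ (f : X → ℤ) {xs} → Pick (λ x → Odd (f x)) xs → 1 ℕ.≤ ∑² f xs
    ∑²-odd f (pick h o) = subst (1 ℕ.≤_) (sym (∑²-↭ f h)) (ℕP.≤-trans (sq-odd o) (ℕP.m≤m+n _ _))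

    ∑²-nonZero : ∀ (f : X → ℤ) {xs} → Pick (λ x → f x ≢ + 0) xs → 1 ℕ.≤ ∑² f xs
    ∑²-nonZero f (pick h o) = subst (1 ℕ.≤_) (sym (∑²-↭ f h)) (ℕP.≤-trans (sq-nonZero o) (ℕP.m≤m+n _ _))

    ∑²-even-nonZero : ∀ (f : X → ℤ) {xs} → All (λ x → Even (f x)) xs → Pick (λ x → f x ≢ + 0) xs → 4 ℕ.≤ ∑² f xs
    ∑²-even-nonZero f es (pick h o) with All-resp-↭ h es
    ... | e ∷ _ = subst (4 ℕ.≤_) (sym (∑²-↭ f h)) (ℕP.≤-trans (sq-even e o) (ℕP.m≤m+n _ _))

    even-zero⊎≥4 : ∀ (f : X → ℤ) {xs} → All (λ x → Even (f x)) xs → All (λ x → f x ≡ + 0) xs ⊎ 4 ℕ.≤ ∑² f xs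
    even-zero⊎≥4 f {xs} es with pickNonZero⊎zero f xs
    ... | inj₁ p  = inj₂ (∑²-even-nonZero f es p)
    ... | inj₂ zs = inj₁ zs

    tail-length : ∀ {xs ys : List X} {x n} → xs ↭ x ∷ ys → length xs ℕ.≤ suc n → length ys ℕ.≤ n
    tail-length h le = ℕP.≤-pred (subst (ℕ._≤ _) (↭-length h) le)

    -- The final contradiction of every case: two of five terms are used up by w₁² + w₂² and three
    -- are left for 7. Only the values 0, 1, 2 have to be tried.
    seven≢threeSquares : ∀ (f : X → ℤ) xs → length xs ℕ.≤ 3 → ∑² f xs ≢ 7
    seven≢threeSquares f [] _ ()
    seven≢threeSquares f (x ∷ []) _ e = 7≢□+□+□ ∣ f x ∣ 0 0 e
    seven≢threeSquares f (x ∷ y ∷ []) _ e = 7≢□+□+□ (∣ f x ∣) (∣ f y ∣) 0 e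
    seven≢threeSquares f (x ∷ y ∷ z ∷ []) _ e = 7≢□+□+□ (∣ f x ∣) (∣ f y ∣) (∣ f z ∣) e
    seven≢threeSquares f (_ ∷ _ ∷ _ ∷ _ ∷ _) (s≤s (s≤s (s≤s ())))

-- Size estimates and two basic sums that are not short sums of squares.

module SumsOfSquares where

  open CoordinateEquations using (∑; ∑²; sq; +sq; _⊠_)
  open Parity
  open import Data.Integer using (_+_; _*_; -_)
  open ℤ-Solver using (solve-∀)

  -- Together with `from≥` this is the scheme of all the estimates: each lower bound n ≥ m is
  -- replaced by n = m + k, and a polynomial identity with natural coefficients then shows that one
  -- side exceeds the other by a successor.
  excess : ∀ {m n} k → m ≡ n → m ≡ n ℕ.+ suc k → ⊥
  excess {m} {n} k refl e = ℕP.m≢1+m+n m (trans e (ℕP.+-suc m k))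

  from≥ : ∀ (P : ℕ → Set) {m n} → m ℕ.≤ n → (∀ k → P (m ℕ.+ k)) → P n
  from≥ P {m} {n} le h = subst P (ℕP.m+[n∸m]≡n le) (h (n ℕ.∸ m))

  from≥₂ : ∀ (P : ℕ → ℕ → Set) {m n m' n'} → m ℕ.≤ n → m' ℕ.≤ n' → (∀ k k' → P (m ℕ.+ k) (m' ℕ.+ k')) → P n n'
  from≥₂ P {n' = n'} le le' h = from≥ (λ n → P n n') le (λ k → from≥ (P _) le' (h k))

  from≥₃ : ∀ (P : ℕ → ℕ → ℕ → Set) {m n m' n' m″ n″} → m ℕ.≤ n → m' ℕ.≤ n' → m″ ℕ.≤ n″ → (∀ k k' k″ → P (m ℕ.+ k) (m' ℕ.+ k') (m″ ℕ.+ k″)) → P n n' n″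
  from≥₃ P {n' = n'} {n″ = n″} le le' le″ h = from≥ (λ n → P n n' n″) le (λ k → from≥₂ (P _) le' le″ (h k))

  from≥₄ : ∀ (P : ℕ → ℕ → ℕ → ℕ → Set) {m n m' n' m″ n″ m‴ n‴} → m ℕ.≤ n → m' ℕ.≤ n' → m″ ℕ.≤ n″ → m‴ ℕ.≤ n‴ →
    (∀ k k' k″ k‴ → P (m ℕ.+ k) (m' ℕ.+ k') (m″ ℕ.+ k″) (m‴ ℕ.+ k‴)) → P n n' n″ n‴
  from≥₄ P {n' = n'} {n″ = n″} {n‴ = n‴} le le' le″ le‴ h = from≥ (λ n → P n n' n″ n‴) le (λ k → from≥₃ (P _) le' le″ le‴ (h k))

  +ℤ-cancelˡ : ∀ x {y z} → x + y ≡ x + z → y ≡ z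
  +ℤ-cancelˡ x {y} {z} e = trans (lemma x y) (trans (cong (λ t → - x + t) e) (sym (lemma x z)))
    where
    lemma : ∀ x y → y ≡ - x + (x + y)
    lemma = solve-∀

  odd-one : Odd (+ 1)
  odd-one = + 0 , refl

  even≢1 : ∀ z → + 2 * z ≢ + 1
  even≢1 z e = even≢odd (z , sym e) odd-one

  unit-* : ∀ {z} → Unit z → z * z ≡ + 1
  unit-* (inj₁ refl) = refl
  unit-* (inj₂ refl) = refl

  -- Three odd values would be forced by parity if there were two.
  others-zero : ∀ {X : Set} (f g : X → ℤ) x ys → All (λ x → f x ≡₂ g x) (x ∷ ys) → Odd (g x) →
    Odd (∑ (f ⊠ g) (x ∷ ys)) → ¬ (3 ℕ.≤ ∑² g (x ∷ ys)) → Unit (g x) × All (λ y → g y ≡ + 0) ys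
  others-zero f g x ys (px ∷ par) ogx o∑ few = odd⇒unit ogx (ℕP.≰⇒> λ le → few (ℕP.≤-trans (ℕP.≤-trans (ℕP.m≤m+n 3 6) le) (ℕP.m≤m+n _ _))) , zeros (pickOdd⊎even g ys)
    where
    rest-even : Even (∑ (f ⊠ g) ys)
    rest-even = odd-+⁻ʳ-even {f x * g x} (odd-* (≡₂-odd (≡₂-sym {f x} px) ogx) ogx) o∑
    zeros : Pick (λ y → Odd (g y)) ys ⊎ All (λ y → Even (g y)) ys → All (λ y → g y ≡ + 0) ys
    zeros (inj₁ (pick {y} {zs} h oy)) = ⊥-elim (few (ℕP.+-mono-≤ (sq-odd ogx) (subst (2 ℕ.≤_) (sym (∑²-↭ g h)) (ℕP.+-mono-≤ (sq-odd oy) third))))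
      where
      ofy : Odd (f y)
      ofy = ≡₂-odd (≡₂-sym {f y} (All.head (All-resp-↭ h par))) oy
      third : 1 ℕ.≤ ∑² g zs
      third with pickOdd (f ⊠ g) zs (odd-+⁻ʳ {f y * g y} (odd-* ofy oy) (subst Even (∑-↭ (f ⊠ g) h) rest-even))
      ... | pick {z} k oz = ∑²-odd g (pick k (proj₂ (odd-*⁻ (f z) (g z) oz)))
    zeros (inj₂ es) with even-zero⊎≥4 g es
    ... | inj₁ zs = zs
    ... | inj₂ ge = ⊥-elim (few (ℕP.≤-trans (s≤s (s≤s (s≤s z≤n))) (ℕP.+-mono-≤ (sq-odd ogx) ge)))

  even-parts : ∀ {X : Set} (f g : X → ℤ) {xs} → All (λ x → f x ≡₂ g x) xs → All (λ x → g x ≡ + 0) xs → All (λ x → Even (f x)) xs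
  even-parts f g par zs = All.zipWith (λ { {x} (p , e) → ≡₂-even (≡₂-sym {f x} p) (subst Even (sym e) (+ 0 , refl)) }) (par , zs)

  twenty-eight≢threeSquares : ∀ {X : Set} (f : X → ℤ) xs → All (λ x → Even (f x)) xs → length xs ℕ.≤ 3 → ∑² f xs ≢ 28
  twenty-eight≢threeSquares f xs es len e =
    seven≢threeSquares (λ x → half (f x)) xs len (ℕP.*-cancelˡ-≡ _ 7 4 (trans (sym (∑²-4* f _ (halves f es))) e))

  private
    -- Three copies of s overshoot as 2s > 29. This would fail for s = 13; the next s ≡ 1 (mod 4) is
    -- 17.
    peters-bound : ∀ {s A B} → 17 ℕ.≤ s → 3 ℕ.≤ B → A ℕ.+ s ℕ.* B ≡ 29 ℕ.+ s → ⊥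
    peters-bound {A = A} hs hB = from≥₂ (λ s B → A ℕ.+ s ℕ.* B ≡ 29 ℕ.+ s → ⊥) hs hB λ s B e → excess _ e (lemma s A B)
      where
      lemma : ∀ s A B → A ℕ.+ (17 ℕ.+ s) ℕ.* (3 ℕ.+ B) ≡ 29 ℕ.+ (17 ℕ.+ s) ℕ.+ suc (A ℕ.+ 2 ℕ.* s ℕ.+ (17 ℕ.+ s) ℕ.* B ℕ.+ 4)
      lemma = ℕ-Solver.solve-∀

  -- Peters: 7 + ((1 + √s)/2)² is not a sum of four squares ((f + g√s)/2)².
  peters : ∀ {X : Set} (f g : X → ℤ) s xs → 17 ℕ.≤ s → All (λ x → f x ≡₂ g x) xs →
    ∑² f xs ℕ.+ s ℕ.* ∑² g xs ≡ 29 ℕ.+ s → ∑ (f ⊠ g) xs ≡ + 1 → length xs ℕ.≤ 4 → ⊥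
  peters f g s xs hs par e₀ e₁ len with pickOdd (f ⊠ g) xs (subst Odd (sym e₁) odd-one)
  -- The term x takes the place of (1 + √s)/2: f and g are ±1 there, and g vanishes elsewhere. The
  -- other f are even with Σf² = 28 = 4 · 7.
  ... | pick {x} {ys} h o = twenty-eight≢threeSquares f ys (even-parts f g (All.tail (All-resp-↭ h par)) zs) (tail-length h len) (remaining E₀)
    where
    E₀ : (sq (f x) ℕ.+ ∑² f ys) ℕ.+ s ℕ.* (sq (g x) ℕ.+ ∑² g ys) ≡ 29 ℕ.+ s
    E₀ = trans (cong₂ (λ a b → a ℕ.+ s ℕ.* b) (sym (∑²-↭ f h)) (sym (∑²-↭ g h))) e₀
    E₁ : f x * g x + ∑ (f ⊠ g) ys ≡ + 1
    E₁ = trans (sym (∑-↭ (f ⊠ g) h)) e₁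
    alone = others-zero f g x ys (All-resp-↭ h par) (proj₂ (odd-*⁻ (f x) (g x) o)) (subst Odd (sym E₁) odd-one) (λ le → peters-bound hs le E₀)
    zs = proj₂ alone
    ones : sq (f x) ≡ 1 × sq (g x) ≡ 1
    ones = product-one (f x) (g x) (trans (sym (ℤP.+-identityʳ _)) (trans (cong (λ t → f x * g x + t) (sym (∑-⊠-zeroʳ f g zs))) E₁))
    remaining : (sq (f x) ℕ.+ ∑² f ys) ℕ.+ s ℕ.* (sq (g x) ℕ.+ ∑² g ys) ≡ 29 ℕ.+ s → ∑² f ys ≡ 28
    remaining = solveFor (∑² f ys) (proj₁ ones) (proj₂ ones) (∑²-zero g zs)
      where
      solveFor : ∀ F {m n l} → m ≡ 1 → n ≡ 1 → l ≡ 0 → (m ℕ.+ F) ℕ.+ s ℕ.* (n ℕ.+ l) ≡ 29 ℕ.+ s → F ≡ 28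
      solveFor F refl refl refl e = ℕP.+-cancelʳ-≡ (1 ℕ.+ s) F 28 (trans (rearrange F s) (trans e (sym (ℕP.+-suc 28 s))))
        where
        rearrange : ∀ F s → F ℕ.+ (1 ℕ.+ s) ≡ (1 ℕ.+ F) ℕ.+ s ℕ.* 1
        rearrange = ℕ-Solver.solve-∀

  -- The matrix with rows (b, b') and (c, c') has entries ±1 and orthogonal rows, so it is √2 times
  -- an orthogonal matrix. It sends (u, v) to (1, 1), of squared length 2, whence u² + v² = 1.
  unit-rotation : ∀ {b b' c c'} u v → Unit b → Unit b' → Unit c → Unit c' → b * c + b' * c' ≡ + 0 →
    u * b + v * b' ≡ + 1 → u * c + v * c' ≡ + 1 → sq u ℕ.+ sq v ≡ 1
  unit-rotation {b} {b'} {c} {c'} u v ub ub' uc uc' e₀ e₁ e₂ = ℤP.+-injective (ℤP.*-cancelˡ-≡ (+ 2) _ _ (begin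
      + 2 * (+ sq u + + sq v)  ≡⟨ cong₂ (λ a b → + 2 * (a + b)) (+sq u) (+sq v) ⟩
      + 2 * (u * u + v * v)    ≡⟨ identity u v b b' c c' ⟩
      rhs (u * b + v * b') (u * c + v * c') (b * c + b' * c') (b * b) (b' * b') (c * c) (c' * c')
                               ≡⟨ substitute e₁ e₂ e₀ (unit-* ub) (unit-* ub') (unit-* uc) (unit-* uc') ⟩
      rhs (+ 1) (+ 1) (+ 0) (+ 1) (+ 1) (+ 1) (+ 1)
                               ≡⟨ final u v b b' c c' ⟩
      + 2                      ∎))
    where
    open ≡-Reasoning
    rhs : ℤ → ℤ → ℤ → ℤ → ℤ → ℤ → ℤ → ℤ
    rhs x y z bb bb' cc cc' = x * x + y * y + - (+ 2 * (u * v) * (b' * c * z + b * b' * (+ 1 + - cc) + c * c' * (+ 1 + - bb')))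
      + u * u * (+ 2 + - bb + - cc) + v * v * (+ 2 + - bb' + - cc')
    substitute : ∀ {x x₁ y y₁ z z₁ p p₁ q q₁ r r₁ s s₁} → x ≡ x₁ → y ≡ y₁ → z ≡ z₁ → p ≡ p₁ → q ≡ q₁ → r ≡ r₁ → s ≡ s₁ → rhs x y z p q r s ≡ rhs x₁ y₁ z₁ p₁ q₁ r₁ s₁
    substitute refl refl refl refl refl refl refl = refl
    identity : ∀ u v b b' c c' → + 2 * (u * u + v * v) ≡
      (u * b + v * b') * (u * b + v * b') + (u * c + v * c') * (u * c + v * c')
      + - (+ 2 * (u * v) * (b' * c * (b * c + b' * c') + b * b' * (+ 1 + - (c * c)) + c * c' * (+ 1 + - (b' * b'))))
      + u * u * (+ 2 + - (b * b) + - (c * c)) + v * v * (+ 2 + - (b' * b') + - (c' * c'))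
    identity = solve-∀
    final : ∀ u v b b' c c' → + 1 * + 1 + + 1 * + 1 + - (+ 2 * (u * v) * (b' * c * + 0 + b * b' * (+ 1 + - (+ 1)) + c * c' * (+ 1 + - (+ 1))))
      + u * u * (+ 2 + - (+ 1) + - (+ 1)) + v * v * (+ 2 + - (+ 1) + - (+ 1)) ≡ + 2
    final = solve-∀

  private
    four-four : ∀ {p q A B C} → 10 ℕ.≤ p → 10 ℕ.≤ q → 4 ℕ.≤ B → 4 ℕ.≤ C → 4 ℕ.* A ℕ.+ p ℕ.* B ℕ.+ q ℕ.* C ≡ 32 ℕ.+ 2 ℕ.* p ℕ.+ 2 ℕ.* q → ⊥
    four-four {A = A} hp hq hB hC = from≥₄ (λ p q B C → 4 ℕ.* A ℕ.+ p ℕ.* B ℕ.+ q ℕ.* C ≡ 32 ℕ.+ 2 ℕ.* p ℕ.+ 2 ℕ.* q → ⊥) hp hq hB hC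
      λ p q B C e → excess _ e (lemma p q A B C)
      where
      lemma : ∀ p q A B C → 4 ℕ.* A ℕ.+ (10 ℕ.+ p) ℕ.* (4 ℕ.+ B) ℕ.+ (10 ℕ.+ q) ℕ.* (4 ℕ.+ C) ≡
        32 ℕ.+ 2 ℕ.* (10 ℕ.+ p) ℕ.+ 2 ℕ.* (10 ℕ.+ q) ℕ.+ suc (7 ℕ.+ 4 ℕ.* A ℕ.+ 2 ℕ.* p ℕ.+ 2 ℕ.* q ℕ.+ (10 ℕ.+ p) ℕ.* B ℕ.+ (10 ℕ.+ q) ℕ.* C)
      lemma = ℕ-Solver.solve-∀

    -- The comparison is 4p > 32, which for square-free p means p ≥ 10: the reason for excluding the
    -- radicands 2, 3, 5, 6 and 7.
    six-two : ∀ {p q A B C} → 10 ℕ.≤ p → 6 ℕ.≤ B → 2 ℕ.≤ C → 4 ℕ.* A ℕ.+ p ℕ.* B ℕ.+ q ℕ.* C ≡ 32 ℕ.+ 2 ℕ.* p ℕ.+ 2 ℕ.* q → ⊥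
    six-two {q = q} {A} hp hB hC = from≥₃ (λ p B C → 4 ℕ.* A ℕ.+ p ℕ.* B ℕ.+ q ℕ.* C ≡ 32 ℕ.+ 2 ℕ.* p ℕ.+ 2 ℕ.* q → ⊥) hp hB hC
      λ p B C e → excess _ e (lemma p q A B C)
      where
      lemma : ∀ p q A B C → 4 ℕ.* A ℕ.+ (10 ℕ.+ p) ℕ.* (6 ℕ.+ B) ℕ.+ q ℕ.* (2 ℕ.+ C) ≡
        32 ℕ.+ 2 ℕ.* (10 ℕ.+ p) ℕ.+ 2 ℕ.* q ℕ.+ suc (7 ℕ.+ 4 ℕ.* A ℕ.+ 4 ℕ.* p ℕ.+ (10 ℕ.+ p) ℕ.* B ℕ.+ q ℕ.* C)
      lemma = ℕ-Solver.solve-∀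

  -- 7 + (1 + (√p + √q)/2)² + ((√p − √q)/2)² is not a sum of five squares (a + (b√p + c√q)/2)².
  noFiveSquares-X : ∀ {X : Set} (a b c : X → ℤ) p q xs → 10 ℕ.≤ p → 10 ℕ.≤ q → All (λ x → b x ≡₂ c x) xs →
    4 ℕ.* ∑² a xs ℕ.+ p ℕ.* ∑² b xs ℕ.+ q ℕ.* ∑² c xs ≡ 32 ℕ.+ 2 ℕ.* p ℕ.+ 2 ℕ.* q →
    ∑ (b ⊠ c) xs ≡ + 0 → ∑ (a ⊠ b) xs ≡ + 1 → ∑ (a ⊠ c) xs ≡ + 1 → length xs ℕ.≤ 5 → ⊥
  noFiveSquares-X {X} a b c p q xs hp hq par e₀ ebc eab eac len with pickOdd (a ⊠ b) xs (subst Odd (sym eab) odd-one)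
  ... | pick {x} {ys} h o with pickOdd (b ⊠ c) ys (odd-+⁻ʳ {b x * c x} (odd-* obx ocx) (subst Even (trans (sym ebc) (∑-↭ (b ⊠ c) h)) (+ 0 , refl)))
    where
    obx : Odd (b x)
    obx = proj₂ (odd-*⁻ (a x) (b x) o)
    ocx : Odd (c x)
    ocx = ≡₂-odd (All.head (All-resp-↭ h par)) obx
  ...   | pick {y} {zs} h' o' = main (pickOdd⊎even b zs)
    where
    obx : Odd (b x)
    obx = proj₂ (odd-*⁻ (a x) (b x) o)
    ocx : Odd (c x)
    ocx = ≡₂-odd (All.head (All-resp-↭ h par)) obx
    oby : Odd (b y)
    oby = proj₁ (odd-*⁻ (b y) (c y) o')
    ocy : Odd (c y)
    ocy = proj₂ (odd-*⁻ (b y) (c y) o')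
    par-zs : All (λ x → b x ≡₂ c x) zs
    par-zs = All.tail (All-resp-↭ h' (All.tail (All-resp-↭ h par)))
    ∑²-split : ∀ (f : X → ℤ) → ∑² f xs ≡ sq (f x) ℕ.+ (sq (f y) ℕ.+ ∑² f zs)
    ∑²-split f = trans (∑²-↭ f h) (cong (sq (f x) ℕ.+_) (∑²-↭ f h'))
    ∑-split : ∀ (f : X → ℤ) → ∑ f xs ≡ f x + (f y + ∑ f zs)
    ∑-split f = trans (∑-↭ f h) (cong (λ s → f x + s) (∑-↭ f h'))
    E₀ : 4 ℕ.* ∑² a xs ℕ.+ p ℕ.* (sq (b x) ℕ.+ (sq (b y) ℕ.+ ∑² b zs)) ℕ.+ q ℕ.* (sq (c x) ℕ.+ (sq (c y) ℕ.+ ∑² c zs)) ≡ 32 ℕ.+ 2 ℕ.* p ℕ.+ 2 ℕ.* q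
    E₀ = trans (cong₂ (λ s t → 4 ℕ.* ∑² a xs ℕ.+ p ℕ.* s ℕ.+ q ℕ.* t) (sym (∑²-split b)) (sym (∑²-split c))) e₀
    E₀' : 4 ℕ.* ∑² a xs ℕ.+ q ℕ.* (sq (c x) ℕ.+ (sq (c y) ℕ.+ ∑² c zs)) ℕ.+ p ℕ.* (sq (b x) ℕ.+ (sq (b y) ℕ.+ ∑² b zs)) ≡ 32 ℕ.+ 2 ℕ.* q ℕ.+ 2 ℕ.* p
    E₀' = trans (swap (4 ℕ.* ∑² a xs) _ _) (trans E₀ (swap 32 (2 ℕ.* p) (2 ℕ.* q)))
      where
      swap : ∀ l m n → l ℕ.+ m ℕ.+ n ≡ l ℕ.+ n ℕ.+ m
      swap = ℕ-Solver.solve-∀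
    two-b : 2 ℕ.≤ sq (b x) ℕ.+ (sq (b y) ℕ.+ ∑² b zs)
    two-b = ℕP.+-mono-≤ (sq-odd obx) (ℕP.≤-trans (sq-odd oby) (ℕP.m≤m+n _ _))
    two-c : 2 ℕ.≤ sq (c x) ℕ.+ (sq (c y) ℕ.+ ∑² c zs)
    two-c = ℕP.+-mono-≤ (sq-odd ocx) (ℕP.≤-trans (sq-odd ocy) (ℕP.m≤m+n _ _))
    main : Pick (λ y → Odd (b y)) zs ⊎ All (λ y → Even (b y)) zs → ⊥
    -- The number of terms with bc odd is even because Σbc = 0, so a third odd term brings a fourth
    -- and both Σb² and Σc² reach 4.
    main (inj₁ (pick {w} {ws} k ow)) = four-four {A = ∑² a xs} hp hq (four b obx oby ow (∑²-odd b (proj₁ fourth))) (four c ocx ocy ocw (∑²-odd c (proj₂ fourth))) E₀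
      where
      ocw : Odd (c w)
      ocw = ≡₂-odd (All.head (All-resp-↭ k par-zs)) ow
      even-zs : Even (∑ (b ⊠ c) zs)
      even-zs = even-+⁻ʳ (odd-+ {b x * c x} (odd-* obx ocx) o')
        (subst Even (trans (sym ebc) (trans (∑-split (b ⊠ c)) (sym (ℤP.+-assoc (b x * c x) _ _)))) (+ 0 , refl))
      fourth : Pick (λ v → Odd (b v)) ws × Pick (λ v → Odd (c v)) ws
      fourth with pickOdd (b ⊠ c) ws (odd-+⁻ʳ {b w * c w} (odd-* ow ocw) (subst Even (∑-↭ (b ⊠ c) k) even-zs))
      ... | pick {v} l ov = pick l (proj₁ (odd-*⁻ (b v) (c v) ov)) , pick l (proj₂ (odd-*⁻ (b v) (c v) ov))
      four : ∀ f → Odd (f x) → Odd (f y) → Odd (f w) → 1 ℕ.≤ ∑² f ws → 4 ℕ.≤ sq (f x) ℕ.+ (sq (f y) ℕ.+ ∑² f zs)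
      four f o₁ o₂ o₃ le = ℕP.+-mono-≤ (sq-odd o₁) (ℕP.+-mono-≤ (sq-odd o₂) (subst (2 ℕ.≤_) (sym (∑²-↭ f k)) (ℕP.+-mono-≤ (sq-odd o₃) le)))
    main (inj₂ es) = finish (even-zero⊎≥4 b es) (even-zero⊎≥4 c (All.zipWith (λ { {z} (p , e) → ≡₂-even p e }) (par-zs , es)))
      where
      big : ∀ (f : X → ℤ) → Odd (f x) → Odd (f y) → 4 ℕ.≤ ∑² f zs → 6 ℕ.≤ sq (f x) ℕ.+ (sq (f y) ℕ.+ ∑² f zs)
      big f o₁ o₂ le = ℕP.+-mono-≤ (sq-odd o₁) (ℕP.+-mono-≤ (sq-odd o₂) le)
      small-x : ∀ (f : X → ℤ) → (6 ℕ.≤ sq (f x) ℕ.+ (sq (f y) ℕ.+ ∑² f zs) → ⊥) → Odd (f x) → Unit (f x)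
      small-x f absurd o = odd⇒unit o (ℕP.≰⇒> λ le → absurd (ℕP.≤-trans (ℕP.≤-trans (ℕP.m≤m+n 6 3) le) (ℕP.m≤m+n _ _)))
      small-y : ∀ (f : X → ℤ) → (6 ℕ.≤ sq (f x) ℕ.+ (sq (f y) ℕ.+ ∑² f zs) → ⊥) → Odd (f y) → Unit (f y)
      small-y f absurd o = odd⇒unit o (ℕP.≰⇒> λ le → absurd (ℕP.≤-trans (ℕP.≤-trans (ℕP.≤-trans (ℕP.m≤m+n 6 3) le) (ℕP.m≤m+n _ _)) (ℕP.m≤n+m _ (sq (f x)))))
      no-b : 6 ℕ.≤ sq (b x) ℕ.+ (sq (b y) ℕ.+ ∑² b zs) → ⊥
      no-b le = six-two {q = q} {A = ∑² a xs} hp le two-c E₀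
      no-c : 6 ℕ.≤ sq (c x) ℕ.+ (sq (c y) ℕ.+ ∑² c zs) → ⊥
      no-c le = six-two {q = p} {A = ∑² a xs} hq le two-b E₀'
      drop : ∀ (f g : X → ℤ) {n} → ∑ (f ⊠ g) zs ≡ + 0 → ∑ (f ⊠ g) xs ≡ n → f x * g x + f y * g y ≡ n
      drop f g z e = trans (cong (λ t → f x * g x + t) (trans (sym (ℤP.+-identityʳ _)) (cong (λ t → f y * g y + t) (sym z)))) (trans (sym (∑-split (f ⊠ g))) e)
      finish : All (λ y → b y ≡ + 0) zs ⊎ 4 ℕ.≤ ∑² b zs → All (λ y → c y ≡ + 0) zs ⊎ 4 ℕ.≤ ∑² c zs → ⊥
      finish (inj₂ le) _ = no-b (big b obx oby le)
      finish (inj₁ _) (inj₂ le) = no-c (big c ocx ocy le)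
      -- Now b and c are ±1 at x and y and vanish elsewhere, so Σa² = 8. The two terms at x and y
      -- contribute 1 to it by `unit-rotation`.
      finish (inj₁ bz) (inj₁ cz) = seven≢threeSquares a zs (tail-length h' (tail-length h len)) (ℕP.+-cancelˡ-≡ 1 _ _ eight)
        where
        ub = small-x b no-b obx
        ub' = small-y b no-b oby
        uc = small-x c no-c ocx
        uc' = small-y c no-c ocy
        one : sq (a x) ℕ.+ sq (a y) ≡ 1
        one = unit-rotation (a x) (a y) ub ub' uc uc' (drop b c (∑-⊠-zeroʳ b c cz) ebc) (drop a b (∑-⊠-zeroʳ a b bz) eab) (drop a c (∑-⊠-zeroʳ a c cz) eac)
        eight : 1 ℕ.+ ∑² a zs ≡ 8
        eight = trans (cong (ℕ._+ ∑² a zs) (sym one)) (trans (ℕP.+-assoc (sq (a x)) _ _) (trans (sym (∑²-split a))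
          (solveFor (∑² a xs) p q (collapse {∑² a xs} (unit-sq ub) (unit-sq ub') (unit-sq uc) (unit-sq uc') (∑²-zero b bz) (∑²-zero c cz) E₀))))
          where
          collapse : ∀ {A b b' c c' s t} → b ≡ 1 → b' ≡ 1 → c ≡ 1 → c' ≡ 1 → s ≡ 0 → t ≡ 0 →
            4 ℕ.* A ℕ.+ p ℕ.* (b ℕ.+ (b' ℕ.+ s)) ℕ.+ q ℕ.* (c ℕ.+ (c' ℕ.+ t)) ≡ 32 ℕ.+ 2 ℕ.* p ℕ.+ 2 ℕ.* q →
            4 ℕ.* A ℕ.+ p ℕ.* 2 ℕ.+ q ℕ.* 2 ≡ 32 ℕ.+ 2 ℕ.* p ℕ.+ 2 ℕ.* q
          collapse refl refl refl refl refl refl e = e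
          solveFor : ∀ A p q → 4 ℕ.* A ℕ.+ p ℕ.* 2 ℕ.+ q ℕ.* 2 ≡ 32 ℕ.+ 2 ℕ.* p ℕ.+ 2 ℕ.* q → A ≡ 8
          solveFor A p q e = ℕP.*-cancelˡ-≡ A 8 4 (ℕP.+-cancelʳ-≡ (2 ℕ.* p ℕ.+ 2 ℕ.* q) (4 ℕ.* A) 32 (trans (lhs A p q) (trans e (ℕP.+-assoc 32 (2 ℕ.* p) (2 ℕ.* q)))))
            where
            lhs : ∀ A p q → 4 ℕ.* A ℕ.+ (2 ℕ.* p ℕ.+ 2 ℕ.* q) ≡ 4 ℕ.* A ℕ.+ p ℕ.* 2 ℕ.+ q ℕ.* 2
            lhs = ℕ-Solver.solve-∀

-- Denominator 2, with witnesses built from √p and √q.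

module HalfIntegralSystems where

  open CoordinateEquations using (∑; ∑²; sq; +sq; _⊠_)
  open Parity
  open SumsOfSquares
  open import Data.Integer using (_+_; _*_; -_)
  open ℤ-Solver using (solve-∀)

  even-zero : Even (+ 0)
  even-zero = + 0 , refl

  Zero : ∀ {X : Set} → (X → ℤ) → List X → Set
  Zero f = All (λ x → f x ≡ + 0)

  -- n² Σ x² = T₀ + 2T₁√p + 2T₂√q + 2T₃√r for x = (a + b√p + c√q + d√r)/n; used with n = 2 and n = 4.
  record System {X : Set} (a b c d : X → ℤ) (p q r : ℕ) (k₁ k₂ k₃ : ℤ) (T₀ : ℕ) (T₁ T₂ T₃ : ℤ) (xs : List X) : Set where
    constructor system
    field
      e₀  : ∑² a xs ℕ.+ p ℕ.* ∑² b xs ℕ.+ q ℕ.* ∑² c xs ℕ.+ r ℕ.* ∑² d xs ≡ T₀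
      e₁  : ∑ (a ⊠ b) xs + k₃ * ∑ (c ⊠ d) xs ≡ T₁
      e₂  : ∑ (a ⊠ c) xs + k₂ * ∑ (b ⊠ d) xs ≡ T₂
      e₃  : ∑ (a ⊠ d) xs + k₁ * ∑ (b ⊠ c) xs ≡ T₃

  system-↭ : ∀ {X : Set} {a b c d : X → ℤ} {p q r k₁ k₂ k₃ T₀ T₁ T₂ T₃ xs ys} → xs ↭ ys →
    System a b c d p q r k₁ k₂ k₃ T₀ T₁ T₂ T₃ xs → System a b c d p q r k₁ k₂ k₃ T₀ T₁ T₂ T₃ ys
  system-↭ {a = a} {b} {c} {d} {p} {q} {r} {k₁} {k₂} {k₃} h (system e₀ e₁ e₂ e₃) = system
      (trans (cong₂ ℕ._+_ (cong₂ ℕ._+_ (cong₂ ℕ._+_ (sym (∑²-↭ a h)) (cong (p ℕ.*_) (sym (∑²-↭ b h)))) (cong (q ℕ.*_) (sym (∑²-↭ c h)))) (cong (r ℕ.*_) (sym (∑²-↭ d h)))) e₀)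
      (trans (cong₂ (λ s t → s + k₃ * t) (sym (∑-↭ (a ⊠ b) h)) (sym (∑-↭ (c ⊠ d) h))) e₁)
      (trans (cong₂ (λ s t → s + k₂ * t) (sym (∑-↭ (a ⊠ c) h)) (sym (∑-↭ (b ⊠ d) h))) e₂)
      (trans (cong₂ (λ s t → s + k₁ * t) (sym (∑-↭ (a ⊠ d) h)) (sym (∑-↭ (b ⊠ c) h))) e₃)

  ∑-⊠-even : ∀ {X : Set} (f g : X → ℤ) {xs} → All (λ x → Even (g x)) xs → ∑ (f ⊠ g) xs ≡ + 2 * ∑ (f ⊠ (λ x → half (g x))) xs
  ∑-⊠-even f g es = ∑-scale (+ 2) (f ⊠ g) _ (All.map (λ {x} e → trans (cong (λ t → f x * t) (half-even e)) (lemma (f x) (half (g x)))) es)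
    where
    lemma : ∀ u v → u * (+ 2 * v) ≡ + 2 * (u * v)
    lemma = solve-∀

  ∑-⊠-comm : ∀ {X : Set} (f g : X → ℤ) xs → ∑ (f ⊠ g) xs ≡ ∑ (g ⊠ f) xs
  ∑-⊠-comm f g []       = refl
  ∑-⊠-comm f g (x ∷ xs) = cong₂ _+_ (ℤP.*-comm (f x) (g x)) (∑-⊠-comm f g xs)

  ∑-⊠-evenˡ : ∀ {X : Set} (f g : X → ℤ) {xs} → All (λ x → Even (f x)) xs → ∑ (f ⊠ g) xs ≡ + 2 * ∑ ((λ x → half (f x)) ⊠ g) xs
  ∑-⊠-evenˡ f g {xs} es = trans (∑-⊠-comm f g xs) (trans (∑-⊠-even g f es) (cong (λ t → + 2 * t) (∑-⊠-comm g (λ x → half (f x)) xs)))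

  drop-zero : ∀ u {s} → s ≡ + 0 → u + s ≡ u
  drop-zero u refl = ℤP.+-identityʳ u

  vanish : ∀ {x y} k → y ≡ + 0 → x + k * y ≡ x
  vanish {x} k refl = lemma x k
    where
    lemma : ∀ x k → x + k * + 0 ≡ x
    lemma = solve-∀

  product-zero : ∀ {k x} → k ≢ + 0 → k * x ≡ + 0 → x ≡ + 0
  product-zero {k} h e with ℤP.i*j≡0⇒i≡0∨j≡0 k e
  ... | inj₁ z = ⊥-elim (h z)
  ... | inj₂ z = z

  module _ {X : Set} (a b c d : X → ℤ) (p q r : ℕ) (k₁ k₂ k₃ : ℤ) (xs : List X)
    (par-bc : All (λ x → b x ≡₂ c x) xs) (hp : 10 ℕ.≤ p) (hq : 10 ℕ.≤ q) (len : length xs ℕ.≤ 5)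
    (sys : System a b c d p q r k₁ k₂ k₃ (32 ℕ.+ 2 ℕ.* p ℕ.+ 2 ℕ.* q) (+ 2) (+ 2) (+ 0) xs) where
    open System sys

    private
      a' : X → ℤ
      a' x = half (a x)

    -- Without √r-coordinates the last equation reads k₁ Σbc = 0. This gives the orthogonality on
    -- which `noFiveSquares-X` rests.
    noFiveSquares-d≡0 : k₁ ≢ + 0 → Zero d xs → All (λ x → Even (a x)) xs → ⊥
    noFiveSquares-d≡0 k₁≢0 dz ae = noFiveSquares-X a' b c p q xs hp hq par-bc E₀ Ebc
      (ℤP.*-cancelˡ-≡ (+ 2) _ (+ 1) (trans (sym (∑-⊠-evenˡ a b ae)) (trans (sym (vanish k₃ (∑-⊠-zeroʳ c d dz))) e₁)))
      (ℤP.*-cancelˡ-≡ (+ 2) _ (+ 1) (trans (sym (∑-⊠-evenˡ a c ae)) (trans (sym (vanish k₂ (∑-⊠-zeroʳ b d dz))) e₂)))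
      len
      where
      E₀ : 4 ℕ.* ∑² a' xs ℕ.+ p ℕ.* ∑² b xs ℕ.+ q ℕ.* ∑² c xs ≡ 32 ℕ.+ 2 ℕ.* p ℕ.+ 2 ℕ.* q
      E₀ = trans (trans (cong (λ t → t ℕ.+ p ℕ.* ∑² b xs ℕ.+ q ℕ.* ∑² c xs) (sym (∑²-4* a a' (halves a ae))))
                        (trans (sym (ℕP.+-identityʳ _)) (cong (∑² a xs ℕ.+ p ℕ.* ∑² b xs ℕ.+ q ℕ.* ∑² c xs ℕ.+_) (sym (trans (cong (r ℕ.*_) (∑²-zero d dz)) (ℕP.*-zeroʳ r)))))) e₀
      Ebc : ∑ (b ⊠ c) xs ≡ + 0
      Ebc = product-zero k₁≢0 (trans (sym (ℤP.+-identityˡ _)) (trans (cong (λ t → t + k₁ * ∑ (b ⊠ c) xs) (sym (∑-⊠-zeroʳ a d dz))) e₃))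

    private
      bound-I : ∀ {A B C D} → 10 ℕ.≤ r → 2 ℕ.≤ B → 2 ℕ.≤ C → 4 ℕ.≤ D → A ℕ.+ p ℕ.* B ℕ.+ q ℕ.* C ℕ.+ r ℕ.* D ≡ 32 ℕ.+ 2 ℕ.* p ℕ.+ 2 ℕ.* q → ⊥
      bound-I {A} hr hB hC hD = from≥₄ (λ r B C D → A ℕ.+ p ℕ.* B ℕ.+ q ℕ.* C ℕ.+ r ℕ.* D ≡ 32 ℕ.+ 2 ℕ.* p ℕ.+ 2 ℕ.* q → ⊥) hr hB hC hD
        λ r B C D e → excess _ e (lemma A p q r B C D)
        where
        lemma : ∀ A p q r B C D → A ℕ.+ p ℕ.* (2 ℕ.+ B) ℕ.+ q ℕ.* (2 ℕ.+ C) ℕ.+ (10 ℕ.+ r) ℕ.* (4 ℕ.+ D) ≡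
          32 ℕ.+ 2 ℕ.* p ℕ.+ 2 ℕ.* q ℕ.+ suc (7 ℕ.+ A ℕ.+ p ℕ.* B ℕ.+ q ℕ.* C ℕ.+ 4 ℕ.* r ℕ.+ (10 ℕ.+ r) ℕ.* D)
        lemma = ℕ-Solver.solve-∀

      two-odd : ∀ (f g : X → ℤ) → All (λ x → f x ≡₂ g x) xs → Pick (λ x → Odd (f x)) xs → Even (∑ (f ⊠ g) xs) → 2 ℕ.≤ ∑² f xs × 2 ℕ.≤ ∑² g xs
      two-odd f g par (pick {x} {ys} h o) ev with pickOdd (f ⊠ g) ys (odd-+⁻ʳ {f x * g x} (odd-* o (≡₂-odd (All.head (All-resp-↭ h par)) o)) (subst Even (∑-↭ (f ⊠ g) h) ev))
      ... | pick {y} {zs} h' o' =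
          subst (2 ℕ.≤_) (sym (∑²-↭ f h)) (ℕP.+-mono-≤ (sq-odd o) (∑²-odd f (pick h' (proj₁ (odd-*⁻ (f y) (g y) o')))))
        , subst (2 ℕ.≤_) (sym (∑²-↭ g h)) (ℕP.+-mono-≤ (sq-odd (≡₂-odd (All.head (All-resp-↭ h par)) o)) (∑²-odd g (pick h' (proj₂ (odd-*⁻ (f y) (g y) o')))))

    -- With a and d even, half of the last equation shows Σbc even, so odd values of b come in
    -- pairs; half of the second one equals 1, so there are some. Thus Σb² and Σc² are at least 2,
    -- and a nonzero d, being even, would add 4r > 32.
    noFiveSquares-I : 10 ℕ.≤ r → (∃ λ κ → Odd κ × k₁ ≡ + 2 * κ) → All (λ x → Even (a x)) xs → All (λ x → Even (d x)) xs → ⊥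
    noFiveSquares-I hr (κ , oκ , refl) ae de = main (even-zero⊎≥4 d de)
      where
      d' : X → ℤ
      d' x = half (d x)
      even-bc : Even (∑ (b ⊠ c) xs)
      even-bc with parity (∑ (b ⊠ c) xs)
      ... | inj₁ e = e
      ... | inj₂ o = ⊥-elim (even≢odd (∑ (a' ⊠ d') xs * - (+ 1) , cancel (∑ (a' ⊠ d') xs) (∑ (b ⊠ c) xs) (trans (cong (λ s → s + + 2 * κ * ∑ (b ⊠ c) xs) (sym ad)) e₃)) (odd-* oκ o))
        where
        ad : ∑ (a ⊠ d) xs ≡ + 2 * (+ 2 * ∑ (a' ⊠ d') xs)
        ad = trans (∑-⊠-evenˡ a d ae) (cong (λ t → + 2 * t) (∑-⊠-even a' d de))
        cancel : ∀ s t → + 2 * (+ 2 * s) + + 2 * κ * t ≡ + 0 → κ * t ≡ + 2 * (s * - (+ 1))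
        cancel s t e = ℤP.*-cancelˡ-≡ (+ 2) _ _ (trans (lemma s t κ) (trans (cong (λ z → z + - (+ 4 * s)) e) (lemma' s)))
          where
          lemma : ∀ s t κ → + 2 * (κ * t) ≡ (+ 2 * (+ 2 * s) + + 2 * κ * t) + - (+ 4 * s)
          lemma = solve-∀
          lemma' : ∀ s → + 0 + - (+ 4 * s) ≡ + 2 * (+ 2 * (s * - (+ 1)))
          lemma' = solve-∀
      odd-b : Pick (λ x → Odd (b x)) xs
      odd-b with pickOdd⊎even b xs
      ... | inj₁ o  = o
      ... | inj₂ be = ⊥-elim (even≢odd
          (even-+ {∑ (a' ⊠ b) xs} (∑-even (a' ⊠ b) (All.map (λ {x} e → even-*ʳ (a' x) e) be))
                  (even-*ʳ k₃ (∑-even (c ⊠ d') (All.zipWith (λ { {x} (h , e) → even-*ˡ (d' x) (≡₂-even h e) }) (par-bc , be)))))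
          (subst Odd (sym (ℤP.*-cancelˡ-≡ (+ 2) (∑ (a' ⊠ b) xs + k₃ * ∑ (c ⊠ d') xs) (+ 1)
            (trans (lemma (∑ (a' ⊠ b) xs) k₃ (∑ (c ⊠ d') xs)) (trans (cong₂ (λ s t → s + k₃ * t) (sym (∑-⊠-evenˡ a b ae)) (sym (∑-⊠-even c d de))) e₁)))) odd-one))
        where
        lemma : ∀ s k t → + 2 * (s + k * t) ≡ + 2 * s + k * (+ 2 * t)
        lemma = solve-∀
      k₁≢0 : + 2 * κ ≢ + 0
      k₁≢0 e = odd⇒nonZero oκ (product-zero {+ 2} {κ} (λ ()) e)
      main : Zero d xs ⊎ 4 ℕ.≤ ∑² d xs → ⊥
      main (inj₁ dz) = noFiveSquares-d≡0 k₁≢0 dz ae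
      main (inj₂ le) = let (lb , lc) = two-odd b c par-bc odd-b even-bc in bound-I {∑² a xs} hr lb lc le e₀

    private
      bound-2 : ∀ {A B C D} → 33 ℕ.+ p ℕ.+ q ℕ.≤ r → 2 ℕ.≤ D → A ℕ.+ p ℕ.* B ℕ.+ q ℕ.* C ℕ.+ r ℕ.* D ≡ 32 ℕ.+ 2 ℕ.* p ℕ.+ 2 ℕ.* q → ⊥
      bound-2 {A} {B} {C} hr hD = from≥₂ (λ r D → A ℕ.+ p ℕ.* B ℕ.+ q ℕ.* C ℕ.+ r ℕ.* D ≡ 32 ℕ.+ 2 ℕ.* p ℕ.+ 2 ℕ.* q → ⊥) hr hD
        λ r D e → excess _ e (lemma A p q r B C D)
        where
        lemma : ∀ A p q r B C D → A ℕ.+ p ℕ.* B ℕ.+ q ℕ.* C ℕ.+ (33 ℕ.+ p ℕ.+ q ℕ.+ r) ℕ.* (2 ℕ.+ D) ≡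
          32 ℕ.+ 2 ℕ.* p ℕ.+ 2 ℕ.* q ℕ.+ suc (33 ℕ.+ A ℕ.+ p ℕ.* B ℕ.+ q ℕ.* C ℕ.+ 2 ℕ.* r ℕ.+ (33 ℕ.+ p ℕ.+ q ℕ.+ r) ℕ.* D)
        lemma = ℕ-Solver.solve-∀

      bound-1 : ∀ {A B C D} → 33 ℕ.+ p ℕ.+ q ℕ.≤ r → 1 ℕ.≤ B → 1 ℕ.≤ C → 1 ℕ.≤ D → A ℕ.+ p ℕ.* B ℕ.+ q ℕ.* C ℕ.+ r ℕ.* D ≡ 32 ℕ.+ 2 ℕ.* p ℕ.+ 2 ℕ.* q → ⊥
      bound-1 {A} hr hB hC hD = from≥₄ (λ r B C D → A ℕ.+ p ℕ.* B ℕ.+ q ℕ.* C ℕ.+ r ℕ.* D ≡ 32 ℕ.+ 2 ℕ.* p ℕ.+ 2 ℕ.* q → ⊥) hr hB hC hD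
        λ r B C D e → excess _ e (lemma A p q r B C D)
        where
        lemma : ∀ A p q r B C D → A ℕ.+ p ℕ.* (1 ℕ.+ B) ℕ.+ q ℕ.* (1 ℕ.+ C) ℕ.+ (33 ℕ.+ p ℕ.+ q ℕ.+ r) ℕ.* (1 ℕ.+ D) ≡
          32 ℕ.+ 2 ℕ.* p ℕ.+ 2 ℕ.* q ℕ.+ suc (A ℕ.+ p ℕ.* B ℕ.+ q ℕ.* C ℕ.+ r ℕ.+ (33 ℕ.+ p ℕ.+ q ℕ.+ r) ℕ.* D)
        lemma = ℕ-Solver.solve-∀

    -- Two copies of r exceed 32 + 2p + 2q. If only one d is nonzero and it is odd, then Σad is odd,
    -- so Σbc is odd by the last equation; now b and c do not vanish either, and p + q + r is again
    -- too large.
    noFiveSquares-II-large : 33 ℕ.+ p ℕ.+ q ℕ.≤ r → k₁ ≢ + 0 → All (λ x → a x ≡₂ d x) xs → ⊥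
    noFiveSquares-II-large hr k₁≢0 par-ad = main (pickOdd⊎even d xs)
      where
      main : Pick (λ x → Odd (d x)) xs ⊎ All (λ x → Even (d x)) xs → ⊥
      main (inj₂ de) with even-zero⊎≥4 d de
      ... | inj₁ dz = noFiveSquares-d≡0 k₁≢0 dz (All.zipWith (λ { {x} (h , e) → ≡₂-even (≡₂-sym {a x} h) e }) (par-ad , de))
      ... | inj₂ le = bound-2 {∑² a xs} {∑² b xs} {∑² c xs} hr (ℕP.≤-trans (s≤s (s≤s z≤n)) le) e₀
      main (inj₁ (pick {x} {ys} h o)) with pickNonZero⊎zero d ys
      ... | inj₁ nz = bound-2 {∑² a xs} {∑² b xs} {∑² c xs} hr (subst (2 ℕ.≤_) (sym (∑²-↭ d h)) (ℕP.+-mono-≤ (sq-odd o) (∑²-nonZero d nz))) e₀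
      ... | inj₂ dz = bound-1 {∑² a xs} hr (∑²-odd b (proj₁ odd-bc)) (∑²-odd c (proj₂ odd-bc)) (∑²-odd d (pick h o)) e₀
        where
        ad : ∑ (a ⊠ d) xs ≡ a x * d x
        ad = trans (∑-↭ (a ⊠ d) h) (trans (cong (λ t → a x * d x + t) (∑-⊠-zeroʳ a d dz)) (ℤP.+-identityʳ _))
        odd-ad : Odd (∑ (a ⊠ d) xs)
        odd-ad = subst Odd (sym ad) (odd-* (≡₂-odd (≡₂-sym {a x} (All.head (All-resp-↭ h par-ad))) o) o)
        odd-bc : Pick (λ x → Odd (b x)) xs × Pick (λ x → Odd (c x)) xs
        odd-bc with pickOdd (b ⊠ c) xs (proj₂ (odd-*⁻ k₁ (∑ (b ⊠ c) xs) (odd-+⁻ʳ odd-ad (subst Even (sym e₃) even-zero))))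
        ... | pick {y} k oy = pick k (proj₁ (odd-*⁻ (b y) (c y) oy)) , pick k (proj₂ (odd-*⁻ (b y) (c y) oy))

  unit-product : ∀ {x y} → Unit x → Unit y → Unit (x * y)
  unit-product (inj₁ refl) (inj₁ refl) = inj₁ refl
  unit-product (inj₁ refl) (inj₂ refl) = inj₂ refl
  unit-product (inj₂ refl) (inj₁ refl) = inj₂ refl
  unit-product (inj₂ refl) (inj₂ refl) = inj₁ refl

  multiple≢1 : ∀ {k x} → 2 ℕ.≤ k → + k * x ≢ + 1
  multiple≢1 {k} {x} le e = ℕP.<⇒≱ le (ℕP.≤-reflexive (ℕP.m*n≡1⇒m≡1 k ∣ x ∣ (trans (sym (ℤP.abs-* (+ k) x)) (cong ∣_∣ e))))

-- Denominator 2 when r is at most 32 + p + q.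

module HalfIntegralSmall where

  open CoordinateEquations using (∑; ∑²; sq; +sq; _⊠_)
  open Parity
  open SumsOfSquares
  open HalfIntegralSystems
  open import Data.Integer using (_+_; _*_; -_)
  open ℤ-Solver using (solve-∀)

  module _ (p q r : ℕ) where
    -- The right-hand side is the rational coordinate of 4α for α = 7 + ((1 + √r)/2)² + (1 + (√p +
    -- √q)/2)², namely 28 + (1 + r) + (4 + p + q).
    Total : ℕ → ℕ → ℕ → ℕ → Set
    Total A B C D = A ℕ.+ p ℕ.* B ℕ.+ q ℕ.* C ℕ.+ r ℕ.* D ≡ 33 ℕ.+ r ℕ.+ p ℕ.+ q

  private
    bound₁ : ∀ {p q r A B C D} → r ℕ.≤ 32 ℕ.+ p ℕ.+ q → 33 ℕ.≤ p ℕ.+ q → 4 ℕ.≤ B → 4 ℕ.≤ C → Total p q r A B C D → ⊥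
    bound₁ {p} {q} {r} {A} {B} {C} {D} hr hpq hB hC e = from≥₂ (λ B C → Total p q r A B C D → ⊥) hB hC (λ B C e → excess {n = 65 ℕ.+ (p ℕ.+ q) ℕ.+ (p ℕ.+ q)} (slack B C)
        (trans (cong (ℕ._+ ε) e) (trans (shift r ε p q) (trans (cong (λ t → 33 ℕ.+ t ℕ.+ p ℕ.+ q) r+ε) (shift' p q))))
        (trans (expand A p q B C (r ℕ.* D) ε) (trans (cong (λ t → t ℕ.+ t ℕ.+ (p ℕ.+ q) ℕ.+ (p ℕ.+ q) ℕ.+ rest B C) (sym pq)) (assemble f (p ℕ.+ q) (rest B C))))) e
      where
      ε = (32 ℕ.+ p ℕ.+ q) ℕ.∸ r
      r+ε : r ℕ.+ ε ≡ 32 ℕ.+ p ℕ.+ q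
      r+ε = ℕP.m+[n∸m]≡n hr
      f = (p ℕ.+ q) ℕ.∸ 33
      pq : 33 ℕ.+ f ≡ p ℕ.+ q
      pq = ℕP.m+[n∸m]≡n hpq
      rest : ℕ → ℕ → ℕ
      rest B C = A ℕ.+ p ℕ.* B ℕ.+ q ℕ.* C ℕ.+ r ℕ.* D ℕ.+ ε
      slack : ℕ → ℕ → ℕ
      slack B C = f ℕ.+ f ℕ.+ rest B C
      shift : ∀ r ε p q → 33 ℕ.+ r ℕ.+ p ℕ.+ q ℕ.+ ε ≡ 33 ℕ.+ (r ℕ.+ ε) ℕ.+ p ℕ.+ q
      shift = ℕ-Solver.solve-∀
      shift' : ∀ p q → 33 ℕ.+ (32 ℕ.+ p ℕ.+ q) ℕ.+ p ℕ.+ q ≡ 65 ℕ.+ (p ℕ.+ q) ℕ.+ (p ℕ.+ q)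
      shift' = ℕ-Solver.solve-∀
      expand : ∀ A p q B C R ε → A ℕ.+ p ℕ.* (4 ℕ.+ B) ℕ.+ q ℕ.* (4 ℕ.+ C) ℕ.+ R ℕ.+ ε ≡
        (p ℕ.+ q) ℕ.+ (p ℕ.+ q) ℕ.+ (p ℕ.+ q) ℕ.+ (p ℕ.+ q) ℕ.+ (A ℕ.+ p ℕ.* B ℕ.+ q ℕ.* C ℕ.+ R ℕ.+ ε)
      expand = ℕ-Solver.solve-∀
      assemble : ∀ f t R → (33 ℕ.+ f) ℕ.+ (33 ℕ.+ f) ℕ.+ t ℕ.+ t ℕ.+ R ≡ 65 ℕ.+ t ℕ.+ t ℕ.+ suc (f ℕ.+ f ℕ.+ R)
      assemble = ℕ-Solver.solve-∀

    bound₂ : ∀ {p q r A B C D} → 17 ℕ.≤ r → 1 ℕ.≤ B → 1 ℕ.≤ C → 4 ℕ.≤ D → Total p q r A B C D → ⊥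
    bound₂ {p} {q} {A = A} hr hB hC hD = from≥₄ (λ r B C D → Total p q r A B C D → ⊥) hr hB hC hD λ r B C D e → excess _ e (lemma A p q r B C D)
      where
      lemma : ∀ A p q r B C D → A ℕ.+ p ℕ.* (1 ℕ.+ B) ℕ.+ q ℕ.* (1 ℕ.+ C) ℕ.+ (17 ℕ.+ r) ℕ.* (4 ℕ.+ D) ≡
        33 ℕ.+ (17 ℕ.+ r) ℕ.+ p ℕ.+ q ℕ.+ suc (17 ℕ.+ A ℕ.+ p ℕ.* B ℕ.+ q ℕ.* C ℕ.+ 3 ℕ.* r ℕ.+ (17 ℕ.+ r) ℕ.* D)
      lemma = ℕ-Solver.solve-∀

    -- This rules out a second term with odd b and c. The comparison is 1 + p + q > 33; the 1 comes
    -- from an odd a, which accompanies an odd d.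
    bound₃ : ∀ {p q r A B C D} → 33 ℕ.≤ p ℕ.+ q → 1 ℕ.≤ A → 2 ℕ.≤ B → 2 ℕ.≤ C → 1 ℕ.≤ D → Total p q r A B C D → ⊥
    bound₃ {p} {q} {r} hpq hA hB hC hD = from≥₄ (λ A B C D → Total p q r A B C D → ⊥) hA hB hC hD λ A B C D e →
        excess _ e (trans (expand A p q r B C D) (trans (cong (λ t → t ℕ.+ rest A B C D) (sym pq)) (assemble f r p q A B C D)))
      where
      f = (p ℕ.+ q) ℕ.∸ 33
      pq : 33 ℕ.+ f ≡ p ℕ.+ q
      pq = ℕP.m+[n∸m]≡n hpq
      rest : ℕ → ℕ → ℕ → ℕ → ℕ
      rest A B C D = (r ℕ.+ p ℕ.+ q) ℕ.+ suc (A ℕ.+ p ℕ.* B ℕ.+ q ℕ.* C ℕ.+ r ℕ.* D)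
      expand : ∀ A p q r B C D → (1 ℕ.+ A) ℕ.+ p ℕ.* (2 ℕ.+ B) ℕ.+ q ℕ.* (2 ℕ.+ C) ℕ.+ r ℕ.* (1 ℕ.+ D) ≡
        (p ℕ.+ q) ℕ.+ ((r ℕ.+ p ℕ.+ q) ℕ.+ suc (A ℕ.+ p ℕ.* B ℕ.+ q ℕ.* C ℕ.+ r ℕ.* D))
      expand = ℕ-Solver.solve-∀
      assemble : ∀ f r p q A B C D → 33 ℕ.+ f ℕ.+ ((r ℕ.+ p ℕ.+ q) ℕ.+ suc (A ℕ.+ p ℕ.* B ℕ.+ q ℕ.* C ℕ.+ r ℕ.* D)) ≡
        33 ℕ.+ r ℕ.+ p ℕ.+ q ℕ.+ suc (f ℕ.+ (A ℕ.+ p ℕ.* B ℕ.+ q ℕ.* C ℕ.+ r ℕ.* D))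
      assemble = ℕ-Solver.solve-∀

    bound₄ : ∀ {p q r A B C D} → 10 ℕ.≤ p → 5 ℕ.≤ B → 1 ℕ.≤ C → 1 ℕ.≤ D → Total p q r A B C D → ⊥
    bound₄ {q = q} {r} {A} hp hB hC hD = from≥₄ (λ p B C D → Total p q r A B C D → ⊥) hp hB hC hD λ p B C D e → excess _ e (lemma A p q r B C D)
      where
      lemma : ∀ A p q r B C D → A ℕ.+ (10 ℕ.+ p) ℕ.* (5 ℕ.+ B) ℕ.+ q ℕ.* (1 ℕ.+ C) ℕ.+ r ℕ.* (1 ℕ.+ D) ≡
        33 ℕ.+ r ℕ.+ (10 ℕ.+ p) ℕ.+ q ℕ.+ suc (6 ℕ.+ A ℕ.+ 4 ℕ.* p ℕ.+ (10 ℕ.+ p) ℕ.* B ℕ.+ q ℕ.* C ℕ.+ r ℕ.* D)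
      lemma = ℕ-Solver.solve-∀

    bound₅ : ∀ {r A D} → 17 ℕ.≤ r → 3 ℕ.≤ D → A ℕ.+ r ℕ.* D ≡ 33 ℕ.+ r → ⊥
    bound₅ {A = A} hr hD = from≥₂ (λ r D → A ℕ.+ r ℕ.* D ≡ 33 ℕ.+ r → ⊥) hr hD λ r D e → excess _ e (lemma A r D)
      where
      lemma : ∀ A r D → A ℕ.+ (17 ℕ.+ r) ℕ.* (3 ℕ.+ D) ≡ 33 ℕ.+ (17 ℕ.+ r) ℕ.+ suc (A ℕ.+ 2 ℕ.* r ℕ.+ (17 ℕ.+ r) ℕ.* D)
      lemma = ℕ-Solver.solve-∀

    swap-total : ∀ {p q r A B C D} → Total p q r A B C D → Total q p r A C B D
    swap-total {p} {q} {r} {A} {B} {C} {D} e = trans (lhs A (p ℕ.* B) (q ℕ.* C) (r ℕ.* D)) (trans e (rhs p q r))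
      where
      lhs : ∀ a b c d → a ℕ.+ c ℕ.+ b ℕ.+ d ≡ a ℕ.+ b ℕ.+ c ℕ.+ d
      lhs = ℕ-Solver.solve-∀
      rhs : ∀ p q r → 33 ℕ.+ r ℕ.+ p ℕ.+ q ≡ 33 ℕ.+ r ℕ.+ q ℕ.+ p
      rhs = ℕ-Solver.solve-∀

  unit⇒≢0 : ∀ {z} → Unit z → z ≢ + 0
  unit⇒≢0 (inj₁ refl) ()
  unit⇒≢0 (inj₂ refl) ()

  odd-remainder : ∀ k s {e} → Unit e → s + k * e ≡ + 1 + k → Odd s
  odd-remainder k s (inj₁ refl) h = + 0 , trans (l s k) (trans (cong (λ t → t + - k) h) (m k))
    where
    l : ∀ s k → s ≡ s + k * + 1 + - k
    l = solve-∀
    m : ∀ k → + 1 + k + - k ≡ + 1 + + 2 * + 0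
    m = solve-∀
  odd-remainder k s (inj₂ refl) h = k , trans (l s k) (trans (cong (λ t → t + k) h) (m k))
    where
    l : ∀ s k → s ≡ s + k * - (+ 1) + k
    l = solve-∀
    m : ∀ k → + 1 + k + k ≡ + 1 + + 2 * k
    m = solve-∀

  one-remainder : ∀ k s {t} → t ≡ + 1 → s + k * t ≡ + 1 + k → s ≡ + 1
  one-remainder k s refl e = +ℤ-cancelˡ k (trans (l k s) (trans e (ℤP.+-comm (+ 1) k)))
    where
    l : ∀ k s → k + s ≡ s + k * + 1
    l = solve-∀

  sq-two : ∀ {u v} → Unit v → u * v ≡ + 2 → sq u ≡ 4
  sq-two {u} (inj₁ refl) e = cong sq (trans (sym (ℤP.*-identityʳ u)) e)
  sq-two {u} (inj₂ refl) e = cong sq (trans (l u) (cong -_ e))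
    where
    l : ∀ u → u ≡ - (u * - (+ 1))
    l = solve-∀

  remaining-28 : ∀ {r A l m n o s} → l ≡ 4 → m ≡ 1 → n ≡ 1 → o ≡ 0 → s ≡ 0 → l ℕ.+ (m ℕ.+ A) ℕ.+ r ℕ.* (o ℕ.+ (n ℕ.+ s)) ≡ 33 ℕ.+ r → A ≡ 28
  remaining-28 {r} {A} refl refl refl refl refl e = ℕP.+-cancelʳ-≡ (5 ℕ.+ r) A 28 (trans (l A r) (trans e (m r)))
    where
    l : ∀ A r → A ℕ.+ (5 ℕ.+ r) ≡ 4 ℕ.+ (1 ℕ.+ A) ℕ.+ r ℕ.* 1
    l = ℕ-Solver.solve-∀
    m : ∀ r → 33 ℕ.+ r ≡ 28 ℕ.+ (5 ℕ.+ r)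
    m = ℕ-Solver.solve-∀

  -- With bc = −1 the equations give ad = 1 + 2k₁ and {k₂, k₃} = {2k₁ − 1, 2k₁ + 3}.
  coincident : ∀ {a b c d} (k₁ k₂ k₃ : ℕ) → Unit b → Unit c → Unit d → sq a ℕ.≤ 33 → k₂ ≢ k₃ → 2 ℕ.≤ k₂ → 2 ℕ.≤ k₃ →
    10 ℕ.≤ k₁ ℕ.* k₂ → 10 ℕ.≤ k₁ ℕ.* k₃ →
    a * b + + k₃ * (c * d) ≡ + 2 → a * c + + k₂ * (b * d) ≡ + 2 → a * d + + k₁ * (b * c) ≡ + 1 + + k₁ → ⊥
  coincident {a} {b} {c} {d} k₁ k₂ k₃ ub uc ud small k₂≢k₃ h₂ h₃ hp hq e₁ e₂ e₃ = main (unit-product ub uc)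
    where
    s = b * d
    us : Unit s
    us = unit-product ub ud
    bb = unit-* ub
    cc = unit-* uc
    dd = unit-* ud
    c≡ : ∀ {e} → b * c ≡ e → c ≡ e * b
    c≡ {e} refl = trans (sym (ℤP.*-identityˡ c)) (trans (cong (_* c) (sym bb)) (lemma b c))
      where
      lemma : ∀ b c → b * b * c ≡ b * c * b
      lemma = solve-∀
    same : c ≡ b → ⊥
    same refl = k₂≢k₃ (ℤP.+-injective (ℤP.*-cancelʳ-≡ (+ k₂) (+ k₃) s {{ℤ.≢-nonZero (unit⇒≢0 us)}} (+ℤ-cancelˡ (a * b) (trans e₂ (sym e₁)))))
    opposite : c ≡ - b → a * d ≡ + 1 + + 2 * + k₁ × (+ k₃ ≡ + 1 + + 2 * + k₁ + - (+ 2 * s)) × (+ k₂ ≡ + 1 + + 2 * + k₁ + + 2 * s)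
    opposite refl = ad
      , trans (sub₃ (+ k₃)) (cong₂ (λ u v → u + - (v * s)) ad e₁)
      , trans (sub₂ (+ k₂)) (cong₂ (λ u v → u + v * s) ad e₂)
      where
      ad : a * d ≡ + 1 + + 2 * + k₁
      ad = trans (lemma a b d (+ k₁)) (trans (cong₂ (λ u v → u + + k₁ * v) e₃ bb) (lemma' (+ k₁)))
        where
        lemma : ∀ a b d k → a * d ≡ (a * d + k * (b * - b)) + k * (b * b)
        lemma = solve-∀
        lemma' : ∀ k → + 1 + k + k * + 1 ≡ + 1 + + 2 * k
        lemma' = solve-∀
      sub₃ : ∀ k → k ≡ a * d + - ((a * b + k * (- b * d)) * s)
      sub₃ k = trans (trans (sym (one k)) (cong₂ (λ u v → k * (u * v) + (a * d + - (a * d * u))) (sym bb) (sym dd))) (lemma a b d k)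
        where
        one : ∀ k → k * (+ 1 * + 1) + (a * d + - (a * d * + 1)) ≡ k
        one k = identity k (a * d)
          where
          identity : ∀ k t → k * (+ 1 * + 1) + (t + - (t * + 1)) ≡ k
          identity = solve-∀
        lemma : ∀ a b d k → k * (b * b * (d * d)) + (a * d + - (a * d * (b * b))) ≡ a * d + - ((a * b + k * (- b * d)) * (b * d))
        lemma = solve-∀
      sub₂ : ∀ k → k ≡ a * d + (a * - b + k * (b * d)) * s
      sub₂ k = trans (trans (sym (one k)) (cong₂ (λ u v → k * (u * v) + (a * d + - (a * d * u))) (sym bb) (sym dd))) (lemma a b d k)
        where
        one : ∀ k → k * (+ 1 * + 1) + (a * d + - (a * d * + 1)) ≡ k
        one k = identity k (a * d)
          where
          identity : ∀ k t → k * (+ 1 * + 1) + (t + - (t * + 1)) ≡ k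
          identity = solve-∀
        lemma : ∀ a b d k → k * (b * b * (d * d)) + (a * d + - (a * d * (b * b))) ≡ a * d + (a * - b + k * (b * d)) * (b * d)
        lemma = solve-∀
    -- The smaller of k₂, k₃ is l = 2k₁ - 1. For k₁ ≤ 1 it is below 2, for k₁ = 2 the radicand k₁l
    -- is 6, and for k₁ ≥ 3 the modulus of a is at least 7, against a² ≤ 33.
    finite : ∀ k₁ {l} → sq a ℕ.≤ 33 → a * d ≡ + 1 + + 2 * + k₁ → + l ≡ + 1 + + 2 * + k₁ + - (+ 2) → 2 ℕ.≤ l → 10 ℕ.≤ k₁ ℕ.* l → ⊥
    finite 0 _ _ _ _ ()
    finite 1 _ _ e h _ with ℤP.+-injective e
    finite 1 _ _ e (s≤s ()) _ | refl
    finite 2 _ _ e _ h with ℤP.+-injective e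
    ... | refl with h
    ...   | s≤s (s≤s (s≤s (s≤s (s≤s (s≤s ())))))
    finite (suc (suc (suc k))) {l} sm e _ _ _ = ℕP.<⇒≱ (ℕP.≤-trans (s≤s sm) (ℕP.m≤m+n 34 15)) (ℕP.*-mono-≤ seven seven)
      where
      abs-a : ∣ a ∣ ≡ 7 ℕ.+ 2 ℕ.* k
      abs-a = trans (sym (trans (ℤP.abs-* a d) (trans (cong (∣ a ∣ ℕ.*_) (abs-unit ud)) (ℕP.*-identityʳ _)))) (cong ∣_∣ (trans e (trans (cong (λ t → + 1 + t) (sym (ℤP.pos-* 2 (3 ℕ.+ k)))) (cong +_ (lemma k)))))
        where
        abs-unit : ∀ {z} → Unit z → ∣ z ∣ ≡ 1
        abs-unit (inj₁ refl) = refl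
        abs-unit (inj₂ refl) = refl
        lemma : ∀ k → 1 ℕ.+ 2 ℕ.* (3 ℕ.+ k) ≡ 7 ℕ.+ 2 ℕ.* k
        lemma = ℕ-Solver.solve-∀
      seven : 7 ℕ.≤ ∣ a ∣
      seven = subst (7 ℕ.≤_) (sym abs-a) (ℕP.m≤m+n 7 _)
    main : Unit (b * c) → ⊥
    main (inj₁ e) = same (trans (c≡ e) (ℤP.*-identityˡ b))
    main (inj₂ e) = split (opposite (trans (c≡ e) (ℤP.-1*i≡-i b))) us
      where
      split : a * d ≡ + 1 + + 2 * + k₁ × (+ k₃ ≡ + 1 + + 2 * + k₁ + - (+ 2 * s)) × (+ k₂ ≡ + 1 + + 2 * + k₁ + + 2 * s) → Unit s → ⊥
      split (ad , e₃ , e₂) (inj₁ s≡) = finite k₁ {k₃} small ad (trans e₃ (cong (λ s → + 1 + + 2 * + k₁ + - (+ 2 * s)) s≡)) h₃ hq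
      split (ad , e₃ , e₂) (inj₂ s≡) = finite k₁ {k₂} small ad (trans e₂ (cong (λ s → + 1 + + 2 * + k₁ + + 2 * s) s≡)) h₂ hp

  module _ {X : Set} (a b c d : X → ℤ) (p q r k₁ k₂ k₃ : ℕ) (p≡ : p ≡ k₁ ℕ.* k₂) (q≡ : q ≡ k₁ ℕ.* k₃) (r≡ : r ≡ k₂ ℕ.* k₃)
    (hp : 10 ℕ.≤ p) (hq : 10 ℕ.≤ q) (hr : 17 ℕ.≤ r) (h₂ : 2 ℕ.≤ k₂) (h₃ : 2 ℕ.≤ k₃) (k₂≢k₃ : k₂ ≢ k₃)
    (r≤ : r ℕ.≤ 32 ℕ.+ p ℕ.+ q) (p+q≥ : 33 ℕ.≤ p ℕ.+ q) where

    private
      Sys : List X → Set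
      Sys = System a b c d p q r (+ k₁) (+ k₂) (+ k₃) (33 ℕ.+ r ℕ.+ p ℕ.+ q) (+ 2) (+ 2) (+ 1 + + k₁)

      b' c' : X → ℤ
      b' x = half (b x)
      c' x = half (c x)

      -- If all b and c were even, half of the second and third equations would equal 1. Then b = 0
      -- would make k₃ a divisor of 1, and c = 0 likewise k₂; so both are nonzero and cost 4p + 4q,
      -- too much for r ≤ 32 + p + q.
      odd-b : ∀ xs → All (λ x → b x ≡₂ c x) xs → Sys xs → Pick (λ x → Odd (b x)) xs
      odd-b xs par (system e₀ e₁ e₂ e₃) with pickOdd⊎even b xs
      ... | inj₁ o  = o
      ... | inj₂ be = ⊥-elim (main (even-zero⊎≥4 b be) (even-zero⊎≥4 c ce))
        where
        ce : All (λ x → Even (c x)) xs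
        ce = All.zipWith (λ { (h , e) → ≡₂-even h e }) (par , be)
        E₁ : ∑ (a ⊠ b') xs + + k₃ * ∑ (c' ⊠ d) xs ≡ + 1
        E₁ = ℤP.*-cancelˡ-≡ (+ 2) _ (+ 1) (trans (lemma (∑ (a ⊠ b') xs) (+ k₃) (∑ (c' ⊠ d) xs)) (trans (cong₂ (λ s t → s + + k₃ * t) (sym (∑-⊠-even a b be)) (sym (∑-⊠-evenˡ c d ce))) e₁))
          where
          lemma : ∀ s k t → + 2 * (s + k * t) ≡ + 2 * s + k * (+ 2 * t)
          lemma = solve-∀
        E₂ : ∑ (a ⊠ c') xs + + k₂ * ∑ (b' ⊠ d) xs ≡ + 1
        E₂ = ℤP.*-cancelˡ-≡ (+ 2) _ (+ 1) (trans (lemma (∑ (a ⊠ c') xs) (+ k₂) (∑ (b' ⊠ d) xs)) (trans (cong₂ (λ s t → s + + k₂ * t) (sym (∑-⊠-even a c ce)) (sym (∑-⊠-evenˡ b d be))) e₂))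
          where
          lemma : ∀ s k t → + 2 * (s + k * t) ≡ + 2 * s + k * (+ 2 * t)
          lemma = solve-∀
        half-zero : ∀ {f : X → ℤ} → Zero f xs → Zero (λ x → half (f x)) xs
        half-zero = All.map (λ {x} e → cong half e)
        main : Zero b xs ⊎ 4 ℕ.≤ ∑² b xs → Zero c xs ⊎ 4 ℕ.≤ ∑² c xs → ⊥
        main (inj₁ bz) _ = multiple≢1 {x = ∑ (c' ⊠ d) xs} h₃ (trans (sym (ℤP.+-identityˡ _)) (trans (cong (λ t → t + + k₃ * ∑ (c' ⊠ d) xs) (sym (∑-⊠-zeroʳ a b' (half-zero {b} bz)))) E₁))
        main _ (inj₁ cz) = multiple≢1 {x = ∑ (b' ⊠ d) xs} h₂ (trans (sym (ℤP.+-identityˡ _)) (trans (cong (λ t → t + + k₂ * ∑ (b' ⊠ d) xs) (sym (∑-⊠-zeroʳ a c' (half-zero {c} cz)))) E₂))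
        main (inj₂ lb) (inj₂ lc) = bound₁ {p} {q} {r} {∑² a xs} {D = ∑² d xs} r≤ p+q≥ lb lc e₀

      -- For k₁ = 1 the radicand r is the product pq, which for p, q ≥ 10 exceeds 32 + p + q.
      k₁≢1 : k₁ ≢ 1
      k₁≢1 refl = from≥₂ (λ k₂ k₃ → k₂ ℕ.* k₃ ℕ.≤ 32 ℕ.+ k₂ ℕ.+ k₃ → ⊥) (subst (10 ℕ.≤_) p≡k₂ hp) (subst (10 ℕ.≤_) q≡k₃ hq)
        (λ m n le → ℕP.<⇒≱ (subst (32 ℕ.+ (10 ℕ.+ m) ℕ.+ (10 ℕ.+ n) ℕ.<_) (sym (lemma m n)) (ℕP.m<m+n _ (s≤s z≤n))) le)
        (subst₂ ℕ._≤_ r≡ (cong₂ (λ s t → 32 ℕ.+ s ℕ.+ t) p≡k₂ q≡k₃) r≤)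
        where
        p≡k₂ : p ≡ k₂
        p≡k₂ = trans p≡ (ℕP.*-identityˡ k₂)
        q≡k₃ : q ≡ k₃
        q≡k₃ = trans q≡ (ℕP.*-identityˡ k₃)
        lemma : ∀ m n → (10 ℕ.+ m) ℕ.* (10 ℕ.+ n) ≡ (32 ℕ.+ (10 ℕ.+ m) ℕ.+ (10 ℕ.+ n)) ℕ.+ suc (47 ℕ.+ 9 ℕ.* m ℕ.+ 9 ℕ.* n ℕ.+ m ℕ.* n)
        lemma = ℕ-Solver.solve-∀

      -- If d vanishes, the last equation becomes k₁(Σbc - 1) = 1 and forces k₁ = 1. If d is even
      -- and nonzero, it costs 4r.
      odd-d : ∀ xs → All (λ x → a x ≡₂ d x) xs → 1 ℕ.≤ ∑² b xs → 1 ℕ.≤ ∑² c xs → Sys xs → Pick (λ x → Odd (d x)) xs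
      odd-d xs par lb lc (system e₀ e₁ e₂ e₃) with pickOdd⊎even d xs
      ... | inj₁ o  = o
      ... | inj₂ de = ⊥-elim (main (even-zero⊎≥4 d de))
        where
        main : Zero d xs ⊎ 4 ℕ.≤ ∑² d xs → ⊥
        main (inj₁ dz) = k₁≢1 (ℕP.m*n≡1⇒m≡1 k₁ ∣ t + - (+ 1) ∣ (trans (sym (ℤP.abs-* (+ k₁) (t + - (+ 1)))) (cong ∣_∣ eq)))
          where
          t = ∑ (b ⊠ c) xs
          eq : + k₁ * (t + - (+ 1)) ≡ + 1
          eq = trans (lemma (+ k₁) t) (trans (cong (λ z → z + - (+ k₁)) (trans (cong (λ z → z + + k₁ * t) (sym (∑-⊠-zeroʳ a d dz))) e₃)) (lemma' (+ k₁)))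
            where
            lemma : ∀ k t → k * (t + - (+ 1)) ≡ + 0 + k * t + - k
            lemma = solve-∀
            lemma' : ∀ k → + 1 + k + - k ≡ + 1
            lemma' = solve-∀
        main (inj₂ ld) = bound₂ {p} {q} {r} {∑² a xs} hr lb lc ld e₀

    -- Exactly one term x has b odd; there b and c are ±1, and both vanish elsewhere. This leaves
    -- Σa² + rΣd² = 33 + r with Σad odd. If d is odd at x itself, all roots meet in one term, which
    -- `coincident` refutes. Otherwise d is ±1 at a second term, and x and that term contribute like
    -- w₂² and w₁².
    noFiveSquares-II-small : ∀ xs → All (λ x → a x ≡₂ d x) xs → All (λ x → b x ≡₂ c x) xs → length xs ℕ.≤ 5 → Sys xs → ⊥
    noFiveSquares-II-small xs par-ad₀ par-bc₀ len sys₀ with odd-b xs par-bc₀ sys₀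
    ... | pick {x} {ys} perm obx = main (parity (d x))
      where
      sys : Sys (x ∷ ys)
      sys = system-↭ perm sys₀
      open System sys
      par-ad : All (λ x → a x ≡₂ d x) (x ∷ ys)
      par-ad = All-resp-↭ perm par-ad₀
      par-bc : All (λ x → b x ≡₂ c x) (x ∷ ys)
      par-bc = All-resp-↭ perm par-bc₀
      ocx : Odd (c x)
      ocx = ≡₂-odd (All.head par-bc) obx
      one-b : 1 ℕ.≤ ∑² b (x ∷ ys)
      one-b = ℕP.≤-trans (sq-odd obx) (ℕP.m≤m+n _ _)
      one-c : 1 ℕ.≤ ∑² c (x ∷ ys)
      one-c = ℕP.≤-trans (sq-odd ocx) (ℕP.m≤m+n _ _)
      some-d : Pick (λ x → Odd (d x)) (x ∷ ys)
      some-d = odd-d (x ∷ ys) par-ad one-b one-c sys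
      one-d : 1 ℕ.≤ ∑² d (x ∷ ys)
      one-d = ∑²-odd d some-d
      one-a : 1 ℕ.≤ ∑² a (x ∷ ys)
      one-a with some-d
      ... | pick {z} h o = ∑²-odd a (pick h (≡₂-odd (≡₂-sym {a z} (All.head (All-resp-↭ h par-ad))) o))
      five-b : ¬ (5 ℕ.≤ ∑² b (x ∷ ys))
      five-b le = bound₄ {p} {q} {r} {∑² a (x ∷ ys)} hp le one-c one-d e₀
      five-c : ¬ (5 ℕ.≤ ∑² c (x ∷ ys))
      five-c le = bound₄ {q} {p} {r} {∑² a (x ∷ ys)} hq le one-b one-d (swap-total {p} {q} {r} {∑² a (x ∷ ys)} {∑² b (x ∷ ys)} {∑² c (x ∷ ys)} {∑² d (x ∷ ys)} e₀)
      even-b : All (λ y → Even (b y)) ys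
      even-b with pickOdd⊎even b ys
      ... | inj₂ es = es
      ... | inj₁ (pick {y} h oy) = ⊥-elim (bound₃ {p} {q} {r} p+q≥ one-a
              (ℕP.+-mono-≤ (sq-odd obx) (∑²-odd b (pick h oy)))
              (ℕP.+-mono-≤ (sq-odd ocx) (∑²-odd c (pick h (≡₂-odd (All.head (All-resp-↭ h (All.tail par-bc))) oy)))) one-d e₀)
      zeros : ∀ (f : X → ℤ) → Odd (f x) → ¬ (5 ℕ.≤ ∑² f (x ∷ ys)) → All (λ y → Even (f y)) ys → Zero f ys
      zeros f o few es with even-zero⊎≥4 f es
      ... | inj₁ z  = z
      ... | inj₂ le = ⊥-elim (few (ℕP.+-mono-≤ (sq-odd o) le))
      bz : Zero b ys
      bz = zeros b obx five-b even-b
      cz : Zero c ys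
      cz = zeros c ocx five-c (All.zipWith (λ { (h , e) → ≡₂-even h e }) (All.tail par-bc , even-b))
      unit : ∀ (f : X → ℤ) → Odd (f x) → ¬ (5 ℕ.≤ ∑² f (x ∷ ys)) → Unit (f x)
      unit f o few = odd⇒unit o (ℕP.≰⇒> λ le → few (ℕP.≤-trans (ℕP.≤-trans (ℕP.m≤m+n 5 4) le) (ℕP.m≤m+n _ _)))
      ub : Unit (b x)
      ub = unit b obx five-b
      uc : Unit (c x)
      uc = unit c ocx five-c
      E₀ : ∑² a (x ∷ ys) ℕ.+ r ℕ.* ∑² d (x ∷ ys) ≡ 33 ℕ.+ r
      E₀ = collapse {∑² a (x ∷ ys)} {∑² d (x ∷ ys)} (unit-sq ub) (unit-sq uc) (∑²-zero b bz) (∑²-zero c cz) e₀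
        where
        collapse : ∀ {A D m n s t} → m ≡ 1 → n ≡ 1 → s ≡ 0 → t ≡ 0 → Total p q r A (m ℕ.+ s) (n ℕ.+ t) D → A ℕ.+ r ℕ.* D ≡ 33 ℕ.+ r
        collapse {A} {D} refl refl refl refl e = ℕP.+-cancelʳ-≡ (p ℕ.+ q) _ _ (trans (lhs A p q (r ℕ.* D)) (trans e (rhs p q r)))
          where
          lhs : ∀ A p q R → A ℕ.+ R ℕ.+ (p ℕ.+ q) ≡ A ℕ.+ p ℕ.* 1 ℕ.+ q ℕ.* 1 ℕ.+ R
          lhs = ℕ-Solver.solve-∀
          rhs : ∀ p q r → 33 ℕ.+ r ℕ.+ p ℕ.+ q ≡ 33 ℕ.+ r ℕ.+ (p ℕ.+ q)
          rhs = ℕ-Solver.solve-∀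
      few-d : ¬ (3 ℕ.≤ ∑² d (x ∷ ys))
      few-d le = bound₅ {A = ∑² a (x ∷ ys)} hr le E₀
      E₃ : ∑ (a ⊠ d) (x ∷ ys) + + k₁ * (b x * c x) ≡ + 1 + + k₁
      E₃ = trans (cong (λ t → ∑ (a ⊠ d) (x ∷ ys) + + k₁ * t) (sym (drop-zero (b x * c x) (∑-⊠-zeroʳ b c cz)))) e₃
      odd-ad : Odd (∑ (a ⊠ d) (x ∷ ys))
      odd-ad = odd-remainder (+ k₁) (∑ (a ⊠ d) (x ∷ ys)) (unit-product ub uc) E₃

      main : Even (d x) ⊎ Odd (d x) → ⊥
      main (inj₂ odx) = coincident {a x} k₁ k₂ k₃ ub uc (proj₁ alone) small k₂≢k₃ h₂ h₃ (subst (10 ℕ.≤_) p≡ hp) (subst (10 ℕ.≤_) q≡ hq)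
          (trans (cong₂ (λ s t → s + + k₃ * t) (sym (drop-zero (a x * b x) (∑-⊠-zeroʳ a b bz))) (sym (drop-zero (c x * d x) (∑-⊠-zeroʳ c d dz)))) e₁)
          (trans (cong₂ (λ s t → s + + k₂ * t) (sym (drop-zero (a x * c x) (∑-⊠-zeroʳ a c cz))) (sym (drop-zero (b x * d x) (∑-⊠-zeroʳ b d dz)))) e₂)
          (trans (cong (λ s → s + + k₁ * (b x * c x)) (sym (drop-zero (a x * d x) (∑-⊠-zeroʳ a d dz)))) E₃)
        where
        alone = others-zero a d x ys par-ad odx odd-ad few-d
        dz : Zero d ys
        dz = proj₂ alone
        small : sq (a x) ℕ.≤ 33
        small = bound {sq (a x)} {∑² a ys} (unit-sq (proj₁ alone)) (∑²-zero d dz) E₀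
          where
          bound : ∀ {A S m s} → m ≡ 1 → s ≡ 0 → (A ℕ.+ S) ℕ.+ r ℕ.* (m ℕ.+ s) ≡ 33 ℕ.+ r → A ℕ.≤ 33
          bound {A} {S} refl refl e = ℕP.≤-trans (ℕP.m≤m+n A S) (ℕP.≤-reflexive (ℕP.+-cancelʳ-≡ r _ _ (trans (cong (A ℕ.+ S ℕ.+_) (sym (ℕP.*-identityʳ r))) e)))
      main (inj₁ edx) = second (pickOdd (a ⊠ d) ys (subst Odd ad-ys odd-ad))
        where
        dx≡0 : d x ≡ + 0
        dx≡0 = decidable-stable (d x ℤP.≟ + 0) (λ nz → few-d (ℕP.≤-trans (ℕP.≤-trans (ℕP.m≤m+n 3 1) (sq-even edx nz)) (ℕP.m≤m+n _ _)))
        ad-ys : ∑ (a ⊠ d) (x ∷ ys) ≡ ∑ (a ⊠ d) ys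
        ad-ys = trans (cong (λ t → a x * t + ∑ (a ⊠ d) ys) dx≡0) (trans (cong (λ t → t + ∑ (a ⊠ d) ys) (ℤP.*-zeroʳ (a x))) (ℤP.+-identityˡ _))
        second : Pick (λ y → Odd (a y * d y)) ys → ⊥
        -- At x the equations ab = ac = 2 give a² = 4, and at z they give a² = d² = 1. Of 33 + r
        -- there remain 28 for three even numerators.
        second (pick {z} {ws} h o) = twenty-eight≢threeSquares a ws (even-parts a d (All.tail (All-resp-↭ h (All.tail par-ad))) dz)
            (tail-length h (tail-length perm len)) (remaining-28 {r} {∑² a ws} four (proj₁ ones) (proj₂ ones) (cong sq dx≡0) (∑²-zero d dz)
               (trans (cong₂ (λ s t → sq (a x) ℕ.+ s ℕ.+ r ℕ.* (sq (d x) ℕ.+ t)) (sym (∑²-↭ a h)) (sym (∑²-↭ d h))) E₀))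
          where
          alone = others-zero a d z ws (All-resp-↭ h (All.tail par-ad)) (proj₂ (odd-*⁻ (a z) (d z) o)) (subst Odd (trans ad-ys (∑-↭ (a ⊠ d) h)) odd-ad)
            (λ le → few-d (ℕP.≤-trans (subst (3 ℕ.≤_) (sym (∑²-↭ d h)) le) (ℕP.m≤n+m _ (sq (d x)))))
          dz : Zero d ws
          dz = proj₂ alone
          dot-zero : ∀ (f : X → ℤ) → Zero f ys → ∑ (f ⊠ d) (x ∷ ys) ≡ + 0
          dot-zero f fz = ∑-zero (f ⊠ d) (trans (cong (λ t → f x * t) dx≡0) (ℤP.*-zeroʳ (f x)) ∷ All.map (λ {y} e → cong (λ t → t * d y) e) fz)
          ab : a x * b x ≡ + 2
          ab = trans (trans (sym (drop-zero (a x * b x) (∑-⊠-zeroʳ a b bz))) (sym (vanish {a x * b x + ∑ (a ⊠ b) ys} (+ k₃) (dot-zero c cz)))) e₁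
          ac : a x * c x ≡ + 2
          ac = trans (trans (sym (drop-zero (a x * c x) (∑-⊠-zeroʳ a c cz))) (sym (vanish {a x * c x + ∑ (a ⊠ c) ys} (+ k₂) (dot-zero b bz)))) e₂
          ax≢0 : a x ≢ + 0
          ax≢0 e = two≢0 (trans (sym ab) (cong (λ t → t * b x) e))
            where
            two≢0 : + 2 ≡ + 0 → ⊥
            two≢0 ()
          b≡c : b x ≡ c x
          b≡c = ℤP.*-cancelˡ-≡ (a x) (b x) (c x) {{ℤ.≢-nonZero ax≢0}} (trans ab (sym ac))
          adz : a z * d z ≡ + 1
          adz = one-remainder (+ k₁) (a z * d z) (trans (cong (λ t → b x * t) (sym b≡c)) (unit-* ub)) (trans (cong (λ s → s + + k₁ * (b x * c x)) (sym (trans ad-ys (trans (∑-↭ (a ⊠ d) h) (drop-zero (a z * d z) (∑-⊠-zeroʳ a d dz)))))) E₃)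
          ones : sq (a z) ≡ 1 × sq (d z) ≡ 1
          ones = product-one (a z) (d z) adz
          four : sq (a x) ≡ 4
          four = sq-two {a x} ub ab

-- Systems in which one radicand is the product of the two others.

module CoprimeSystems where

  open CoordinateEquations using (∑; ∑²; sq; +sq; _⊠_)
  open Parity
  open SumsOfSquares
  open HalfIntegralSystems
  open HalfIntegralSmall
  open import Data.Integer using (_+_; _*_; -_)
  open ℤ-Solver using (solve-∀)

  private
    iii-c : ∀ {p r A B C D} → 10 ℕ.≤ p → 17 ℕ.≤ r → 1 ℕ.≤ C → A ℕ.+ p ℕ.* B ℕ.+ (p ℕ.* r) ℕ.* C ℕ.+ r ℕ.* D ≡ 33 ℕ.+ r ℕ.+ 4 ℕ.* p → ⊥
    iii-c {A = A} {B} {D = D} hp hr hC = from≥₃ (λ p r C → A ℕ.+ p ℕ.* B ℕ.+ (p ℕ.* r) ℕ.* C ℕ.+ r ℕ.* D ≡ 33 ℕ.+ r ℕ.+ 4 ℕ.* p → ⊥) hp hr hC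
      λ p r C e → excess _ e (lemma A p r B C D)
      where
      lemma : ∀ A p r B C D → A ℕ.+ (10 ℕ.+ p) ℕ.* B ℕ.+ ((10 ℕ.+ p) ℕ.* (17 ℕ.+ r)) ℕ.* (1 ℕ.+ C) ℕ.+ (17 ℕ.+ r) ℕ.* D ≡
        33 ℕ.+ (17 ℕ.+ r) ℕ.+ 4 ℕ.* (10 ℕ.+ p) ℕ.+ suc (79 ℕ.+ 9 ℕ.* r ℕ.+ 13 ℕ.* p ℕ.+ p ℕ.* r ℕ.+ A ℕ.+ (10 ℕ.+ p) ℕ.* B ℕ.+ ((10 ℕ.+ p) ℕ.* (17 ℕ.+ r)) ℕ.* C ℕ.+ (17 ℕ.+ r) ℕ.* D)
      lemma = ℕ-Solver.solve-∀

    iii-b : ∀ {p q r A B C D} → 10 ℕ.≤ p → 8 ℕ.≤ B → 1 ℕ.≤ D → A ℕ.+ p ℕ.* B ℕ.+ q ℕ.* C ℕ.+ r ℕ.* D ≡ 33 ℕ.+ r ℕ.+ 4 ℕ.* p → ⊥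
    iii-b {q = q} {r} {A} {C = C} hp hB hD = from≥₃ (λ p B D → A ℕ.+ p ℕ.* B ℕ.+ q ℕ.* C ℕ.+ r ℕ.* D ≡ 33 ℕ.+ r ℕ.+ 4 ℕ.* p → ⊥) hp hB hD
      λ p B D e → excess _ e (lemma A p r B (q ℕ.* C) D)
      where
      lemma : ∀ A p r B C D → A ℕ.+ (10 ℕ.+ p) ℕ.* (8 ℕ.+ B) ℕ.+ C ℕ.+ r ℕ.* (1 ℕ.+ D) ≡
        33 ℕ.+ r ℕ.+ 4 ℕ.* (10 ℕ.+ p) ℕ.+ suc (6 ℕ.+ 4 ℕ.* p ℕ.+ A ℕ.+ (10 ℕ.+ p) ℕ.* B ℕ.+ C ℕ.+ r ℕ.* D)
      lemma = ℕ-Solver.solve-∀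

    iii-rest : ∀ {p q r A D l m s t o} → l ≡ 4 → m ≡ 4 → s ≡ 0 → t ≡ 0 → o ≡ 0 →
      (l ℕ.+ A) ℕ.+ p ℕ.* (m ℕ.+ s) ℕ.+ q ℕ.* t ℕ.+ r ℕ.* (o ℕ.+ D) ≡ 33 ℕ.+ r ℕ.+ 4 ℕ.* p → A ℕ.+ r ℕ.* D ≡ 29 ℕ.+ r
    iii-rest {p} {q} {r} {A} {D} refl refl refl refl refl e = ℕP.+-cancelʳ-≡ (4 ℕ.+ 4 ℕ.* p) _ _ (trans (lhs A p q (r ℕ.* D)) (trans e (rhs p r)))
      where
      lhs : ∀ A p q R → A ℕ.+ R ℕ.+ (4 ℕ.+ 4 ℕ.* p) ≡ (4 ℕ.+ A) ℕ.+ p ℕ.* 4 ℕ.+ q ℕ.* 0 ℕ.+ R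
      lhs = ℕ-Solver.solve-∀
      rhs : ∀ p r → 33 ℕ.+ r ℕ.+ 4 ℕ.* p ≡ 29 ℕ.+ r ℕ.+ (4 ℕ.+ 4 ℕ.* p)
      rhs = ℕ-Solver.solve-∀

  module _ {X : Set} (a b c d : X → ℤ) (p r : ℕ) (hp : 10 ℕ.≤ p) (hr : 17 ℕ.≤ r) where
    private
      Sys : List X → Set
      Sys = System a b c d p (p ℕ.* r) r (+ p) (+ 1) (+ r) (33 ℕ.+ r ℕ.+ 4 ℕ.* p) (+ 4) (+ 0) (+ 1)

    -- The radicand q = pr is too large for any nonzero c, and with c = 0 the equations decouple
    -- into Σab = 4, Σad = 1 and Σbd = 0. As b is even and Σb² < 8, a single term has b = ±2; there
    -- a = ±2 and d = 0, the contribution of 1 + √p. The other terms would contradict `peters` for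
    -- r.
    noFiveSquares-II-coprime : ∀ xs → All (λ x → a x ≡₂ d x) xs → All (λ x → b x ≡₂ c x) xs → length xs ℕ.≤ 5 → Sys xs → ⊥
    noFiveSquares-II-coprime xs par-ad par-bc len sys = main (pickNonZero⊎zero b xs)
      where
      open System sys
      c-zero : Zero c xs
      c-zero = Sum.[ (λ nz → ⊥-elim (iii-c {p} {r} {∑² a xs} {∑² b xs} {D = ∑² d xs} hp hr (∑²-nonZero c nz) e₀)) , (λ z → z) ]′ (pickNonZero⊎zero c xs)
      b-even : All (λ x → Even (b x)) xs
      b-even = even-parts b c par-bc c-zero
      ∑ad : ∑ (a ⊠ d) xs ≡ + 1
      ∑ad = trans (sym (vanish {∑ (a ⊠ d) xs} (+ p) (∑-⊠-zeroʳ b c c-zero))) e₃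
      ∑ab : ∑ (a ⊠ b) xs ≡ + 4
      ∑ab = trans (sym (vanish {∑ (a ⊠ b) xs} (+ r) (∑-⊠-zeroˡ c d c-zero))) e₁
      ∑bd : ∑ (b ⊠ d) xs ≡ + 0
      ∑bd = trans (sym (trans (cong (λ t → t + + 1 * ∑ (b ⊠ d) xs) (∑-⊠-zeroʳ a c c-zero)) (trans (ℤP.+-identityˡ _) (ℤP.*-identityˡ _)))) e₂
      one-d : 1 ℕ.≤ ∑² d xs
      one-d = odd-d (pickOdd (a ⊠ d) xs (subst Odd (sym ∑ad) odd-one))
        where
        odd-d : Pick (λ x → Odd (a x * d x)) xs → 1 ℕ.≤ ∑² d xs
        odd-d (pick {x} h o) = ∑²-odd d (pick h (proj₂ (odd-*⁻ (a x) (d x) o)))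
      few-b : ¬ (8 ℕ.≤ ∑² b xs)
      few-b le = iii-b {p} {p ℕ.* r} {r} {∑² a xs} {C = ∑² c xs} hp le one-d e₀
      main : Pick (λ x → b x ≢ + 0) xs ⊎ Zero b xs → ⊥
      main (inj₂ bz) = 0≢4 (trans (sym (∑-⊠-zeroʳ a b bz)) ∑ab)
        where
        0≢4 : + 0 ≢ + 4
        0≢4 ()
      main (inj₁ (pick {x} {ys} h bx≢0)) = peters a d r ys hr (All.tail (All-resp-↭ h par-ad))
          (iii-rest {p} {p ℕ.* r} {r} {∑² a ys} {∑² d ys} four sq-bx (∑²-zero b b-ys) (∑²-zero c c-zero) (cong sq dx≡0)
            (trans (cong₃ (λ s t u → s ℕ.+ p ℕ.* t ℕ.+ (p ℕ.* r) ℕ.* ∑² c xs ℕ.+ r ℕ.* u) (∑²-↭ a h) (∑²-↭ b h) (∑²-↭ d h)) e₀))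
          (trans (sym (trans (∑-↭ (a ⊠ d) h) (trans (cong (λ t → t + ∑ (a ⊠ d) ys) (trans (cong (λ t → a x * t) dx≡0) (ℤP.*-zeroʳ (a x)))) (ℤP.+-identityˡ _)))) ∑ad)
          (tail-length h len)
        where
        cong₃ : ∀ (f : ℕ → ℕ → ℕ → ℕ) {s s' t t' u u'} → s ≡ s' → t ≡ t' → u ≡ u' → f s' t' u' ≡ f s t u
        cong₃ f refl refl refl = refl
        evens : All (λ x → Even (b x)) (x ∷ ys)
        evens = All-resp-↭ h b-even
        b' = half (b x)
        bx≡ : b x ≡ + 2 * b'
        bx≡ = half-even (All.head evens)
        b-ys : Zero b ys
        b-ys = Sum.[ (λ z → z) , (λ le → ⊥-elim (few-b (subst (8 ℕ.≤_) (sym (∑²-↭ b h)) (ℕP.+-mono-≤ (sq-even (All.head evens) bx≢0) le)))) ]′ (even-zero⊎≥4 b (All.tail evens))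
        ub' : Unit b'
        ub' = small⇒unit (λ e → bx≢0 (trans bx≡ (cong (λ t → + 2 * t) e)))
          (ℕP.≰⇒> λ le → few-b (ℕP.≤-trans (ℕP.≤-trans (ℕP.m≤m+n 8 8) (subst (16 ℕ.≤_) (sym (trans (cong sq bx≡) (sq-2* b'))) (ℕP.*-monoʳ-≤ 4 le))) (subst (sq (b x) ℕ.≤_) (sym (∑²-↭ b h)) (ℕP.m≤m+n _ _))))
        sq-bx : sq (b x) ≡ 4
        sq-bx = trans (cong sq bx≡) (trans (sq-2* b') (cong (4 ℕ.*_) (unit-sq ub')))
        four : sq (a x) ≡ 4
        four = sq-two {a x} ub' (ℤP.*-cancelˡ-≡ (+ 2) _ (+ 2) (trans (swap (a x) b') (trans (cong (λ t → a x * t) (sym bx≡)) (trans (sym (trans (∑-↭ (a ⊠ b) h) (drop-zero (a x * b x) (∑-⊠-zeroʳ a b b-ys)))) ∑ab))))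
          where
          swap : ∀ u v → + 2 * (u * v) ≡ u * (+ 2 * v)
          swap = solve-∀
        dx≡0 : d x ≡ + 0
        dx≡0 = product-zero bx≢0 (trans (sym (trans (∑-↭ (b ⊠ d) h) (drop-zero (b x * d x) (∑-⊠-zeroˡ b d b-ys)))) ∑bd)

  private
    coprime-bound : ∀ {p q A B C} → 17 ℕ.≤ p → 17 ℕ.≤ q → 2 ℕ.≤ B → 2 ℕ.≤ C → A ℕ.+ p ℕ.* B ℕ.+ q ℕ.* C ≡ 30 ℕ.+ p ℕ.+ q → ⊥
    coprime-bound {A = A} hp hq hB hC = from≥₄ (λ p q B C → A ℕ.+ p ℕ.* B ℕ.+ q ℕ.* C ≡ 30 ℕ.+ p ℕ.+ q → ⊥) hp hq hB hC λ p q B C e → excess _ e (lemma A p q B C)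
      where
      lemma : ∀ A p q B C → A ℕ.+ (17 ℕ.+ p) ℕ.* (2 ℕ.+ B) ℕ.+ (17 ℕ.+ q) ℕ.* (2 ℕ.+ C) ≡
        30 ℕ.+ (17 ℕ.+ p) ℕ.+ (17 ℕ.+ q) ℕ.+ suc (3 ℕ.+ p ℕ.+ q ℕ.+ A ℕ.+ (17 ℕ.+ p) ℕ.* B ℕ.+ (17 ℕ.+ q) ℕ.* C)
      lemma = ℕ-Solver.solve-∀

    coprime-rest : ∀ {p q A C l m s o} → l ≡ 1 → m ≡ 1 → s ≡ 0 → o ≡ 0 → (l ℕ.+ A) ℕ.+ p ℕ.* (m ℕ.+ s) ℕ.+ q ℕ.* (o ℕ.+ C) ≡ 30 ℕ.+ p ℕ.+ q → A ℕ.+ q ℕ.* C ≡ 29 ℕ.+ q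
    coprime-rest {p} {q} {A} {C} refl refl refl refl e = ℕP.+-cancelʳ-≡ (1 ℕ.+ p) _ _ (trans (lhs A p (q ℕ.* C)) (trans e (rhs p q)))
      where
      lhs : ∀ A p R → A ℕ.+ R ℕ.+ (1 ℕ.+ p) ≡ (1 ℕ.+ A) ℕ.+ p ℕ.* 1 ℕ.+ R
      lhs = ℕ-Solver.solve-∀
      rhs : ∀ p q → 30 ℕ.+ p ℕ.+ q ≡ 29 ℕ.+ q ℕ.+ (1 ℕ.+ p)
      rhs = ℕ-Solver.solve-∀

    -- If Σb² < 2, only one term has b ≠ 0. The equation Σab = 1 makes a and b equal to ±1 there,
    -- and Σbc = 0 makes c vanish. Removing the term, which acts as (1 + √p)/2, leaves the situation
    -- of `peters` for q.
    single : ∀ {X : Set} (a b c : X → ℤ) p q xs → 17 ℕ.≤ q → All (λ x → Even (a x + b x + c x)) xs →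
      ∑² a xs ℕ.+ p ℕ.* ∑² b xs ℕ.+ q ℕ.* ∑² c xs ≡ 30 ℕ.+ p ℕ.+ q → ¬ (2 ℕ.≤ ∑² b xs) →
      ∑ (a ⊠ b) xs ≡ + 1 → ∑ (a ⊠ c) xs ≡ + 1 → ∑ (b ⊠ c) xs ≡ + 0 → length xs ℕ.≤ 5 → ⊥
    single {X} a b c p q xs hq par e₀ few eab eac ebc len = main (pickOdd (a ⊠ b) xs (subst Odd (sym eab) odd-one))
      where
      main : Pick (λ x → Odd (a x * b x)) xs → ⊥
      main (pick {x} {ys} h o) = peters a c q ys hq
          (All.zipWith (λ { {y} (e , z) → subst Even (trans (cong (λ t → a y + t + c y) z) (cong (λ t → t + c y) (ℤP.+-identityʳ (a y)))) e }) (All.tail (All-resp-↭ h par) , bz))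
          (coprime-rest {p} {q} {∑² a ys} {∑² c ys} (proj₁ ones) (proj₂ ones) (∑²-zero b bz) (cong sq cx≡0)
            (trans (cong₃ (λ s t u → s ℕ.+ p ℕ.* t ℕ.+ q ℕ.* u) (∑²-↭ a h) (∑²-↭ b h) (∑²-↭ c h)) e₀))
          (trans (sym (trans (∑-↭ (a ⊠ c) h) (trans (cong (λ t → t + ∑ (a ⊠ c) ys) (trans (cong (λ t → a x * t) cx≡0) (ℤP.*-zeroʳ (a x)))) (ℤP.+-identityˡ _)))) eac)
          (tail-length h len)
        where
        cong₃ : ∀ (f : ℕ → ℕ → ℕ → ℕ) {s s' t t' u u'} → s ≡ s' → t ≡ t' → u ≡ u' → f s' t' u' ≡ f s t u
        cong₃ f refl refl refl = refl
        obx : Odd (b x)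
        obx = proj₂ (odd-*⁻ (a x) (b x) o)
        bz : Zero b ys
        bz = Sum.[ (λ nz → ⊥-elim (few (subst (2 ℕ.≤_) (sym (∑²-↭ b h)) (ℕP.+-mono-≤ (sq-odd obx) (∑²-nonZero b nz))))) , (λ z → z) ]′ (pickNonZero⊎zero b ys)
        ones : sq (a x) ≡ 1 × sq (b x) ≡ 1
        ones = product-one (a x) (b x) (trans (sym (trans (∑-↭ (a ⊠ b) h) (drop-zero (a x * b x) (∑-⊠-zeroʳ a b bz)))) eab)
        cx≡0 : c x ≡ + 0
        cx≡0 = product-zero (odd⇒nonZero obx) (trans (sym (trans (∑-↭ (b ⊠ c) h) (drop-zero (b x * c x) (∑-⊠-zeroˡ b c bz)))) ebc)

  -- Σb² and Σc² cannot both reach 2, since p + q > 30; by symmetry one of them may be taken below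
  -- 2.
  noFiveSquares-III-coprime : ∀ {X : Set} (a b c : X → ℤ) p q xs → 17 ℕ.≤ p → 17 ℕ.≤ q → All (λ x → Even (a x + b x + c x)) xs →
    ∑² a xs ℕ.+ p ℕ.* ∑² b xs ℕ.+ q ℕ.* ∑² c xs ≡ 30 ℕ.+ p ℕ.+ q →
    ∑ (a ⊠ b) xs ≡ + 1 → ∑ (a ⊠ c) xs ≡ + 1 → ∑ (b ⊠ c) xs ≡ + 0 → length xs ℕ.≤ 5 → ⊥
  noFiveSquares-III-coprime a b c p q xs hp hq par e₀ eab eac ebc len =
    single a b c p q xs hq par e₀
      (λ le → single a c b q p xs hp (All.map (λ {x} → subst Even (swap (a x) (b x) (c x))) par)
        (trans (swapℕ (∑² a xs) (q ℕ.* ∑² c xs) (p ℕ.* ∑² b xs)) (trans e₀ (swapℕ 30 p q)))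
        (λ le' → coprime-bound {A = ∑² a xs} hp hq le le' e₀) eac eab (trans (∑-⊠-comm c b xs) ebc) len)
      eab eac ebc len
    where
    swap : ∀ a b c → a + b + c ≡ a + c + b
    swap = solve-∀
    swapℕ : ∀ a b c → a ℕ.+ b ℕ.+ c ≡ a ℕ.+ c ℕ.+ b
    swapℕ = ℕ-Solver.solve-∀

-- Equations for the coordinates of a single term with denominator 4.

module UnitEquations where

  open CoordinateEquations using (∑; ∑²; sq; +sq; _⊠_)
  open Parity
  open SumsOfSquares
  open HalfIntegralSystems
  open import Data.Integer using (_+_; _*_; -_)
  open ℤ-Solver using (solve-∀)

  One₄ : ℤ → Set
  One₄ k = ∃ λ m → k ≡ + 1 + + 4 * m


  private
    neg-unit : ∀ {z} → Unit z → Unit (- z)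
    neg-unit (inj₁ refl) = inj₂ refl
    neg-unit (inj₂ refl) = inj₁ refl

    neg-* : ∀ u v k s t → - u * - v + k * (- s * - t) ≡ u * v + k * (s * t)
    neg-* = solve-∀

    D≡1-extra : ∀ A B C w k₁ k₂ k₃ → Unit B → Unit C → Odd w → One₄ k₁ → One₄ k₂ → One₄ k₃ → k₃ ≢ - (+ 3) →
      A * B + k₃ * (C * + 1) ≡ + 5 + k₃ → A * C + + 4 * w + k₂ * (B * + 1) ≡ + 1 + k₂ → A * + 1 + k₁ * (B * C) ≡ + 1 + k₁ → ⊥
    D≡1-extra A .(+ 1) .(+ 1) w k₁ k₂ k₃ (inj₁ refl) (inj₁ refl) ow _ _ _ _ e₁ e₂ e₃ = 4≢0 (trans (l A k₁ k₃) (trans (cong₂ (λ u v → u + - v + - k₃ + k₁) e₁ e₃) (m k₁ k₃)))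
      where
      4≢0 : + 0 ≢ + 4
      4≢0 ()
      l : ∀ A k₁ k₃ → + 0 ≡ A * + 1 + k₃ * + 1 + - (A * + 1 + k₁ * + 1) + - k₃ + k₁
      l = solve-∀
      m : ∀ k₁ k₃ → + 5 + k₃ + - (+ 1 + k₁) + - k₃ + k₁ ≡ + 4
      m = solve-∀
    D≡1-extra A .(-[1+ 0 ]) .(-[1+ 0 ]) w k₁ k₂ k₃ (inj₂ refl) (inj₂ refl) ow _ _ _ k₃≢ e₁ e₂ e₃ =
      k₃≢ (ℤP.*-cancelˡ-≡ (+ 2) k₃ _ (trans (l A k₁ k₃) (trans (cong₂ (λ u v → - u + - v + k₁ + k₃) e₁ e₃) (m k₁ k₃))))
      where
      l : ∀ A k₁ k₃ → + 2 * k₃ ≡ - (A * - (+ 1) + k₃ * - (+ 1)) + - (A * + 1 + k₁ * + 1) + k₁ + k₃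
      l = solve-∀
      m : ∀ k₁ k₃ → - (+ 5 + k₃) + - (+ 1 + k₁) + k₁ + k₃ ≡ + 2 * - (+ 3)
      m = solve-∀
    D≡1-extra A .(+ 1) .(-[1+ 0 ]) w k₁ k₂ k₃ (inj₁ refl) (inj₂ refl) ow (m₁ , refl) _ (m₃ , refl) _ e₁ e₂ e₃ =
      even≢1 (m₁ + - m₃) (ℤP.*-cancelˡ-≡ (+ 4) _ (+ 1) (trans (l A m₁ m₃) (trans (cong₂ (λ u v → u + - v + - (+ 4 * m₃) + + 4 * m₁) e₁ e₃) (m m₁ m₃))))
      where
      l : ∀ A m₁ m₃ → + 4 * (+ 2 * (m₁ + - m₃)) ≡ A * + 1 + (+ 1 + + 4 * m₃) * - (+ 1) + - (A * + 1 + (+ 1 + + 4 * m₁) * - (+ 1)) + - (+ 4 * m₃) + + 4 * m₁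
      l = solve-∀
      m : ∀ m₁ m₃ → + 5 + (+ 1 + + 4 * m₃) + - (+ 1 + (+ 1 + + 4 * m₁)) + - (+ 4 * m₃) + + 4 * m₁ ≡ + 4 * + 1
      m = solve-∀
    D≡1-extra A .(-[1+ 0 ]) .(+ 1) w k₁ k₂ k₃ (inj₂ refl) (inj₁ refl) ow _ (m₂ , refl) _ _ e₁ e₂ e₃ =
      even≢odd (+ 1 + m₂ , ℤP.*-cancelˡ-≡ (+ 4) w _ (trans (l A w m₂ k₃) (trans (cong₂ (λ u v → u + v + + 1 + + 4 * m₂ + - k₃) e₁ e₂) (m m₂ k₃)))) ow
      where
      l : ∀ A w m₂ k₃ → + 4 * w ≡ A * - (+ 1) + k₃ * + 1 + (A * + 1 + + 4 * w + (+ 1 + + 4 * m₂) * - (+ 1)) + + 1 + + 4 * m₂ + - k₃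
      l = solve-∀
      m : ∀ m₂ k₃ → + 5 + k₃ + (+ 1 + (+ 1 + + 4 * m₂)) + + 1 + + 4 * m₂ + - k₃ ≡ + 4 * (+ 2 * (+ 1 + m₂))
      m = solve-∀

  -- A global sign makes D = 1, and each choice of (B, C) fails: (1, 1) gives A = 5 and A = 1; (-1,
  -- -1) gives k₃ = -3; (1, -1) gives k₁ - k₃ = 2, though both are 1 modulo 4; (-1, 1) gives 2w = 3
  -- + k₂, so w is even. The term 4w stands for a second summand with a √q-coordinate.
  extra-impossible : ∀ A B C D w k₁ k₂ k₃ → Unit B → Unit C → Unit D → Odd w → One₄ k₁ → One₄ k₂ → One₄ k₃ → k₃ ≢ - (+ 3) →
    A * B + k₃ * (C * D) ≡ + 5 + k₃ → A * C + + 4 * w + k₂ * (B * D) ≡ + 1 + k₂ → A * D + k₁ * (B * C) ≡ + 1 + k₁ → ⊥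
  extra-impossible A B C .(+ 1) w k₁ k₂ k₃ ub uc (inj₁ refl) ow h₁ h₂ h₃ k₃≢ e₁ e₂ e₃ = D≡1-extra A B C w k₁ k₂ k₃ ub uc ow h₁ h₂ h₃ k₃≢ e₁ e₂ e₃
  extra-impossible A B C .(-[1+ 0 ]) w k₁ k₂ k₃ ub uc (inj₂ refl) ow h₁ h₂ h₃ k₃≢ e₁ e₂ e₃ =
    D≡1-extra (- A) (- B) (- C) w k₁ k₂ k₃ (neg-unit ub) (neg-unit uc) ow h₁ h₂ h₃ k₃≢
      (trans (neg-* A B k₃ C (- (+ 1))) e₁) (trans (l A C w k₂ B) e₂) (trans (neg-* A (- (+ 1)) k₁ B C) e₃)
    where
    l : ∀ A C w k B → - A * - C + + 4 * w + k * (- B * + 1) ≡ A * C + + 4 * w + k * (B * - (+ 1))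
    l = solve-∀

  private
    D≡1-plain : ∀ A B C k₁ k₂ → Odd B → Unit C → One₄ k₁ → One₄ k₂ → k₁ ≢ k₂ →
      A * C + k₂ * (B * + 1) ≡ + 1 + k₂ → A * + 1 + k₁ * (B * C) ≡ + 1 + k₁ → A ≡ + 1 × B ≡ + 1 × C ≡ + 1
    D≡1-plain A B .(+ 1) k₁ k₂ oB (inj₁ refl) _ _ k₁≢k₂ e₂ e₃ = A≡1 , B≡1 , refl
      where
      l : ∀ A B k₁ k₂ → (k₂ + - k₁) * (B + - (+ 1)) ≡ A * + 1 + k₂ * (B * + 1) + - (A * + 1 + k₁ * (B * + 1)) + k₁ + - k₂
      l = solve-∀
      m : ∀ k₁ k₂ → + 1 + k₂ + - (+ 1 + k₁) + k₁ + - k₂ ≡ + 0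
      m = solve-∀
      n : ∀ B → B ≡ B + - (+ 1) + + 1
      n = solve-∀
      k≢ : k₂ + - k₁ ≢ + 0
      k≢ e = k₁≢k₂ (sym (ℤP.i-j≡0⇒i≡j k₂ k₁ e))
      B≡1 : B ≡ + 1
      B≡1 = trans (n B) (cong (λ t → t + + 1) (product-zero k≢ (trans (l A B k₁ k₂) (trans (cong₂ (λ u v → u + - v + k₁ + - k₂) e₂ e₃) (m k₁ k₂)))))
      A≡1 : A ≡ + 1
      A≡1 = trans (o A k₁) (trans (cong (λ t → t + - k₁) (trans (cong (λ B → A * + 1 + k₁ * (B * + 1)) (sym B≡1)) e₃)) (r k₁))
        where
        o : ∀ A k → A ≡ A * + 1 + k * (+ 1 * + 1) + - k
        o = solve-∀
        r : ∀ k → + 1 + k + - k ≡ + 1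
        r = solve-∀
    D≡1-plain A B .(-[1+ 0 ]) k₁ k₂ (t , refl) (inj₂ refl) (m₁ , refl) (m₂ , refl) _ e₂ e₃ =
      ⊥-elim (even≢1 (t * (m₂ + - m₁) + - m₁) (ℤP.*-cancelˡ-≡ (+ 4) _ (+ 1) (trans (l A t m₁ m₂) (trans (cong₂ (λ u v → u + v + + 2 + - (+ 4 * m₁) + - (+ 4 * m₂) + - (+ 2)) e₂ e₃) (m m₁ m₂)))))
      where
      l : ∀ A t m₁ m₂ → + 4 * (+ 2 * (t * (m₂ + - m₁) + - m₁)) ≡
        A * - (+ 1) + (+ 1 + + 4 * m₂) * ((+ 1 + + 2 * t) * + 1) + (A * + 1 + (+ 1 + + 4 * m₁) * ((+ 1 + + 2 * t) * - (+ 1))) + + 2 + - (+ 4 * m₁) + - (+ 4 * m₂) + - (+ 2)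
      l = solve-∀
      m : ∀ m₁ m₂ → + 1 + (+ 1 + + 4 * m₂) + (+ 1 + (+ 1 + + 4 * m₁)) + + 2 + - (+ 4 * m₁) + - (+ 4 * m₂) + - (+ 2) ≡ + 4 * + 1
      m = solve-∀

  -- Again D = 1 after a change of sign. For C = 1 the difference of the equations is (k₂ - k₁)(B -
  -- 1) = 0, so A = B = 1. For C = -1 their sum contradicts kᵢ ≡ 1 (mod 4) modulo 8. So the term is
  -- ±(1 + √p + √q + √r)/4.
  plain-solution : ∀ A B C D k₁ k₂ → Odd B → Unit C → Unit D → One₄ k₁ → One₄ k₂ → k₁ ≢ k₂ →
    A * C + k₂ * (B * D) ≡ + 1 + k₂ → A * D + k₁ * (B * C) ≡ + 1 + k₁ → A * B ≡ + 1 × C * D ≡ + 1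
  plain-solution A B C .(+ 1) k₁ k₂ oB uC (inj₁ refl) h₁ h₂ k₁≢k₂ e₂ e₃ =
    let (A≡ , B≡ , C≡) = D≡1-plain A B C k₁ k₂ oB uC h₁ h₂ k₁≢k₂ e₂ e₃ in cong₂ _*_ A≡ B≡ , cong (λ c → c * + 1) C≡
  plain-solution A B C .(-[1+ 0 ]) k₁ k₂ oB uC (inj₂ refl) h₁ h₂ k₁≢k₂ e₂ e₃ =
    let (A≡ , B≡ , C≡) = D≡1-plain (- A) (- B) (- C) k₁ k₂ (odd-neg oB) (neg-unit uC) h₁ h₂ k₁≢k₂
          (trans (neg-* A C k₂ B (- (+ 1))) e₂) (trans (neg-* A (- (+ 1)) k₁ B C) e₃)
    in trans (sym (two-neg A B)) (cong₂ _*_ A≡ B≡) , trans (one-neg C) C≡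
    where
    two-neg : ∀ A B → - A * - B ≡ A * B
    two-neg = solve-∀
    one-neg : ∀ C → C * - (+ 1) ≡ - C
    one-neg = solve-∀
    odd-neg : ∀ {z} → Odd z → Odd (- z)
    odd-neg {z} (a , refl) = - a + - (+ 1) , shift a
      where
      shift : ∀ a → - (+ 1 + + 2 * a) ≡ + 1 + + 2 * (- a + - (+ 1))
      shift = solve-∀

-- Denominator 4: the radicands are all 1 modulo 4.

module QuarterIntegralSystems where

  open CoordinateEquations using (∑; ∑²; sq; +sq; _⊠_)
  open Parity
  open SumsOfSquares
  open HalfIntegralSystems
  open UnitEquations
  open import Data.Integer using (_+_; _*_; -_)
  open ℤ-Solver using (solve-∀)

  -- The two kinds of integers (A + B√p + C√q + D√r)/4 when p, q, r ≡ 1 (mod 4).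
  EvenQuarter OddQuarter Quarter : (k A B C D : ℤ) → Set
  EvenQuarter k A B C D = Even A × Even B × Even C × Even D × Even (half A + half B + half C + half D)
  OddQuarter k A B C D = Odd A × Odd B × Odd C × Odd D × ∃ λ V → A * B ≡ k * (C * D) + + 4 * V
  Quarter k A B C D = EvenQuarter k A B C D ⊎ OddQuarter k A B C D

  private
    halve : ∀ {z t} → z ≡ + 2 * t → half z ≡ t
    halve {z} {t} e = ℤP.*-cancelˡ-≡ (+ 2) (half z) t (trans (sym (half-even (t , e))) e)

    evenQuarter-form : ∀ {k A B C D} → EvenQuarter k A B C D → Even (half (A * B + k * (C * D))) × A * B + k * (C * D) ≡ + 2 * half (A * B + k * (C * D))
    evenQuarter-form {k} {A} {B} {C} {D} ((a , refl) , (b , refl) , (c , refl) , (d , refl) , _) =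
      (_ , halve (lemma a b c d k)) , half-even (_ , lemma a b c d k)
      where
      lemma : ∀ a b c d k → + 2 * a * (+ 2 * b) + k * (+ 2 * c * (+ 2 * d)) ≡ + 2 * (+ 2 * (a * b + k * (c * d)))
      lemma = solve-∀

    oddQuarter-form : ∀ {k A B C D} → OddQuarter k A B C D → Odd (half (A * B + k * (C * D))) × A * B + k * (C * D) ≡ + 2 * half (A * B + k * (C * D))
    oddQuarter-form {k} {A} {B} {C} {D} (oA , oB , _ , _ , V , e) with odd-* oA oB
    ... | w , f = (w + - V , halve form) , half-even (_ , form)
      where
      l : ∀ s V → s ≡ (s + + 4 * V) + - (+ 4 * V)
      l = solve-∀
      m : ∀ w V → + 1 + + 2 * w + (+ 1 + + 2 * w + - (+ 4 * V)) ≡ + 2 * (+ 1 + + 2 * (w + - V))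
      m = solve-∀
      form : A * B + k * (C * D) ≡ + 2 * (+ 1 + + 2 * (w + - V))
      form = trans (cong₂ (λ s t → s + t) f (trans (l (k * (C * D)) V) (cong (λ t → t + - (+ 4 * V)) (trans (sym e) f)))) (m w V)

  module _ (p q r : ℕ) where
    -- The right-hand side is the rational coordinate of 16α for α = 7 + ((1 + √p)/2)² + ((1 + √p +
    -- √q + √r)/4)², namely 112 + 4(1 + p) + (1 + p + q + r).
    Total₁₆ : ℕ → ℕ → ℕ → ℕ → Set
    Total₁₆ A B C D = A ℕ.+ p ℕ.* B ℕ.+ q ℕ.* C ℕ.+ r ℕ.* D ≡ 117 ℕ.+ 5 ℕ.* p ℕ.+ q ℕ.+ r

  private
    -- The comparison is 2(q + r) > 117 + 2p, which is where 59 comes from.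
    three-odd : ∀ {p q r A B C D} → 59 ℕ.+ p ℕ.≤ q ℕ.+ r → 3 ℕ.≤ B → 3 ℕ.≤ C → 3 ℕ.≤ D → Total₁₆ p q r A B C D → ⊥
    three-odd {p} {q} {r} {A} h hB hC hD = from≥₃ (λ B C D → Total₁₆ p q r A B C D → ⊥) hB hC hD λ B C D e →
        excess _ e (trans (expand A p q r B C D) (trans (cong (λ t → 2 ℕ.* t ℕ.+ (3 ℕ.* p ℕ.+ q ℕ.+ r ℕ.+ (A ℕ.+ p ℕ.* B ℕ.+ q ℕ.* C ℕ.+ r ℕ.* D))) (sym f≡)) (assemble f p q r (A ℕ.+ p ℕ.* B ℕ.+ q ℕ.* C ℕ.+ r ℕ.* D))))
      where
      f = (q ℕ.+ r) ℕ.∸ (59 ℕ.+ p)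
      f≡ : 59 ℕ.+ p ℕ.+ f ≡ q ℕ.+ r
      f≡ = ℕP.m+[n∸m]≡n h
      expand : ∀ A p q r B C D → A ℕ.+ p ℕ.* (3 ℕ.+ B) ℕ.+ q ℕ.* (3 ℕ.+ C) ℕ.+ r ℕ.* (3 ℕ.+ D) ≡
        2 ℕ.* (q ℕ.+ r) ℕ.+ (3 ℕ.* p ℕ.+ q ℕ.+ r ℕ.+ (A ℕ.+ p ℕ.* B ℕ.+ q ℕ.* C ℕ.+ r ℕ.* D))
      expand = ℕ-Solver.solve-∀
      assemble : ∀ f p q r R → 2 ℕ.* (59 ℕ.+ p ℕ.+ f) ℕ.+ (3 ℕ.* p ℕ.+ q ℕ.+ r ℕ.+ R) ≡ 117 ℕ.+ 5 ℕ.* p ℕ.+ q ℕ.+ r ℕ.+ suc (2 ℕ.* f ℕ.+ R)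
      assemble = ℕ-Solver.solve-∀

    five-five-one : ∀ {p q r A B C D} → 33 ℕ.≤ q → 5 ℕ.≤ B → 5 ℕ.≤ C → 1 ℕ.≤ D → Total₁₆ p q r A B C D → ⊥
    five-five-one {p} {r = r} {A} hq hB hC hD = from≥₄ (λ q B C D → Total₁₆ p q r A B C D → ⊥) hq hB hC hD λ q B C D e → excess _ e (lemma A p q r B C D)
      where
      lemma : ∀ A p q r B C D → A ℕ.+ p ℕ.* (5 ℕ.+ B) ℕ.+ (33 ℕ.+ q) ℕ.* (5 ℕ.+ C) ℕ.+ r ℕ.* (1 ℕ.+ D) ≡
        117 ℕ.+ 5 ℕ.* p ℕ.+ (33 ℕ.+ q) ℕ.+ r ℕ.+ suc (14 ℕ.+ 4 ℕ.* q ℕ.+ A ℕ.+ p ℕ.* B ℕ.+ (33 ℕ.+ q) ℕ.* C ℕ.+ r ℕ.* D)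
      lemma = ℕ-Solver.solve-∀

    one-five-five : ∀ {p q r A B C D} → 33 ℕ.≤ q → p ℕ.≤ r → 1 ℕ.≤ B → 5 ℕ.≤ C → 5 ℕ.≤ D → Total₁₆ p q r A B C D → ⊥
    one-five-five {p} {q} {r} {A} hq hr hB hC hD = from≥₃ (λ B C D → Total₁₆ p q r A B C D → ⊥) hB hC hD λ B C D e →
        excess _ e (trans (expand A p q r B C D) (trans (cong₂ (λ s t → 4 ℕ.* s ℕ.+ 4 ℕ.* t ℕ.+ (p ℕ.+ q ℕ.+ r ℕ.+ (A ℕ.+ p ℕ.* B ℕ.+ q ℕ.* C ℕ.+ r ℕ.* D))) (sym q≡) (sym r≡)) (assemble (q ℕ.∸ 33) (r ℕ.∸ p) p q r (A ℕ.+ p ℕ.* B ℕ.+ q ℕ.* C ℕ.+ r ℕ.* D))))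
      where
      q≡ : 33 ℕ.+ (q ℕ.∸ 33) ≡ q
      q≡ = ℕP.m+[n∸m]≡n hq
      r≡ : p ℕ.+ (r ℕ.∸ p) ≡ r
      r≡ = ℕP.m+[n∸m]≡n hr
      expand : ∀ A p q r B C D → A ℕ.+ p ℕ.* (1 ℕ.+ B) ℕ.+ q ℕ.* (5 ℕ.+ C) ℕ.+ r ℕ.* (5 ℕ.+ D) ≡
        4 ℕ.* q ℕ.+ 4 ℕ.* r ℕ.+ (p ℕ.+ q ℕ.+ r ℕ.+ (A ℕ.+ p ℕ.* B ℕ.+ q ℕ.* C ℕ.+ r ℕ.* D))
      expand = ℕ-Solver.solve-∀
      assemble : ∀ f e p q r R → 4 ℕ.* (33 ℕ.+ f) ℕ.+ 4 ℕ.* (p ℕ.+ e) ℕ.+ (p ℕ.+ q ℕ.+ r ℕ.+ R) ≡ 117 ℕ.+ 5 ℕ.* p ℕ.+ q ℕ.+ r ℕ.+ suc (14 ℕ.+ 4 ℕ.* f ℕ.+ 4 ℕ.* e ℕ.+ R)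
      assemble = ℕ-Solver.solve-∀

    one-nine-one : ∀ {p q r A B C D} → 33 ℕ.≤ q → p ℕ.≤ q → 1 ℕ.≤ B → 9 ℕ.≤ C → 1 ℕ.≤ D → Total₁₆ p q r A B C D → ⊥
    one-nine-one {p} {q} {r} {A} hq hpq hB hC hD = from≥₃ (λ B C D → Total₁₆ p q r A B C D → ⊥) hB hC hD λ B C D e →
        excess _ e (trans (expand A p q r B C D) (trans (cong₂ (λ s t → 4 ℕ.* s ℕ.+ 4 ℕ.* t ℕ.+ (p ℕ.+ q ℕ.+ r ℕ.+ (A ℕ.+ p ℕ.* B ℕ.+ q ℕ.* C ℕ.+ r ℕ.* D))) (sym q≡) (sym q≡')) (assemble (q ℕ.∸ 33) (q ℕ.∸ p) p q r (A ℕ.+ p ℕ.* B ℕ.+ q ℕ.* C ℕ.+ r ℕ.* D))))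
      where
      q≡ : 33 ℕ.+ (q ℕ.∸ 33) ≡ q
      q≡ = ℕP.m+[n∸m]≡n hq
      q≡' : p ℕ.+ (q ℕ.∸ p) ≡ q
      q≡' = ℕP.m+[n∸m]≡n hpq
      expand : ∀ A p q r B C D → A ℕ.+ p ℕ.* (1 ℕ.+ B) ℕ.+ q ℕ.* (9 ℕ.+ C) ℕ.+ r ℕ.* (1 ℕ.+ D) ≡
        4 ℕ.* q ℕ.+ 4 ℕ.* q ℕ.+ (p ℕ.+ q ℕ.+ r ℕ.+ (A ℕ.+ p ℕ.* B ℕ.+ q ℕ.* C ℕ.+ r ℕ.* D))
      expand = ℕ-Solver.solve-∀
      assemble : ∀ f e p q r R → 4 ℕ.* (33 ℕ.+ f) ℕ.+ 4 ℕ.* (p ℕ.+ e) ℕ.+ (p ℕ.+ q ℕ.+ r ℕ.+ R) ≡ 117 ℕ.+ 5 ℕ.* p ℕ.+ q ℕ.+ r ℕ.+ suc (14 ℕ.+ 4 ℕ.* f ℕ.+ 4 ℕ.* e ℕ.+ R)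
      assemble = ℕ-Solver.solve-∀

    swap-total₁₆ : ∀ {p q r A B C D} → Total₁₆ p q r A B C D → Total₁₆ p r q A B D C
    swap-total₁₆ {p} {q} {r} {A} {B} {C} {D} e = trans (lhs (A ℕ.+ p ℕ.* B) (q ℕ.* C) (r ℕ.* D)) (trans e (lhs (117 ℕ.+ 5 ℕ.* p) r q))
      where
      lhs : ∀ a b c → a ℕ.+ c ℕ.+ b ≡ a ℕ.+ b ℕ.+ c
      lhs = ℕ-Solver.solve-∀

    quarter-rest : ∀ {p q r A B l m n o s t u v} → l ≡ 1 → m ≡ 1 → n ≡ 1 → o ≡ 1 → s ≡ 4 ℕ.* A → t ≡ 4 ℕ.* B → u ≡ 0 → v ≡ 0 →
      (l ℕ.+ s) ℕ.+ p ℕ.* (m ℕ.+ t) ℕ.+ q ℕ.* (n ℕ.+ u) ℕ.+ r ℕ.* (o ℕ.+ v) ≡ 117 ℕ.+ 5 ℕ.* p ℕ.+ q ℕ.+ r → A ℕ.+ p ℕ.* B ≡ 29 ℕ.+ p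
    quarter-rest {p} {q} {r} {A} {B} refl refl refl refl refl refl refl refl e =
      ℕP.*-cancelˡ-≡ _ _ 4 (ℕP.+-cancelʳ-≡ (1 ℕ.+ p ℕ.+ q ℕ.+ r) _ _ (trans (lhs A B p q r) (trans e (rhs p q r))))
      where
      lhs : ∀ A B p q r → 4 ℕ.* (A ℕ.+ p ℕ.* B) ℕ.+ (1 ℕ.+ p ℕ.+ q ℕ.+ r) ≡ (1 ℕ.+ 4 ℕ.* A) ℕ.+ p ℕ.* (1 ℕ.+ 4 ℕ.* B) ℕ.+ q ℕ.* 1 ℕ.+ r ℕ.* 1
      lhs = ℕ-Solver.solve-∀
      rhs : ∀ p q r → 117 ℕ.+ 5 ℕ.* p ℕ.+ q ℕ.+ r ≡ 4 ℕ.* (29 ℕ.+ p) ℕ.+ (1 ℕ.+ p ℕ.+ q ℕ.+ r)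
      rhs = ℕ-Solver.solve-∀

    one≤ : ∀ {X : Set} (f : X → ℤ) {x} ys → Odd (f x) → 1 ℕ.≤ ∑² f (x ∷ ys)
    one≤ f ys o = ℕP.≤-trans (sq-odd o) (ℕP.m≤m+n _ _)

    unit-head : ∀ {X : Set} (f : X → ℤ) {x} ys → Odd (f x) → ¬ (9 ℕ.≤ ∑² f (x ∷ ys)) → Unit (f x)
    unit-head f ys o few = odd⇒unit o (ℕP.≰⇒> λ le → few (ℕP.≤-trans le (ℕP.m≤m+n _ _)))

    tail-zero : ∀ {X : Set} (f : X → ℤ) {x} {ys} → Odd (f x) → All (λ y → Even (f y)) ys → ¬ (5 ℕ.≤ ∑² f (x ∷ ys)) → Zero f ys
    tail-zero f o es few = Sum.[ (λ z → z) , (λ le → ⊥-elim (few (ℕP.+-mono-≤ (sq-odd o) le))) ]′ (even-zero⊎≥4 f es)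

    not9 : ∀ {n} → ¬ (5 ℕ.≤ n) → ¬ (9 ℕ.≤ n)
    not9 h le = h (ℕP.≤-trans (ℕP.m≤m+n 5 4) le)

    half-zero : ∀ {z} → z ≡ + 0 → half z ≡ + 0
    half-zero refl = refl

  module _ {X : Set} (A B C D : X → ℤ) (p q r : ℕ) (k₁ k₂ k₃ : ℤ)
    (h₁ : One₄ k₁) (h₂ : One₄ k₂) (h₃ : One₄ k₃) (k₃≢-3 : k₃ ≢ - (+ 3))
    (hq : 33 ℕ.≤ q) (p≤q : p ℕ.≤ q) (p≤r : p ℕ.≤ r) (x : X) (ys : List X)
    (oB : Odd (B x)) (oC : Odd (C x)) (oD : Odd (D x))
    (evens : All (λ y → EvenQuarter k₃ (A y) (B y) (C y) (D y)) ys)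
    (sys : System A B C D p q r k₁ k₂ k₃ (117 ℕ.+ 5 ℕ.* p ℕ.+ q ℕ.+ r) (+ 5 + k₃) (+ 1 + k₂) (+ 1 + k₁) (x ∷ ys)) where
    open System sys

    -- A nonzero even C at y raises ΣC² to 5. The size then forces B, C, D to be ±1 at x, B and D to
    -- vanish elsewhere, and C to be ±2 at y and zero at the remaining terms. The parity of
    -- half-sums makes A/2 odd at y, so y adds 4w with w odd to a single equation, the situation of
    -- `extra-impossible`.
    extra-C-impossible : Pick (λ y → C y ≢ + 0) ys → ⊥
    extra-C-impossible found@(pick {y} {zs} h Cy≢0) = extra-impossible (A x) (B x) (C x) (D x) (half (A y) * c) k₁ k₂ k₃ uB uC uD (odd-* odd-a (unit-odd uc)) h₁ h₂ h₃ k₃≢-3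
        (trans (cong₂ (λ s t → s + k₃ * t) (sym (drop-zero (A x * B x) (∑-⊠-zeroʳ A B Bz))) (sym (drop-zero (C x * D x) (∑-⊠-zeroʳ C D Dz)))) e₁)
        (trans (cong₂ (λ s t → s + k₂ * t) (sym AC) (sym (drop-zero (B x * D x) (∑-⊠-zeroʳ B D Dz)))) e₂)
        (trans (cong₂ (λ s t → s + k₁ * t) (sym (drop-zero (A x * D x) (∑-⊠-zeroʳ A D Dz))) (sym (drop-zero (B x * C x) (∑-⊠-zeroˡ B C Bz)))) e₃)
      where
      c = half (C y)
      at-y : EvenQuarter k₃ (A y) (B y) (C y) (D y)
      at-y = All.head (All-resp-↭ h evens)
      evB : All (λ y → Even (B y)) ys
      evB = All.map (λ e → proj₁ (proj₂ e)) evens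
      evC : All (λ y → Even (C y)) ys
      evC = All.map (λ e → proj₁ (proj₂ (proj₂ e))) evens
      evD : All (λ y → Even (D y)) ys
      evD = All.map (λ e → proj₁ (proj₂ (proj₂ (proj₂ e)))) evens
      five-C : 5 ℕ.≤ ∑² C (x ∷ ys)
      five-C = ℕP.+-mono-≤ (sq-odd oC) (∑²-even-nonZero C evC found)
      few-B : ¬ (5 ℕ.≤ ∑² B (x ∷ ys))
      few-B le = five-five-one {p} {q} {r} {∑² A (x ∷ ys)} hq le five-C (one≤ D ys oD) e₀
      few-D : ¬ (5 ℕ.≤ ∑² D (x ∷ ys))
      few-D le = one-five-five {p} {q} {r} {∑² A (x ∷ ys)} hq p≤r (one≤ B ys oB) five-C le e₀
      few-C : ¬ (9 ℕ.≤ ∑² C (x ∷ ys))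
      few-C le = one-nine-one {p} {q} {r} {∑² A (x ∷ ys)} hq p≤q (one≤ B ys oB) le (one≤ D ys oD) e₀
      uB : Unit (B x)
      uB = unit-head B ys oB (not9 few-B)
      uC : Unit (C x)
      uC = unit-head C ys oC few-C
      uD : Unit (D x)
      uD = unit-head D ys oD (not9 few-D)
      Bz : Zero B ys
      Bz = tail-zero B oB evB few-B
      Dz : Zero D ys
      Dz = tail-zero D oD evD few-D
      Cy≡ : C y ≡ + 2 * c
      Cy≡ = half-even (All.head (All-resp-↭ h evC))
      at-least : ∀ {n} → n ℕ.≤ sq (C y) ℕ.+ ∑² C zs → suc n ℕ.≤ ∑² C (x ∷ ys)
      at-least {n} le = ℕP.+-mono-≤ (sq-odd oC) (subst (n ℕ.≤_) (sym (∑²-↭ C h)) le)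
      uc : Unit c
      uc = small⇒unit (λ e → Cy≢0 (trans Cy≡ (cong (λ t → + 2 * t) e)))
        (ℕP.≰⇒> λ le → few-C (ℕP.≤-trans (ℕP.m≤m+n 9 8) (at-least (ℕP.≤-trans (subst (16 ℕ.≤_) (sym (trans (cong sq Cy≡) (sq-2* c))) (ℕP.*-monoʳ-≤ 4 le)) (ℕP.m≤m+n _ _)))))
      Cz : Zero C zs
      Cz = Sum.[ (λ z → z) , (λ le → ⊥-elim (few-C (at-least (ℕP.+-mono-≤ (sq-even (All.head (All-resp-↭ h evC)) Cy≢0) le)))) ]′ (even-zero⊎≥4 C (All.tail (All-resp-↭ h evC)))
      unit-odd : ∀ {z} → Unit z → Odd z
      unit-odd (inj₁ refl) = odd-one
      unit-odd (inj₂ refl) = -[1+ 0 ] , refl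
      odd-a : Odd (half (A y))
      odd-a = ≡₂-odd {c} (subst Even (trans (cong₂ (λ s t → half (A y) + s + c + t) (half-zero (All.head (All-resp-↭ h Bz))) (half-zero (All.head (All-resp-↭ h Dz)))) (tidy (half (A y)) c))
          (proj₂ (proj₂ (proj₂ (proj₂ at-y))))) (unit-odd uc)
        where
        tidy : ∀ a c → a + + 0 + c + + 0 ≡ c + a
        tidy = solve-∀
      AC : A x * C x + ∑ (A ⊠ C) ys ≡ A x * C x + + 4 * (half (A y) * c)
      AC = cong (λ t → A x * C x + t) (trans (∑-↭ (A ⊠ C) h) (trans (drop-zero (A y * C y) (∑-⊠-zeroʳ A C Cz)) (trans (cong₂ _*_ (half-even (proj₁ at-y)) Cy≡) (tidy (half (A y)) c))))
        where
        tidy : ∀ a c → + 2 * a * (+ 2 * c) ≡ + 4 * (a * c)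
        tidy = solve-∀

  module _ {X : Set} (A B C D : X → ℤ) (p q r : ℕ) (k₁ k₂ k₃ : ℤ)
    (h₁ : One₄ k₁) (h₂ : One₄ k₂) (h₃ : One₄ k₃) (k₁≢k₂ : k₁ ≢ k₂) (k₃≢-3 : k₃ ≢ - (+ 3))
    (hp : 17 ℕ.≤ p) (hq : 33 ℕ.≤ q) (hr : 33 ℕ.≤ r) (p≤q : p ℕ.≤ q) (p≤r : p ℕ.≤ r) (hpqr : 59 ℕ.+ p ℕ.≤ q ℕ.+ r) where

    private
      Sys : List X → Set
      Sys = System A B C D p q r k₁ k₂ k₃ (117 ℕ.+ 5 ℕ.* p ℕ.+ q ℕ.+ r) (+ 5 + k₃) (+ 1 + k₂) (+ 1 + k₁)

      Quarter-at EvenQuarter-at OddQuarter-at : X → Set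
      Quarter-at x     = Quarter k₃ (A x) (B x) (C x) (D x)
      EvenQuarter-at x = EvenQuarter k₃ (A x) (B x) (C x) (D x)
      OddQuarter-at x  = OddQuarter k₃ (A x) (B x) (C x) (D x)

      -- AB + k₃CD is divisible by 4 on the even kind and is 2 modulo 4 on the odd kind, so the
      -- parity of its half tells the kinds apart. This form is the left side of an equation whose
      -- right side is 5 + k₃ ≡ 2 (mod 4): the number of terms of odd kind is odd.
      form h : X → ℤ
      form x = A x * B x + k₃ * (C x * D x)
      h x = half (form x)

      odd-h : ∀ {x} → Quarter-at x → Odd (h x) → OddQuarter-at x
      odd-h (inj₁ e) o = ⊥-elim (even≢odd (proj₁ (evenQuarter-form {k₃} e)) o)
      odd-h (inj₂ q) o = q

      even-h : ∀ {x} → Quarter-at x → Even (h x) → EvenQuarter-at x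
      even-h (inj₁ e) _ = e
      even-h (inj₂ q) e = ⊥-elim (even≢odd e (proj₁ (oddQuarter-form {k₃} q)))

      form≡2h : ∀ {x} → Quarter-at x → form x ≡ + 2 * h x
      form≡2h (inj₁ e) = proj₂ (evenQuarter-form {k₃} e)
      form≡2h (inj₂ q) = proj₂ (oddQuarter-form {k₃} q)

      ∑-form : ∀ xs → ∑ form xs ≡ ∑ (A ⊠ B) xs + k₃ * ∑ (C ⊠ D) xs
      ∑-form []       = base k₃
        where
        base : ∀ k → + 0 ≡ + 0 + k * + 0
        base = solve-∀
      ∑-form (x ∷ xs) = trans (cong (λ t → form x + t) (∑-form xs)) (step (A x * B x) (C x * D x) k₃ (∑ (A ⊠ B) xs) (∑ (C ⊠ D) xs))
        where
        step : ∀ u v k s t → u + k * v + (s + k * t) ≡ u + s + k * (v + t)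
        step = solve-∀

      odd-∑h : ∀ xs → All Quarter-at xs → Sys xs → Odd (∑ h xs)
      odd-∑h xs qs sys = odd-half h₃ (trans (sym (∑-scale (+ 2) form h (All.map form≡2h qs))) (trans (∑-form xs) (System.e₁ sys)))
        where
        odd-half : ∀ {k s} → One₄ k → + 2 * s ≡ + 5 + k → Odd s
        odd-half (m , refl) e = + 1 + m , ℤP.*-cancelˡ-≡ (+ 2) _ _ (trans e (tidy m))
          where
          tidy : ∀ m → + 5 + (+ 1 + + 4 * m) ≡ + 2 * (+ 1 + + 2 * (+ 1 + m))
          tidy = solve-∀

      -- That number being odd, a second term of odd kind implies a third, and three of them cost 3p
      -- + 3q + 3r.
      rest-even : ∀ x ys → All Quarter-at (x ∷ ys) → Sys (x ∷ ys) → Odd (h x) → All EvenQuarter-at ys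
      rest-even x ys qs@(qx ∷ qys) sys ohx = decide (pickOdd⊎even h ys)
        where
        open System sys
        even-ys : Even (∑ h ys)
        even-ys = odd-+⁻ʳ-even ohx (odd-∑h (x ∷ ys) qs sys)
        decide : Pick (λ y → Odd (h y)) ys ⊎ All (λ y → Even (h y)) ys → All EvenQuarter-at ys
        decide (inj₂ es) = All.zipWith (λ { (q , e) → even-h q e }) (qys , es)
        decide (inj₁ (pick {y} {zs} k oy)) = third (pickOdd h zs (odd-+⁻ʳ oy (subst Even (∑-↭ h k) even-ys)))
          where
          third : Pick (λ z → Odd (h z)) zs → All EvenQuarter-at ys
          third (pick {z} {ws} l oz) = ⊥-elim (three-odd {p} {q} {r} {∑² A (x ∷ ys)} hpqr
              (three B (proj₁ (proj₂ Qx)) (proj₁ (proj₂ Qy)) (proj₁ (proj₂ Qz)))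
              (three C (proj₁ (proj₂ (proj₂ Qx))) (proj₁ (proj₂ (proj₂ Qy))) (proj₁ (proj₂ (proj₂ Qz))))
              (three D (proj₁ (proj₂ (proj₂ (proj₂ Qx)))) (proj₁ (proj₂ (proj₂ (proj₂ Qy)))) (proj₁ (proj₂ (proj₂ (proj₂ Qz))))) e₀)
            where
            Qx : OddQuarter-at x
            Qx = odd-h qx ohx
            qzs : All Quarter-at (y ∷ zs)
            qzs = All-resp-↭ k qys
            Qy : OddQuarter-at y
            Qy = odd-h (All.head qzs) oy
            Qz : OddQuarter-at z
            Qz = odd-h (All.head (All-resp-↭ l (All.tail qzs))) oz
            three : ∀ (f : X → ℤ) → Odd (f x) → Odd (f y) → Odd (f z) → 3 ℕ.≤ ∑² f (x ∷ ys)
            three f o₁ o₂ o₃ = ℕP.+-mono-≤ (sq-odd o₁) (subst (2 ℕ.≤_) (sym (∑²-↭ f k)) (ℕP.+-mono-≤ (sq-odd o₂) (∑²-odd f (pick l o₃))))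

      -- By `plain-solution` x contributes exactly like (1 + √p + √q + √r)/4. The other terms,
      -- divided by 2, represent 7 + ((1 + √p)/2)² by four squares in ℚ(√p), against `peters`.
      plain-impossible : ∀ x ys → OddQuarter-at x → All EvenQuarter-at ys → length ys ℕ.≤ 4 → Sys (x ∷ ys) → Zero C ys → Zero D ys → ⊥
      plain-impossible x ys (oA , oB , oC , oD , _) evens len sys Cz Dz = peters a b p ys hp parities
          (quarter-rest {p} {q} {r} {∑² a ys} {∑² b ys} (proj₁ ones) (proj₂ ones) (unit-sq uC) (unit-sq uD) (∑²-4* A a (halves A evA)) (∑²-4* B b (halves B evB)) (∑²-zero C Cz) (∑²-zero D Dz) e₀)
          ∑ab len
        where
        open System sys
        a b : X → ℤ
        a y = half (A y)
        b y = half (B y)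
        evA : All (λ y → Even (A y)) ys
        evA = All.map proj₁ evens
        evB : All (λ y → Even (B y)) ys
        evB = All.map (λ e → proj₁ (proj₂ e)) evens
        uC : Unit (C x)
        uC = unit-head C ys oC (λ le → one-nine-one {p} {q} {r} {∑² A (x ∷ ys)} hq p≤q (one≤ B ys oB) le (one≤ D ys oD) e₀)
        uD : Unit (D x)
        uD = unit-head D ys oD (λ le → one-nine-one {p} {r} {q} {∑² A (x ∷ ys)} hr p≤r (one≤ B ys oB) le (one≤ C ys oC) (swap-total₁₆ {p} {q} {r} {∑² A (x ∷ ys)} {∑² B (x ∷ ys)} {∑² C (x ∷ ys)} {∑² D (x ∷ ys)} e₀))
        solution : A x * B x ≡ + 1 × C x * D x ≡ + 1
        solution = plain-solution (A x) (B x) (C x) (D x) k₁ k₂ oB uC uD h₁ h₂ k₁≢k₂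
          (trans (cong₂ (λ s t → s + k₂ * t) (sym (drop-zero (A x * C x) (∑-⊠-zeroʳ A C Cz))) (sym (drop-zero (B x * D x) (∑-⊠-zeroʳ B D Dz)))) e₂)
          (trans (cong₂ (λ s t → s + k₁ * t) (sym (drop-zero (A x * D x) (∑-⊠-zeroʳ A D Dz))) (sym (drop-zero (B x * C x) (∑-⊠-zeroʳ B C Cz)))) e₃)
        ones : sq (A x) ≡ 1 × sq (B x) ≡ 1
        ones = product-one (A x) (B x) (proj₁ solution)
        parities : All (λ y → a y ≡₂ b y) ys
        parities = All.zipWith (λ { {y} ((e , cz) , dz) → subst Even (trans (cong₂ (λ s t → a y + b y + s + t) (half-zero cz) (half-zero dz)) (tidy (a y + b y))) (proj₂ (proj₂ (proj₂ (proj₂ e)))) }) (All.zipWith (λ z → z) (evens , Cz) , Dz)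
          where
          tidy : ∀ s → s + + 0 + + 0 ≡ s
          tidy = solve-∀
        ∑ab : ∑ (a ⊠ b) ys ≡ + 1
        ∑ab = ℤP.*-cancelˡ-≡ (+ 4) _ (+ 1) (trans (sym four) (extract k₃ (proj₁ solution) (trans (drop-zero (C x * D x) (∑-⊠-zeroʳ C D Dz)) (proj₂ solution)) e₁))
          where
          four : ∑ (A ⊠ B) ys ≡ + 4 * ∑ (a ⊠ b) ys
          four = ∑-scale (+ 4) (A ⊠ B) (a ⊠ b) (All.zipWith (λ { {y} (eA , eB) → trans (cong₂ _*_ (half-even eA) (half-even eB)) (tidy (a y) (b y)) }) (evA , evB))
            where
            tidy : ∀ a b → + 2 * a * (+ 2 * b) ≡ + 4 * (a * b)
            tidy = solve-∀
          extract : ∀ k {u s v} → u ≡ + 1 → v ≡ + 1 → u + s + k * v ≡ + 5 + k → s ≡ + 4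
          extract k {s = s} refl refl e = +ℤ-cancelˡ (+ 1 + k) (trans (l k s) (trans e (m k)))
            where
            l : ∀ k s → + 1 + k + s ≡ + 1 + s + k * + 1
            l = solve-∀
            m : ∀ k → + 5 + k ≡ + 1 + k + + 4
            m = solve-∀

    noFiveSquares-III : ∀ xs → All Quarter-at xs → length xs ℕ.≤ 5 → Sys xs → ⊥
    noFiveSquares-III xs qs₀ len sys₀ = main (pickOdd h xs (odd-∑h xs qs₀ sys₀))
      where
      main : Pick (λ x → Odd (h x)) xs → ⊥
      main (pick {x} {ys} perm ohx) = finish (pickNonZero⊎zero C ys) (pickNonZero⊎zero D ys)
        where
        sys : Sys (x ∷ ys)
        sys = system-↭ perm sys₀
        open System sys
        qs : All Quarter-at (x ∷ ys)
        qs = All-resp-↭ perm qs₀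
        Q : OddQuarter-at x
        Q = odd-h (All.head qs) ohx
        evens : All EvenQuarter-at ys
        evens = rest-even x ys qs sys ohx
        oB = proj₁ (proj₂ Q)
        oC = proj₁ (proj₂ (proj₂ Q))
        oD = proj₁ (proj₂ (proj₂ (proj₂ Q)))
        swapped : All (λ y → EvenQuarter k₃ (A y) (B y) (D y) (C y)) ys
        swapped = All.map (λ { {y} (a , b , c , d , e) → a , b , d , c , subst Even (tidy (half (A y) + half (B y)) (half (C y)) (half (D y))) e }) evens
          where
          tidy : ∀ s c d → s + c + d ≡ s + d + c
          tidy = solve-∀
        finish : Pick (λ y → C y ≢ + 0) ys ⊎ Zero C ys → Pick (λ y → D y ≢ + 0) ys ⊎ Zero D ys → ⊥
        finish (inj₁ nz) _ = extra-C-impossible A B C D p q r k₁ k₂ k₃ h₁ h₂ h₃ k₃≢-3 hq p≤q p≤r x ys oB oC oD evens sys nz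
        -- Exchanging √q and √r exchanges k₁ with k₂ and the last two equations with each other.
        finish (inj₂ _) (inj₁ nz) = extra-C-impossible A B D C p r q k₂ k₁ k₃ h₂ h₁ h₃ k₃≢-3 hr p≤r p≤q x ys oB oD oC swapped
          (system (swap-total₁₆ {p} {q} {r} {∑² A (x ∷ ys)} {∑² B (x ∷ ys)} {∑² C (x ∷ ys)} {∑² D (x ∷ ys)} e₀)
                  (trans (cong (λ t → ∑ (A ⊠ B) (x ∷ ys) + k₃ * t) (∑-⊠-comm D C (x ∷ ys))) e₁) e₃ e₂) nz
        finish (inj₂ Cz) (inj₂ Dz) = plain-impossible x ys Q evens (tail-length perm len) sys Cz Dz

-- Parities of integral coordinates for the residue types.

module Congruences where

  open Quadruples using (Quad; quad; c₀; c₁; c₂; c₃)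
  open IntegralCoordinates using (IntegralCoords)
  open Parity
  open SumsOfSquares using (even≢1)
  open UnitEquations using (One₄)
  open QuarterIntegralSystems using (Quarter)
  open import Data.Integer using (_+_; _*_; -_)
  open ℤ-Solver using (solve-∀)

  Three₄ TwiceOdd : ℤ → Set
  Three₄ k   = ∃ λ m → k ≡ + 3 + + 4 * m
  TwiceOdd k = ∃ λ m → Odd m × k ≡ + 2 * m

  one₄⇒odd : ∀ {k} → One₄ k → Odd k
  one₄⇒odd (m , refl) = + 2 * m , l m
    where
    l : ∀ m → + 1 + + 4 * m ≡ + 1 + + 2 * (+ 2 * m)
    l = solve-∀

  three₄⇒odd : ∀ {k} → Three₄ k → Odd k
  three₄⇒odd (m , refl) = + 1 + + 2 * m , l m
    where
    l : ∀ m → + 3 + + 4 * m ≡ + 1 + + 2 * (+ 1 + + 2 * m)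
    l = solve-∀

  private
    even-4* : ∀ n → Even (+ 4 * n)
    even-4* n = even-*ˡ n (+ 2 , refl)

    odd-square : ∀ {x} → Odd x → ∃ λ t → x * x ≡ + 1 + + 4 * t
    odd-square (a , refl) = a + a * a , l a
      where
      l : ∀ a → (+ 1 + + 2 * a) * (+ 1 + + 2 * a) ≡ + 1 + + 4 * (a + a * a)
      l = solve-∀

    square-odd : ∀ x → Odd (x * x) → Odd x
    square-odd x o = proj₁ (odd-*⁻ x x o)

    square-even : ∀ x → Even (x * x) → Even x
    square-even x e = Sum.[ (λ h → h) , (λ o → ⊥-elim (even≢odd e (odd-* o o))) ]′ (parity x)

    odd-factor-even : ∀ {k x} → Odd k → Even (k * x) → Even x
    odd-factor-even {k} {x} o e = Sum.[ (λ h → h) , (λ o' → ⊥-elim (even≢odd e (odd-* o o'))) ]′ (parity x)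

  even-from-odd-multiple : ∀ {k x y n} → Odd k → x * x ≡ k * (y * y) + + 4 * n → Even x → Even y
  even-from-odd-multiple {k} {x} {y} {n} ok e ex = square-even y (odd-factor-even ok (even-+⁻ʳ (even-4* n) (subst Even (trans e (ℤP.+-comm (k * (y * y)) (+ 4 * n))) (even-*ˡ x ex))))

  odd-from-odd-multiple : ∀ {k x y n} → Odd k → x * x ≡ k * (y * y) + + 4 * n → Odd x → Odd y
  odd-from-odd-multiple {k} {x} {y} {n} ok e ox = square-odd y (proj₂ (odd-*⁻ k (y * y) (odd-summand (subst Odd e (odd-* ox ox)))))
    where
    odd-summand : Odd (k * (y * y) + + 4 * n) → Odd (k * (y * y))
    odd-summand o = Sum.[ (λ h → ⊥-elim (even≢odd (even-+ h (even-4* n)) o)) , (λ h → h) ]′ (parity (k * (y * y)))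

  -- Odd squares are 1 modulo 4, so odd x and y would give 1 ≡ 3 (mod 4).
  three-even : ∀ {k x y n} → Three₄ k → x * x ≡ k * (y * y) + + 4 * n → Even x × Even y
  three-even {k} {x} {y} {n} hk@(m , k≡) e = decide (parity x)
    where
    decide : Even x ⊎ Odd x → Even x × Even y
    decide (inj₁ ex) = ex , even-from-odd-multiple {k} {x} {y} {n} (three₄⇒odd hk) e ex
    decide (inj₂ ox) = ⊥-elim (clash (odd-square ox) (odd-square (odd-from-odd-multiple {k} {x} {y} {n} (three₄⇒odd hk) e ox)))
      where
      l : ∀ s t m n → + 2 * (+ 2 * (s + - (+ 3 * t) + - m + - (+ 4 * (m * t)) + - n)) ≡ + 1 + + 4 * s + - (+ 1) + - (+ 4 * (+ 3 * t + m + + 4 * (m * t) + n))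
      l = solve-∀
      r : ∀ s t m n → (+ 3 + + 4 * m) * (+ 1 + + 4 * t) + + 4 * n + - (+ 1) + - (+ 4 * (+ 3 * t + m + + 4 * (m * t) + n)) ≡ + 2 * + 1
      r = solve-∀
      clash : (∃ λ t → x * x ≡ + 1 + + 4 * t) → (∃ λ t → y * y ≡ + 1 + + 4 * t) → ⊥
      clash (s , f) (t , g) = even≢1 (s + - (+ 3 * t) + - m + - (+ 4 * (m * t)) + - n)
        (ℤP.*-cancelˡ-≡ (+ 2) _ (+ 1) (trans (l s t m n) (trans (cong (λ z → z + - (+ 1) + - (+ 4 * (+ 3 * t + m + + 4 * (m * t) + n))) (trans (sym f) (trans e (cong₂ (λ k z → k * z + + 4 * n) k≡ g)))) (r s t m n))))

  two-even : ∀ {k x y n} → TwiceOdd k → x * x ≡ k * (y * y) + + 4 * n → Even x × Even y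
  two-even {k} {x} {y} {n} (m , om , refl) e = ex , ey
    where
    ex : Even x
    ex = square-even x (subst Even (sym e) (even-+ {+ 2 * m * (y * y)} (even-*ˡ (y * y) (m , refl)) (even-4* n)))
    ey : Even y
    ey = square-even y (odd-factor-even om (even-+⁻ʳ {+ 2 * n} (n , refl) (a * a * + 1 , ℤP.*-cancelˡ-≡ (+ 2) _ _ (trans (l m (y * y) n) (trans (sym e) (trans (cong₂ _*_ (proj₂ ex) (proj₂ ex)) (r a)))))))
      where
      a = proj₁ ex
      l : ∀ m s n → + 2 * (+ 2 * n + m * s) ≡ + 2 * m * s + + 4 * n
      l = solve-∀
      r : ∀ a → + 2 * a * (+ 2 * a) ≡ + 2 * (+ 2 * (a * a * + 1))
      r = solve-∀

  -- The coordinates of an integer (a + b√p + c√q + d√r)/2.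
  record Halves (k₁ k₂ k₃ a b c d : ℤ) : Set where
    field
      U V n  : ℤ
      norm-U  : a * a + (k₁ * k₂) * (b * b) ≡ (k₁ * k₃) * (c * c) + (k₂ * k₃) * (d * d) + + 2 * U
      norm-V  : a * b ≡ k₃ * (c * d) + V
      norm-UV : U * U ≡ (k₁ * k₂) * (V * V) + + 4 * n

  toHalves : ∀ {k₁ k₂ k₃ X} → IntegralCoords k₁ k₂ k₃ X → Even (c₀ X) → Even (c₁ X) → Even (c₂ X) → Even (c₃ X) →
    Halves k₁ k₂ k₃ (half (c₀ X)) (half (c₁ X)) (half (c₂ X)) (half (c₃ X))
  toHalves {k₁} {k₂} {k₃} {quad A B C D} coords eA eB eC eD = record
    { U = U ; V = V ; n = n
    ; norm-U = ℤP.*-cancelˡ-≡ (+ 4) _ _ (trans (l a b (k₁ * k₂)) (trans (sym (cong₂ (λ s t → s + (k₁ * k₂) * t) (cong₂ _*_ A≡ A≡) (cong₂ _*_ B≡ B≡)))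
        (trans norm-U (trans (cong₂ (λ s t → (k₁ * k₃) * s + (k₂ * k₃) * t + + 8 * U) (cong₂ _*_ C≡ C≡) (cong₂ _*_ D≡ D≡)) (m c d (k₁ * k₃) (k₂ * k₃) U)))))
    ; norm-V = ℤP.*-cancelˡ-≡ (+ 4) _ _ (trans (o a b) (trans (sym (cong₂ _*_ A≡ B≡)) (trans norm-V (trans (cong (λ s → k₃ * s + + 4 * V) (cong₂ _*_ C≡ D≡)) (w k₃ c d V)))))
    ; norm-UV = norm-UV }
    where
    open IntegralCoords coords
    a = half A
    b = half B
    c = half C
    d = half D
    A≡ = half-even eA
    B≡ = half-even eB
    C≡ = half-even eC
    D≡ = half-even eD
    l : ∀ a b k → + 4 * (a * a + k * (b * b)) ≡ + 2 * a * (+ 2 * a) + k * (+ 2 * b * (+ 2 * b))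
    l = solve-∀
    m : ∀ c d k l U → k * (+ 2 * c * (+ 2 * c)) + l * (+ 2 * d * (+ 2 * d)) + + 8 * U ≡ + 4 * (k * (c * c) + l * (d * d) + + 2 * U)
    m = solve-∀
    o : ∀ a b → + 4 * (a * b) ≡ + 2 * a * (+ 2 * b)
    o = solve-∀
    w : ∀ k c d V → k * (+ 2 * c * (+ 2 * d)) + + 4 * V ≡ + 4 * (k * (c * d) + V)
    w = solve-∀

  private
    V-even : ∀ {k₁ k₂ k₃ a b c d} (H : Halves k₁ k₂ k₃ a b c d) → Even (Halves.V H) → Odd k₃ → a * b ≡₂ c * d
    V-even {k₃ = k₃} {a} {b} {c} {d} H eV ok = decide (parity (c * d))
      where
      open Halves H
      decide : Even (c * d) ⊎ Odd (c * d) → a * b ≡₂ c * d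
      decide (inj₁ e) = even-+ {a * b} (subst Even (sym norm-V) (even-+ (even-*ʳ k₃ e) eV)) e
      decide (inj₂ o) = odd-+ {a * b} (subst Odd (sym norm-V) (odd-+-even (odd-* ok o) eV)) o

    even-difference : ∀ {x y z} → Even x → Even y → x + z ≡ y → Even z
    even-difference ex ey refl = even-+⁻ʳ ex ey

    square≡₂ : ∀ x → x * x ≡₂ x
    square≡₂ x = Sum.[ (λ e → even-+ (even-*ˡ x e) e) , (λ o → odd-+ (odd-* o o) o) ]′ (parity x)

    ≡₂-trans : ∀ {x y z} → x ≡₂ y → y ≡₂ z → x ≡₂ z
    ≡₂-trans {x} {y} {z} e f = Sum.[ (λ ey → even-+ (≡₂-even {y} (≡₂-sym {x} e) ey) (≡₂-even f ey)) , (λ oy → odd-+ (≡₂-odd {y} (≡₂-sym {x} e) oy) (≡₂-odd f oy)) ]′ (parity y)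

    odd-times : ∀ {k} x → Odd k → k * x ≡₂ x
    odd-times {k} x o = Sum.[ (λ e → even-+ (even-*ʳ k e) e) , (λ o' → odd-+ (odd-* o o') o') ]′ (parity x)

  private
    square-shift : ∀ {a d} → a ≡₂ d → ∃ λ s → a * a ≡ d * d + + 4 * s
    square-shift {a} {d} (t , e) = t * t + - (t * d) , trans (cong₂ _*_ a≡ a≡) (l t d)
      where
      a≡ : a ≡ + 2 * t + - d
      a≡ = trans (m a d) (cong (λ z → z + - d) e)
        where
        m : ∀ a d → a ≡ a + d + - d
        m = solve-∀
      l : ∀ t d → (+ 2 * t + - d) * (+ 2 * t + - d) ≡ d * d + + 4 * (t * t + - (t * d))
      l = solve-∀

    equal⇒≡₂ : ∀ x y u v → x + + 2 * u ≡ y + + 2 * v → x ≡₂ y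
    equal⇒≡₂ x y u v e = y + v + - u , trans (l x y u) (trans (cong (λ z → z + - (+ 2 * u) + y) e) (m y u v))
      where
      l : ∀ x y u → x + y ≡ x + + 2 * u + - (+ 2 * u) + y
      l = solve-∀
      m : ∀ y u v → y + + 2 * v + - (+ 2 * u) + y ≡ + 2 * (y + v + - u)
      m = solve-∀

    odd-square≡₂ : ∀ {k} x → Odd k → k * (x * x) ≡₂ x
    odd-square≡₂ {k} x o = ≡₂-trans {k * (x * x)} {x * x} {x} (odd-times (x * x) o) (square≡₂ x)

    head≡₂ : ∀ {a b c d p' q' r u} → Odd r → a * a + + 2 * p' * (b * b) ≡ + 2 * q' * (c * c) + r * (d * d) + + 4 * u → a ≡₂ d
    head≡₂ {a} {b} {c} {d} {p'} {q'} {r} {u} or e =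
      ≡₂-trans {a} {a * a} {d} (≡₂-sym {a * a} (square≡₂ a)) (≡₂-trans {a * a} {r * (d * d)} {d}
        (equal⇒≡₂ (a * a) (r * (d * d)) (p' * (b * b)) (q' * (c * c) + + 2 * u) (trans (l (a * a) p' (b * b)) (trans e (m q' (c * c) (r * (d * d)) u)))) (odd-square≡₂ d or))
      where
      l : ∀ a p b → a + + 2 * (p * b) ≡ a + + 2 * p * b
      l = solve-∀
      m : ∀ q c d u → + 2 * q * c + d + + 4 * u ≡ d + + 2 * (q * c + + 2 * u)
      m = solve-∀

    -- Modulo 2 the equation gives a ≡ d, hence a² ≡ rd² (mod 4). What remains modulo 4 is 2p'b² ≡
    -- 2q'c².
    two-one : ∀ {a b c d p' q' r u} → Odd p' → Odd q' → One₄ r → a * a + + 2 * p' * (b * b) ≡ + 2 * q' * (c * c) + r * (d * d) + + 4 * u → a ≡₂ d × b ≡₂ c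
    two-one {a} {b} {c} {d} {p'} {q'} {r} {u} op oq or@(j , r≡) e = a≡₂d ,
        ≡₂-trans {b} {p' * (b * b)} {c} (≡₂-sym {p' * (b * b)} (odd-square≡₂ b op)) (≡₂-trans {p' * (b * b)} {q' * (c * c)} {c}
          (equal⇒≡₂ (p' * (b * b)) (q' * (c * c)) s (j * (d * d) + u) (ℤP.*-cancelˡ-≡ (+ 2) _ _ (trans (l (d * d) s p' (b * b)) (trans (cong (λ z → z + - (d * d)) (trans (cong (λ z → z + + 2 * p' * (b * b)) (sym s≡)) (trans e (cong (λ r → + 2 * q' * (c * c) + r * (d * d) + + 4 * u) r≡)))) (m q' (c * c) j (d * d) u)))))
          (odd-square≡₂ c oq))
      where
      a≡₂d : a ≡₂ d
      a≡₂d = head≡₂ {a} {b} {c} {d} {p'} {q'} {r} {u} (one₄⇒odd or) e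
      s = proj₁ (square-shift {a} {d} a≡₂d)
      s≡ = proj₂ (square-shift {a} {d} a≡₂d)
      l : ∀ d s p b → + 2 * (p * b + + 2 * s) ≡ d + + 4 * s + + 2 * p * b + - d
      l = solve-∀
      m : ∀ q c j d u → + 2 * q * c + (+ 1 + + 4 * j) * d + + 4 * u + - d ≡ + 2 * (q * c + + 2 * (j * d + u))
      m = solve-∀

    -- Again a ≡ d, but now a² - rd² ≡ 2d² (mod 4) and therefore b ≡ c + d. For odd d the congruence
    -- ab ≡ cd would say b ≡ c, so d is even.
    two-three : ∀ {a b c d p' q' r u} → Odd p' → Odd q' → Three₄ r → a * a + + 2 * p' * (b * b) ≡ + 2 * q' * (c * c) + r * (d * d) + + 4 * u →
      a * b ≡₂ c * d → Even a × Even d × b ≡₂ c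
    two-three {a} {b} {c} {d} {p'} {q'} {r} {u} op oq or@(j , r≡) e ab≡₂cd = decide (parity d)
      where
      a≡₂d : a ≡₂ d
      a≡₂d = head≡₂ {a} {b} {c} {d} {p'} {q'} {r} {u} (three₄⇒odd or) e
      s = proj₁ (square-shift {a} {d} a≡₂d)
      s≡ = proj₂ (square-shift {a} {d} a≡₂d)
      l : ∀ d s p b → + 2 * (p * b + + 2 * s) ≡ d + + 4 * s + + 2 * p * b + - d
      l = solve-∀
      m : ∀ q c j d u → + 2 * q * c + (+ 3 + + 4 * j) * d + + 4 * u + - d ≡ + 2 * (q * c + d + + 2 * (j * d + u))
      m = solve-∀
      b≡₂c+d² : b ≡₂ q' * (c * c) + d * d
      b≡₂c+d² = ≡₂-trans {b} {p' * (b * b)} {q' * (c * c) + d * d} (≡₂-sym {p' * (b * b)} (odd-square≡₂ b op))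
        (equal⇒≡₂ (p' * (b * b)) (q' * (c * c) + d * d) s (j * (d * d) + u) (ℤP.*-cancelˡ-≡ (+ 2) _ _ (trans (l (d * d) s p' (b * b)) (trans (cong (λ z → z + - (d * d)) (trans (cong (λ z → z + + 2 * p' * (b * b)) (sym s≡)) (trans e (cong (λ r → + 2 * q' * (c * c) + r * (d * d) + + 4 * u) r≡)))) (m q' (c * c) j (d * d) u)))))
      decide : Even d ⊎ Odd d → Even a × Even d × b ≡₂ c
      decide (inj₁ ed) = ≡₂-even {d} (≡₂-sym {a} a≡₂d) ed , ed ,
        ≡₂-trans {b} {q' * (c * c) + d * d} {c} b≡₂c+d² (≡₂-trans {q' * (c * c) + d * d} {q' * (c * c)} {c} (subst Even (n (q' * (c * c)) (d * d)) (even-+ (q' * (c * c) , refl) (even-*ˡ d ed))) (odd-square≡₂ c oq))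
        where
        n : ∀ x y → + 2 * x + y ≡ x + y + x
        n = solve-∀
      decide (inj₂ od) = ⊥-elim (even≢odd b≡₂c+d² (subst Odd (n b (q' * (c * c)) (d * d)) (odd-+-even (odd-* od od)
          (≡₂-trans {b} {c} {q' * (c * c)} b≡₂c (≡₂-sym {q' * (c * c)} (odd-square≡₂ c oq))))))
        where
        oa : Odd a
        oa = ≡₂-odd {d} (≡₂-sym {a} a≡₂d) od
        b≡₂c : b ≡₂ c
        b≡₂c = ≡₂-trans {b} {a * b} {c} (≡₂-sym {a * b} (odd-times b oa)) (≡₂-trans {a * b} {c * d} {c} ab≡₂cd (subst (λ z → z ≡₂ c) (ℤP.*-comm d c) (odd-times c od)))
        n : ∀ b x y → y + (b + x) ≡ b + (x + y)
        n = solve-∀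

    -- Modulo 2 the sum a + b + c + d is even, so b ≡ c is equivalent to a ≡ d. If b and c differ in
    -- parity, ab ≡ cd determines all four parities, and the equation becomes 3 ≡ 1 or 1 ≡ 3 modulo
    -- 4.
    three-three : ∀ {a b c d p q r u} → Three₄ p → Three₄ q → One₄ r → a * a + p * (b * b) ≡ q * (c * c) + r * (d * d) + + 4 * u →
      a * b ≡₂ c * d → a ≡₂ d × b ≡₂ c
    three-three {a} {b} {c} {d} {p} {q} {r} {u} hp@(i , p≡) hq@(l , q≡) hr@(j , r≡) e ab≡₂cd = decide (parity b) (parity c)
      where
      E : a * a + (+ 3 + + 4 * i) * (b * b) ≡ (+ 3 + + 4 * l) * (c * c) + (+ 1 + + 4 * j) * (d * d) + + 4 * u
      E = trans (cong (λ p → a * a + p * (b * b)) (sym p≡)) (trans e (cong₂ (λ q r → q * (c * c) + r * (d * d) + + 4 * u) q≡ r≡))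
      sum-even : Even (a * a + p * (b * b) + (q * (c * c) + r * (d * d)))
      sum-even = equal⇒≡₂ (a * a + p * (b * b)) (q * (c * c) + r * (d * d)) (+ 0) (+ 2 * u) (trans (ℤP.+-identityʳ _) (trans e (cong (λ z → q * (c * c) + r * (d * d) + z) (n u))))
        where
        n : ∀ u → + 4 * u ≡ + 2 * (+ 2 * u)
        n = solve-∀
      four : Even (a + b + c + d)
      -- Each term is congruent to its variable modulo 2; the last even number, -2 times the four
      -- terms, cancels their double occurrence.
      four = subst Even (n a b c d (a * a) (p * (b * b)) (q * (c * c)) (r * (d * d)))
        (even-+ sum-even (even-+ (square≡₂ a) (even-+ (odd-square≡₂ b (three₄⇒odd hp)) (even-+ (odd-square≡₂ c (three₄⇒odd hq)) (even-+ (odd-square≡₂ d (one₄⇒odd hr)) (- (a * a) + - (p * (b * b)) + - (q * (c * c)) + - (r * (d * d)) , refl))))))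
        where
        n : ∀ a b c d x y z w → x + y + (z + w) + (x + a + (y + b + (z + c + (w + d + + 2 * (- x + - y + - z + - w))))) ≡ a + b + c + d
        n = solve-∀
      even-sq : ∀ {x} → Even x → ∃ λ t → x * x ≡ + 4 * t
      even-sq (t , refl) = t * t , n t
        where
        n : ∀ t → + 2 * t * (+ 2 * t) ≡ + 4 * (t * t)
        n = solve-∀
      clash₁ : (∃ λ t → a * a ≡ + 4 * t) → (∃ λ t → b * b ≡ + 1 + + 4 * t) → (∃ λ t → c * c ≡ + 4 * t) → (∃ λ t → d * d ≡ + 1 + + 4 * t) → ⊥
      clash₁ (α , f) (β , g) (γ , h) (δ , k) = even≢1 _ (ℤP.*-cancelˡ-≡ (+ 2) _ (+ 1) (trans (L α β γ δ i l j u)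
        (trans (cong (λ z → - z + + 3 + + 4 * rest) (trans (sym (cong₂ (λ x y → x + (+ 3 + + 4 * i) * y) f g)) (trans E (cong₂ (λ x y → (+ 3 + + 4 * l) * x + (+ 1 + + 4 * j) * y + + 4 * u) h k)))) (R γ δ l j u))))
        where
        rest = (+ 3 + + 4 * l) * γ + δ + j + + 4 * (j * δ) + u
        L : ∀ α β γ δ i l j u → + 2 * (+ 2 * (- α + - (+ 3 * β) + - i + - (+ 4 * (i * β)) + ((+ 3 + + 4 * l) * γ + δ + j + + 4 * (j * δ) + u))) ≡
          - (+ 4 * α + (+ 3 + + 4 * i) * (+ 1 + + 4 * β)) + + 3 + + 4 * ((+ 3 + + 4 * l) * γ + δ + j + + 4 * (j * δ) + u)
        L = solve-∀
        R : ∀ γ δ l j u → - ((+ 3 + + 4 * l) * (+ 4 * γ) + (+ 1 + + 4 * j) * (+ 1 + + 4 * δ) + + 4 * u) + + 3 + + 4 * ((+ 3 + + 4 * l) * γ + δ + j + + 4 * (j * δ) + u) ≡ + 2 * + 1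
        R = solve-∀
      clash₂ : (∃ λ t → a * a ≡ + 1 + + 4 * t) → (∃ λ t → b * b ≡ + 4 * t) → (∃ λ t → c * c ≡ + 1 + + 4 * t) → (∃ λ t → d * d ≡ + 4 * t) → ⊥
      clash₂ (α , f) (β , g) (γ , h) (δ , k) = even≢1 _ (ℤP.*-cancelˡ-≡ (+ 2) _ (+ 1) (trans (L α β γ δ i l j u)
        (trans (cong (λ z → z + - (+ 1) + - (+ 4 * rest)) (trans (sym (cong₂ (λ x y → x + (+ 3 + + 4 * i) * y) f g)) (trans E (cong₂ (λ x y → (+ 3 + + 4 * l) * x + (+ 1 + + 4 * j) * y + + 4 * u) h k)))) (R γ δ l j u))))
        where
        rest = + 3 * γ + l + + 4 * (l * γ) + (+ 1 + + 4 * j) * δ + u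
        L : ∀ α β γ δ i l j u → + 2 * (+ 2 * (α + (+ 3 + + 4 * i) * β + - (+ 3 * γ + l + + 4 * (l * γ) + (+ 1 + + 4 * j) * δ + u))) ≡
          + 1 + + 4 * α + (+ 3 + + 4 * i) * (+ 4 * β) + - (+ 1) + - (+ 4 * (+ 3 * γ + l + + 4 * (l * γ) + (+ 1 + + 4 * j) * δ + u))
        L = solve-∀
        R : ∀ γ δ l j u → (+ 3 + + 4 * l) * (+ 1 + + 4 * γ) + (+ 1 + + 4 * j) * (+ 4 * δ) + + 4 * u + - (+ 1) + - (+ 4 * (+ 3 * γ + l + + 4 * (l * γ) + (+ 1 + + 4 * j) * δ + u)) ≡ + 2 * + 1
        R = solve-∀
      from-bc : b ≡₂ c → a ≡₂ d × b ≡₂ c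
      from-bc h = even-difference {b + c} h four (n a b c d) , h
        where
        n : ∀ a b c d → b + c + (a + d) ≡ a + b + c + d
        n = solve-∀
      decide : Even b ⊎ Odd b → Even c ⊎ Odd c → a ≡₂ d × b ≡₂ c
      decide (inj₁ eb) (inj₁ ec) = from-bc (even-+ eb ec)
      decide (inj₂ ob) (inj₂ oc) = from-bc (odd-+ ob oc)
      decide (inj₂ ob) (inj₁ ec) = ⊥-elim (clash₁ (even-sq ea) (odd-square ob) (even-sq ec) (odd-square od))
        where
        ea : Even a
        ea = Sum.[ (λ h → h) , (λ oa → ⊥-elim (even≢odd (≡₂-even {c * d} (≡₂-sym {a * b} ab≡₂cd) (even-*ˡ d ec)) (odd-* oa ob))) ]′ (parity a)
        od : Odd d
        od = odd-+⁻ʳ (subst Odd (n a b c) (odd-+-even ob (even-+ ea ec))) four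
          where
          n : ∀ a b c → b + (a + c) ≡ a + b + c
          n = solve-∀
      decide (inj₁ eb) (inj₂ oc) = ⊥-elim (clash₂ (odd-square oa) (even-sq eb) (odd-square oc) (even-sq ed))
        where
        ed : Even d
        ed = Sum.[ (λ h → h) , (λ od → ⊥-elim (even≢odd (≡₂-even {a * b} ab≡₂cd (even-*ʳ a eb)) (odd-* oc od))) ]′ (parity d)
        oa : Odd a
        oa = odd-+⁻ʳ (odd-+-even oc (even-+ eb ed)) (subst Even (n a b c d) four)
          where
          n : ∀ a b c d → a + b + c + d ≡ c + (b + d) + a
          n = solve-∀

  AllEven : Quad ℤ → Set
  AllEven X = Even (c₀ X) × Even (c₁ X) × Even (c₂ X) × Even (c₃ X)

  private
    twiceOdd-* : ∀ {k l} → TwiceOdd k → Odd l → TwiceOdd (k * l)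
    twiceOdd-* {l = l} (m , om , refl) ol = m * l , odd-* om ol , ℤP.*-assoc (+ 2) m l

    double-U : ∀ {U} → (e : Even U) → + 2 * U ≡ + 4 * proj₁ e
    double-U (u , refl) = l u
      where
      l : ∀ u → + 2 * (+ 2 * u) ≡ + 4 * u
      l = solve-∀

  module _ {k₁ k₂ k₃ : ℤ} {X : Quad ℤ} (coords : IntegralCoords k₁ k₂ k₃ X) where
    open IntegralCoords coords
    private
      A = c₀ X
      B = c₁ X
      C = c₂ X
      D = c₃ X
      a = half A
      b = half B
      c = half C
      d = half D

    module _ (h₁ : TwiceOdd k₁) (o₂ : Odd k₂) (o₃ : Odd k₃) (oᵣ : Odd (k₂ * k₃)) where
      private
        p₂ : TwiceOdd (k₁ * k₂)
        p₂ = twiceOdd-* h₁ o₂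
        q₂ : TwiceOdd (k₁ * k₃)
        q₂ = twiceOdd-* h₁ o₃

      evens-2 : AllEven X
      evens-2 = eA , eB , proj₂ (two-even {k₁ * k₃} {A} {C} {n₂} q₂ trace₂) , even-from-odd-multiple {k₂ * k₃} {A} {D} {n₃} oᵣ trace₃ eA
        where
        eA = proj₁ (two-even {k₁ * k₂} {A} {B} {n₁} p₂ trace₁)
        eB = proj₂ (two-even {k₁ * k₂} {A} {B} {n₁} p₂ trace₁)

      private
        H : Halves k₁ k₂ k₃ a b c d
        H = let (eA , eB , eC , eD) = evens-2 in toHalves coords eA eB eC eD
        module H = Halves H
        eU : Even H.U
        eU = proj₁ (two-even {k₁ * k₂} {H.U} {H.V} {H.n} p₂ H.norm-UV)
        ab≡₂cd : a * b ≡₂ c * d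
        ab≡₂cd = V-even H (proj₂ (two-even {k₁ * k₂} {H.U} {H.V} {H.n} p₂ H.norm-UV)) o₃
        p' = proj₁ p₂
        q' = proj₁ q₂
        E : a * a + + 2 * p' * (b * b) ≡ + 2 * q' * (c * c) + k₂ * k₃ * (d * d) + + 4 * proj₁ eU
        E = trans (cong (λ p → a * a + p * (b * b)) (sym (proj₂ (proj₂ p₂)))) (trans H.norm-U (cong₂ (λ q u → q * (c * c) + k₂ * k₃ * (d * d) + u) (proj₂ (proj₂ q₂)) (double-U eU)))

      halves-2-3 : Three₄ (k₂ * k₃) → Even a × Even d × b ≡₂ c
      halves-2-3 h = two-three {a} {b} {c} {d} {p'} {q'} {k₂ * k₃} {proj₁ eU} (proj₁ (proj₂ p₂)) (proj₁ (proj₂ q₂)) h E ab≡₂cd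

      halves-2-1 : One₄ (k₂ * k₃) → a ≡₂ d × b ≡₂ c
      halves-2-1 h = two-one {a} {b} {c} {d} {p'} {q'} {k₂ * k₃} {proj₁ eU} (proj₁ (proj₂ p₂)) (proj₁ (proj₂ q₂)) h E

    module _ (hp : Three₄ (k₁ * k₂)) (hq : Three₄ (k₁ * k₃)) (hr : One₄ (k₂ * k₃)) (o₃ : Odd k₃) where

      evens-3 : AllEven X
      evens-3 = eA , proj₂ (three-even {k₁ * k₂} {A} {B} {n₁} hp trace₁) , proj₂ (three-even {k₁ * k₃} {A} {C} {n₂} hq trace₂) , even-from-odd-multiple {k₂ * k₃} {A} {D} {n₃} (one₄⇒odd hr) trace₃ eA
        where
        eA = proj₁ (three-even {k₁ * k₂} {A} {B} {n₁} hp trace₁)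

      halves-3 : a ≡₂ d × b ≡₂ c
      halves-3 = three-three {a} {b} {c} {d} {k₁ * k₂} {k₁ * k₃} {k₂ * k₃} {proj₁ eU} hp hq hr
          (trans H.norm-U (cong (λ u → (k₁ * k₃) * (c * c) + k₂ * k₃ * (d * d) + u) (double-U eU)))
          (V-even H (proj₂ (three-even {k₁ * k₂} {H.U} {H.V} {H.n} hp H.norm-UV)) o₃)
        where
        H : Halves k₁ k₂ k₃ a b c d
        H = let (eA , eB , eC , eD) = evens-3 in toHalves coords eA eB eC eD
        module H = Halves H
        eU : Even H.U
        eU = proj₁ (three-even {k₁ * k₂} {H.U} {H.V} {H.n} hp H.norm-UV)

    module _ (op : Odd (k₁ * k₂)) (oq : Odd (k₁ * k₃)) (or : Odd (k₂ * k₃)) where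

      -- The relative traces make A, B, C, D all even or all odd. In the even case the relative
      -- norm, read modulo 2 on the halves, gives the parity of their sum; in the odd case its
      -- √p-part is the congruence for AB modulo 4.
      quarter : Quarter k₃ A B C D
      quarter = decide (parity A)
        where
        decide : Even A ⊎ Odd A → Quarter k₃ A B C D
        decide (inj₂ oA) = inj₂ (oA , odd-from-odd-multiple {k₁ * k₂} {A} {B} {n₁} op trace₁ oA , odd-from-odd-multiple {k₁ * k₃} {A} {C} {n₂} oq trace₂ oA , odd-from-odd-multiple {k₂ * k₃} {A} {D} {n₃} or trace₃ oA , V , norm-V)
        decide (inj₁ eA) = inj₁ (eA , eB , eC , eD , subst Even (l a b c d (a * a) (k₁ * k₂ * (b * b)) (k₁ * k₃ * (c * c)) (k₂ * k₃ * (d * d)))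
            (even-+ total (even-+ (square≡₂ a) (even-+ (odd-square≡₂ b op) (even-+ (odd-square≡₂ c oq) (even-+ (odd-square≡₂ d or) (- (a * a) + - (k₁ * k₂ * (b * b)) + - (k₁ * k₃ * (c * c)) + - (k₂ * k₃ * (d * d)) , refl)))))))
          where
          eB = even-from-odd-multiple {k₁ * k₂} {A} {B} {n₁} op trace₁ eA
          eC = even-from-odd-multiple {k₁ * k₃} {A} {C} {n₂} oq trace₂ eA
          eD = even-from-odd-multiple {k₂ * k₃} {A} {D} {n₃} or trace₃ eA
          H : Halves k₁ k₂ k₃ a b c d
          H = toHalves coords eA eB eC eD
          module H = Halves H
          total : Even (a * a + k₁ * k₂ * (b * b) + (k₁ * k₃ * (c * c) + k₂ * k₃ * (d * d)))
          total = equal⇒≡₂ (a * a + k₁ * k₂ * (b * b)) (k₁ * k₃ * (c * c) + k₂ * k₃ * (d * d)) (+ 0) H.U (trans (ℤP.+-identityʳ _) H.norm-U)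
          l : ∀ a b c d x y z w → x + y + (z + w) + (x + a + (y + b + (z + c + (w + d + + 2 * (- x + - y + - z + - w))))) ≡ a + b + c + d
          l = solve-∀

-- Integrality of the witnesses.

module IntegralWitnesses where

  open Quadruples
  open AlmostIntegrality
  open FieldMaps
  open IntegralElements
  open IntegralCoordinates using (ι-*-cancelʳ)
  open CoordinateEquations using (QuarterAlmostInt)
  open Parity using (Odd)
  open UnitEquations using (One₄)
  open Congruences using (TwiceOdd; Three₄)
  open import Data.Rational using (_*_)

  scale₄ : Quad ℤ → Quad ℤ
  scale₄ z = quad (+ 4 ℤ.* c₀ z) (+ 4 ℤ.* c₁ z) (+ 4 ℤ.* c₂ z) (+ 4 ℤ.* c₃ z)

  ¼ : ℚ
  ¼ = (+ 1) ℚ./ 4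

  ι4*¼ : ι (+ 4) * ¼ ≡ 1ℚ
  ι4*¼ = trans (cong (_* ¼) (ι-def (+ 4))) refl

  module Witnesses (k₁ k₂ k₃ : ℤ) where
    open AlmostInteger k₁ k₂ k₃
    open Integrality k₁ k₂ k₃
    private
      module S = SemiringSolver commutativeSemiring
      h : Quad ℚ
      h = emb (ι (+ 4))
      QAI : Quad ℤ → Set
      QAI = QuarterAlmostInt k₁ k₂ k₃

    ιQ-scale₄ : ∀ z → ιQ (scale₄ z) ≡ h · ιQ z
    ιQ-scale₄ z = trans (quad-≡ (ι-* (+ 4) _) (ι-* (+ 4) _) (ι-* (+ 4) _) (ι-* (+ 4) _)) (sym (emb-· _ _))

    h-cancel : ∀ x y → h · x ≡ h · y → x ≡ y
    h-cancel x y e = quad-≡ (cancel (cong c₀ e')) (cancel (cong c₁ e')) (cancel (cong c₂ e')) (cancel (cong c₃ e'))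
      where
      e' = trans (sym (emb-· _ x)) (trans e (emb-· _ y))
      cancel : ∀ {s t} → ι (+ 4) * s ≡ ι (+ 4) * t → s ≡ t
      cancel {s} {t} e = ι-*-cancelʳ 4 s t (trans (ℚP.*-comm s _) (trans e (ℚP.*-comm _ t)))

    quarter-of : Quad ℤ → Quad ℚ
    quarter-of W = emb ¼ · ιQ W

    h·quarter : ∀ W → ιQ W ≡ h · quarter-of W
    h·quarter W = sym (trans (sym (·-assoc h (emb ¼) (ιQ W))) (trans (cong (_· ιQ W) (trans (emb-emb _ _) (cong emb ι4*¼))) (·-identityˡ _)))

    product-quarter : ∀ {W W' V w w'} → ιQ W ≡ h · w → ιQ W' ≡ h · w' → W ·Z W' ≡ scale₄ V → ιQ V ≡ h · (w · w')
    product-quarter {W} {W'} {V} {w} {w'} e e' p = h-cancel _ _ (begin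
      h · ιQ V                 ≡⟨ sym (ιQ-scale₄ V) ⟩
      ιQ (scale₄ V)            ≡⟨ cong ιQ (sym p) ⟩
      ιQ (W ·Z W')             ≡⟨ ιQ-· W W' ⟩
      ιQ W · ιQ W'             ≡⟨ cong₂ _·_ e e' ⟩
      (h · w) · (h · w')       ≡⟨ solve 3 (λ h w w' → (h :* w) :* (h :* w') := h :* (h :* (w :* w'))) refl h w w' ⟩
      h · (h · (w · w'))       ∎)
      where
      open ≡-Reasoning
      open S

    QAI-Λ : ∀ Z → QAI (scale₄ Z)
    QAI-Λ Z = ιQ Z , Λ⇒AlmostInt (Z , refl) , ιQ-scale₄ Z

    QAI-+ : ∀ {W W'} → QAI W → QAI W' → QAI (W +Z W')
    QAI-+ {W} {W'} (w , i , e) (w' , i' , e') = w +Q w' , AlmostInt-+ i i' , trans (ιQ-+ W W') (trans (cong₂ _+Q_ e e') (sym (distribˡ h w w')))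

    QAI-· : ∀ {W W' V} → QAI W → QAI W' → W ·Z W' ≡ scale₄ V → QAI V
    QAI-· (w , i , e) (w' , i' , e') p = w · w' , AlmostInt-· i i' , product-quarter e e' p

    square-powers : ∀ w k → ∃ λ j → (w ^Q k ≡ (w · w) ^Q j) ⊎ (w ^Q k ≡ w · (w · w) ^Q j)
    square-powers w zero = 0 , inj₁ refl
    square-powers w (suc k) = step (square-powers w k)
      where
      step : (∃ λ j → (w ^Q k ≡ (w · w) ^Q j) ⊎ (w ^Q k ≡ w · (w · w) ^Q j)) → ∃ λ j → (w · w ^Q k ≡ (w · w) ^Q j) ⊎ (w · w ^Q k ≡ w · (w · w) ^Q j)
      step (j , inj₁ e) = j , inj₂ (cong (w ·_) e)
      step (j , inj₂ e) = suc j , inj₁ (trans (cong (w ·_) e) (sym (·-assoc w w _)))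

    -- Every power of w is a power of w², up to one factor w; a common denominator of w takes care
    -- of that factor.
    AlmostInt-sqrt : ∀ {w} → AlmostInt (w · w) → AlmostInt w
    AlmostInt-sqrt {w} (N , f) = D ℕ.+ N ℕ.* suc D , λ k → subst (λ u → Λ (u · w ^Q k)) scalar (member k (square-powers w k))
      where
      open S
      D = proj₁ (commonDenominator w)
      n = emb (ι (+ suc N))
      d = emb (ι (+ suc D))
      scalar : n · d ≡ emb (ι (+ suc (D ℕ.+ N ℕ.* suc D)))
      scalar = trans (emb-emb _ _) (cong emb (sym (ι-* (+ suc N) (+ suc D))))
      member : ∀ k → (∃ λ j → (w ^Q k ≡ (w · w) ^Q j) ⊎ (w ^Q k ≡ w · (w · w) ^Q j)) → Λ (n · d · w ^Q k)
      member k (j , inj₁ e) = subst Λ (trans (solve 3 (λ n d y → d :* (n :* y) := n :* d :* y) refl n d ((w · w) ^Q j)) (cong (n · d ·_) (sym e))) (Λ-· (Λ-emb (+ suc D)) (f j))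
      member k (j , inj₂ e) = subst Λ (trans (solve 4 (λ n d w y → (d :* w) :* (n :* y) := n :* d :* (w :* y)) refl n d w ((w · w) ^Q j)) (cong (n · d ·_) (sym e))) (Λ-· (proj₂ (commonDenominator w)) (f j))

    QAI-sqrt : ∀ {W V} → QAI V → W ·Z W ≡ scale₄ V → QAI W
    QAI-sqrt {W} {V} (v , i , e) p = w , AlmostInt-sqrt (subst AlmostInt v≡w² i) , h·quarter W
      where
      w = quarter-of W
      v≡w² : v ≡ w · w
      v≡w² = h-cancel _ _ (trans (sym e) (product-quarter {W} {W} {V} (h·quarter W) (h·quarter W) p))

    -- w² = w + m
    QAI-root : ∀ {W} m → W ·Z W ≡ scale₄ (W +Z embZ (+ 4 ℤ.* m)) → QAI W
    QAI-root {W} m p = w , Integral⇒AlmostInt ((ℤ.- m) ∷ (ℤ.- (+ 1)) ∷ [] , root) , h·quarter W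
      where
      open ≡-Reasoning
      open S
      w = quarter-of W
      M = emb (ι m)
      n = emb (ι (ℤ.- m))
      o = emb (ι (ℤ.- (+ 1)))
      square : w · w ≡ w +Q M
      square = h-cancel _ _ (begin
        h · (w · w)                    ≡⟨ sym (product-quarter {W} {W} (h·quarter W) (h·quarter W) p) ⟩
        ιQ (W +Z embZ (+ 4 ℤ.* m))     ≡⟨ ιQ-+ W _ ⟩
        ιQ W +Q ιQ (embZ (+ 4 ℤ.* m))  ≡⟨ cong₂ _+Q_ (h·quarter W) (trans (ιQ-embZ _) (trans (cong emb (ι-* (+ 4) m)) (sym (emb-emb _ _)))) ⟩
        h · w +Q h · M                 ≡⟨ sym (distribˡ h w M) ⟩
        h · (w +Q M)                   ∎)
      M+n : M +Q n ≡ emb 0ℚ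
      M+n = trans (cong (M +Q_) (quad-≡ (ι-neg m) refl refl refl)) (-‿inverseʳ M)
      one+o : emb 1ℚ +Q o ≡ emb 0ℚ
      one+o = trans (cong (emb 1ℚ +Q_) (quad-≡ (trans (ι-neg (+ 1)) (cong ℚ.-_ ι-1)) refl refl refl)) (-‿inverseʳ (emb 1ℚ))
      root : w ^Q 2 +Q eval ((ℤ.- m) ∷ (ℤ.- (+ 1)) ∷ []) w ≡ emb 0ℚ
      root = begin
        w · (w · emb 1ℚ) +Q (n +Q w · (o +Q w · emb 0ℚ))  ≡⟨ solve 3 (λ w n o → w :* (w :* con 1) :+ (n :+ w :* (o :+ w :* con 0)) := w :* w :+ (n :+ w :* o)) refl w n o ⟩
        w · w +Q (n +Q w · o)                             ≡⟨ cong (_+Q (n +Q w · o)) square ⟩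
        (w +Q M) +Q (n +Q w · o)                          ≡⟨ solve 4 (λ w M n o → (w :+ M) :+ (n :+ w :* o) := (M :+ n) :+ w :* (con 1 :+ o)) refl w M n o ⟩
        (M +Q n) +Q w · (emb 1ℚ +Q o)                     ≡⟨ cong₂ (λ s t → s +Q w · t) M+n one+o ⟩
        emb 0ℚ +Q w · emb 0ℚ                              ≡⟨ trans (+Q-identityˡ _) (·-zeroʳ w) ⟩
        emb 0ℚ                                            ∎

    private
      open ℤ-Solver using (solve-∀)
      z₀ : ∀ k → + 0 ℤ.+ k ℤ.* + 0 ≡ + 0
      z₀ = solve-∀

      root-c₀ : ∀ {s} m P Q → s ≡ + 1 ℤ.+ + 4 ℤ.* m → + 4 ℤ.+ s ℤ.* + 4 ℤ.+ P ℤ.* + 0 ℤ.+ Q ℤ.* + 0 ≡ + 4 ℤ.* (+ 2 ℤ.+ + 4 ℤ.* m)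
      root-c₀ m P Q refl = l m P Q
        where
        l : ∀ m P Q → + 4 ℤ.+ (+ 1 ℤ.+ + 4 ℤ.* m) ℤ.* + 4 ℤ.+ P ℤ.* + 0 ℤ.+ Q ℤ.* + 0 ≡ + 4 ℤ.* (+ 2 ℤ.+ + 4 ℤ.* m)
        l = solve-∀
      shuffle₂ : ∀ a b c d → a ℤ.+ b ℤ.+ c ℤ.+ d ≡ a ℤ.+ c ℤ.+ b ℤ.+ d
      shuffle₂ = solve-∀
      shuffle₃ : ∀ a b c d → a ℤ.+ b ℤ.+ c ℤ.+ d ≡ a ℤ.+ d ℤ.+ b ℤ.+ c
      shuffle₃ = solve-∀
      eight : ∀ k → + 8 ℤ.+ k ℤ.* + 0 ≡ + 8
      eight = solve-∀

    half-1+√p : One₄ (k₁ ℤ.* k₂) → QAI (quad (+ 2) (+ 2) (+ 0) (+ 0))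
    half-1+√p (m , e) = QAI-root m (quad-≡ (root-c₀ m (k₁ ℤ.* k₃) (k₂ ℤ.* k₃) e) (eight k₃) (z₀ k₂) (z₀ k₁))

    half-1+√q : One₄ (k₁ ℤ.* k₃) → QAI (quad (+ 2) (+ 0) (+ 2) (+ 0))
    half-1+√q (m , e) = QAI-root m (quad-≡ (trans (shuffle₂ (+ 4) ((k₁ ℤ.* k₂) ℤ.* + 0) ((k₁ ℤ.* k₃) ℤ.* + 4) ((k₂ ℤ.* k₃) ℤ.* + 0)) (root-c₀ m (k₁ ℤ.* k₂) (k₂ ℤ.* k₃) e)) (z₀ k₃) (eight k₂) (z₀ k₁))

    half-1+√r : One₄ (k₂ ℤ.* k₃) → QAI (quad (+ 2) (+ 0) (+ 0) (+ 2))
    half-1+√r (m , e) = QAI-root m (quad-≡ (trans (shuffle₃ (+ 4) ((k₁ ℤ.* k₂) ℤ.* + 0) ((k₁ ℤ.* k₃) ℤ.* + 0) ((k₂ ℤ.* k₃) ℤ.* + 4)) (root-c₀ m (k₁ ℤ.* k₂) (k₁ ℤ.* k₃) e)) (z₀ k₃) (z₀ k₂) (eight k₁))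

    private
      -- The square of (√p + √q)/2 is (p + q)/4 + k₁√r/2, which lies in ℚ(√r) and is easier to
      -- recognise as integral.
      sqrt-sum : ∀ {P} → k₁ ℤ.* k₂ ℤ.+ k₁ ℤ.* k₃ ≡ P → QAI (quad P (+ 0) (+ 0) (+ 2 ℤ.* k₁)) → QAI (quad (+ 0) (+ 2) (+ 2) (+ 0))
      sqrt-sum refl v = QAI-sqrt v (quad-≡ (l (k₁ ℤ.* k₂) (k₁ ℤ.* k₃) (k₂ ℤ.* k₃)) (z₀ k₃) (z₀ k₂) (m k₁))
        where
        l : ∀ P Q R → + 0 ℤ.+ P ℤ.* + 4 ℤ.+ Q ℤ.* + 4 ℤ.+ R ℤ.* + 0 ≡ + 4 ℤ.* (P ℤ.+ Q)
        l = solve-∀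
        m : ∀ k → + 0 ℤ.+ k ℤ.* + 8 ≡ + 4 ℤ.* (+ 2 ℤ.* k)
        m = solve-∀

    -- Here p + q = k₁(k₂ + k₃) is a multiple of 4 and k₁/2 is an integer, so the square lies in the
    -- order itself.
    half-√p+√q-even : TwiceOdd k₁ → Odd k₂ → Odd k₃ → QAI (quad (+ 0) (+ 2) (+ 2) (+ 0))
    half-√p+√q-even (κ , _ , e₁) (s , e₂) (t , e₃) = sqrt-sum (trans (cong₂ (λ u v → u ℤ.+ v) (cong₂ ℤ._*_ e₁ e₂) (cong₂ ℤ._*_ e₁ e₃)) (l κ s t))
        (subst (λ z → QAI (quad (+ 4 ℤ.* (κ ℤ.* (+ 1 ℤ.+ s ℤ.+ t))) (+ 0) (+ 0) z)) (trans (m κ) (cong (λ k → + 2 ℤ.* k) (sym e₁))) (QAI-Λ (quad (κ ℤ.* (+ 1 ℤ.+ s ℤ.+ t)) (+ 0) (+ 0) κ)))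
      where
      l : ∀ κ s t → (+ 2 ℤ.* κ) ℤ.* (+ 1 ℤ.+ + 2 ℤ.* s) ℤ.+ (+ 2 ℤ.* κ) ℤ.* (+ 1 ℤ.+ + 2 ℤ.* t) ≡ + 4 ℤ.* (κ ℤ.* (+ 1 ℤ.+ s ℤ.+ t))
      l = solve-∀
      m : ∀ κ → + 4 ℤ.* κ ≡ + 2 ℤ.* (+ 2 ℤ.* κ)
      m = solve-∀

    -- Here p + q ≡ 2 (mod 4) and k₁ is odd, so the square differs from (1 + √r)/2 by an element of
    -- the order.
    half-√p+√q-odd : Odd k₁ → (∃ λ t → k₂ ℤ.+ k₃ ≡ + 2 ℤ.+ + 4 ℤ.* t) → One₄ (k₂ ℤ.* k₃) → QAI (quad (+ 0) (+ 2) (+ 2) (+ 0))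
    half-√p+√q-odd (κ , e₁) (t , e) hr = sqrt-sum (trans (sym (ℤP.*-distribˡ-+ k₁ k₂ k₃)) (trans (cong₂ ℤ._*_ e₁ e) (l κ t)))
        (subst (λ z → QAI (quad (+ 2 ℤ.+ + 4 ℤ.* u) (+ 0) (+ 0) z)) (trans (m κ) (cong (λ k → + 2 ℤ.* k) (sym e₁))) (QAI-+ (half-1+√r hr) (QAI-Λ (quad u (+ 0) (+ 0) κ))))
      where
      u = κ ℤ.+ t ℤ.+ + 2 ℤ.* (κ ℤ.* t)
      l : ∀ κ t → (+ 1 ℤ.+ + 2 ℤ.* κ) ℤ.* (+ 2 ℤ.+ + 4 ℤ.* t) ≡ + 2 ℤ.+ + 4 ℤ.* (κ ℤ.+ t ℤ.+ + 2 ℤ.* (κ ℤ.* t))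
      l = solve-∀
      m : ∀ κ → + 2 ℤ.+ + 4 ℤ.* κ ≡ + 2 ℤ.* (+ 1 ℤ.+ + 2 ℤ.* κ)
      m = solve-∀

    -- The product of (1 + √p)/2 and (1 + √q)/2 is (1 + √p + √q + k₁√r)/4. As k₁ ≡ 1 (mod 4), it
    -- differs from the witness by an integer multiple of √r; this is what the normalisation of
    -- signs is for.
    quarter-sum : One₄ k₁ → One₄ (k₁ ℤ.* k₂) → One₄ (k₁ ℤ.* k₃) → QAI (quad (+ 1) (+ 1) (+ 1) (+ 1))
    quarter-sum (m , e) hp hq = subst (λ z → QAI (quad (+ 1) (+ 1) (+ 1) z)) (trans (cong (λ k → k ℤ.+ + 4 ℤ.* (ℤ.- m)) e) (l m))
        (QAI-+ {quad (+ 1) (+ 1) (+ 1) k₁} (QAI-· {V = quad (+ 1) (+ 1) (+ 1) k₁} (half-1+√p hp) (half-1+√q hq) (quad-≡ (n (k₁ ℤ.* k₂) (k₁ ℤ.* k₃) (k₂ ℤ.* k₃)) (four k₃) (four k₂) (o k₁))) (QAI-Λ (quad (+ 0) (+ 0) (+ 0) (ℤ.- m))))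
      where
      l : ∀ m → + 1 ℤ.+ + 4 ℤ.* m ℤ.+ + 4 ℤ.* (ℤ.- m) ≡ + 1
      l = solve-∀
      n : ∀ P Q R → + 4 ℤ.+ P ℤ.* + 0 ℤ.+ Q ℤ.* + 0 ℤ.+ R ℤ.* + 0 ≡ + 4
      n = solve-∀
      four : ∀ k → + 4 ℤ.+ k ℤ.* + 0 ≡ + 4
      four = solve-∀
      o : ∀ k → + 0 ℤ.+ k ℤ.* + 4 ≡ + 4 ℤ.* k
      o = solve-∀

    -- The summand 7 = 2² + 1² + 1² + 1², with numerators over 4. So α itself is a sum of six
    -- squares.
    seven : List (Quad ℤ) → List (Quad ℤ)
    seven Ws = embZ (+ 8) ∷ embZ (+ 4) ∷ embZ (+ 4) ∷ embZ (+ 4) ∷ Ws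

    QAI-seven : ∀ {Ws} → All QAI Ws → All QAI (seven Ws)
    QAI-seven hs = QAI-Λ (embZ (+ 2)) ∷ QAI-Λ (embZ (+ 1)) ∷ QAI-Λ (embZ (+ 1)) ∷ QAI-Λ (embZ (+ 1)) ∷ hs

-- The lower bound for each residue type.

module FieldTypes where

  open Quadruples
  open AlmostIntegrality using (embZ)
  open Presentations
  open IntegralCoordinates using (IntegralCoords)
  open CoordinateEquations
  open Parity
  open SumsOfSquares
  open HalfIntegralSystems
  open HalfIntegralSmall
  open CoprimeSystems
  open UnitEquations
  open QuarterIntegralSystems
  open Congruences
  open IntegralWitnesses
  open import Data.Integer using (_+_; _*_; -_)
  open ℤ-Solver using (solve-∀)

  half₀ half₁ half₂ half₃ : Quad ℤ → ℤ
  half₀ X = half (c₀ X)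
  half₁ X = half (c₁ X)
  half₂ X = half (c₂ X)
  half₃ X = half (c₃ X)

  private
    ∑-⊠-quarter : ∀ (f g : Quad ℤ → ℤ) {Xs} → All (λ X → Even (f X)) Xs → All (λ X → Even (g X)) Xs →
      ∑ (f ⊠ g) Xs ≡ + 4 * ∑ ((λ X → half (f X)) ⊠ (λ X → half (g X))) Xs
    ∑-⊠-quarter f g ef eg = ∑-scale (+ 4) (f ⊠ g) _ (All.zipWith (λ { {X} (e , e') → trans (cong₂ _*_ (half-even e) (half-even e')) (l (half (f X)) (half (g X))) }) (ef , eg))
      where
      l : ∀ a b → + 2 * a * (+ 2 * b) ≡ + 4 * (a * b)
      l = solve-∀

  -- When all numerators over 4 are even, the equations can be divided by 4 and denominator 2
  -- suffices.
  halveSystem : ∀ {p q r k₁ k₂ k₃ Xs Ws} T₀ T₁ T₂ T₃ → All AllEven Xs → Equations p q r k₁ k₂ k₃ Xs Ws →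
    ∑² c₀ Ws ℕ.+ p ℕ.* ∑² c₁ Ws ℕ.+ q ℕ.* ∑² c₂ Ws ℕ.+ r ℕ.* ∑² c₃ Ws ≡ 4 ℕ.* T₀ →
    ∑ (c₀ ⊠ c₁) Ws + k₃ * ∑ (c₂ ⊠ c₃) Ws ≡ + 4 * T₁ →
    ∑ (c₀ ⊠ c₂) Ws + k₂ * ∑ (c₁ ⊠ c₃) Ws ≡ + 4 * T₂ →
    ∑ (c₀ ⊠ c₃) Ws + k₁ * ∑ (c₁ ⊠ c₂) Ws ≡ + 4 * T₃ →
    System half₀ half₁ half₂ half₃ p q r k₁ k₂ k₃ T₀ T₁ T₂ T₃ Xs
  halveSystem {p} {q} {r} {k₁} {k₂} {k₃} {Xs} {Ws} T₀ T₁ T₂ T₃ evens (equations eq₀ eq₁ eq₂ eq₃) w₀ w₁ w₂ w₃ = system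
      (ℕP.*-cancelˡ-≡ _ T₀ 4 (trans (l₀ (∑² half₀ Xs) (∑² half₁ Xs) (∑² half₂ Xs) (∑² half₃ Xs) p q r)
        (trans (cong₂ ℕ._+_ (cong₂ ℕ._+_ (cong₂ ℕ._+_ (sym (∑²-4* c₀ half₀ (halves c₀ ev₀))) (cong (p ℕ.*_) (sym (∑²-4* c₁ half₁ (halves c₁ ev₁))))) (cong (q ℕ.*_) (sym (∑²-4* c₂ half₂ (halves c₂ ev₂))))) (cong (r ℕ.*_) (sym (∑²-4* c₃ half₃ (halves c₃ ev₃)))))
          (trans eq₀ w₀))))
      (cross k₃ T₁ (∑-⊠-quarter c₀ c₁ ev₀ ev₁) (∑-⊠-quarter c₂ c₃ ev₂ ev₃) (trans eq₁ w₁))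
      (cross k₂ T₂ (∑-⊠-quarter c₀ c₂ ev₀ ev₂) (∑-⊠-quarter c₁ c₃ ev₁ ev₃) (trans eq₂ w₂))
      (cross k₁ T₃ (∑-⊠-quarter c₀ c₃ ev₀ ev₃) (∑-⊠-quarter c₁ c₂ ev₁ ev₂) (trans eq₃ w₃))
    where
    ev₀ = All.map proj₁ evens
    ev₁ = All.map (λ e → proj₁ (proj₂ e)) evens
    ev₂ = All.map (λ e → proj₁ (proj₂ (proj₂ e))) evens
    ev₃ = All.map (λ e → proj₂ (proj₂ (proj₂ e))) evens
    l₀ : ∀ a b c d p q r → 4 ℕ.* (a ℕ.+ p ℕ.* b ℕ.+ q ℕ.* c ℕ.+ r ℕ.* d) ≡ 4 ℕ.* a ℕ.+ p ℕ.* (4 ℕ.* b) ℕ.+ q ℕ.* (4 ℕ.* c) ℕ.+ r ℕ.* (4 ℕ.* d)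
    l₀ = ℕ-Solver.solve-∀
    cross : ∀ k T {u v s t} → u ≡ + 4 * s → v ≡ + 4 * t → u + k * v ≡ + 4 * T → s + k * t ≡ T
    cross k T {s = s} {t} refl refl e = ℤP.*-cancelˡ-≡ (+ 4) _ T (trans (l k s t) e)
      where
      l : ∀ k s t → + 4 * (s + k * t) ≡ + 4 * s + k * (+ 4 * t)
      l = solve-∀

  private
    w-zero : ∀ k → + 0 + k * + 0 ≡ + 0
    w-zero = solve-∀
    w-eight : ∀ k → + 8 + k * + 0 ≡ + 4 * + 2
    w-eight = solve-∀

  module Cases {p₀ q₀ : ℕ} {k₁ k₂ k₃ : ℤ} (P : Presentation p₀ q₀ k₁ k₂ k₃) (p q r : ℕ)
    (p≡ : + p ≡ k₁ * k₂) (q≡ : + q ≡ k₁ * k₃) (r≡ : + r ≡ k₂ * k₃)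
    (sp : SquareFree p) (sq : SquareFree q) (sr : SquareFree r)
    (hp : 10 ℕ.≤ p) (hq : 10 ℕ.≤ q) (hr : 10 ℕ.≤ r) where

    open Witnesses k₁ k₂ k₃

    private
      QAI : Quad ℤ → Set
      QAI = QuarterAlmostInt k₁ k₂ k₃

      prove : (Ws : List (Quad ℤ)) → All QAI Ws →
        (∀ Xs → All (IntegralCoords k₁ k₂ k₃) Xs → length Xs ℕ.≤ 5 → Equations p q r k₁ k₂ k₃ Xs (seven Ws) → ⊥) → PythagorasGe p₀ q₀ 6
      prove Ws hs = criterion k₁ k₂ k₃ P p q r {{ℕ.>-nonZero (ℕP.≤-trans (s≤s z≤n) hp)}} {{ℕ.>-nonZero (ℕP.≤-trans (s≤s z≤n) hq)}} {{ℕ.>-nonZero (ℕP.≤-trans (s≤s z≤n) hr)}}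
        p≡ q≡ r≡ sp sq sr (seven Ws) (QAI-seven hs)

      k₁≢0 : k₁ ≢ + 0
      k₁≢0 e = ℕP.<⇒≢ (ℕP.≤-trans (s≤s z≤n) hp) (sym (ℤP.+-injective (trans p≡ (cong (λ k → k * k₂) e))))

      -- 4w₁ and 4w₂ for w₁, w₂ equal to
      --   1 + (√p + √q)/2  and  (√p − √q)/2,
      --   (1 + √r)/2       and  1 + (√p + √q)/2,
      --   (1 + √r)/2       and  1 + √p.
      Ws-X Ws-small Ws-coprime : List (Quad ℤ)
      Ws-X       = quad (+ 4) (+ 2) (+ 2) (+ 0) ∷ quad (+ 0) (+ 2) (- (+ 2)) (+ 0) ∷ []
      Ws-small   = quad (+ 2) (+ 0) (+ 0) (+ 2) ∷ quad (+ 4) (+ 2) (+ 2) (+ 0) ∷ []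
      Ws-coprime = quad (+ 2) (+ 0) (+ 0) (+ 2) ∷ quad (+ 4) (+ 4) (+ 0) (+ 0) ∷ []

      shifted : QAI (quad (+ 0) (+ 2) (+ 2) (+ 0)) → QAI (quad (+ 4) (+ 2) (+ 2) (+ 0))
      shifted w = QAI-+ {embZ (+ 4)} (QAI-Λ (embZ (+ 1))) w

      ints-X : QAI (quad (+ 0) (+ 2) (+ 2) (+ 0)) → All QAI Ws-X
      ints-X w = shifted w ∷ QAI-+ {quad (+ 0) (+ 2) (+ 2) (+ 0)} w (QAI-Λ (quad (+ 0) (+ 0) (- (+ 1)) (+ 0))) ∷ []

      system-X : ∀ {Xs} → All AllEven Xs → Equations p q r k₁ k₂ k₃ Xs (seven Ws-X) →
        System half₀ half₁ half₂ half₃ p q r k₁ k₂ k₃ (32 ℕ.+ 2 ℕ.* p ℕ.+ 2 ℕ.* q) (+ 2) (+ 2) (+ 0) Xs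
      system-X ev eqs = halveSystem (32 ℕ.+ 2 ℕ.* p ℕ.+ 2 ℕ.* q) (+ 2) (+ 2) (+ 0) ev eqs (l p q r) (w-eight k₃) (w-eight k₂) (w-zero k₁)
        where
        l : ∀ p q r → 128 ℕ.+ p ℕ.* 8 ℕ.+ q ℕ.* 8 ℕ.+ r ℕ.* 0 ≡ 4 ℕ.* (32 ℕ.+ 2 ℕ.* p ℕ.+ 2 ℕ.* q)
        l = ℕ-Solver.solve-∀

    case-I : TwiceOdd k₁ → Odd k₂ → Odd k₃ → Three₄ (k₂ * k₃) → PythagorasGe p₀ q₀ 6
    case-I h₁@(κ , oκ , k₁≡) o₂ o₃ h = prove Ws-X (ints-X (half-√p+√q-even h₁ o₂ o₃)) λ Xs coords len eqs →
      let facts = All.map (λ {X} c → halves-2-3 {X = X} c h₁ o₂ o₃ (three₄⇒odd h) h) coords in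
      noFiveSquares-I half₀ half₁ half₂ half₃ p q r k₁ k₂ k₃ Xs (All.map (λ f → proj₂ (proj₂ f)) facts) hp hq len
        (system-X (All.map (λ {X} c → evens-2 {X = X} c h₁ o₂ o₃ (three₄⇒odd h)) coords) eqs)
        hr (κ , oκ , k₁≡) (All.map proj₁ facts) (All.map (λ f → proj₁ (proj₂ f)) facts)

    -- Several residue patterns of the kᵢ have the same integers: halves with a ≡ d and b ≡ c modulo
    -- 2. The arguments below depend on these parities only, so they are taken as hypotheses.
    module TypeII (evens : ∀ {X} → IntegralCoords k₁ k₂ k₃ X → AllEven X)
      (parities : ∀ {X} → IntegralCoords k₁ k₂ k₃ X → (half₀ X ≡₂ half₃ X) × (half₁ X ≡₂ half₂ X))
      (w : QAI (quad (+ 0) (+ 2) (+ 2) (+ 0))) (hr₄ : One₄ (k₂ * k₃)) where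

      private
        par-ad : ∀ {Xs} → All (IntegralCoords k₁ k₂ k₃) Xs → All (λ X → half₀ X ≡₂ half₃ X) Xs
        par-ad = All.map (λ {X} c → proj₁ (parities {X} c))
        par-bc : ∀ {Xs} → All (IntegralCoords k₁ k₂ k₃) Xs → All (λ X → half₁ X ≡₂ half₂ X) Xs
        par-bc = All.map (λ {X} c → proj₂ (parities {X} c))

      case-II-large : 33 ℕ.+ p ℕ.+ q ℕ.≤ r → PythagorasGe p₀ q₀ 6
      case-II-large big = prove Ws-X (ints-X w) λ Xs coords len eqs →
        noFiveSquares-II-large half₀ half₁ half₂ half₃ p q r k₁ k₂ k₃ Xs (par-bc coords) hp hq len
          (system-X (All.map (λ {X} → evens {X}) coords) eqs) big k₁≢0 (par-ad coords)

      case-II-small : ∀ {n₁ n₂ n₃} → k₁ ≡ + n₁ → k₂ ≡ + n₂ → k₃ ≡ + n₃ → 17 ℕ.≤ r → 2 ℕ.≤ n₂ → 2 ℕ.≤ n₃ → n₂ ≢ n₃ →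
        r ℕ.≤ 32 ℕ.+ p ℕ.+ q → 33 ℕ.≤ p ℕ.+ q → PythagorasGe p₀ q₀ 6
      case-II-small {n₁} {n₂} {n₃} refl refl refl r≥17 h₂ h₃ n₂≢n₃ r≤ p+q≥ = prove Ws-small (half-1+√r hr₄ ∷ shifted w ∷ []) λ Xs coords len eqs →
        noFiveSquares-II-small half₀ half₁ half₂ half₃ p q r n₁ n₂ n₃
          (natural n₁ n₂ p≡) (natural n₁ n₃ q≡) (natural n₂ n₃ r≡)
          hp hq r≥17 h₂ h₃ n₂≢n₃ r≤ p+q≥ Xs (par-ad coords) (par-bc coords) len
          (halveSystem (33 ℕ.+ r ℕ.+ p ℕ.+ q) (+ 2) (+ 2) (+ 1 + + n₁) (All.map (λ {X} → evens {X}) coords) eqs (l p q r) (w-eight (+ n₃)) (w-eight (+ n₂)) (m (+ n₁)))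
        where
        natural : ∀ {s} m n → + s ≡ + m * + n → s ≡ m ℕ.* n
        natural m n e = ℤP.+-injective (trans e (sym (ℤP.pos-* m n)))
        l : ∀ p q r → 132 ℕ.+ p ℕ.* 4 ℕ.+ q ℕ.* 4 ℕ.+ r ℕ.* 4 ≡ 4 ℕ.* (33 ℕ.+ r ℕ.+ p ℕ.+ q)
        l = ℕ-Solver.solve-∀
        m : ∀ k → + 4 + k * + 4 ≡ + 4 * (+ 1 + k)
        m = solve-∀

      -- With k₂ = 1 one has k₁ = p, k₃ = r and q = pr; the divisibility argument of the small case,
      -- which uses k₂ ≥ 2, breaks down. The witness 1 + √p avoids √q.
      case-II-coprime : k₂ ≡ + 1 → 17 ℕ.≤ r → PythagorasGe p₀ q₀ 6
      case-II-coprime k₂≡1 r≥17 = prove Ws-coprime (half-1+√r hr₄ ∷ QAI-Λ (quad (+ 1) (+ 1) (+ 0) (+ 0)) ∷ []) λ Xs coords len eqs →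
        noFiveSquares-II-coprime half₀ half₁ half₂ half₃ p r hp r≥17 Xs (par-ad coords) (par-bc coords) len
          (rename k₁≡p k₂≡1 k₃≡r q≡pr
            (halveSystem (33 ℕ.+ r ℕ.+ 4 ℕ.* p) (+ 4) (+ 0) (+ 1) (All.map (λ {X} → evens {X}) coords) eqs (l p q r) (sixteen k₃) (w-zero k₂) (four k₁)))
        where
        k₁≡p : k₁ ≡ + p
        k₁≡p = trans (sym (ℤP.*-identityʳ k₁)) (trans (cong (k₁ *_) (sym k₂≡1)) (sym p≡))
        k₃≡r : k₃ ≡ + r
        k₃≡r = trans (sym (ℤP.*-identityˡ k₃)) (trans (cong (_* k₃) (sym k₂≡1)) (sym r≡))
        q≡pr : q ≡ p ℕ.* r
        q≡pr = ℤP.+-injective (trans q≡ (trans (cong₂ _*_ k₁≡p k₃≡r) (sym (ℤP.pos-* p r))))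
        rename : ∀ {X : Set} {a b c d : X → ℤ} {Xs q l₁ l₂ l₃ l₁' l₂' l₃' q' T₀ T₁ T₂ T₃} → l₁ ≡ l₁' → l₂ ≡ l₂' → l₃ ≡ l₃' → q ≡ q' →
          System a b c d p q r l₁ l₂ l₃ T₀ T₁ T₂ T₃ Xs → System a b c d p q' r l₁' l₂' l₃' T₀ T₁ T₂ T₃ Xs
        rename refl refl refl refl s = s
        l : ∀ p q r → 132 ℕ.+ p ℕ.* 16 ℕ.+ q ℕ.* 0 ℕ.+ r ℕ.* 4 ≡ 4 ℕ.* (33 ℕ.+ r ℕ.+ 4 ℕ.* p)
        l = ℕ-Solver.solve-∀
        sixteen : ∀ k → + 16 + k * + 0 ≡ + 4 * + 4
        sixteen = solve-∀
        four : ∀ k → + 4 + k * + 0 ≡ + 4 * + 1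
        four = solve-∀

    module TypeIII (h₁ : One₄ k₁) (h₂ : One₄ k₂) (h₃ : One₄ k₃) where
      private
        one₄-* : ∀ {k l} → One₄ k → One₄ l → One₄ (k * l)
        one₄-* (s , refl) (t , refl) = s + t + + 4 * (s * t) , l s t
          where
          l : ∀ s t → (+ 1 + + 4 * s) * (+ 1 + + 4 * t) ≡ + 1 + + 4 * (s + t + + 4 * (s * t))
          l = solve-∀
        p₄ : One₄ (k₁ * k₂)
        p₄ = one₄-* h₁ h₂
        q₄ : One₄ (k₁ * k₃)
        q₄ = one₄-* h₁ h₃
        r₄ : One₄ (k₂ * k₃)
        r₄ = one₄-* h₂ h₃
        quarters : ∀ {Xs} → All (IntegralCoords k₁ k₂ k₃) Xs → All (λ X → Quarter k₃ (c₀ X) (c₁ X) (c₂ X) (c₃ X)) Xs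
        quarters = All.map (λ {X} c → quarter {X = X} c (one₄⇒odd p₄) (one₄⇒odd q₄) (one₄⇒odd r₄))

      case-III : k₁ ≢ k₂ → k₃ ≢ - (+ 3) → 17 ℕ.≤ p → 33 ℕ.≤ q → 33 ℕ.≤ r → p ℕ.≤ q → p ℕ.≤ r → 59 ℕ.+ p ℕ.≤ q ℕ.+ r → PythagorasGe p₀ q₀ 6
      case-III k₁≢k₂ k₃≢-3 hp' hq' hr' p≤q p≤r big = prove (quad (+ 2) (+ 2) (+ 0) (+ 0) ∷ quad (+ 1) (+ 1) (+ 1) (+ 1) ∷ [])
        (half-1+√p p₄ ∷ quarter-sum h₁ p₄ q₄ ∷ []) λ Xs coords len eqs →
          noFiveSquares-III c₀ c₁ c₂ c₃ p q r k₁ k₂ k₃ h₁ h₂ h₃ k₁≢k₂ k₃≢-3 hp' hq' hr' p≤q p≤r big Xs (quarters coords) len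
            (system (trans (Equations.eq₀ eqs) (l p q r)) (trans (Equations.eq₁ eqs) (m₅ k₃)) (trans (Equations.eq₂ eqs) (m₁ k₂)) (trans (Equations.eq₃ eqs) (m₁ k₁)))
        where
        l : ∀ p q r → 117 ℕ.+ p ℕ.* 5 ℕ.+ q ℕ.* 1 ℕ.+ r ℕ.* 1 ≡ 117 ℕ.+ 5 ℕ.* p ℕ.+ q ℕ.+ r
        l = ℕ-Solver.solve-∀
        m₅ : ∀ k → + 5 + k * + 1 ≡ + 5 + k
        m₅ = solve-∀
        m₁ : ∀ k → + 1 + k * + 1 ≡ + 1 + k
        m₁ = solve-∀

      -- Now r = pq exceeds 120 + 4p + 4q, so no √r-coordinate survives. Terms of odd kind have an
      -- odd one, so all terms have denominator 2.
      case-III-coprime : k₁ ≡ + 1 → 17 ℕ.≤ p → 17 ℕ.≤ q → PythagorasGe p₀ q₀ 6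
      case-III-coprime k₁≡1 hp' hq' = prove (quad (+ 2) (+ 2) (+ 0) (+ 0) ∷ quad (+ 2) (+ 0) (+ 2) (+ 0) ∷ []) (half-1+√p p₄ ∷ half-1+√q q₄ ∷ []) contradict
        where
        r≡pq : r ≡ p ℕ.* q
        r≡pq = ℤP.+-injective (trans r≡ (trans (cong₂ _*_ (sym (trans p≡ (trans (cong (_* k₂) k₁≡1) (ℤP.*-identityˡ k₂)))) (sym (trans q≡ (trans (cong (_* k₃) k₁≡1) (ℤP.*-identityˡ k₃))))) (sym (ℤP.pos-* p q))))
        bound : ∀ {A B C D} → 1 ℕ.≤ D → A ℕ.+ p ℕ.* B ℕ.+ q ℕ.* C ℕ.+ (p ℕ.* q) ℕ.* D ≡ 120 ℕ.+ p ℕ.* 4 ℕ.+ q ℕ.* 4 ℕ.+ 0 → ⊥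
        bound {A} {B} {C} hD = from≥₃ (λ p q D → A ℕ.+ p ℕ.* B ℕ.+ q ℕ.* C ℕ.+ (p ℕ.* q) ℕ.* D ≡ 120 ℕ.+ p ℕ.* 4 ℕ.+ q ℕ.* 4 ℕ.+ 0 → ⊥) hp' hq' hD λ p q D e → excess _ e (lemma A p q B C D)
          where
          lemma : ∀ A p q B C D → A ℕ.+ (17 ℕ.+ p) ℕ.* B ℕ.+ (17 ℕ.+ q) ℕ.* C ℕ.+ ((17 ℕ.+ p) ℕ.* (17 ℕ.+ q)) ℕ.* (1 ℕ.+ D) ≡
            120 ℕ.+ (17 ℕ.+ p) ℕ.* 4 ℕ.+ (17 ℕ.+ q) ℕ.* 4 ℕ.+ 0 ℕ.+ suc (32 ℕ.+ 13 ℕ.* p ℕ.+ 13 ℕ.* q ℕ.+ p ℕ.* q ℕ.+ A ℕ.+ (17 ℕ.+ p) ℕ.* B ℕ.+ (17 ℕ.+ q) ℕ.* C ℕ.+ ((17 ℕ.+ p) ℕ.* (17 ℕ.+ q)) ℕ.* D)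
          lemma = ℕ-Solver.solve-∀
        contradict : ∀ Xs → All (IntegralCoords k₁ k₂ k₃) Xs → length Xs ℕ.≤ 5 →
          Equations p q r k₁ k₂ k₃ Xs (seven (quad (+ 2) (+ 2) (+ 0) (+ 0) ∷ quad (+ 2) (+ 0) (+ 2) (+ 0) ∷ [])) → ⊥
        contradict Xs coords len eqs = noFiveSquares-III-coprime half₀ half₁ half₂ p q Xs hp' hq' sums E₀
            (trans (sym (vanish {∑ (half₀ ⊠ half₁) Xs} k₃ (∑-⊠-zeroʳ half₂ half₃ Dz'))) e₁)
            (trans (sym (vanish {∑ (half₀ ⊠ half₂) Xs} k₂ (∑-⊠-zeroʳ half₁ half₃ Dz'))) e₂)
            (product-zero {k₁} k₁≢0 (trans (sym (ℤP.+-identityˡ _)) (trans (cong (λ t → t + k₁ * ∑ (half₁ ⊠ half₂) Xs) (sym (∑-⊠-zeroʳ half₀ half₃ Dz'))) e₃))) len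
          where
          Dz : Zero c₃ Xs
          Dz = Sum.[ (λ nz → ⊥-elim (bound {∑² c₀ Xs} {∑² c₁ Xs} {∑² c₂ Xs} (∑²-nonZero c₃ nz)
                 (trans (cong (λ t → ∑² c₀ Xs ℕ.+ p ℕ.* ∑² c₁ Xs ℕ.+ q ℕ.* ∑² c₂ Xs ℕ.+ t ℕ.* ∑² c₃ Xs) (sym r≡pq)) (trans (Equations.eq₀ eqs) (cong (λ t → 120 ℕ.+ p ℕ.* 4 ℕ.+ q ℕ.* 4 ℕ.+ t) (ℕP.*-zeroʳ r)))))) , (λ z → z) ]′ (pickNonZero⊎zero c₃ Xs)
          even-quarters : All (λ X → EvenQuarter k₃ (c₀ X) (c₁ X) (c₂ X) (c₃ X)) Xs
          even-quarters = All.zipWith (λ { (qu , z) → choose z qu }) (quarters coords , Dz)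
            where
            choose : ∀ {A B C D} → D ≡ + 0 → Quarter k₃ A B C D → EvenQuarter k₃ A B C D
            choose z (inj₁ e) = e
            choose z (inj₂ (_ , _ , _ , oD , _)) = ⊥-elim (odd⇒nonZero oD z)
          Dz' : Zero half₃ Xs
          Dz' = All.map (λ z → cong half z) Dz
          sums : All (λ X → Even (half₀ X + half₁ X + half₂ X)) Xs
          sums = All.zipWith (λ { {X} ((_ , _ , _ , _ , e) , z) → subst Even (trans (cong (λ t → half₀ X + half₁ X + half₂ X + t) z) (ℤP.+-identityʳ _)) e }) (even-quarters , Dz')
          sys : System half₀ half₁ half₂ half₃ p q r k₁ k₂ k₃ (30 ℕ.+ p ℕ.+ q) (+ 1) (+ 1) (+ 0) Xs
          sys = halveSystem (30 ℕ.+ p ℕ.+ q) (+ 1) (+ 1) (+ 0) (All.map (λ { (a , b , c , d , _) → a , b , c , d }) even-quarters) eqs (l p q r) (four k₃) (four k₂) (w-zero k₁)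
            where
            l : ∀ p q r → 120 ℕ.+ p ℕ.* 4 ℕ.+ q ℕ.* 4 ℕ.+ r ℕ.* 0 ≡ 4 ℕ.* (30 ℕ.+ p ℕ.+ q)
            l = ℕ-Solver.solve-∀
            four : ∀ k → + 4 + k * + 0 ≡ + 4 * + 1
            four = solve-∀
          open System sys
          E₀ : ∑² half₀ Xs ℕ.+ p ℕ.* ∑² half₁ Xs ℕ.+ q ℕ.* ∑² half₂ Xs ≡ 30 ℕ.+ p ℕ.+ q
          E₀ = trans (sym (trans (cong (∑² half₀ Xs ℕ.+ p ℕ.* ∑² half₁ Xs ℕ.+ q ℕ.* ∑² half₂ Xs ℕ.+_) (trans (cong (r ℕ.*_) (∑²-zero half₃ Dz')) (ℕP.*-zeroʳ r))) (ℕP.+-identityʳ _))) e₀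

-- Square-free radicands and the symmetric description of the field.

open Quadruples using (Quad; quad)
open Presentations
open IntegralCoordinates using (GcdSplit; gcdSplit; splitGcd; IntegralCoords)
open CoordinateEquations using (QuarterAlmostInt)
open Parity using (Odd; _≡₂_)
open UnitEquations using (One₄)
open Congruences
open IntegralWitnesses
open FieldTypes
open ℤ-Solver using (solve-∀)
open import Data.Nat using (_+_; _*_; _≤_; _%_)

squareFree-factorʳ : ∀ m n → SquareFree (m * n) → SquareFree n
squareFree-factorʳ m n sf d h = sf d (∣-trans h (n∣m*n m))

-- If d² divides mn, then e = gcd(m, d) is prime to n and e² divides m, so e = 1. Thus d is prime to
-- m, and d² divides n.
squareFree-* : ∀ m n → .{{ℕ.NonZero m}} → .{{ℕ.NonZero n}} → SquareFree m → SquareFree n → Coprime m n → SquareFree (m * n)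
squareFree-* m n sm sn c d h = main (splitGcd m d)
  where
  main : GcdSplit m d → d ≡ 1
  main (gcdSplit e m' d' m≡ d≡ cop) = sn d (d²∣n (coprime-divisor d⊥m (∣-trans (m∣m*n d) h)))
    where
    instance
      m≢0 : ℕ.NonZero (e * m')
      m≢0 = subst ℕ.NonZero m≡ (ℕ.≢-nonZero (ℕ.≢-nonZero⁻¹ m))
      e≢0 : ℕ.NonZero e
      e≢0 = ℕP.m*n≢0⇒m≢0 e
    e∣m'n : e ∣ n * m'
    e∣m'n = subst (e ∣_) (ℕP.*-comm m' n) (∣-trans (m∣m*n (d' * d')) (*-cancelˡ-∣ e (subst₂ _∣_ (l₁ e d') (l₂ e m' n) (subst₂ _∣_ (cong₂ _*_ d≡ d≡) (cong (_* n) m≡) h))))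
      where
      l₁ : ∀ e d → e * d * (e * d) ≡ e * (e * (d * d))
      l₁ = ℕ-Solver.solve-∀
      l₂ : ∀ e m n → e * m * n ≡ e * (m * n)
      l₂ = ℕ-Solver.solve-∀
    e⊥n : Coprime e n
    e⊥n (p , q) = c (∣-trans p (subst (e ∣_) (sym m≡) (m∣m*n m')) , q)
    e≡1 : e ≡ 1
    e≡1 = sm e (subst (e * e ∣_) (sym m≡) (*-monoʳ-∣ e (coprime-divisor e⊥n e∣m'n)))
    d⊥m : Coprime d m
    d⊥m {f} (p , q) = cop (subst (f ∣_) (trans m≡ (trans (cong (_* m') e≡1) (ℕP.*-identityˡ m'))) q , subst (f ∣_) (trans d≡ (trans (cong (_* d') e≡1) (ℕP.*-identityˡ d'))) p)
    d²∣n : d ∣ n → d * d ∣ n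
    d²∣n (divides t n≡) = subst (d * d ∣_) (trans (ℕP.*-comm d t) (sym n≡)) (*-monoʳ-∣ d (coprime-divisor d⊥m (*-cancelˡ-∣ d {{d≢0}} (subst (d * d ∣_) (trans (cong (m *_) n≡) (l m t d)) h))))
      where
      l : ∀ m t d → m * (t * d) ≡ d * (m * t)
      l = ℕ-Solver.solve-∀
      d≢0 : ℕ.NonZero d
      d≢0 = ℕP.m*n≢0⇒n≢0 t {{subst ℕ.NonZero n≡ (ℕ.≢-nonZero (ℕ.≢-nonZero⁻¹ n))}}

-- What the six missing square roots mean for a radicand. Beyond 10, only 13 has to be named: it is
-- the one value below 17 that is 1 modulo 4.
record Good (s : ℕ) : Set where
  constructor good
  field
    squareFree : SquareFree s
    ≥10        : 10 ≤ s
    ≢13        : s ≢ 13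

-- The hypotheses in a form invariant under permutations of the kᵢ, so that each pattern is treated
-- in one order only.
record Field (p₀ q₀ k₁ k₂ k₃ : ℕ) : Set where
  constructor biquadratic
  field
    presentation : Presentation p₀ q₀ (+ k₁) (+ k₂) (+ k₃)
    good₁₂       : Good (k₁ * k₂)
    good₁₃       : Good (k₁ * k₃)
    good₂₃       : Good (k₂ * k₃)

swap-good : ∀ m n → Good (m * n) → Good (n * m)
swap-good m n = subst Good (ℕP.*-comm m n)

field-swap₂₃ : ∀ {p₀ q₀ k₁ k₂ k₃} → Field p₀ q₀ k₁ k₂ k₃ → Field p₀ q₀ k₁ k₃ k₂
field-swap₂₃ {k₂ = k₂} {k₃} (biquadratic P g₁₂ g₁₃ g₂₃) = biquadratic (swap₂₃-presentation P) g₁₃ g₁₂ (swap-good k₂ k₃ g₂₃)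

field-swap₁₂ : ∀ {p₀ q₀ k₁ k₂ k₃} → Field p₀ q₀ k₁ k₂ k₃ → Field p₀ q₀ k₂ k₁ k₃
field-swap₁₂ {k₁ = k₁} {k₂} (biquadratic P g₁₂ g₁₃ g₂₃) = biquadratic (swap₁₂-presentation P) (swap-good k₁ k₂ g₁₂) g₂₃ g₁₃

private
  2≢1 : 2 ≢ 1
  2≢1 ()

  3≢1 : 3 ≢ 1
  3≢1 ()

at-least-10 : ∀ s → SquareFree s → 1 < s → s ≢ 2 → s ≢ 3 → s ≢ 5 → s ≢ 6 → s ≢ 7 → 10 ≤ s
at-least-10 0 _ () _ _ _ _ _
at-least-10 1 _ (s≤s ()) _ _ _ _ _
at-least-10 2 _ _ h _ _ _ _ = ⊥-elim (h refl)
at-least-10 3 _ _ _ h _ _ _ = ⊥-elim (h refl)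
at-least-10 4 sf _ _ _ _ _ _ = ⊥-elim (2≢1 (sf 2 (divides 1 refl)))
at-least-10 5 _ _ _ _ h _ _ = ⊥-elim (h refl)
at-least-10 6 _ _ _ _ _ h _ = ⊥-elim (h refl)
at-least-10 7 _ _ _ _ _ _ h = ⊥-elim (h refl)
at-least-10 8 sf _ _ _ _ _ _ = ⊥-elim (2≢1 (sf 2 (divides 2 refl)))
at-least-10 9 sf _ _ _ _ _ _ = ⊥-elim (3≢1 (sf 3 (divides 1 refl)))
at-least-10 (suc (suc (suc (suc (suc (suc (suc (suc (suc (suc n)))))))))) _ _ _ _ _ _ _ = ℕP.m≤m+n 10 n

good-≥17 : ∀ {s} → Good s → (∃ λ m → s ≡ 1 + 4 * m) → 17 ≤ s
good-≥17 (good _ ≥10 ≢13) (m , e) = subst (17 ≤_) (sym e) (s≤s (ℕP.*-monoʳ-≤ 4 (four m (subst (10 ≤_) e ≥10) (λ h → ≢13 (trans e (cong (λ m → 1 + 4 * m) h))))))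
  where
  four : ∀ m → 10 ≤ 1 + 4 * m → m ≢ 3 → 4 ≤ m
  four 0 (s≤s ()) _
  four 1 (s≤s (s≤s (s≤s (s≤s (s≤s ()))))) _
  four 2 (s≤s (s≤s (s≤s (s≤s (s≤s (s≤s (s≤s (s≤s (s≤s ()))))))))) _
  four 3 _ h = ⊥-elim (h refl)
  four (suc (suc (suc (suc m)))) _ _ = ℕP.m≤m+n 4 m

-- Residue patterns modulo 4.

data Residue (k : ℕ) : Set where
  zero₄  : ∀ m → k ≡ 4 * m → Residue k
  one₄   : ∀ m → k ≡ 1 + 4 * m → Residue k
  two₄   : ∀ m → k ≡ 2 + 4 * m → Residue k
  three₄ : ∀ m → k ≡ 3 + 4 * m → Residue k

residue : ∀ k → Residue k
residue zero = zero₄ 0 refl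
residue (suc k) with residue k
... | zero₄ m e  = one₄ m (cong suc e)
... | one₄ m e   = two₄ m (cong suc e)
... | two₄ m e   = three₄ m (cong suc e)
... | three₄ m e = zero₄ (suc m) (trans (cong suc e) (l m))
  where
  l : ∀ m → 4 + 4 * m ≡ 4 * suc m
  l = ℕ-Solver.solve-∀

data OddResidue (k : ℕ) : Set where
  one   : ∀ m → k ≡ 1 + 4 * m → OddResidue k
  three : ∀ m → k ≡ 3 + 4 * m → OddResidue k

pos-form : ∀ {k} c m → k ≡ c + 4 * m → + k ≡ + c ℤ.+ + 4 ℤ.* + m
pos-form c m refl = trans (ℤP.pos-+ c (4 * m)) (cong (λ t → + c ℤ.+ t) (ℤP.pos-* 4 m))

oddResidue⇒odd : ∀ {k} → OddResidue k → Odd (+ k)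
oddResidue⇒odd (one m e)   = one₄⇒odd (+ m , pos-form 1 m e)
oddResidue⇒odd (three m e) = three₄⇒odd (+ m , pos-form 3 m e)

two₄⇒twiceOdd : ∀ {k} m → k ≡ 2 + 4 * m → TwiceOdd (+ k)
two₄⇒twiceOdd m e = + 1 ℤ.+ + 2 ℤ.* + m , (+ m , refl) , trans (pos-form 2 m e) (l (+ m))
  where
  l : ∀ m → + 2 ℤ.+ + 4 ℤ.* m ≡ + 2 ℤ.* (+ 1 ℤ.+ + 2 ℤ.* m)
  l = solve-∀

data SameOdd (k l : ℕ) : Set where
  bothOne   : ∀ m n → k ≡ 1 + 4 * m → l ≡ 1 + 4 * n → SameOdd k l
  bothThree : ∀ m n → k ≡ 3 + 4 * m → l ≡ 3 + 4 * n → SameOdd k l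

sameOdd-sym : ∀ {k l} → SameOdd k l → SameOdd l k
sameOdd-sym (bothOne m n e f)   = bothOne n m f e
sameOdd-sym (bothThree m n e f) = bothThree n m f e

sameOdd-product : ∀ {k l} → SameOdd k l → ∃ λ m → k * l ≡ 1 + 4 * m
sameOdd-product (bothOne m n refl refl) = m + n + 4 * (m * n) , l m n
  where
  l : ∀ m n → (1 + 4 * m) * (1 + 4 * n) ≡ 1 + 4 * (m + n + 4 * (m * n))
  l = ℕ-Solver.solve-∀
sameOdd-product (bothThree m n refl refl) = 2 + 3 * m + 3 * n + 4 * (m * n) , l m n
  where
  l : ∀ m n → (3 + 4 * m) * (3 + 4 * n) ≡ 1 + 4 * (2 + 3 * m + 3 * n + 4 * (m * n))
  l = ℕ-Solver.solve-∀

sameOdd-sum : ∀ {k l} → SameOdd k l → ∃ λ t → + k ℤ.+ + l ≡ + 2 ℤ.+ + 4 ℤ.* t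
sameOdd-sum (bothOne m n e f) = + m ℤ.+ + n , trans (cong₂ ℤ._+_ (pos-form 1 m e) (pos-form 1 n f)) (l (+ m) (+ n))
  where
  l : ∀ m n → + 1 ℤ.+ + 4 ℤ.* m ℤ.+ (+ 1 ℤ.+ + 4 ℤ.* n) ≡ + 2 ℤ.+ + 4 ℤ.* (m ℤ.+ n)
  l = solve-∀
sameOdd-sum (bothThree m n e f) = + 1 ℤ.+ + m ℤ.+ + n , trans (cong₂ ℤ._+_ (pos-form 3 m e) (pos-form 3 n f)) (l (+ m) (+ n))
  where
  l : ∀ m n → + 3 ℤ.+ + 4 ℤ.* m ℤ.+ (+ 3 ℤ.+ + 4 ℤ.* n) ≡ + 2 ℤ.+ + 4 ℤ.* (+ 1 ℤ.+ m ℤ.+ n)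
  l = solve-∀

sameOdd-oddʳ : ∀ {k l} → SameOdd k l → Odd (+ l)
sameOdd-oddʳ (bothOne m n e f)   = oddResidue⇒odd (one n f)
sameOdd-oddʳ (bothThree m n e f) = oddResidue⇒odd (three n f)

product-one₄ : ∀ {k l} → SameOdd k l → One₄ (+ k ℤ.* + l)
product-one₄ {k} {l} s = let (m , e) = sameOdd-product s in + m , trans (sym (ℤP.pos-* k l)) (pos-form 1 m e)

one-three : ∀ {k l} m n → k ≡ 1 + 4 * m → l ≡ 3 + 4 * n → Three₄ (+ k ℤ.* + l)
one-three {k} {l} m n e f = + n ℤ.+ + 3 ℤ.* + m ℤ.+ + 4 ℤ.* (+ m ℤ.* + n) , trans (cong₂ ℤ._*_ (pos-form 1 m e) (pos-form 3 n f)) (lemma (+ m) (+ n))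
  where
  lemma : ∀ m n → (+ 1 ℤ.+ + 4 ℤ.* m) ℤ.* (+ 3 ℤ.+ + 4 ℤ.* n) ≡ + 3 ℤ.+ + 4 ℤ.* (n ℤ.+ + 3 ℤ.* m ℤ.+ + 4 ℤ.* (m ℤ.* n))
  lemma = solve-∀

three-one : ∀ {k l} m n → k ≡ 3 + 4 * m → l ≡ 1 + 4 * n → Three₄ (+ k ℤ.* + l)
three-one {k} {l} m n e f = subst Three₄ (ℤP.*-comm (+ l) (+ k)) (one-three n m f e)

-- The patterns with r ≡ 1 while p and q are both 2 or both 3 modulo 4.
data TypeII (k₁ k₂ k₃ : ℕ) : Set where
  even       : ∀ m → k₁ ≡ 2 + 4 * m → SameOdd k₂ k₃ → TypeII k₁ k₂ k₃
  three-one₄ : ∀ l m n → k₁ ≡ 3 + 4 * l → k₂ ≡ 1 + 4 * m → k₃ ≡ 1 + 4 * n → TypeII k₁ k₂ k₃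
  one-three₄ : ∀ l m n → k₁ ≡ 1 + 4 * l → k₂ ≡ 3 + 4 * m → k₃ ≡ 3 + 4 * n → TypeII k₁ k₂ k₃

typeII-sameOdd : ∀ {k₁ k₂ k₃} → TypeII k₁ k₂ k₃ → SameOdd k₂ k₃
typeII-sameOdd (even _ _ s)               = s
typeII-sameOdd (three-one₄ _ m n _ e f) = bothOne m n e f
typeII-sameOdd (one-three₄ _ m n _ e f) = bothThree m n e f

typeII-swap : ∀ {k₁ k₂ k₃} → TypeII k₁ k₂ k₃ → TypeII k₁ k₃ k₂
typeII-swap (even m e s)             = even m e (sameOdd-sym s)
typeII-swap (three-one₄ l m n d e f) = three-one₄ l n m d f e
typeII-swap (one-three₄ l m n d e f) = one-three₄ l n m d f e

module _ {k₁ k₂ k₃ : ℕ} where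
  private
    odd-data : SameOdd k₂ k₃ → Odd (+ k₂) × Odd (+ k₃) × Odd (+ k₂ ℤ.* + k₃)
    odd-data s = sameOdd-oddʳ (sameOdd-sym s) , sameOdd-oddʳ s , one₄⇒odd (product-one₄ s)

  typeII-evens : TypeII k₁ k₂ k₃ → ∀ {X} → IntegralCoords (+ k₁) (+ k₂) (+ k₃) X → AllEven X
  typeII-evens (even m e s) {X} c = let (o₂ , o₃ , oᵣ) = odd-data s in evens-2 {X = X} c (two₄⇒twiceOdd m e) o₂ o₃ oᵣ
  typeII-evens (three-one₄ l m n d e f) {X} c = evens-3 {X = X} c (three-one l m d e) (three-one l n d f) (product-one₄ (bothOne m n e f)) (sameOdd-oddʳ (bothOne m n e f))
  typeII-evens (one-three₄ l m n d e f) {X} c = evens-3 {X = X} c (one-three l m d e) (one-three l n d f) (product-one₄ (bothThree m n e f)) (sameOdd-oddʳ (bothThree m n e f))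

  typeII-parities : TypeII k₁ k₂ k₃ → ∀ {X} → IntegralCoords (+ k₁) (+ k₂) (+ k₃) X → (half₀ X ≡₂ half₃ X) × (half₁ X ≡₂ half₂ X)
  typeII-parities (even m e s) {X} c = let (o₂ , o₃ , oᵣ) = odd-data s in halves-2-1 {X = X} c (two₄⇒twiceOdd m e) o₂ o₃ oᵣ (product-one₄ s)
  typeII-parities (three-one₄ l m n d e f) {X} c = halves-3 {X = X} c (three-one l m d e) (three-one l n d f) (product-one₄ (bothOne m n e f)) (sameOdd-oddʳ (bothOne m n e f))
  typeII-parities (one-three₄ l m n d e f) {X} c = halves-3 {X = X} c (one-three l m d e) (one-three l n d f) (product-one₄ (bothThree m n e f)) (sameOdd-oddʳ (bothThree m n e f))

  typeII-witness : TypeII k₁ k₂ k₃ → QuarterAlmostInt (+ k₁) (+ k₂) (+ k₃) (quad (+ 0) (+ 2) (+ 2) (+ 0))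
  typeII-witness (even m e s) = let (o₂ , o₃ , _) = odd-data s in Witnesses.half-√p+√q-even _ _ _ (two₄⇒twiceOdd m e) o₂ o₃
  typeII-witness (three-one₄ l m n d e f) = let s = bothOne m n e f in Witnesses.half-√p+√q-odd _ _ _ (oddResidue⇒odd (three l d)) (sameOdd-sum s) (product-one₄ s)
  typeII-witness (one-three₄ l m n d e f) = let s = bothThree m n e f in Witnesses.half-√p+√q-odd _ _ _ (oddResidue⇒odd (one l d)) (sameOdd-sum s) (product-one₄ s)

private
  mod-4 : ∀ {k} c m → k ≡ c + 4 * m → k % 4 ≡ c % 4
  mod-4 c m refl = trans (cong (λ t → (c + t) % 4) (ℕP.*-comm 4 m)) (DivMod.[m+kn]%n≡m%n c m 4)

  sameOdd-mod : ∀ {k l} → SameOdd k l → k % 4 ≡ l % 4 × k % 4 ≢ 2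
  sameOdd-mod (bothOne m n e f) = trans (mod-4 1 m e) (sym (mod-4 1 n f)) , λ h → 1≢2 (trans (sym (mod-4 1 m e)) h)
    where
    1≢2 : 1 ≢ 2
    1≢2 ()
  sameOdd-mod (bothThree m n e f) = trans (mod-4 3 m e) (sym (mod-4 3 n f)) , λ h → 3≢2 (trans (sym (mod-4 3 m e)) h)
    where
    3≢2 : 3 ≢ 2
    3≢2 ()

  -- The finite remainder of the size distinction: p + q ≤ 32 and r ≤ 32 + p + q ≤ 64. The radicand
  -- 18 is excluded as not square-free; otherwise the triple 2, 5, 9 would survive the search.
  Small : ℕ → ℕ → ℕ → Set
  Small k₁ k₂ k₃ = (k₁ * k₂ + k₁ * k₃ ≤ 32) × (10 ≤ k₁ * k₂) × (10 ≤ k₁ * k₃) × (k₂ * k₃ ≤ 64) × (k₂ % 4 ≡ k₃ % 4) × (k₂ % 4 ≢ 2) × (k₂ ≢ k₃) × (k₁ * k₂ ≢ 18) × (k₁ * k₃ ≢ 18)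

  table : ∀ (k₁ k₂ k₃ : Fin 33) → ¬ Small (toℕ k₁) (toℕ k₂) (toℕ k₃)
  table = toWitness {a? = all? λ a → all? λ b → all? λ c → let k₁ = toℕ a; k₂ = toℕ b; k₃ = toℕ c in
    ¬? ((k₁ * k₂ + k₁ * k₃ ℕP.≤? 32) ×-dec (10 ℕP.≤? k₁ * k₂) ×-dec (10 ℕP.≤? k₁ * k₃) ×-dec (k₂ * k₃ ℕP.≤? 64) ×-dec (k₂ % 4 ℕP.≟ k₃ % 4) ×-dec ¬? (k₂ % 4 ℕP.≟ 2) ×-dec ¬? (k₂ ℕP.≟ k₃) ×-dec ¬? (k₁ * k₂ ℕP.≟ 18) ×-dec ¬? (k₁ * k₃ ℕP.≟ 18))} _

no-small : ∀ {k₁ k₂ k₃} → Small k₁ k₂ k₃ → ⊥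
no-small {k₁} {k₂} {k₃} s@(sum≤ , p≥ , q≥ , _) = subst₃ (λ a b c → ¬ Small a b c) (toℕ-fromℕ< b₁) (toℕ-fromℕ< b₂) (toℕ-fromℕ< b₃) (table (fromℕ< b₁) (fromℕ< b₂) (fromℕ< b₃)) s
  where
  subst₃ : ∀ (P : ℕ → ℕ → ℕ → Set) {a a' b b' c c'} → a ≡ a' → b ≡ b' → c ≡ c' → P a b c → P a' b' c'
  subst₃ P refl refl refl h = h
  factorˡ : ∀ m n → 10 ≤ m * n → m ≤ m * n
  factorˡ m zero h = ⊥-elim (ℕP.<⇒≱ (s≤s z≤n) (subst (10 ≤_) (ℕP.*-zeroʳ m) h))
  factorˡ m (suc n) h = ℕP.m≤m*n m (suc n)
  factorʳ : ∀ m n → 10 ≤ m * n → n ≤ m * n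
  factorʳ m n h = subst (n ≤_) (ℕP.*-comm n m) (factorˡ n m (subst (10 ≤_) (ℕP.*-comm m n) h))
  b₁ : k₁ < 33
  b₁ = s≤s (ℕP.≤-trans (factorˡ k₁ k₂ p≥) (ℕP.≤-trans (ℕP.m≤m+n _ _) sum≤))
  b₂ : k₂ < 33
  b₂ = s≤s (ℕP.≤-trans (factorʳ k₁ k₂ p≥) (ℕP.≤-trans (ℕP.m≤m+n _ _) sum≤))
  b₃ : k₃ < 33
  b₃ = s≤s (ℕP.≤-trans (factorʳ k₁ k₃ q≥) (ℕP.≤-trans (ℕP.m≤n+m _ (k₁ * k₂)) sum≤))

-- From residues and sizes to the individual cases.

module _ {p₀ q₀ k₁ k₂ k₃ : ℕ} (F : Field p₀ q₀ k₁ k₂ k₃) where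
  open Field F
  private
    module G₁₂ = Good good₁₂
    module G₁₃ = Good good₁₃
    module G₂₃ = Good good₂₃

    module Positive = Cases presentation (k₁ * k₂) (k₁ * k₃) (k₂ * k₃) (ℤP.pos-* k₁ k₂) (ℤP.pos-* k₁ k₃) (ℤP.pos-* k₂ k₃)
      G₁₂.squareFree G₁₃.squareFree G₂₃.squareFree G₁₂.≥10 G₁₃.≥10 G₂₃.≥10

    neg-product : ∀ m n → + (m * n) ≡ ℤ.- + m ℤ.* ℤ.- + n
    neg-product m n = trans (ℤP.pos-* m n) (l (+ m) (+ n))
      where
      l : ∀ m n → m ℤ.* n ≡ ℤ.- m ℤ.* ℤ.- n
      l = solve-∀

    -- The same field with all kᵢ negated, so that kᵢ ≡ 3 becomes -kᵢ ≡ 1 modulo 4.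
    module Negative = Cases (flip-presentation presentation) (k₁ * k₂) (k₁ * k₃) (k₂ * k₃) (neg-product k₁ k₂) (neg-product k₁ k₃) (neg-product k₂ k₃)
      G₁₂.squareFree G₁₃.squareFree G₂₃.squareFree G₁₂.≥10 G₁₃.≥10 G₂₃.≥10

    not-equal : ∀ {m n} → SquareFree (m * n) → 10 ≤ m * n → m ≢ n
    not-equal {m} sf le refl = ten (sf m (divides 1 (sym (ℕP.+-identityʳ (m * m)))))
      where
      ten : m ≡ 1 → ⊥
      ten refl = ℕP.<⇒≱ (s≤s (s≤s z≤n)) le

    nonSquareFree-18 : ∀ {s} → SquareFree s → s ≢ 18
    nonSquareFree-18 sf refl = 3≢1 (sf 3 (divides 2 refl))

  two-residue : ∀ m → k₁ ≡ 2 + 4 * m → OddResidue k₂ → OddResidue k₃ → Three₄ (+ k₂ ℤ.* + k₃) → PythagorasGe p₀ q₀ 6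
  two-residue m e o₂ o₃ h = Positive.case-I (two₄⇒twiceOdd m e) (oddResidue⇒odd o₂) (oddResidue⇒odd o₃) h

  typeII-coprime : TypeII k₁ k₂ k₃ → k₂ ≡ 1 → PythagorasGe p₀ q₀ 6
  typeII-coprime t k₂≡1 = Positive.TypeII.case-II-coprime (λ {X} → typeII-evens t {X}) (λ {X} → typeII-parities t {X}) (typeII-witness t) (product-one₄ (typeII-sameOdd t)) (cong +_ k₂≡1)
    (good-≥17 good₂₃ (sameOdd-product (typeII-sameOdd t)))

  -- A large r leaves no room for √r-coordinates and a small r lets (1 + √r)/2 be a witness. The
  -- latter also needs p + q > 32; what is left is finite and empty.
  typeII-general : TypeII k₁ k₂ k₃ → k₂ ≢ 1 → k₃ ≢ 1 → PythagorasGe p₀ q₀ 6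
  typeII-general t k₂≢1 k₃≢1 = size (ℕP.≤-<-connex (k₂ * k₃) (32 + k₁ * k₂ + k₁ * k₃)) (ℕP.≤-<-connex (k₁ * k₂ + k₁ * k₃) 32)
    where
    s = typeII-sameOdd t
    two≤ : ∀ m n → 10 ≤ m * n → n ≢ 1 → 2 ≤ n
    two≤ m zero h _ = ⊥-elim (ℕP.<⇒≱ (s≤s z≤n) (subst (10 ≤_) (ℕP.*-zeroʳ m) h))
    two≤ m (suc zero) _ h = ⊥-elim (h refl)
    two≤ m (suc (suc n)) _ _ = s≤s (s≤s z≤n)
    open Positive.TypeII (λ {X} → typeII-evens t {X}) (λ {X} → typeII-parities t {X}) (typeII-witness t) (product-one₄ s)
    size : k₂ * k₃ ≤ 32 + k₁ * k₂ + k₁ * k₃ ⊎ 32 + k₁ * k₂ + k₁ * k₃ < k₂ * k₃ → k₁ * k₂ + k₁ * k₃ ≤ 32 ⊎ 32 < k₁ * k₂ + k₁ * k₃ → PythagorasGe p₀ q₀ 6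
    size (inj₂ big) _ = case-II-large big
    size (inj₁ r≤) (inj₂ sum>) = case-II-small refl refl refl (good-≥17 good₂₃ (sameOdd-product s))
      (two≤ k₁ k₂ G₁₂.≥10 k₂≢1) (two≤ k₁ k₃ G₁₃.≥10 k₃≢1) (not-equal G₂₃.squareFree G₂₃.≥10) r≤ sum>
    size (inj₁ r≤) (inj₁ sum≤) = ⊥-elim (no-small {k₁} {k₂} {k₃} (sum≤ , G₁₂.≥10 , G₁₃.≥10
      , ℕP.≤-trans r≤ (subst (_≤ 64) (sym (ℕP.+-assoc 32 (k₁ * k₂) (k₁ * k₃))) (ℕP.+-monoʳ-≤ 32 sum≤))
      , proj₁ (sameOdd-mod s) , proj₂ (sameOdd-mod s) , not-equal G₂₃.squareFree G₂₃.≥10 , nonSquareFree-18 G₁₂.squareFree , nonSquareFree-18 G₁₃.squareFree))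

  private
    step₄ : ∀ {c m n} → m < n → c + 4 * m + 4 ≤ c + 4 * n
    step₄ {c} {m} {n} lt = subst (_≤ c + 4 * n) (l c m) (ℕP.+-monoʳ-≤ c (ℕP.*-monoʳ-≤ 4 lt))
      where
      l : ∀ c m → c + 4 * suc m ≡ c + 4 * m + 4
      l = ℕ-Solver.solve-∀

    -- Distinct kᵢ in one class modulo 4 differ by at least 4, so they are at least 3, 7 and 11.
    -- This yields q ≥ 33 and r ≥ 77, enough for all estimates with denominator 4.
    module Sizes (h₁ : 3 ≤ k₁) (h₂ : k₁ + 4 ≤ k₂) (h₃ : k₂ + 4 ≤ k₃) where
      k₂≥7 : 7 ≤ k₂
      k₂≥7 = ℕP.≤-trans (ℕP.+-monoˡ-≤ 4 h₁) h₂
      k₃≥11 : 11 ≤ k₃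
      k₃≥11 = ℕP.≤-trans (ℕP.+-monoˡ-≤ 4 k₂≥7) h₃
      k₁≤k₂ : k₁ ≤ k₂
      k₁≤k₂ = ℕP.≤-trans (ℕP.m≤m+n k₁ 4) h₂
      k₂≤k₃ : k₂ ≤ k₃
      k₂≤k₃ = ℕP.≤-trans (ℕP.m≤m+n k₂ 4) h₃
      q≥33 : 33 ≤ k₁ * k₃
      q≥33 = ℕP.*-mono-≤ h₁ k₃≥11
      r≥33 : 33 ≤ k₂ * k₃
      r≥33 = ℕP.≤-trans q≥33 (ℕP.*-monoˡ-≤ k₃ k₁≤k₂)
      p≤q : k₁ * k₂ ≤ k₁ * k₃
      p≤q = ℕP.*-monoʳ-≤ k₁ k₂≤k₃
      p≤r : k₁ * k₂ ≤ k₂ * k₃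
      p≤r = ℕP.≤-trans p≤q (ℕP.*-monoˡ-≤ k₃ k₁≤k₂)
      sum-large : 59 + k₁ * k₂ ≤ k₁ * k₃ + k₂ * k₃
      sum-large = subst (_≤ k₁ * k₃ + k₂ * k₃) (ℕP.+-comm (k₁ * k₂) 59) (ℕP.+-mono-≤ p≤q (ℕP.≤-trans (ℕP.m≤m+n 59 18) (ℕP.*-mono-≤ k₂≥7 k₃≥11)))

  -- The smallest factor may be 1, which is below the range of `Sizes`; then r = pq and the coprime
  -- witnesses are used.
  typeIII-one : ∀ {m₁ m₂ m₃} → k₁ ≡ 1 + 4 * m₁ → k₂ ≡ 1 + 4 * m₂ → k₃ ≡ 1 + 4 * m₃ → m₁ < m₂ → m₂ < m₃ → PythagorasGe p₀ q₀ 6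
  typeIII-one {m₁} {m₂} {m₃} e₁ e₂ e₃ lt lt' = first m₁ e₁
    where
    open Positive.TypeIII (+ m₁ , pos-form 1 m₁ e₁) (+ m₂ , pos-form 1 m₂ e₂) (+ m₃ , pos-form 1 m₃ e₃)
    product : ∀ {k l} m n → k ≡ 1 + 4 * m → l ≡ 1 + 4 * n → Good (k * l) → 17 ≤ k * l
    product m n e f g = good-≥17 g (sameOdd-product (bothOne m n e f))
    first : ∀ m → k₁ ≡ 1 + 4 * m → PythagorasGe p₀ q₀ 6
    first zero e = case-III-coprime (cong +_ e) (product m₁ m₂ e₁ e₂ good₁₂) (product m₁ m₃ e₁ e₃ good₁₃)
    first (suc m) e = case-III (λ h → not-equal G₁₂.squareFree G₁₂.≥10 (ℤP.+-injective h)) (λ ()) (product m₁ m₂ e₁ e₂ good₁₂) q≥33 r≥33 p≤q p≤r sum-large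
      where
      open Sizes (subst (3 ≤_) (sym e) (s≤s (ℕP.≤-trans (s≤s (s≤s z≤n)) (ℕP.*-monoʳ-≤ 4 (s≤s (z≤n {m}))))))
        (subst₂ (λ a b → a + 4 ≤ b) (sym e₁) (sym e₂) (step₄ {1} lt)) (subst₂ (λ a b → a + 4 ≤ b) (sym e₂) (sym e₃) (step₄ {1} lt'))

  -- After negation the exceptional value -3 of the last factor could occur; the ordering puts the
  -- largest factor last, and it is at least 11.
  typeIII-three : ∀ {m₁ m₂ m₃} → k₁ ≡ 3 + 4 * m₁ → k₂ ≡ 3 + 4 * m₂ → k₃ ≡ 3 + 4 * m₃ → m₁ < m₂ → m₂ < m₃ → PythagorasGe p₀ q₀ 6
  typeIII-three {m₁} {m₂} {m₃} e₁ e₂ e₃ lt lt' =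
    case-III (λ h → not-equal G₁₂.squareFree G₁₂.≥10 (ℤP.+-injective (ℤP.neg-injective h)))
      (λ h → ℕP.<⇒≱ (ℕP.≤-trans (s≤s (s≤s (s≤s (s≤s z≤n)))) k₃≥11) (ℕP.≤-reflexive (ℤP.+-injective (ℤP.neg-injective h))))
      (good-≥17 good₁₂ (sameOdd-product (bothThree m₁ m₂ e₁ e₂))) q≥33 r≥33 p≤q p≤r sum-large
    where
    negated : ∀ {k} m → k ≡ 3 + 4 * m → One₄ (ℤ.- + k)
    negated m e = ℤ.- (+ 1 ℤ.+ + m) , trans (cong ℤ.-_ (pos-form 3 m e)) (l (+ m))
      where
      l : ∀ m → ℤ.- (+ 3 ℤ.+ + 4 ℤ.* m) ≡ + 1 ℤ.+ + 4 ℤ.* (ℤ.- (+ 1 ℤ.+ m))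
      l = solve-∀
    open Negative.TypeIII (negated m₁ e₁) (negated m₂ e₂) (negated m₃ e₃)
    open Sizes (subst (3 ≤_) (sym e₁) (ℕP.m≤m+n 3 (4 * m₁)))
      (subst₂ (λ a b → a + 4 ≤ b) (sym e₁) (sym e₂) (step₄ {3} lt)) (subst₂ (λ a b → a + 4 ≤ b) (sym e₂) (sym e₃) (step₄ {3} lt'))

  distinct : (k₁ ≢ k₂) × (k₁ ≢ k₃) × (k₂ ≢ k₃)
  distinct = not-equal G₁₂.squareFree G₁₂.≥10 , not-equal G₁₃.squareFree G₁₃.≥10 , not-equal G₂₃.squareFree G₂₃.≥10

  no-four : ∀ m → k₁ ≢ 4 * m
  no-four m e = 2≢1 (G₁₂.squareFree 2 (divides (m * k₂) (trans (cong (_* k₂) e) (l m k₂))))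
    where
    l : ∀ m k → 4 * m * k ≡ m * k * 4
    l = ℕ-Solver.solve-∀

  no-two-twos : ∀ m n → k₁ ≡ 2 + 4 * m → k₂ ≢ 2 + 4 * n
  no-two-twos m n e f = 2≢1 (G₁₂.squareFree 2 (divides ((1 + 2 * m) * (1 + 2 * n)) (trans (cong₂ _*_ e f) (l m n))))
    where
    l : ∀ m n → (2 + 4 * m) * (2 + 4 * n) ≡ (1 + 2 * m) * (1 + 2 * n) * 4
    l = ℕ-Solver.solve-∀

typeII : ∀ {p₀ q₀ k₁ k₂ k₃} → Field p₀ q₀ k₁ k₂ k₃ → TypeII k₁ k₂ k₃ → PythagorasGe p₀ q₀ 6
typeII {k₂ = k₂} {k₃} F t with k₂ ℕP.≟ 1 | k₃ ℕP.≟ 1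
... | yes k₂≡1 | _ = typeII-coprime F t k₂≡1
... | no _ | yes k₃≡1 = typeII-coprime (field-swap₂₃ F) (typeII-swap t) k₃≡1
... | no k₂≢1 | no k₃≢1 = typeII-general F t k₂≢1 k₃≢1

-- The estimates with denominator 4 want p to be the smallest radicand, that is k₁ < k₂ < k₃; any
-- order is reached by the two swaps.
module Sorted (p₀ q₀ c : ℕ)
  (sorted : ∀ {k₁ k₂ k₃} → Field p₀ q₀ k₁ k₂ k₃ → ∀ {m₁ m₂ m₃} → k₁ ≡ c + 4 * m₁ → k₂ ≡ c + 4 * m₂ → k₃ ≡ c + 4 * m₃ → m₁ < m₂ → m₂ < m₃ → PythagorasGe p₀ q₀ 6) where

  private
    apart : ∀ {k l m n} → k ≡ c + 4 * m → l ≡ c + 4 * n → k ≢ l → m ≢ n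
    apart e f k≢l refl = k≢l (trans e (sym f))

  insert : ∀ {k₁ k₂ k₃} → Field p₀ q₀ k₁ k₂ k₃ → ∀ {m₁ m₂ m₃} → k₁ ≡ c + 4 * m₁ → k₂ ≡ c + 4 * m₂ → k₃ ≡ c + 4 * m₃ → m₁ < m₂ → PythagorasGe p₀ q₀ 6
  insert F {m₁} {m₂} {m₃} e₁ e₂ e₃ lt with ℕP.<-cmp m₂ m₃ | ℕP.<-cmp m₁ m₃
  ... | tri< lt' _ _ | _ = sorted F e₁ e₂ e₃ lt lt'
  ... | tri≈ _ eq _ | _ = ⊥-elim (apart e₂ e₃ (proj₂ (proj₂ (distinct F))) eq)
  ... | tri> _ _ gt | tri< lt' _ _ = sorted (field-swap₂₃ F) e₁ e₃ e₂ lt' gt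
  ... | tri> _ _ gt | tri≈ _ eq _ = ⊥-elim (apart e₁ e₃ (proj₁ (proj₂ (distinct F))) eq)
  ... | tri> _ _ gt | tri> _ _ gt' = sorted (field-swap₁₂ (field-swap₂₃ F)) e₃ e₁ e₂ gt' lt

  sort : ∀ {k₁ k₂ k₃} → Field p₀ q₀ k₁ k₂ k₃ → ∀ {m₁ m₂ m₃} → k₁ ≡ c + 4 * m₁ → k₂ ≡ c + 4 * m₂ → k₃ ≡ c + 4 * m₃ → PythagorasGe p₀ q₀ 6
  sort F {m₁} {m₂} {m₃} e₁ e₂ e₃ with ℕP.<-cmp m₁ m₂
  ... | tri< lt _ _ = insert F {m₃ = m₃} e₁ e₂ e₃ lt
  ... | tri≈ _ eq _ = ⊥-elim (apart e₁ e₂ (proj₁ (distinct F)) eq)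
  ... | tri> _ _ gt = insert (field-swap₁₂ F) {m₃ = m₃} e₂ e₁ e₃ gt

twoFirst : ∀ {p₀ q₀ k₁ k₂ k₃} → Field p₀ q₀ k₁ k₂ k₃ → ∀ m → k₁ ≡ 2 + 4 * m → OddResidue k₂ → OddResidue k₃ → PythagorasGe p₀ q₀ 6
twoFirst F m e (one a x) (one b y)     = typeII F (even m e (bothOne a b x y))
twoFirst F m e (three a x) (three b y) = typeII F (even m e (bothThree a b x y))
twoFirst F m e (one a x) (three b y)   = two-residue F m e (one a x) (three b y) (one-three a b x y)
twoFirst F m e (three a x) (one b y)   = two-residue F m e (three a x) (one b y) (three-one a b x y)

oddCase : ∀ {p₀ q₀ k₁ k₂ k₃} → Field p₀ q₀ k₁ k₂ k₃ → OddResidue k₁ → OddResidue k₂ → OddResidue k₃ → PythagorasGe p₀ q₀ 6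
oddCase {p₀} {q₀} F (one a x) (one b y) (one c z)       = Sorted.sort p₀ q₀ 1 typeIII-one F {a} {b} {c} x y z
oddCase {p₀} {q₀} F (three a x) (three b y) (three c z) = Sorted.sort p₀ q₀ 3 typeIII-three F {a} {b} {c} x y z
oddCase F (three a x) (one b y) (one c z)     = typeII F (three-one₄ a b c x y z)
oddCase F (one a x) (three b y) (three c z)   = typeII F (one-three₄ a b c x y z)
oddCase F (one a x) (three b y) (one c z)     = typeII (field-swap₁₂ F) (three-one₄ b a c y x z)
oddCase F (three a x) (one b y) (three c z)   = typeII (field-swap₁₂ F) (one-three₄ b a c y x z)
oddCase F (one a x) (one b y) (three c z)     = typeII (field-swap₁₂ (field-swap₂₃ F)) (three-one₄ c a b z x y)
oddCase F (three a x) (three b y) (one c z)   = typeII (field-swap₁₂ (field-swap₂₃ F)) (one-three₄ c a b z x y)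

oddOrTwo : ∀ {k} → (∀ m → k ≢ 4 * m) → OddResidue k ⊎ ∃ λ m → k ≡ 2 + 4 * m
oddOrTwo {k} no4 with residue k
... | zero₄ m e  = ⊥-elim (no4 m e)
... | one₄ m e   = inj₁ (one m e)
... | two₄ m e   = inj₂ (m , e)
... | three₄ m e = inj₁ (three m e)

-- Square-freeness of the products forbids a factor divisible by 4 and two even factors. So at most
-- one kᵢ is even, and a permutation puts it first.
field-pythagorasGe : ∀ {p₀ q₀ k₁ k₂ k₃} → Field p₀ q₀ k₁ k₂ k₃ → PythagorasGe p₀ q₀ 6
field-pythagorasGe {p₀} {q₀} {k₁} {k₂} {k₃} F = main (oddOrTwo (no-four F)) (oddOrTwo (no-four F₂)) (oddOrTwo (no-four F₃))
  where
  F₂ : Field p₀ q₀ k₂ k₁ k₃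
  F₂ = field-swap₁₂ F
  F₃ : Field p₀ q₀ k₃ k₁ k₂
  F₃ = field-swap₁₂ (field-swap₂₃ F)
  main : OddResidue k₁ ⊎ (∃ λ m → k₁ ≡ 2 + 4 * m) → OddResidue k₂ ⊎ (∃ λ m → k₂ ≡ 2 + 4 * m) → OddResidue k₃ ⊎ (∃ λ m → k₃ ≡ 2 + 4 * m) → PythagorasGe p₀ q₀ 6
  main (inj₁ a) (inj₁ b) (inj₁ c) = oddCase F a b c
  main (inj₂ (m , e)) (inj₁ b) (inj₁ c) = twoFirst F m e b c
  main (inj₁ a) (inj₂ (m , e)) (inj₁ c) = twoFirst F₂ m e a c
  main (inj₁ a) (inj₁ b) (inj₂ (m , e)) = twoFirst F₃ m e a b
  main (inj₂ (m , e)) (inj₂ (n , f)) _ = ⊥-elim (no-two-twos F m n e f)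
  main (inj₂ (m , e)) (inj₁ _) (inj₂ (n , f)) = ⊥-elim (no-two-twos (field-swap₂₃ F) m n e f)
  main (inj₁ _) (inj₂ (m , e)) (inj₂ (n , f)) = ⊥-elim (no-two-twos (field-swap₂₃ F₂) m n e f)

theorem1p1 : (p q : ℕ) → 1 < p → 1 < q → p ≢ q → SquareFree p → SquareFree q →
    ¬ HasSqrt p q 2 → ¬ HasSqrt p q 3 → ¬ HasSqrt p q 5 →
    ¬ HasSqrt p q 6 → ¬ HasSqrt p q 7 → ¬ HasSqrt p q 13 →
    PythagorasGe p q 6
theorem1p1 p q 1<p 1<q p≢q sp sq n₂ n₃ n₅ n₆ n₇ n₁₃ = main (splitGcd p q {{ℕ.>-nonZero (ℕP.<-trans (s≤s z≤n) 1<p)}})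
  where
  main : GcdSplit p q → PythagorasGe p q 6
  main (gcdSplit zero k₂ k₃ p≡ q≡ cop) = ⊥-elim (ℕP.<⇒≱ 1<p (subst (_≤ 1) (sym p≡) z≤n))
  main (gcdSplit (suc k) k₂ k₃ p≡ q≡ cop) = field-pythagorasGe (biquadratic P₁ (makeGood (suc k) k₂ P₁ (subst (1 <_) p≡ 1<p) (subst SquareFree p≡ sp))
      (makeGood (suc k) k₃ (swap₂₃-presentation P₁) (subst (1 <_) q≡ 1<q) (subst SquareFree q≡ sq))
      (makeGood k₂ k₃ (swap₂₃-presentation (swap₁₂-presentation P₁)) r>1 (squareFree-* k₂ k₃ {{k₂≢0}} {{k₃≢0}} (squareFree-factorʳ (suc k) k₂ (subst SquareFree p≡ sp)) (squareFree-factorʳ (suc k) k₃ (subst SquareFree q≡ sq)) cop)))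
    where
    P₁ : Presentation p q (+ suc k) (+ k₂) (+ k₃)
    P₁ = standard k (+ k₂) (+ k₃) (trans (cong +_ p≡) (ℤP.pos-* (suc k) k₂)) (trans (cong +_ q≡) (ℤP.pos-* (suc k) k₃))
    makeGood : ∀ {l} m n → Presentation p q (+ m) (+ n) l → 1 < m * n → SquareFree (m * n) → Good (m * n)
    makeGood m n Q 1<s sf = good sf
        (at-least-10 (m * n) sf 1<s (avoid 2 n₂) (avoid 3 n₃) (avoid 5 n₅) (avoid 6 n₆) (avoid 7 n₇)) (avoid 13 n₁₃)
      where
      -- The presentation is permuted so that the radicand in question is the product of its first
      -- two parameters, as `hasSqrt` expects.
      avoid : ∀ s → ¬ HasSqrt p q s → m * n ≢ s
      avoid s noRoot e = noRoot (hasSqrt Q s (trans (cong +_ (sym e)) (ℤP.pos-* m n)))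
    k₂≢0 : ℕ.NonZero k₂
    k₂≢0 = ℕ.≢-nonZero (λ e → ℕP.<⇒≱ 1<p (subst (_≤ 1) (sym (trans p≡ (trans (cong (suc k *_) e) (ℕP.*-zeroʳ (suc k))))) z≤n))
    k₃≢0 : ℕ.NonZero k₃
    k₃≢0 = ℕ.≢-nonZero (λ e → ℕP.<⇒≱ 1<q (subst (_≤ 1) (sym (trans q≡ (trans (cong (suc k *_) e) (ℕP.*-zeroʳ (suc k))))) z≤n))
    -- If k₂k₃ = 1 then k₂ = k₃ = 1 and p = q; here distinctness of p and q enters.
    r>1 : 1 < k₂ * k₃
    r>1 = ℕP.≤∧≢⇒< (ℕ.>-nonZero⁻¹ (k₂ * k₃) {{ℕP.m*n≢0 k₂ k₃ {{k₂≢0}} {{k₃≢0}}}})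
      (λ e → p≢q (trans p≡ (trans (cong (suc k *_) (trans (ℕP.m*n≡1⇒m≡1 k₂ k₃ (sym e)) (sym (ℕP.m*n≡1⇒n≡1 k₂ k₃ (sym e))))) (sym q≡))))
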